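{- There exist the following polynomial-time approximation algorithms for Parallel Min-Sum Set Cover (PMSSC) subject to precedence constraints, where $k\ge2$ is the number of sets: (1) an $O(k^{2/3})$-approximation algorithm for unit cost sets ($c(S)=1$ for all $S\in\mathcal{S}$) and general precedence constraints; (2) an $O(\log k)$-approximation algorithm for identical machines (arbitrary $c:\mathcal{S}\to\mathbb{N}$) and out-forest precedence constraints. Here a $\rho$-approximation algorithm returns, for every instance, a feasible schedule whose cost is at most $\rho$ times the minimum cost of a feasible schedule, and the constants hidden in $O(\cdot)$ are absolute.
   Context: Notation: $\mathbb{N}=\{1,2,\dots\}$. An instance of PMSSC with precedence constraints (identical machines): a finite universe $\mathcal{U}$, a collection $\mathcal{S}$ of $k$ subsets of $\mathcal{U}$ with $\bigcup_{S\in\mathcal{S}}S=\mathcal{U}$, a number $m\ge1$ of machines, costs $c:\mathcal{S}\to\mathbb{N}$ (the processing time of $S$ on every machine), weights $w:\mathcal{U}\to\mathbb{N}$ (numbers encoded in binary), and a directed acyclic graph $G$ on $\mathcal{S}$. If there is a directed path in $G$ from $S_1$ to $S_2$, then $S_1$ is a predecessor of $S_2$ and must be completed before $S_2$ is started. The constraints are general if $G$ is an arbitrary directed acyclic graph, and out-forest if each set has at most one direct predecessor in $G$ (so $G$ is a collection of trees directed from root to leaves). A schedule processes some of the sets non-preemptively on the $m$ machines, each scheduled set $S$ being processed once, on one machine, for $c(S)$ time units, with each machine processing at most one set at a time (machines may idle). It is feasible if the scheduled sets cover $\mathcal{U}$ and, for each scheduled set, all its predecessors are scheduled and completed before it starts.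 The covering time $\operatorname{ct}(u)$ of $u\in\mathcal{U}$ is the earliest completion time of a scheduled set containing $u$. The cost of the schedule is $\sum_{u\in\mathcal{U}}w(u)\operatorname{ct}(u)$, to be minimized. -}

module Defs where

open import Data.Bool using (Bool; true; false; T; if_then_else_)
open import Data.Fin using (Fin; toℕ)
open import Data.Fin.Subset using (Subset; _∈_)
open import Data.Fin.Subset.Properties using (_∈?_)
open import Data.List using (List; []; _∷_; foldr; tabulate; allFin; mapMaybe)
open import Data.Maybe using (Maybe; just; nothing)
import Data.Maybe as Maybe
open import Data.Nat using (ℕ; suc; _+_; _*_; _^_; _≤_; _⊓_)
open import Data.Nat.Binary using (ℕᵇ; zero; 2[1+_]; 1+[2_]; fromℕ)
open import Data.Nat.ListAction using (sum)
open import Data.Nat.Logarithm using (⌊log₂_⌋)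
open import Data.Product using (_×_; _,_; ∃; ∃-syntax; ∃₂)
open import Data.Sum using (_⊎_)
open import Data.Vec using (Vec; []; _∷_; lookup)
open import Relation.Binary.Construct.Closure.Transitive using (TransClosure)
open import Relation.Binary.PropositionalEquality using (_≡_; _≢_)
open import Relation.Nullary using (¬_; does)

------------------------------------------------------------------------
-- Instances

-- The universe is Fin n and the collection is a family of k subsets of it,
-- indexed by Fin k; costs, weights and the digraph live on these indices.

record Instance : Set where
  field
    n k m   : ℕ
    sets    : Fin k → Subset n
    cost    : Fin k → ℕ
    weight  : Fin n → ℕ
    edge    : Fin k → Fin k → Bool
    m≥1     : 1 ≤ m
    cost≥1   : ∀ i → 1 ≤ cost i
    weight≥1 : ∀ u → 1 ≤ weight u
    covered : ∀ u → ∃[ i ] u ∈ sets i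

  Edge : Fin k → Fin k → Set
  Edge i j = T (edge i j)

  -- A directed path with at least one edge.
  Predecessor : Fin k → Fin k → Set
  Predecessor = TransClosure Edge

  field
    acyclic : ∀ i → ¬ Predecessor i i

UnitCost : Instance → Set
UnitCost I = ∀ i → cost i ≡ 1
  where open Instance I

OutForest : Instance → Set
OutForest I = ∀ {i i′ j} → Edge i j → Edge i′ j → i ≡ i′
  where open Instance I

------------------------------------------------------------------------
-- Schedules

-- The earliest of a list of times; the value 0 at [] is never used for a
-- feasible schedule, in which every element is covered.

earliest : List ℕ → ℕ
earliest []           = 0
earliest (t ∷ [])     = t
earliest (t ∷ s ∷ ts) = t ⊓ earliest (s ∷ ts)

module _ (I : Instance) where
  open Instance I

  -- `just (p , s)`: the set runs on machine p during [s , s + cost);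
  -- `nothing`: the set is not scheduled.  Since all costs are integral,
  -- rounding every start time down keeps a real-timed schedule feasible and
  -- does not increase its cost, so natural start times lose nothing.

  Schedule : Set
  Schedule = Fin k → Maybe (Fin m × ℕ)

  record Feasible (σ : Schedule) : Set where
    field
      covers      : ∀ u → ∃[ i ] u ∈ sets i × (∃[ x ] σ i ≡ just x)
      no-overlap  : ∀ {i j p s t} → i ≢ j →
                    σ i ≡ just (p , s) → σ j ≡ just (p , t) →
                    s + cost i ≤ t ⊎ t + cost j ≤ s
      precedences : ∀ {i j q t} → Predecessor i j → σ j ≡ just (q , t) →
                    ∃₂ λ p s → σ i ≡ just (p , s) × s + cost i ≤ t

  completion : Schedule → Fin k → Maybe ℕ
  completion σ i = Maybe.map (λ (_ , s) → s + cost i) (σ i)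

  coveringTime : Schedule → Fin n → ℕ
  coveringTime σ u = earliest (mapMaybe
    (λ i → if does (u ∈? sets i) then completion σ i else nothing) (allFin k))

  scheduleCost : Schedule → ℕ
  scheduleCost σ = sum (tabulate λ u → weight u * coveringTime σ u)

------------------------------------------------------------------------
-- Model of computation

-- A deterministic first-order language with recursive functions over binary
-- trees (Lisp-style data).  Each evaluation step costs 1, except that building
-- a pair costs the size of the resulting tree.  So a computation of time t on
-- an input of size s handles only trees of size at most s + t, and Turing
-- machines and this language simulate each other with polynomial overhead.

infixr 5 _∙_

data Tree : Set where
  nil : Tree
  _∙_ : Tree → Tree → Tree

size : Tree → ℕ
size nil     = 1
size (x ∙ y) = 1 + size x + size y

-- Expressions over F function symbols, all unary, with v variables in scope.

data Exp (F v : ℕ) : Set where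
  var  : Fin v → Exp F v
  nil  : Exp F v
  cons : Exp F v → Exp F v → Exp F v
  case : Exp F v → Exp F v → Exp F (2 + v) → Exp F v
  bind : Exp F v → Exp F (suc v) → Exp F v
  call : Fin F → Exp F v → Exp F v

record Program : Set where
  field
    F    : ℕ
    body : Fin F → Exp F 1
    main : Exp F 1

-- Call-by-value evaluation: ρ ⊢ e ⇓ x [ t ] says that e evaluates to x in
-- environment ρ in time t.

module Semantics {F : ℕ} (body : Fin F → Exp F 1) where

  infix 4 _⊢_⇓_[_]

  data _⊢_⇓_[_] {v} (ρ : Vec Tree v) : Exp F v → Tree → ℕ → Set where
    var  : ∀ {i} → ρ ⊢ var i ⇓ lookup ρ i [ 1 ]
    nil  : ρ ⊢ nil ⇓ nil [ 1 ]
    cons : ∀ {d e x y s t} →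
           ρ ⊢ d ⇓ x [ s ] → ρ ⊢ e ⇓ y [ t ] →
           ρ ⊢ cons d e ⇓ x ∙ y [ size (x ∙ y) + s + t ]
    case-nil : ∀ {c d e z s t} →
           ρ ⊢ c ⇓ nil [ s ] → ρ ⊢ d ⇓ z [ t ] →
           ρ ⊢ case c d e ⇓ z [ 1 + s + t ]
    case-∙ : ∀ {c d e x y z s t} →
           ρ ⊢ c ⇓ x ∙ y [ s ] → (x ∷ y ∷ ρ) ⊢ e ⇓ z [ t ] →
           ρ ⊢ case c d e ⇓ z [ 1 + s + t ]
    bind : ∀ {d e x z s t} →
           ρ ⊢ d ⇓ x [ s ] → (x ∷ ρ) ⊢ e ⇓ z [ t ] →
           ρ ⊢ bind d e ⇓ z [ 1 + s + t ]
    call : ∀ {f e x z s t} →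
           ρ ⊢ e ⇓ x [ s ] → (x ∷ []) ⊢ body f ⇓ z [ t ] →
           ρ ⊢ call f e ⇓ z [ 1 + s + t ]

Runs : Program → Tree → Tree → ℕ → Set
Runs P x y t = (x ∷ []) ⊢ main ⇓ y [ t ]
  where
  open Program P
  open Semantics body

------------------------------------------------------------------------
-- Encodings

encodeBool : Bool → Tree
encodeBool false = nil
encodeBool true  = nil ∙ nil

encodeList : List Tree → Tree
encodeList = foldr _∙_ nil

-- Least significant digit first; ℕᵇ uses the base-2 digits 1 and 2, so the
-- length is logarithmic and every number has exactly one representation.

encodeℕᵇ : ℕᵇ → Tree
encodeℕᵇ zero     = nil
encodeℕᵇ 2[1+ b ] = encodeBool false ∙ encodeℕᵇ b
encodeℕᵇ 1+[2 b ] = encodeBool true ∙ encodeℕᵇ b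

encodeℕ : ℕ → Tree
encodeℕ a = encodeℕᵇ (fromℕ a)

encodeFamily : ∀ {l} → (Fin l → Tree) → Tree
encodeFamily f = encodeList (tabulate f)

-- The numbers n and k are given by the lengths of the lists of weights and
-- costs; the sets are given by an incidence matrix, the digraph by its
-- adjacency matrix.

encodeInstance : Instance → Tree
encodeInstance I =
    encodeℕ m
  ∙ encodeFamily (λ i → encodeℕ (cost i))
  ∙ encodeFamily (λ u → encodeℕ (weight u))
  ∙ encodeFamily (λ i → encodeFamily λ u → encodeBool (lookup (sets i) u))
  ∙ encodeFamily (λ i → encodeFamily λ j → encodeBool (edge i j))
  where open Instance I

encodeEntry : ∀ {m} → Maybe (Fin m × ℕ) → Tree
encodeEntry nothing        = nil
encodeEntry (just (p , s)) = encodeℕ (toℕ p) ∙ encodeℕ s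

encodeSchedule : (I : Instance) → Schedule I → Tree
encodeSchedule I σ = encodeFamily (λ i → encodeEntry (σ i))

------------------------------------------------------------------------
-- Approximation algorithms

-- `Ratio k a b` expresses a ≤ ρ(k) · b, where ρ may depend on the number k of
-- sets.  Comparing with every feasible schedule is comparing with the minimum.

IsApproximationFor : (ℕ → ℕ → ℕ → Set) → (I : Instance) → Schedule I → Set
IsApproximationFor Ratio I σ =
  Feasible I σ ×
  (∀ τ → Feasible I τ → Ratio (Instance.k I) (scheduleCost I σ) (scheduleCost I τ))

PolyTimeApproximation : (Instance → Set) → (ℕ → ℕ → ℕ → Set) → Set
PolyTimeApproximation Class Ratio =
  ∃[ P ] ∃[ a ] ∃[ d ] ∀ (I : Instance) → 2 ≤ Instance.k I → Class I →
    ∃[ σ ] ∃[ t ]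
      Runs P (encodeInstance I) (encodeSchedule I σ) t ×
      t ≤ a * size (encodeInstance I) ^ d ×
      IsApproximationFor Ratio I σ

-- a ≤ C · k^(2/3) · b, with both sides cubed to stay in ℕ.

Within-k^⅔ : ℕ → ℕ → ℕ → ℕ → Set
Within-k^⅔ C k a b = a ^ 3 ≤ (C * b) ^ 3 * k ^ 2

-- For k ≥ 2 the rounded logarithm is at least 1 and differs from log k by at
-- most a constant factor, so the rounding is absorbed by C.

Within-log : ℕ → ℕ → ℕ → ℕ → Set
Within-log C k a b = a ≤ C * ⌊log₂ k ⌋ * b

{-# OPTIONS --safe #-}

-- In phase j a family of sets, closed under predecessors, is enlarged by a
-- planner so that it covers nearly as much weight as any closed family that can
-- be completed by time T = 2^j, at an additional cost of at most R m T, where m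
-- is the number of machines.  If the sets added in the phase are scheduled in
-- O(ρ T) time, then the uncovered weight is at most 1/8 of the previous one plus
-- the weight that the optimum covers after T, and summing the geometric series
-- gives a schedule of cost O(ρ) times the optimum.
--
-- Unit costs: the planner adds the predecessor closure of a single set, of size
-- at most m T, whenever it covers more than the (8 m T)-th part of the uncovered
-- weight.  At most 8 m T closures are added, and at most k sets, so the number of
-- new sets is at most the geometric mean of k and 8 (m T)², that is O(√k) m T.
-- They are scheduled by depth, which gives ρ = O(√k).
--
-- Out-forests: the class of a set is the binary length of the number of its
-- descendants, so the sets of one class form vertical paths.  The planner
-- recursively walks the trees and keeps the result of a walk below v if the gain,
-- multiplied by the class of v, exceeds its cost.  Submodularity loses one unit
-- of the multiplier whenever several branches meet, but there the class drops, so
-- R = O(log k).  The scheduler goes through the O(log k) classes from large to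
-- small and fills rows of height 2 T with paths, each of cost at most T.
--
-- Polynomial time: the algorithms are written in a language of recursive
-- functions on trees in which the size of the value carried through a recursion
-- may enter its next value only linearly with factor one.  All its programs run in
-- polynomial time and are compiled to the given model.

module Submission where

open import Defs
open import Data.Product using (_×_; _,_; ∃-syntax)

module Language where

  open import Data.Bool using (Bool; true; false; T)
  open import Data.Fin using (Fin; zero; suc)
  open import Data.Fin.Patterns using (0F; 1F; 2F; 3F; 4F; 5F; 6F; 7F; 8F; 9F) public
  open import Data.Nat using (ℕ; zero; suc; _+_; _*_; _^_; _≤_; z≤n)
  open import Data.Nat.Properties
  open import Data.Nat.Tactic.RingSolver using (solve-∀)
  open import Data.Vec using (Vec; []; _∷_; lookup; zipWith; map; replicate)
  open import Relation.Binary.PropositionalEquality using (_≡_; refl; sym; trans; cong; cong₂)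

  open ≤-Reasoning

  data Poly : Set where
    con       : ℕ → Poly
    X         : Poly
    _⊞_ _⊠_ : Poly → Poly → Poly

  infixl 6 _⊞_
  infixl 7 _⊠_

  eval : Poly → ℕ → ℕ
  eval (con c) n = c
  eval X       n = n
  eval (p ⊞ q) n = eval p n + eval q n
  eval (p ⊠ q) n = eval p n * eval q n

  infixl 8 _⟨_⟩

  _⟨_⟩ : Poly → Poly → Poly
  con c   ⟨ r ⟩ = con c
  X       ⟨ r ⟩ = r
  (p ⊞ q) ⟨ r ⟩ = p ⟨ r ⟩ ⊞ q ⟨ r ⟩
  (p ⊠ q) ⟨ r ⟩ = p ⟨ r ⟩ ⊠ q ⟨ r ⟩

  eval-⟨⟩ : ∀ p r n → eval (p ⟨ r ⟩) n ≡ eval p (eval r n)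
  eval-⟨⟩ (con c) r n = refl
  eval-⟨⟩ X       r n = refl
  eval-⟨⟩ (p ⊞ q) r n = cong₂ _+_ (eval-⟨⟩ p r n) (eval-⟨⟩ q r n)
  eval-⟨⟩ (p ⊠ q) r n = cong₂ _*_ (eval-⟨⟩ p r n) (eval-⟨⟩ q r n)

  eval-mono : ∀ p {m n} → m ≤ n → eval p m ≤ eval p n
  eval-mono (con c) le = ≤-refl
  eval-mono X       le = le
  eval-mono (p ⊞ q) le = +-mono-≤ (eval-mono p le) (eval-mono q le)
  eval-mono (p ⊠ q) le = *-mono-≤ (eval-mono p le) (eval-mono q le)

  eval-⟨⟩-mono : ∀ p r {m n} → m ≤ eval r n → eval p m ≤ eval (p ⟨ r ⟩) n
  eval-⟨⟩-mono p r {_} {n} le = ≤-trans (eval-mono p le) (≤-reflexive (sym (eval-⟨⟩ p r n)))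

  coefficient degree : Poly → ℕ
  coefficient (con c) = c
  coefficient X       = 1
  coefficient (p ⊞ q) = coefficient p + coefficient q
  coefficient (p ⊠ q) = coefficient p * coefficient q
  degree (con c) = 0
  degree X       = 1
  degree (p ⊞ q) = degree p + degree q
  degree (p ⊠ q) = degree p + degree q

  eval-monomial : ∀ p {n} → 1 ≤ n → eval p n ≤ coefficient p * n ^ degree p
  eval-monomial (con c) _ = ≤-reflexive (sym (*-identityʳ c))
  eval-monomial X {n} _ = ≤-reflexive (sym (trans (*-identityˡ (n * 1)) (*-identityʳ n)))
  eval-monomial (p ⊞ q) {n@(suc _)} n≥1 = begin
    eval p n + eval q n
      ≤⟨ +-mono-≤ (eval-monomial p n≥1) (eval-monomial q n≥1) ⟩
    coefficient p * n ^ degree p + coefficient q * n ^ degree q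
      ≤⟨ +-mono-≤ (*-monoʳ-≤ (coefficient p) (^-monoʳ-≤ n (m≤m+n (degree p) (degree q))))
                  (*-monoʳ-≤ (coefficient q) (^-monoʳ-≤ n (m≤n+m (degree q) (degree p)))) ⟩
    coefficient p * n ^ (degree p + degree q) + coefficient q * n ^ (degree p + degree q)
      ≡⟨ *-distribʳ-+ (n ^ (degree p + degree q)) (coefficient p) (coefficient q) ⟨
    (coefficient p + coefficient q) * n ^ (degree p + degree q) ∎
  eval-monomial (p ⊠ q) {n} n≥1 = begin
    eval p n * eval q n
      ≤⟨ *-mono-≤ (eval-monomial p n≥1) (eval-monomial q n≥1) ⟩
    coefficient p * n ^ degree p * (coefficient q * n ^ degree q)
      ≡⟨ [m*n]*[o*p]≡[m*o]*[n*p] (coefficient p) (n ^ degree p) (coefficient q) (n ^ degree q) ⟩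
    coefficient p * coefficient q * (n ^ degree p * n ^ degree q)
      ≡⟨ cong (coefficient p * coefficient q *_) (^-distribˡ-+-* n (degree p) (degree q)) ⟨
    coefficient p * coefficient q * n ^ (degree p + degree q) ∎

  -- The size of a value may depend on the size of a variable not at all,
  -- linearly with factor one, or polynomially.

  data Growth : Set where
    𝟎 𝟏 ω : Growth

  infixl 6 _⊕_ _⊔ᵍ_
  infixl 7 _⊗_

  _⊕_ _⊔ᵍ_ _⊗_ : Growth → Growth → Growth
  𝟎 ⊕ k = k
  𝟏 ⊕ 𝟎 = 𝟏
  𝟏 ⊕ 𝟏 = ω
  𝟏 ⊕ ω = ω
  ω ⊕ _ = ω
  𝟎 ⊔ᵍ k = k
  𝟏 ⊔ᵍ 𝟎 = 𝟏
  𝟏 ⊔ᵍ 𝟏 = 𝟏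
  𝟏 ⊔ᵍ ω = ω
  ω ⊔ᵍ _ = ω
  𝟎 ⊗ _ = 𝟎
  𝟏 ⊗ k = k
  ω ⊗ 𝟎 = 𝟎
  ω ⊗ 𝟏 = ω
  ω ⊗ ω = ω

  linear? : Growth → Bool
  linear? ω = false
  linear? _ = true

  poly lin : Growth → ℕ → ℕ
  poly ω x = x
  poly _ x = 0
  lin  𝟏 x = x
  lin  _ x = 0

  total : ∀ {v} → Vec Tree v → ℕ
  total []      = 0
  total (x ∷ ρ) = size x + total ρ

  polys lins : ∀ {v} → Vec Growth v → Vec Tree v → ℕ
  polys []      []      = 0
  polys (k ∷ κ) (x ∷ ρ) = poly k (size x) + polys κ ρ
  lins  []      []      = 0
  lins  (k ∷ κ) (x ∷ ρ) = lin k (size x) + lins κ ρ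

  poly-≤ : ∀ k x → poly k x ≤ x
  poly-≤ 𝟎 x = z≤n
  poly-≤ 𝟏 x = z≤n
  poly-≤ ω x = ≤-refl

  lin-≤ : ∀ k x → lin k x ≤ x
  lin-≤ 𝟎 x = z≤n
  lin-≤ 𝟏 x = ≤-refl
  lin-≤ ω x = z≤n

  poly-mono : ∀ k {x y} → x ≤ y → poly k x ≤ poly k y
  poly-mono 𝟎 le = z≤n
  poly-mono 𝟏 le = z≤n
  poly-mono ω le = le

  lin-mono : ∀ k {x y} → x ≤ y → lin k x ≤ lin k y
  lin-mono 𝟎 le = z≤n
  lin-mono 𝟏 le = le
  lin-mono ω le = z≤n

  polys-≤ : ∀ {v} (κ : Vec Growth v) ρ → polys κ ρ ≤ total ρ
  polys-≤ []      []      = z≤n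
  polys-≤ (k ∷ κ) (x ∷ ρ) = +-mono-≤ (poly-≤ k (size x)) (polys-≤ κ ρ)

  lins-≤ : ∀ {v} (κ : Vec Growth v) ρ → lins κ ρ ≤ total ρ
  lins-≤ []      []      = z≤n
  lins-≤ (k ∷ κ) (x ∷ ρ) = +-mono-≤ (lin-≤ k (size x)) (lins-≤ κ ρ)

  poly-⊕ˡ : ∀ k l x → poly k x ≤ poly (k ⊕ l) x
  poly-⊕ˡ 𝟎 l x = z≤n
  poly-⊕ˡ 𝟏 l x = z≤n
  poly-⊕ˡ ω l x = ≤-refl

  poly-⊕ʳ : ∀ k l x → poly l x ≤ poly (k ⊕ l) x
  poly-⊕ʳ 𝟎 l x = ≤-refl
  poly-⊕ʳ 𝟏 𝟎 x = z≤n
  poly-⊕ʳ 𝟏 𝟏 x = z≤n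
  poly-⊕ʳ 𝟏 ω x = ≤-refl
  poly-⊕ʳ ω l x = poly-≤ l x

  lin-⊕ : ∀ k l x → lin k x + lin l x ≤ lin (k ⊕ l) x + (poly (k ⊕ l) x + poly (k ⊕ l) x)
  lin-⊕ 𝟎 l x = m≤m+n _ _
  lin-⊕ 𝟏 𝟎 x = ≤-refl
  lin-⊕ 𝟏 𝟏 x = ≤-refl
  lin-⊕ 𝟏 ω x = +-monoʳ-≤ x z≤n
  lin-⊕ ω l x = ≤-trans (lin-≤ l x) (m≤m+n x x)

  poly-⊔ˡ : ∀ k l x → poly k x ≤ poly (k ⊔ᵍ l) x
  poly-⊔ˡ 𝟎 l x = z≤n
  poly-⊔ˡ 𝟏 l x = z≤n
  poly-⊔ˡ ω l x = ≤-refl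

  poly-⊔ʳ : ∀ k l x → poly l x ≤ poly (k ⊔ᵍ l) x
  poly-⊔ʳ 𝟎 l x = ≤-refl
  poly-⊔ʳ 𝟏 𝟎 x = z≤n
  poly-⊔ʳ 𝟏 𝟏 x = z≤n
  poly-⊔ʳ 𝟏 ω x = ≤-refl
  poly-⊔ʳ ω l x = poly-≤ l x

  lin-⊔ˡ : ∀ k l x → lin k x ≤ lin (k ⊔ᵍ l) x + poly (k ⊔ᵍ l) x
  lin-⊔ˡ 𝟎 l x = z≤n
  lin-⊔ˡ 𝟏 𝟎 x = m≤m+n x 0
  lin-⊔ˡ 𝟏 𝟏 x = m≤m+n x 0
  lin-⊔ˡ 𝟏 ω x = ≤-refl
  lin-⊔ˡ ω l x = z≤n

  lin-⊔ʳ : ∀ k l x → lin l x ≤ lin (k ⊔ᵍ l) x + poly (k ⊔ᵍ l) x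
  lin-⊔ʳ 𝟎 l x = m≤m+n _ _
  lin-⊔ʳ 𝟏 𝟎 x = z≤n
  lin-⊔ʳ 𝟏 𝟏 x = m≤m+n x 0
  lin-⊔ʳ 𝟏 ω x = z≤n
  lin-⊔ʳ ω l x = lin-≤ l x

  poly-ω : ∀ k x → poly k x + lin k x ≡ poly (ω ⊗ k) x
  poly-ω 𝟎 x = refl
  poly-ω 𝟏 x = refl
  poly-ω ω x = +-identityʳ x

  polys-⊕ˡ : ∀ {v} (κ λ′ : Vec Growth v) ρ → polys κ ρ ≤ polys (zipWith _⊕_ κ λ′) ρ
  polys-⊕ˡ []      []       []      = z≤n
  polys-⊕ˡ (k ∷ κ) (l ∷ λ′) (x ∷ ρ) = +-mono-≤ (poly-⊕ˡ k l (size x)) (polys-⊕ˡ κ λ′ ρ)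

  polys-⊕ʳ : ∀ {v} (κ λ′ : Vec Growth v) ρ → polys λ′ ρ ≤ polys (zipWith _⊕_ κ λ′) ρ
  polys-⊕ʳ []      []       []      = z≤n
  polys-⊕ʳ (k ∷ κ) (l ∷ λ′) (x ∷ ρ) = +-mono-≤ (poly-⊕ʳ k l (size x)) (polys-⊕ʳ κ λ′ ρ)

  lins-⊕ : ∀ {v} (κ λ′ : Vec Growth v) ρ → let μ = zipWith _⊕_ κ λ′ in
           lins κ ρ + lins λ′ ρ ≤ lins μ ρ + (polys μ ρ + polys μ ρ)
  lins-⊕ []      []       []      = z≤n
  lins-⊕ (k ∷ κ) (l ∷ λ′) (x ∷ ρ) = begin
    (lin k s + lins κ ρ) + (lin l s + lins λ′ ρ)
      ≡⟨ +-interchange (lin k s) (lins κ ρ) (lin l s) (lins λ′ ρ) ⟩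
    (lin k s + lin l s) + (lins κ ρ + lins λ′ ρ)
      ≤⟨ +-mono-≤ (lin-⊕ k l s) (lins-⊕ κ λ′ ρ) ⟩
    (lin (k ⊕ l) s + (poly (k ⊕ l) s + poly (k ⊕ l) s)) + (lins μ ρ + (polys μ ρ + polys μ ρ))
      ≡⟨ shuffle (lin (k ⊕ l) s) (poly (k ⊕ l) s) (lins μ ρ) (polys μ ρ) ⟩
    (lin (k ⊕ l) s + lins μ ρ) + ((poly (k ⊕ l) s + polys μ ρ) + (poly (k ⊕ l) s + polys μ ρ)) ∎
    where
    s = size x
    μ = zipWith _⊕_ κ λ′
    +-interchange : ∀ a b c d → (a + b) + (c + d) ≡ (a + c) + (b + d)
    +-interchange = solve-∀
    shuffle : ∀ a b c d → (a + (b + b)) + (c + (d + d)) ≡ (a + c) + ((b + d) + (b + d))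
    shuffle = solve-∀

  polys-⊔ˡ : ∀ {v} (κ λ′ : Vec Growth v) ρ → polys κ ρ ≤ polys (zipWith _⊔ᵍ_ κ λ′) ρ
  polys-⊔ˡ []      []       []      = z≤n
  polys-⊔ˡ (k ∷ κ) (l ∷ λ′) (x ∷ ρ) = +-mono-≤ (poly-⊔ˡ k l (size x)) (polys-⊔ˡ κ λ′ ρ)

  polys-⊔ʳ : ∀ {v} (κ λ′ : Vec Growth v) ρ → polys λ′ ρ ≤ polys (zipWith _⊔ᵍ_ κ λ′) ρ
  polys-⊔ʳ []      []       []      = z≤n
  polys-⊔ʳ (k ∷ κ) (l ∷ λ′) (x ∷ ρ) = +-mono-≤ (poly-⊔ʳ k l (size x)) (polys-⊔ʳ κ λ′ ρ)

  lins-shuffle : ∀ a b c d → (a + b) + (c + d) ≡ (a + c) + (b + d)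
  lins-shuffle = solve-∀

  lins-⊔ˡ : ∀ {v} (κ λ′ : Vec Growth v) ρ → let μ = zipWith _⊔ᵍ_ κ λ′ in lins κ ρ ≤ lins μ ρ + polys μ ρ
  lins-⊔ˡ []      []       []      = z≤n
  lins-⊔ˡ (k ∷ κ) (l ∷ λ′) (x ∷ ρ) =
    ≤-trans (+-mono-≤ (lin-⊔ˡ k l (size x)) (lins-⊔ˡ κ λ′ ρ))
            (≤-reflexive (lins-shuffle (lin (k ⊔ᵍ l) (size x)) (poly (k ⊔ᵍ l) (size x)) _ _))

  lins-⊔ʳ : ∀ {v} (κ λ′ : Vec Growth v) ρ → let μ = zipWith _⊔ᵍ_ κ λ′ in lins λ′ ρ ≤ lins μ ρ + polys μ ρ
  lins-⊔ʳ []      []       []      = z≤n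
  lins-⊔ʳ (k ∷ κ) (l ∷ λ′) (x ∷ ρ) =
    ≤-trans (+-mono-≤ (lin-⊔ʳ k l (size x)) (lins-⊔ʳ κ λ′ ρ))
            (≤-reflexive (lins-shuffle (lin (k ⊔ᵍ l) (size x)) (poly (k ⊔ᵍ l) (size x)) _ _))

  polys-ω : ∀ {v} (κ : Vec Growth v) ρ → polys κ ρ + lins κ ρ ≡ polys (map (ω ⊗_) κ) ρ
  polys-ω []      []      = refl
  polys-ω (k ∷ κ) (x ∷ ρ) =
    trans (lins-shuffle (poly k (size x)) (polys κ ρ) _ _) (cong₂ _+_ (poly-ω k (size x)) (polys-ω κ ρ))

  map-𝟏 : ∀ {v} (κ : Vec Growth v) → map (𝟏 ⊗_) κ ≡ κ
  map-𝟏 []      = refl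
  map-𝟏 (k ∷ κ) = cong (k ∷_) (map-𝟏 κ)

  bound : ∀ {v} → Vec Growth v → Poly → Vec Tree v → ℕ
  bound κ P ρ = eval P (polys κ ρ) + lins κ ρ

  bound-total : ∀ {v} (κ : Vec Growth v) P ρ → bound κ P ρ ≤ eval (P ⊞ X) (total ρ)
  bound-total κ P ρ = +-mono-≤ (eval-mono P (polys-≤ κ ρ)) (lins-≤ κ ρ)

  infixl 7 _⊙_

  _⊙_ : Poly → Poly → Poly
  Q ⊙ P = Q ⟨ X ⊞ (P ⊞ X) ⟩ ⊞ (P ⊞ (X ⊞ X))

  -- A value of size S, bounded through κ₁, is substituted for a variable of
  -- growth m; e and l stand for the contribution of the other variables.
  absorb : ∀ {v} Q P (m : Growth) (κ κ₁ : Vec Growth v) ρ {S} e l → S ≤ bound κ₁ P ρ →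
           let μ = zipWith _⊕_ κ (map (m ⊗_) κ₁) in
           eval Q (polys κ ρ + poly m S + e) + (lins κ ρ + lin m S + l) ≤
           eval (Q ⊙ P) (polys μ ρ + e) + (lins μ ρ + l)
  absorb Q P m κ κ₁ ρ {S} e l S≤ = begin
    eval Q (polys κ ρ + poly m S + e) + (lins κ ρ + lin m S + l)
      ≤⟨ +-mono-≤ (eval-⟨⟩-mono Q R arg) rest ⟩
    eval (Q ⟨ R ⟩) n + (eval (P ⊞ (X ⊞ X)) n + (lins μ ρ + l))
      ≡⟨ +-assoc (eval (Q ⟨ R ⟩) n) (eval (P ⊞ (X ⊞ X)) n) (lins μ ρ + l) ⟨
    eval (Q ⊙ P) n + (lins μ ρ + l) ∎
    where
    κ₂ = map (m ⊗_) κ₁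
    μ = zipWith _⊕_ κ κ₂
    n = polys μ ρ + e
    R = X ⊞ (P ⊞ X)
    n≥ : polys μ ρ ≤ n
    n≥ = m≤m+n (polys μ ρ) e
    left : polys κ ρ + e ≤ n
    left = +-monoˡ-≤ e (polys-⊕ˡ κ κ₂ ρ)
    right : polys κ₂ ρ ≤ n
    right = ≤-trans (polys-⊕ʳ κ κ₂ ρ) n≥
    both : lins κ ρ + lins κ₂ ρ ≤ lins μ ρ + (n + n)
    both = ≤-trans (lins-⊕ κ κ₂ ρ) (+-monoʳ-≤ (lins μ ρ) (+-mono-≤ n≥ n≥))
    swap : ∀ a b c → a + b + c ≡ a + c + b
    swap = solve-∀
    polyS : ∀ m → m ⊗ ω ≡ m ⊗ ω → polys (map (m ⊗_) κ₁) ρ ≤ n → poly m S ≤ eval (P ⊞ X) n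
    polyS 𝟎 _ _ = z≤n
    polyS 𝟏 _ _ = z≤n
    polyS ω _ r = ≤-trans S≤ (+-mono-≤
      (eval-mono P (≤-trans (m≤m+n _ _) (≤-trans (≤-reflexive (polys-ω κ₁ ρ)) r)))
      (≤-trans (m≤n+m _ _) (≤-trans (≤-reflexive (polys-ω κ₁ ρ)) r)))
    arg : polys κ ρ + poly m S + e ≤ eval R n
    arg = begin
      polys κ ρ + poly m S + e   ≡⟨ swap (polys κ ρ) (poly m S) e ⟩
      polys κ ρ + e + poly m S   ≤⟨ +-mono-≤ left (polyS m refl right) ⟩
      eval R n                   ∎
    linS : ∀ m → polys (map (m ⊗_) κ₁) ρ ≤ n → lin m S ≤ eval P n + lins (map (m ⊗_) κ₁) ρ
    linS 𝟎 _ = z≤n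
    linS ω _ = z≤n
    linS 𝟏 r = ≤-trans S≤ (+-mono-≤
      (eval-mono P (≤-trans (≤-reflexive (cong (λ κ → polys κ ρ) (sym (map-𝟏 κ₁)))) r))
      (≤-reflexive (cong (λ κ → lins κ ρ) (sym (map-𝟏 κ₁)))))
    shuffle₁ : ∀ a p b l → a + (p + b) + l ≡ p + (a + b) + l
    shuffle₁ = solve-∀
    shuffle₂ : ∀ p a n l → p + (a + (n + n)) + l ≡ (p + (n + n)) + (a + l)
    shuffle₂ = solve-∀
    rest : lins κ ρ + lin m S + l ≤ eval (P ⊞ (X ⊞ X)) n + (lins μ ρ + l)
    rest = begin
      lins κ ρ + lin m S + l
        ≤⟨ +-monoˡ-≤ l (+-monoʳ-≤ (lins κ ρ) (linS m right)) ⟩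
      lins κ ρ + (eval P n + lins κ₂ ρ) + l
        ≡⟨ shuffle₁ (lins κ ρ) (eval P n) (lins κ₂ ρ) l ⟩
      eval P n + (lins κ ρ + lins κ₂ ρ) + l
        ≤⟨ +-monoˡ-≤ l (+-monoʳ-≤ (eval P n) both) ⟩
      eval P n + (lins μ ρ + (n + n)) + l
        ≡⟨ shuffle₂ (eval P n) (lins μ ρ) n l ⟩
      eval (P ⊞ (X ⊞ X)) n + (lins μ ρ + l) ∎

  recTree : (Tree → Tree) → (Tree → Tree → Tree → Tree) → (Tree → Tree → Tree → Tree → Tree) →
            Tree → Tree → Tree
  recTree g s h nil     p = g p
  recTree g s h (a ∙ b) p = h (recTree g s h b (s a b p)) a b p

  caseTree : Tree → Tree → (Tree → Tree → Tree) → Tree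
  caseTree nil     z f = z
  caseTree (x ∙ y) z f = f x y

  unit : ∀ {v} → Fin v → Vec Growth v
  unit zero    = 𝟏 ∷ replicate _ 𝟎
  unit (suc i) = 𝟎 ∷ unit i

  mutual
    data Code : ℕ → Set where
      var   : ∀ {v} → Fin v → Code v
      nil   : ∀ {v} → Code v
      cons  : ∀ {v} → Code v → Code v → Code v
      case  : ∀ {v} → Code v → Code v → Code (2 + v) → Code v
      app   : ∀ {v w} → Code w → Codes v w → Code v
      rec   : ∀ {v} (g : Code (1 + v)) (s : Code (3 + v)) (h : Code (4 + v))
              {_ : T (linear? (lookup (growth s) 2F))} {_ : T (linear? (lookup (growth h) 0F))} →
              Code v → Code v → Code v
      tight : ∀ {v} (c : Code 1) (b : ℕ) → (∀ x → size (⟦ c ⟧ (x ∷ [])) ≤ b + size x) → Code v → Code v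

    data Codes (v : ℕ) : ℕ → Set where
      []  : Codes v 0
      _∷_ : ∀ {w} → Code v → Codes v w → Codes v (suc w)

    ⟦_⟧ : ∀ {v} → Code v → Vec Tree v → Tree
    ⟦ var i ⟧         ρ = lookup ρ i
    ⟦ nil ⟧           ρ = nil
    ⟦ cons d e ⟧      ρ = ⟦ d ⟧ ρ ∙ ⟦ e ⟧ ρ
    ⟦ case c d e ⟧    ρ = caseTree (⟦ c ⟧ ρ) (⟦ d ⟧ ρ) (λ x y → ⟦ e ⟧ (x ∷ y ∷ ρ))
    ⟦ app c es ⟧      ρ = ⟦ c ⟧ (⟦ es ⟧* ρ)
    ⟦ rec g s h d e ⟧ ρ =
      recTree (λ p → ⟦ g ⟧ (p ∷ ρ)) (λ a b p → ⟦ s ⟧ (a ∷ b ∷ p ∷ ρ)) (λ r a b p → ⟦ h ⟧ (r ∷ a ∷ b ∷ p ∷ ρ))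
              (⟦ d ⟧ ρ) (⟦ e ⟧ ρ)
    ⟦ tight c b _ e ⟧ ρ = ⟦ c ⟧ (⟦ e ⟧ ρ ∷ [])

    ⟦_⟧* : ∀ {v w} → Codes v w → Vec Tree v → Vec Tree w
    ⟦ [] ⟧*     ρ = []
    ⟦ e ∷ es ⟧* ρ = ⟦ e ⟧ ρ ∷ ⟦ es ⟧* ρ

    growth : ∀ {v} → Code v → Vec Growth v
    growth (var i)         = unit i
    growth nil             = replicate _ 𝟎
    growth (cons d e)      = zipWith _⊕_ (growth d) (growth e)
    growth (case c d e)    = zipWith _⊔ᵍ_ (growth d) (growthCase (growth c) (growth e))
    growth (app c es)      = growthApp (replicate _ 𝟎) (growth c) es
    growth (rec g s h d e) = growthRec (growth g) (growth s) (growth h) (growth d) (growth e)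
    growth (tight c b _ e) = growth e

    growthCase : ∀ {v} → Vec Growth v → Vec Growth (2 + v) → Vec Growth v
    growthCase κ (k ∷ l ∷ λ′) = zipWith _⊕_ λ′ (map ((k ⊔ᵍ l) ⊗_) κ)

    growthApp : ∀ {v w} → Vec Growth v → Vec Growth w → Codes v w → Vec Growth v
    growthApp κ []       []       = κ
    growthApp κ (k ∷ κ′) (e ∷ es) = growthApp (zipWith _⊕_ κ (map (k ⊗_) (growth e))) κ′ es

    growthRec : ∀ {v} → Vec Growth (1 + v) → Vec Growth (3 + v) → Vec Growth (4 + v) →
                Vec Growth v → Vec Growth v → Vec Growth v
    growthRec (kg ∷ κg) (_ ∷ _ ∷ _ ∷ κs) (_ ∷ _ ∷ _ ∷ kh ∷ κh) κd κe =
      zipWith _⊕_ (zipWith _⊕_ (map (ω ⊗_) (zipWith _⊕_ κg (zipWith _⊕_ κs κh))) (map (ω ⊗_) κd))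
                  (map ((kg ⊔ᵍ ω ⊗ kh) ⊗_) κe)

module Sizes where

  open Language
  open import Data.Bool using (T)
  open import Data.Fin using (Fin; zero; suc)
  open import Data.Nat using (ℕ; zero; suc; _+_; _*_; _≤_; z≤n; s≤s)
  open import Data.Nat.Properties
  open import Data.Nat.Tactic.RingSolver using (solve-∀)
  open import Data.Vec using (Vec; []; _∷_; lookup; zipWith; map; replicate; tail)
  open import Relation.Binary.PropositionalEquality using (_≡_; refl; sym; trans; cong; cong₂; subst)

  open ≤-Reasoning

  sizePoly : ∀ {v} → Code v → Poly
  sizePolyApp : ∀ {v w} → Poly → Codes v w → Poly

  recPolyG recPolyA recPoly : Poly → Poly → Poly → Poly

  recPolyG G S H = S ⊞ X
  recPolyA G S H = X ⊞ X ⊠ recPolyG G S H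
  recPoly G S H = X ⊠ ((H ⊞ X) ⟨ recPolyA G S H ⟩) ⊞ (G ⊞ X) ⟨ recPolyA G S H ⟩ ⊞ X ⊠ recPolyG G S H

  sizePoly (var i)         = con 0
  sizePoly nil             = con 1
  sizePoly (cons d e)      = con 1 ⊞ sizePoly d ⊞ sizePoly e ⊞ (X ⊞ X)
  sizePoly (case c d e)    = sizePoly d ⊞ X ⊞ ((sizePoly e ⊞ X) ⊙ sizePoly c ⊞ X)
  sizePoly (app c es)      = sizePolyApp (sizePoly c) es
  sizePoly (rec g s h d e) = (recPoly (sizePoly g) (sizePoly s) (sizePoly h) ⊙ sizePoly d) ⊙ sizePoly e
  sizePoly (tight c b _ e) = con b ⊞ sizePoly e

  sizePolyApp P []       = P
  sizePolyApp P (e ∷ es) = sizePolyApp (P ⊙ sizePoly e) es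

  module RecSize (g : Tree → Tree) (s : Tree → Tree → Tree → Tree) (h : Tree → Tree → Tree → Tree → Tree)
    (X₀ G Pm H L : ℕ)
    (s≤ : ∀ a b p → size a + size b ≤ X₀ → size (s a b p) ≤ size p + G)
    (h≤ : ∀ r a b p → size a + size b ≤ X₀ → size p ≤ Pm → size (h r a b p) ≤ size r + H)
    (g≤ : ∀ p → size p ≤ Pm → size (g p) ≤ L) where

    param≤ : ∀ a b p → size (a ∙ b) ≤ X₀ → size p + size (a ∙ b) * G ≤ Pm →
             size (s a b p) + size b * G ≤ Pm
    param≤ a b p x≤ p≤ = begin
      size (s a b p) + size b * G       ≤⟨ +-monoˡ-≤ (size b * G) (s≤ a b p (m+n≤o⇒n≤o 1 x≤)) ⟩
      size p + G + size b * G           ≡⟨ +-assoc (size p) G (size b * G) ⟩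
      size p + suc (size b) * G         ≤⟨ +-monoʳ-≤ (size p) (*-monoˡ-≤ G (s≤s (m≤n+m (size b) (size a)))) ⟩
      size p + size (a ∙ b) * G         ≤⟨ p≤ ⟩
      Pm                                ∎

    tail≤ : ∀ a b → size (a ∙ b) ≤ X₀ → size b ≤ X₀
    tail≤ a b = m+n≤o⇒n≤o (suc (size a))

    recTree≤ : ∀ x p → size x ≤ X₀ → size p + size x * G ≤ Pm →
               size (recTree g s h x p) ≤ size x * H + L
    recTree≤ nil p x≤ p≤ = ≤-trans (g≤ p (m+n≤o⇒m≤o (size p) p≤)) (m≤n+m L (H + 0))
    recTree≤ (a ∙ b) p x≤ p≤ = begin
      size (h r a b p)           ≤⟨ h≤ r a b p (m+n≤o⇒n≤o 1 x≤) (m+n≤o⇒m≤o (size p) p≤) ⟩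
      size r + H                 ≤⟨ +-monoˡ-≤ H (recTree≤ b (s a b p) (tail≤ a b x≤) (param≤ a b p x≤ p≤)) ⟩
      size b * H + L + H         ≡⟨ shuffle (size b * H) L H ⟩
      suc (size b) * H + L       ≤⟨ +-monoˡ-≤ L (*-monoˡ-≤ H (s≤s (m≤n+m (size b) (size a)))) ⟩
      size (a ∙ b) * H + L       ∎
      where
      r = recTree g s h b (s a b p)
      shuffle : ∀ x l y → x + l + y ≡ y + x + l
      shuffle = solve-∀

  module RecBounds {v} (κg : Vec Growth (1 + v)) (κs : Vec Growth (3 + v)) (κh : Vec Growth (4 + v))
    (Pg Ps Ph : Poly) (ρ : Vec Tree v)
    (ok-s : T (linear? (lookup κs 2F))) (ok-h : T (linear? (lookup κh 0F))) where

    tail3 : ∀ {v} → Vec Growth (3 + v) → Vec Growth v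
    tail3 (_ ∷ _ ∷ _ ∷ κ) = κ

    tail4 : ∀ {v} → Vec Growth (4 + v) → Vec Growth v
    tail4 (_ ∷ κ) = tail3 κ

    κo : Vec Growth v
    κo = map (ω ⊗_) (zipWith _⊕_ (tail κg) (zipWith _⊕_ (tail3 κs) (tail4 κh)))

    kp : Growth
    kp = lookup κg 0F ⊔ᵍ ω ⊗ lookup κh 3F

    N : ℕ
    N = polys κo ρ

    private
      μ = zipWith _⊕_ (tail3 κs) (tail4 κh)
      κall = zipWith _⊕_ (tail κg) μ

      N≥ : ∀ κ → (polys (map (ω ⊗_) κ) ρ ≤ N) → polys κ ρ + lins κ ρ ≤ N
      N≥ κ r = ≤-trans (≤-reflexive (polys-ω κ ρ)) r

      ω-⊕ˡ : ∀ {v} (κ λ′ : Vec Growth v) ρ → polys (map (ω ⊗_) κ) ρ ≤ polys (map (ω ⊗_) (zipWith _⊕_ κ λ′)) ρ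
      ω-⊕ˡ [] [] [] = z≤n
      ω-⊕ˡ (k ∷ κ) (l ∷ λ′) (x ∷ ρ) = +-mono-≤ (aux k l (size x)) (ω-⊕ˡ κ λ′ ρ)
        where
        aux : ∀ k l x → poly (ω ⊗ k) x ≤ poly (ω ⊗ (k ⊕ l)) x
        aux 𝟎 l x = z≤n
        aux 𝟏 𝟎 x = ≤-refl
        aux 𝟏 𝟏 x = ≤-refl
        aux 𝟏 ω x = ≤-refl
        aux ω l x = ≤-refl

      ω-⊕ʳ : ∀ {v} (κ λ′ : Vec Growth v) ρ → polys (map (ω ⊗_) λ′) ρ ≤ polys (map (ω ⊗_) (zipWith _⊕_ κ λ′)) ρ
      ω-⊕ʳ [] [] [] = z≤n
      ω-⊕ʳ (k ∷ κ) (l ∷ λ′) (x ∷ ρ) = +-mono-≤ (aux k l (size x)) (ω-⊕ʳ κ λ′ ρ)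
        where
        aux : ∀ k l x → poly (ω ⊗ l) x ≤ poly (ω ⊗ (k ⊕ l)) x
        aux 𝟎 l x = ≤-refl
        aux 𝟏 𝟎 x = z≤n
        aux 𝟏 𝟏 x = ≤-refl
        aux 𝟏 ω x = ≤-refl
        aux ω l x = poly-≤ (ω ⊗ l) x

    N-g : polys (tail κg) ρ + lins (tail κg) ρ ≤ N
    N-g = N≥ (tail κg) (ω-⊕ˡ (tail κg) μ ρ)

    N-s : polys (tail3 κs) ρ + lins (tail3 κs) ρ ≤ N
    N-s = N≥ (tail3 κs) (≤-trans (ω-⊕ˡ (tail3 κs) (tail4 κh) ρ) (ω-⊕ʳ (tail κg) μ ρ))

    N-h : polys (tail4 κh) ρ + lins (tail4 κh) ρ ≤ N
    N-h = N≥ (tail4 κh) (≤-trans (ω-⊕ʳ (tail3 κs) (tail4 κh) ρ) (ω-⊕ʳ (tail κg) μ ρ))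

    private
      linear-poly : ∀ k x → T (linear? k) → poly k x ≡ 0
      linear-poly 𝟎 x _ = refl
      linear-poly 𝟏 x _ = refl

      two : ∀ (ka kb : Growth) {a b Y n} (f : Growth → ℕ → ℕ) → (∀ k x → f k x ≤ x) → a + b ≤ Y →
            n ≤ N → f ka a + (f kb b + n) ≤ Y + N
      two ka kb {a} {b} {Y} {n} f f≤ ab≤ n≤ = begin
        f ka a + (f kb b + n)   ≡⟨ +-assoc (f ka a) (f kb b) n ⟨
        f ka a + f kb b + n     ≤⟨ +-mono-≤ (+-mono-≤ (f≤ ka a) (f≤ kb b)) n≤ ⟩
        a + b + N               ≤⟨ +-monoˡ-≤ N ab≤ ⟩
        Y + N                   ∎

    s-bound : ∀ {Y} a b p z → size z ≤ bound κs Ps (a ∷ b ∷ p ∷ ρ) → size a + size b ≤ Y →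
              size z ≤ size p + eval (Ps ⊞ X) (Y + N)
    s-bound {Y} a b p z z≤ ab≤ = go κs N-s ok-s z≤
      where
      shuffle : ∀ la lb lp l → la + (lb + (lp + l)) ≡ lp + (la + (lb + l))
      shuffle = solve-∀
      shuffle′ : ∀ e p r → e + (p + r) ≡ p + (e + r)
      shuffle′ = solve-∀
      go : ∀ (κs : Vec Growth (3 + v)) → polys (tail3 κs) ρ + lins (tail3 κs) ρ ≤ N →
           T (linear? (lookup κs 2F)) → size z ≤ bound κs Ps (a ∷ b ∷ p ∷ ρ) →
           size z ≤ size p + eval (Ps ⊞ X) (Y + N)
      go (ka ∷ kb ∷ ks ∷ κ) n≤ ok z≤ = begin
        size z
          ≤⟨ z≤ ⟩
        eval Ps (poly ka (size a) + (poly kb (size b) + (poly ks (size p) + polys κ ρ))) +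
        (lin ka (size a) + (lin kb (size b) + (lin ks (size p) + lins κ ρ)))
          ≤⟨ +-mono-≤
               (eval-mono Ps (two ka kb poly poly-≤ ab≤
                 (≤-trans (≤-reflexive (cong (_+ polys κ ρ) (linear-poly ks (size p) ok))) (m+n≤o⇒m≤o _ n≤))))
               (≤-trans (≤-reflexive (shuffle (lin ka (size a)) (lin kb (size b)) (lin ks (size p)) (lins κ ρ)))
                 (+-mono-≤ (lin-≤ ks (size p)) (two ka kb lin lin-≤ ab≤ (m+n≤o⇒n≤o (polys κ ρ) n≤)))) ⟩
        eval Ps (Y + N) + (size p + (Y + N))
          ≡⟨ shuffle′ (eval Ps (Y + N)) (size p) (Y + N) ⟩
        size p + eval (Ps ⊞ X) (Y + N) ∎

    h-bound : ∀ {Y Pm A} r a b p z → size z ≤ bound κh Ph (r ∷ a ∷ b ∷ p ∷ ρ) → size a + size b ≤ Y →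
              size p ≤ Pm → Y + (poly kp Pm + N) ≤ A → size z ≤ size r + eval (Ph ⊞ X) A
    h-bound {Y} {Pm} {A} r a b p z z≤ ab≤ p≤ A≥ = go (lookup κg 0F) κh N-h ok-h A≥ z≤
      where
      shuffle′ : ∀ e p r → e + (p + r) ≡ p + (e + r)
      shuffle′ = solve-∀
      param : ∀ kg kq → poly kq (size p) ≤ poly (kg ⊔ᵍ ω ⊗ kq) Pm
      param kg 𝟎 = z≤n
      param kg 𝟏 = z≤n
      param kg ω = ≤-trans p≤ (poly-⊔ʳ kg ω Pm)
      param′ : ∀ kg kq → lin kq (size p) ≤ poly (kg ⊔ᵍ ω ⊗ kq) Pm
      param′ kg 𝟎 = z≤n
      param′ kg 𝟏 = ≤-trans p≤ (poly-⊔ʳ kg ω Pm)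
      param′ kg ω = z≤n
      go : ∀ kg (κh : Vec Growth (4 + v)) → polys (tail4 κh) ρ + lins (tail4 κh) ρ ≤ N →
           T (linear? (lookup κh 0F)) → Y + (poly (kg ⊔ᵍ ω ⊗ lookup κh 3F) Pm + N) ≤ A →
           size z ≤ bound κh Ph (r ∷ a ∷ b ∷ p ∷ ρ) →
           size z ≤ size r + eval (Ph ⊞ X) A
      go kg (kr ∷ ka ∷ kb ∷ kq ∷ κ) n≤ ok A≥ z≤ = begin
        size z
          ≤⟨ z≤ ⟩
        eval Ph (poly kr (size r) + (poly ka (size a) + (poly kb (size b) + (poly kq (size p) + polys κ ρ)))) +
        (lin kr (size r) + (lin ka (size a) + (lin kb (size b) + (lin kq (size p) + lins κ ρ))))
          ≤⟨ +-mono-≤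
               (eval-mono Ph (≤-trans (+-monoˡ-≤ _ (≤-reflexive (linear-poly kr (size r) ok)))
                 (≤-trans (abc poly poly-≤ (+-mono-≤ (param kg kq) (m+n≤o⇒m≤o _ n≤))) A≥)))
               (+-mono-≤ (lin-≤ kr (size r))
                 (≤-trans (abc lin lin-≤ (+-mono-≤ (param′ kg kq) (m+n≤o⇒n≤o (polys κ ρ) n≤))) A≥)) ⟩
        eval Ph A + (size r + A)
          ≡⟨ shuffle′ (eval Ph A) (size r) A ⟩
        size r + eval (Ph ⊞ X) A ∎
        where
        M = poly (kg ⊔ᵍ ω ⊗ kq) Pm + N
        abc : ∀ {n} (f : Growth → ℕ → ℕ) → (∀ k x → f k x ≤ x) → f kq (size p) + n ≤ M →
              f ka (size a) + (f kb (size b) + (f kq (size p) + n)) ≤ Y + M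
        abc {n} f f≤ pn≤ = ≤-trans (≤-reflexive (sym (+-assoc (f ka (size a)) (f kb (size b)) _)))
          (+-mono-≤ (≤-trans (+-mono-≤ (f≤ ka (size a)) (f≤ kb (size b))) ab≤) pn≤)

    g-bound : ∀ {Pm A} p z → size z ≤ bound κg Pg (p ∷ ρ) → size p ≤ Pm → poly kp Pm + N ≤ A →
              size z ≤ eval (Pg ⊞ X) A + lin kp Pm
    g-bound {Pm} {A} p z z≤ p≤ A≥ = go κg (lookup κh 3F) N-g A≥ z≤
      where
      linear : ∀ k l → lin k Pm ≤ lin (k ⊔ᵍ l) Pm + poly (k ⊔ᵍ l) Pm
      linear k l = lin-⊔ˡ k l Pm
      shuffle : ∀ e x y n → e + ((x + y) + n) ≡ e + (y + n) + x
      shuffle = solve-∀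
      go : ∀ (κg : Vec Growth (1 + v)) kq → polys (tail κg) ρ + lins (tail κg) ρ ≤ N →
           poly (lookup κg 0F ⊔ᵍ ω ⊗ kq) Pm + N ≤ A →
           size z ≤ bound κg Pg (p ∷ ρ) → size z ≤ eval (Pg ⊞ X) A + lin (lookup κg 0F ⊔ᵍ ω ⊗ kq) Pm
      go (kg ∷ κ) kq n≤ A≥ z≤ = begin
        size z
          ≤⟨ z≤ ⟩
        eval Pg (poly kg (size p) + polys κ ρ) + (lin kg (size p) + lins κ ρ)
          ≤⟨ +-mono-≤
               (eval-mono Pg (≤-trans (+-mono-≤ (≤-trans (poly-mono kg p≤) (poly-⊔ˡ kg kpω Pm)) (m+n≤o⇒m≤o _ n≤)) A≥))
               (+-mono-≤ (≤-trans (lin-mono kg p≤) (linear kg kpω)) (m+n≤o⇒n≤o (polys κ ρ) n≤)) ⟩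
        eval Pg A + ((lin (kg ⊔ᵍ kpω) Pm + poly (kg ⊔ᵍ kpω) Pm) + N)
          ≡⟨ shuffle (eval Pg A) (lin (kg ⊔ᵍ kpω) Pm) (poly (kg ⊔ᵍ kpω) Pm) N ⟩
        eval Pg A + (poly (kg ⊔ᵍ kpω) Pm + N) + lin (kg ⊔ᵍ kpω) Pm
          ≤⟨ +-monoˡ-≤ (lin (kg ⊔ᵍ kpω) Pm) (+-monoʳ-≤ (eval Pg A) A≥) ⟩
        eval (Pg ⊞ X) A + lin (kg ⊔ᵍ kpω) Pm ∎
        where kpω = ω ⊗ kq

    module Total (X₀ p₀ : ℕ) where
      G Pm y A H L : ℕ
      G = eval (Ps ⊞ X) (X₀ + N)
      Pm = p₀ + X₀ * G
      y = polys κo ρ + X₀ + poly kp p₀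
      A = eval (recPolyA Pg Ps Ph) y
      H = eval (Ph ⊞ X) A
      L = eval (Pg ⊞ X) A + lin kp Pm

      private
        y≥ : X₀ + N ≤ y
        y≥ = ≤-trans (≤-reflexive (+-comm X₀ N)) (m≤m+n (N + X₀) (poly kp p₀))

        G≤ : G ≤ eval (recPolyG Pg Ps Ph) y
        G≤ = eval-mono (Ps ⊞ X) y≥

        poly-+ : ∀ k a b → poly k (a + b) ≤ poly k a + b
        poly-+ 𝟎 a b = z≤n
        poly-+ 𝟏 a b = z≤n
        poly-+ ω a b = ≤-refl

        lin-+ : ∀ k a b → lin k (a + b) ≤ lin k a + b
        lin-+ 𝟎 a b = z≤n
        lin-+ 𝟏 a b = ≤-refl
        lin-+ ω a b = z≤n

        XG≤ : X₀ * G ≤ y * eval (recPolyG Pg Ps Ph) y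
        XG≤ = *-mono-≤ (≤-trans (m≤m+n X₀ N) y≥) G≤

      A≥ : X₀ + (poly kp Pm + N) ≤ A
      A≥ = begin
        X₀ + (poly kp Pm + N)                  ≤⟨ +-monoʳ-≤ X₀ (+-monoˡ-≤ N (poly-+ kp p₀ (X₀ * G))) ⟩
        X₀ + (poly kp p₀ + X₀ * G + N)         ≡⟨ shuffle X₀ (poly kp p₀) (X₀ * G) N ⟩
        y + X₀ * G                             ≤⟨ +-monoʳ-≤ y XG≤ ⟩
        A                                      ∎
        where
        shuffle : ∀ x p g n → x + (p + g + n) ≡ n + x + p + g
        shuffle = solve-∀

      total≤ : X₀ * H + L ≤ eval (recPoly Pg Ps Ph) y + lin kp p₀
      total≤ = begin
        X₀ * H + (eval (Pg ⊞ X) A + lin kp Pm)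
          ≤⟨ +-mono-≤ (*-monoˡ-≤ H (≤-trans (m≤m+n X₀ N) y≥)) (+-monoʳ-≤ (eval (Pg ⊞ X) A)
               (≤-trans (lin-+ kp p₀ (X₀ * G)) (+-monoʳ-≤ (lin kp p₀) XG≤))) ⟩
        y * H + (eval (Pg ⊞ X) A + (lin kp p₀ + y * eval (recPolyG Pg Ps Ph) y))
          ≡⟨ cong₂ (λ h g → y * h + (g + (lin kp p₀ + y * eval (recPolyG Pg Ps Ph) y)))
               (sym (eval-⟨⟩ (Ph ⊞ X) (recPolyA Pg Ps Ph) y)) (sym (eval-⟨⟩ (Pg ⊞ X) (recPolyA Pg Ps Ph) y)) ⟩
        y * H′ + (G′ + (lin kp p₀ + y * eval (recPolyG Pg Ps Ph) y))
          ≡⟨ shuffle (y * H′) G′ (lin kp p₀) (y * eval (recPolyG Pg Ps Ph) y) ⟩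
        eval (recPoly Pg Ps Ph) y + lin kp p₀ ∎
        where
        H′ = eval ((Ph ⊞ X) ⟨ recPolyA Pg Ps Ph ⟩) y
        G′ = eval ((Pg ⊞ X) ⟨ recPolyA Pg Ps Ph ⟩) y
        shuffle : ∀ a b c d → a + (b + (c + d)) ≡ a + b + d + c
        shuffle = solve-∀

  growthRec-≡ : ∀ {v} (κg : Vec Growth (1 + v)) (κs : Vec Growth (3 + v)) (κh : Vec Growth (4 + v)) κd κe Pg Ps Ph ρ a b →
    let open RecBounds κg κs κh Pg Ps Ph ρ a b in
    growthRec κg κs κh κd κe ≡ zipWith _⊕_ (zipWith _⊕_ κo (map (ω ⊗_) κd)) (map (kp ⊗_) κe)
  growthRec-≡ (_ ∷ _) (_ ∷ _ ∷ _ ∷ _) (_ ∷ _ ∷ _ ∷ _ ∷ _) κd κe Pg Ps Ph ρ a b = refl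

  polys-zero : ∀ {v} (ρ : Vec Tree v) → polys (replicate _ 𝟎) ρ ≡ 0
  polys-zero []      = refl
  polys-zero (x ∷ ρ) = polys-zero ρ

  lins-zero : ∀ {v} (ρ : Vec Tree v) → lins (replicate _ 𝟎) ρ ≡ 0
  lins-zero []      = refl
  lins-zero (x ∷ ρ) = lins-zero ρ

  size≤ : ∀ {v} (c : Code v) ρ → size (⟦ c ⟧ ρ) ≤ bound (growth c) (sizePoly c) ρ

  sizeApp≤ : ∀ {v w} P (κ : Vec Growth v) (κ′ : Vec Growth w) (es : Codes v w) ρ →
             eval P (polys κ ρ + polys κ′ (⟦ es ⟧* ρ)) + (lins κ ρ + lins κ′ (⟦ es ⟧* ρ)) ≤
             bound (growthApp κ κ′ es) (sizePolyApp P es) ρ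
  sizeApp≤ P κ [] [] ρ = ≤-reflexive (cong₂ _+_ (cong (eval P) (+-identityʳ (polys κ ρ))) (+-identityʳ (lins κ ρ)))
  sizeApp≤ P κ (k ∷ κ′) (e ∷ es) ρ = begin
    eval P (polys κ ρ + (poly k S + polys κ′ σ)) + (lins κ ρ + (lin k S + lins κ′ σ))
      ≡⟨ cong₂ (λ x y → eval P x + y) (+-assoc (polys κ ρ) _ _) (+-assoc (lins κ ρ) _ _) ⟨
    eval P (polys κ ρ + poly k S + polys κ′ σ) + (lins κ ρ + lin k S + lins κ′ σ)
      ≤⟨ absorb P (sizePoly e) k κ (growth e) ρ (polys κ′ σ) (lins κ′ σ) (size≤ e ρ) ⟩
    eval (P ⊙ sizePoly e) (polys μ ρ + polys κ′ σ) + (lins μ ρ + lins κ′ σ)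
      ≤⟨ sizeApp≤ (P ⊙ sizePoly e) μ κ′ es ρ ⟩
    bound (growthApp μ κ′ es) (sizePolyApp (P ⊙ sizePoly e) es) ρ ∎
    where
    S = size (⟦ e ⟧ ρ)
    σ = ⟦ es ⟧* ρ
    μ = zipWith _⊕_ κ (map (k ⊗_) (growth e))

  sizeCase≤ : ∀ {v} Pc Pe (κ : Vec Growth v) (λ′ : Vec Growth (2 + v)) ρ x y z →
              size (x ∙ y) ≤ bound κ Pc ρ → z ≤ bound λ′ Pe (x ∷ y ∷ ρ) →
              z ≤ bound (growthCase κ λ′) ((Pe ⊞ X) ⊙ Pc) ρ
  sizeCase≤ Pc Pe κ (k ∷ l ∷ λ′) ρ x y z xy≤ z≤ = begin
    z
      ≤⟨ z≤ ⟩
    eval Pe (poly k (size x) + (poly l (size y) + polys λ′ ρ)) + (lin k (size x) + (lin l (size y) + lins λ′ ρ))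
      ≤⟨ +-mono-≤ (eval-mono Pe polys≤) lins≤ ⟩
    eval Pe n + (n + (lins λ′ ρ + lin m S + 0))
      ≡⟨ +-assoc (eval Pe n) n _ ⟨
    eval (Pe ⊞ X) n + (lins λ′ ρ + lin m S + 0)
      ≤⟨ absorb (Pe ⊞ X) Pc m λ′ κ ρ 0 0 xy≤ ⟩
    eval ((Pe ⊞ X) ⊙ Pc) (polys μ ρ + 0) + (lins μ ρ + 0)
      ≡⟨ cong₂ (λ a b → eval ((Pe ⊞ X) ⊙ Pc) a + b) (+-identityʳ _) (+-identityʳ _) ⟩
    bound μ ((Pe ⊞ X) ⊙ Pc) ρ ∎
    where
    S = size (x ∙ y)
    m = k ⊔ᵍ l
    n = polys λ′ ρ + poly m S + 0
    μ = zipWith _⊕_ λ′ (map (m ⊗_) κ)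
    sum≤ : size x + size y ≤ S
    sum≤ = n≤1+n _
    x≤ : size x ≤ S
    x≤ = ≤-trans (m≤m+n (size x) (size y)) sum≤
    y≤ : size y ≤ S
    y≤ = ≤-trans (m≤n+m (size y) (size x)) sum≤
    both : ∀ k l → poly k (size x) + poly l (size y) ≤ poly (k ⊔ᵍ l) S
    both 𝟎 𝟎 = z≤n
    both 𝟎 𝟏 = z≤n
    both 𝟎 ω = y≤
    both 𝟏 𝟎 = z≤n
    both 𝟏 𝟏 = z≤n
    both 𝟏 ω = y≤
    both ω 𝟎 = ≤-trans (+-monoʳ-≤ (size x) z≤n) sum≤
    both ω 𝟏 = ≤-trans (+-monoʳ-≤ (size x) z≤n) sum≤
    both ω ω = sum≤
    both′ : ∀ k l → lin k (size x) + lin l (size y) ≤ poly (k ⊔ᵍ l) S + lin (k ⊔ᵍ l) S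
    both′ 𝟎 𝟎 = z≤n
    both′ 𝟎 𝟏 = y≤
    both′ 𝟎 ω = z≤n
    both′ 𝟏 𝟎 = ≤-trans (+-monoʳ-≤ (size x) z≤n) sum≤
    both′ 𝟏 𝟏 = sum≤
    both′ 𝟏 ω = ≤-trans (+-monoʳ-≤ (size x) z≤n) (≤-trans sum≤ (m≤m+n S 0))
    both′ ω 𝟎 = z≤n
    both′ ω 𝟏 = ≤-trans y≤ (m≤m+n S 0)
    both′ ω ω = z≤n
    shuffle : ∀ a b c → (a + b) + c ≡ c + (a + b) + 0
    shuffle = solve-∀
    polys≤ : poly k (size x) + (poly l (size y) + polys λ′ ρ) ≤ n
    polys≤ = begin
      poly k (size x) + (poly l (size y) + polys λ′ ρ)   ≡⟨ +-assoc (poly k (size x)) _ _ ⟨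
      poly k (size x) + poly l (size y) + polys λ′ ρ     ≤⟨ +-monoˡ-≤ (polys λ′ ρ) (both k l) ⟩
      poly m S + polys λ′ ρ                              ≡⟨ trans (+-comm (poly m S) _) (sym (+-identityʳ _)) ⟩
      n                                                  ∎
    shuffle′ : ∀ p l r → (p + l) + r ≡ p + (r + l + 0)
    shuffle′ = solve-∀
    lins≤ : lin k (size x) + (lin l (size y) + lins λ′ ρ) ≤ n + (lins λ′ ρ + lin m S + 0)
    lins≤ = begin
      lin k (size x) + (lin l (size y) + lins λ′ ρ)      ≡⟨ +-assoc (lin k (size x)) _ _ ⟨
      lin k (size x) + lin l (size y) + lins λ′ ρ        ≤⟨ +-monoˡ-≤ (lins λ′ ρ) (both′ k l) ⟩
      poly m S + lin m S + lins λ′ ρ                     ≡⟨ shuffle′ (poly m S) (lin m S) (lins λ′ ρ) ⟩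
      poly m S + (lins λ′ ρ + lin m S + 0)
        ≤⟨ +-monoˡ-≤ _ (≤-trans (m≤n+m (poly m S) (polys λ′ ρ)) (m≤m+n _ 0)) ⟩
      n + (lins λ′ ρ + lin m S + 0) ∎

  size≤ (var i) ρ = go i ρ
    where
    go : ∀ {v} (i : Fin v) ρ → size (lookup ρ i) ≤ 0 + lins (unit i) ρ
    go zero    (x ∷ ρ) = m≤m+n (size x) _
    go (suc i) (x ∷ ρ) = go i ρ
  size≤ nil ρ = m≤m+n 1 _
  size≤ (cons d e) ρ = begin
    1 + size (⟦ d ⟧ ρ) + size (⟦ e ⟧ ρ)
      ≤⟨ s≤s (+-mono-≤ (size≤ d ρ) (size≤ e ρ)) ⟩
    1 + (eval Pd (polys κ ρ) + lins κ ρ) + (eval Pe (polys λ′ ρ) + lins λ′ ρ)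
      ≤⟨ s≤s (+-mono-≤ (+-monoˡ-≤ (lins κ ρ) (eval-mono Pd (polys-⊕ˡ κ λ′ ρ)))
                       (+-monoˡ-≤ (lins λ′ ρ) (eval-mono Pe (polys-⊕ʳ κ λ′ ρ)))) ⟩
    1 + (eval Pd n + lins κ ρ) + (eval Pe n + lins λ′ ρ)
      ≡⟨ shuffle (eval Pd n) (lins κ ρ) (eval Pe n) (lins λ′ ρ) ⟩
    1 + eval Pd n + eval Pe n + (lins κ ρ + lins λ′ ρ)
      ≤⟨ +-monoʳ-≤ (1 + eval Pd n + eval Pe n) (lins-⊕ κ λ′ ρ) ⟩
    1 + eval Pd n + eval Pe n + (lins μ ρ + (n + n))
      ≡⟨ shuffle′ (1 + eval Pd n + eval Pe n) (lins μ ρ) n ⟩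
    bound μ (con 1 ⊞ Pd ⊞ Pe ⊞ (X ⊞ X)) ρ ∎
    where
    κ = growth d
    λ′ = growth e
    Pd = sizePoly d
    Pe = sizePoly e
    μ = zipWith _⊕_ κ λ′
    n = polys μ ρ
    shuffle : ∀ a l b k → 1 + (a + l) + (b + k) ≡ 1 + a + b + (l + k)
    shuffle = solve-∀
    shuffle′ : ∀ a l n → a + (l + (n + n)) ≡ a + (n + n) + l
    shuffle′ = solve-∀
  size≤ (case c d e) ρ = go (⟦ c ⟧ ρ) refl
    where
    κ = growth d
    λ′ = growthCase (growth c) (growth e)
    μ = zipWith _⊔ᵍ_ κ λ′
    n = polys μ ρ
    Pd = sizePoly d
    Pe = (sizePoly e ⊞ X) ⊙ sizePoly c
    go : ∀ x → ⟦ c ⟧ ρ ≡ x → size (caseTree x (⟦ d ⟧ ρ) (λ x y → ⟦ e ⟧ (x ∷ y ∷ ρ))) ≤ bound μ (Pd ⊞ X ⊞ (Pe ⊞ X)) ρ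
    go nil eq = begin
      size (⟦ d ⟧ ρ)                           ≤⟨ size≤ d ρ ⟩
      eval Pd (polys κ ρ) + lins κ ρ           ≤⟨ +-mono-≤ (eval-mono Pd (polys-⊔ˡ κ λ′ ρ)) (lins-⊔ˡ κ λ′ ρ) ⟩
      eval Pd n + (lins μ ρ + n)               ≤⟨ m≤m+n _ (eval (Pe ⊞ X) n) ⟩
      eval Pd n + (lins μ ρ + n) + eval (Pe ⊞ X) n ≡⟨ shuffle (eval Pd n) (lins μ ρ) n (eval (Pe ⊞ X) n) ⟩
      bound μ (Pd ⊞ X ⊞ (Pe ⊞ X)) ρ            ∎
      where
      shuffle : ∀ a l n e → a + (l + n) + e ≡ a + n + e + l
      shuffle = solve-∀
    go (x ∙ y) eq = begin
      size (⟦ e ⟧ (x ∷ y ∷ ρ))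
        ≤⟨ sizeCase≤ (sizePoly c) (sizePoly e) (growth c) (growth e) ρ x y _
             (subst (λ t → size t ≤ bound (growth c) (sizePoly c) ρ) eq (size≤ c ρ)) (size≤ e (x ∷ y ∷ ρ)) ⟩
      eval Pe (polys λ′ ρ) + lins λ′ ρ         ≤⟨ +-mono-≤ (eval-mono Pe (polys-⊔ʳ κ λ′ ρ)) (lins-⊔ʳ κ λ′ ρ) ⟩
      eval Pe n + (lins μ ρ + n)               ≤⟨ m≤n+m _ (eval (Pd ⊞ X) n) ⟩
      eval (Pd ⊞ X) n + (eval Pe n + (lins μ ρ + n)) ≡⟨ shuffle (eval (Pd ⊞ X) n) (eval Pe n) (lins μ ρ) n ⟩
      bound μ (Pd ⊞ X ⊞ (Pe ⊞ X)) ρ            ∎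
      where
      shuffle : ∀ d a l n → d + (a + (l + n)) ≡ d + (a + n) + l
      shuffle = solve-∀
  size≤ (app c es) ρ = begin
    size (⟦ c ⟧ (⟦ es ⟧* ρ))
      ≤⟨ size≤ c (⟦ es ⟧* ρ) ⟩
    bound (growth c) (sizePoly c) (⟦ es ⟧* ρ)
      ≡⟨ cong₂ (λ a b → eval (sizePoly c) (a + polys (growth c) (⟦ es ⟧* ρ)) + (b + lins (growth c) (⟦ es ⟧* ρ)))
           (polys-zero ρ) (lins-zero ρ) ⟨
    eval (sizePoly c) (polys (replicate _ 𝟎) ρ + polys (growth c) (⟦ es ⟧* ρ)) +
      (lins (replicate _ 𝟎) ρ + lins (growth c) (⟦ es ⟧* ρ))
      ≤⟨ sizeApp≤ (sizePoly c) (replicate _ 𝟎) (growth c) es ρ ⟩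
    bound (growth (app c es)) (sizePoly (app c es)) ρ ∎
  size≤ (rec g s h {ok-s} {ok-h} d e) ρ = begin
    size (⟦ rec g s h {ok-s} {ok-h} d e ⟧ ρ)
      ≤⟨ RecSize.recTree≤ _ _ _ X₀ G Pm H L
           (λ a b p ab≤ → B.s-bound a b p (⟦ s ⟧ (a ∷ b ∷ p ∷ ρ)) (size≤ s (a ∷ b ∷ p ∷ ρ)) ab≤)
           (λ r a b p ab≤ p≤ → B.h-bound r a b p (⟦ h ⟧ (r ∷ a ∷ b ∷ p ∷ ρ)) (size≤ h (r ∷ a ∷ b ∷ p ∷ ρ)) ab≤ p≤ A≥)
           (λ p p≤ → B.g-bound p (⟦ g ⟧ (p ∷ ρ)) (size≤ g (p ∷ ρ)) p≤ (m+n≤o⇒n≤o X₀ A≥))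
           (⟦ d ⟧ ρ) (⟦ e ⟧ ρ) ≤-refl ≤-refl ⟩
    X₀ * H + L
      ≤⟨ total≤ ⟩
    eval Q (polys B.κo ρ + X₀ + poly B.kp p₀) + lin B.kp p₀
      ≤⟨ +-monoʳ-≤ (eval Q (polys B.κo ρ + X₀ + poly B.kp p₀)) (m≤n+m (lin B.kp p₀) (lins B.κo ρ + 0)) ⟩
    eval Q (polys B.κo ρ + X₀ + poly B.kp p₀) + (lins B.κo ρ + 0 + lin B.kp p₀)
      ≤⟨ absorb Q (sizePoly d) ω B.κo (growth d) ρ (poly B.kp p₀) (lin B.kp p₀) (size≤ d ρ) ⟩
    eval (Q ⊙ sizePoly d) (polys κ₁ ρ + poly B.kp p₀) + (lins κ₁ ρ + lin B.kp p₀)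
      ≡⟨ cong₂ (λ a b → eval (Q ⊙ sizePoly d) a + b)
           (+-identityʳ (polys κ₁ ρ + poly B.kp p₀)) (+-identityʳ (lins κ₁ ρ + lin B.kp p₀)) ⟨
    eval (Q ⊙ sizePoly d) (polys κ₁ ρ + poly B.kp p₀ + 0) + (lins κ₁ ρ + lin B.kp p₀ + 0)
      ≤⟨ absorb (Q ⊙ sizePoly d) (sizePoly e) B.kp κ₁ (growth e) ρ 0 0 (size≤ e ρ) ⟩
    eval P (polys κ₂ ρ + 0) + (lins κ₂ ρ + 0)
      ≡⟨ cong₂ (λ a b → eval P a + b) (+-identityʳ (polys κ₂ ρ)) (+-identityʳ (lins κ₂ ρ)) ⟩
    bound κ₂ P ρ
      ≡⟨ cong (λ κ → bound κ P ρ) (growthRec-≡ (growth g) (growth s) (growth h) (growth d) (growth e)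
           (sizePoly g) (sizePoly s) (sizePoly h) ρ ok-s ok-h) ⟨
    bound (growth (rec g s h {ok-s} {ok-h} d e)) P ρ ∎
    where
    module B = RecBounds (growth g) (growth s) (growth h) (sizePoly g) (sizePoly s) (sizePoly h) ρ ok-s ok-h
    X₀ = size (⟦ d ⟧ ρ)
    p₀ = size (⟦ e ⟧ ρ)
    open B.Total X₀ p₀
    Q = recPoly (sizePoly g) (sizePoly s) (sizePoly h)
    P = (Q ⊙ sizePoly d) ⊙ sizePoly e
    κ₁ = zipWith _⊕_ B.κo (map (ω ⊗_) (growth d))
    κ₂ = zipWith _⊕_ κ₁ (map (B.kp ⊗_) (growth e))
  size≤ (tight c b c≤ e) ρ = begin
    size (⟦ c ⟧ (⟦ e ⟧ ρ ∷ []))                          ≤⟨ c≤ (⟦ e ⟧ ρ) ⟩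
    b + size (⟦ e ⟧ ρ)                                   ≤⟨ +-monoʳ-≤ b (size≤ e ρ) ⟩
    b + bound (growth e) (sizePoly e) ρ                  ≡⟨ +-assoc b _ _ ⟨
    bound (growth e) (con b ⊞ sizePoly e) ρ              ∎

module Compilation where

  open Language
  open Sizes
  open import Data.Fin using (Fin; zero; suc; _↑ˡ_; _↑ʳ_; splitAt; toℕ)
  open import Data.Fin.Properties using (splitAt-↑ˡ; splitAt-↑ʳ)
  open import Data.Nat using (ℕ; zero; suc; _+_; _*_; _^_; _≤_; z≤n; s≤s)
  open import Data.Nat.Properties
  open import Data.Nat.Tactic.RingSolver using (solve-∀)
  open import Data.Product using (_×_; _,_; ∃-syntax; proj₁; proj₂)
  open import Data.Sum using ([_,_]′)
  open import Data.Vec using (Vec; []; _∷_; lookup)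
  open import Function using (_∘_)
  open import Relation.Binary.PropositionalEquality using (_≡_; refl; sym; trans; cong; subst)

  open ≤-Reasoning

  -- Compilation: the whole environment is kept in one variable, as a list.

  env : ∀ {v} → Vec Tree v → Tree
  env []      = nil
  env (x ∷ ρ) = x ∙ env ρ

  size-env : ∀ {v} (ρ : Vec Tree v) → size (env ρ) ≡ suc v + total ρ
  size-env []              = refl
  size-env {suc v} (x ∷ ρ) = trans (cong (λ s → suc (size x + s)) (size-env ρ)) (cong suc (shuffle (size x) v (total ρ)))
    where
    shuffle : ∀ x v t → x + suc (v + t) ≡ suc (v + (x + t))
    shuffle = solve-∀

  access : ∀ {F v w} → Fin v → Fin w → Exp F w
  access zero    j = case (var j) nil (var zero)
  access (suc i) j = case (var j) nil (access i 1F)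

  calls : ∀ {v} → Code v → ℕ
  callsApp : ∀ {v w} → Codes v w → ℕ
  calls (var i)         = 0
  calls nil             = 0
  calls (cons d e)      = calls d + calls e
  calls (case c d e)    = calls c + (calls d + calls e)
  calls (app c es)      = calls c + callsApp es
  calls (rec g s h d e) = suc (calls g + (calls s + (calls h + (calls d + calls e))))
  calls (tight c _ _ e) = calls c + calls e
  callsApp []       = 0
  callsApp (e ∷ es) = calls e + callsApp es

  module _ {F : ℕ} where

    recBody : Fin F → Exp F 4 → Exp F 6 → Exp F 8 → Exp F 1
    recBody f g s h =
      case (var zero) nil
        (case (var zero)
          (bind (var 1F) g)
          (bind (cons (var 0F) (cons (var 1F) (var 3F)))
            (bind (call f (cons (var 2F) (cons s (case (var 4F) nil (var 1F)))))
              (bind (cons (var 0F) (var 1F)) h))))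

    compile : ∀ {v} (c : Code v) {w} → (Fin (calls c) → Fin F) → Exp F (suc w)
    compileApp : ∀ {v w} (es : Codes v w) {u} → (Fin (callsApp es) → Fin F) → Exp F (suc u)

    compile (var i)         ι = access i zero
    compile nil             ι = nil
    compile (cons d e)      ι = cons (compile d (ι ∘ (_↑ˡ _))) (compile e (ι ∘ (calls d ↑ʳ_)))
    compile (case c d e)    ι =
      case (compile c (ι ∘ (_↑ˡ _))) (compile d (ι ∘ (calls c ↑ʳ_) ∘ (_↑ˡ _)))
        (bind (cons (var 0F) (cons (var 1F) (var 2F))) (compile e (ι ∘ (calls c ↑ʳ_) ∘ (calls d ↑ʳ_))))
    compile (app c es)      ι = bind (compileApp es (ι ∘ (calls c ↑ʳ_))) (compile c (ι ∘ (_↑ˡ _)))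
    compile (rec g s h d e) ι =
      call (ι zero) (cons (compile d (ι′ ∘ (_↑ˡ _))) (cons (compile e (ι′ ∘ (calls d ↑ʳ_))) (var zero)))
      where
      ι′ = ι ∘ suc ∘ (calls g ↑ʳ_) ∘ (calls s ↑ʳ_) ∘ (calls h ↑ʳ_)
    compile (tight c _ _ e) ι = bind (cons (compile e (ι ∘ (calls c ↑ʳ_))) nil) (compile c (ι ∘ (_↑ˡ _)))

    compileApp []       ι = nil
    compileApp (e ∷ es) ι = cons (compile e (ι ∘ (_↑ˡ _))) (compileApp es (ι ∘ (calls e ↑ʳ_)))

    bodies : ∀ {v} (c : Code v) → (Fin (calls c) → Fin F) → Fin (calls c) → Exp F 1
    bodiesApp : ∀ {v w} (es : Codes v w) → (Fin (callsApp es) → Fin F) → Fin (callsApp es) → Exp F 1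

    merge : ∀ m {n} → (Fin m → Exp F 1) → (Fin n → Exp F 1) → Fin (m + n) → Exp F 1
    merge m f g = [ f , g ]′ ∘ splitAt m

    bodies (cons d e)      ι = merge (calls d) (bodies d (ι ∘ (_↑ˡ _))) (bodies e (ι ∘ (calls d ↑ʳ_)))
    bodies (case c d e)    ι =
      merge (calls c) (bodies c (ι ∘ (_↑ˡ _)))
        (merge (calls d) (bodies d (ι ∘ (calls c ↑ʳ_) ∘ (_↑ˡ _))) (bodies e (ι ∘ (calls c ↑ʳ_) ∘ (calls d ↑ʳ_))))
    bodies (app c es)      ι = merge (calls c) (bodies c (ι ∘ (_↑ˡ _))) (bodiesApp es (ι ∘ (calls c ↑ʳ_)))
    bodies (rec g s h d e) ι zero =
      recBody (ι zero) (compile g (ι ∘ suc ∘ (_↑ˡ _))) (compile s (ι ∘ suc ∘ (calls g ↑ʳ_) ∘ (_↑ˡ _)))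
        (compile h (ι ∘ suc ∘ (calls g ↑ʳ_) ∘ (calls s ↑ʳ_) ∘ (_↑ˡ _)))
    bodies (rec g s h d e) ι (suc j) =
      merge (calls g) (bodies g (ι ∘ suc ∘ (_↑ˡ _)))
        (merge (calls s) (bodies s (ι ∘ suc ∘ (calls g ↑ʳ_) ∘ (_↑ˡ _)))
          (merge (calls h) (bodies h (ι ∘ suc ∘ (calls g ↑ʳ_) ∘ (calls s ↑ʳ_) ∘ (_↑ˡ _)))
            (merge (calls d) (bodies d (ι′ ∘ (_↑ˡ _))) (bodies e (ι′ ∘ (calls d ↑ʳ_)))))) j
      where
      ι′ = ι ∘ suc ∘ (calls g ↑ʳ_) ∘ (calls s ↑ʳ_) ∘ (calls h ↑ʳ_)
    bodies (tight c _ _ e) ι = merge (calls c) (bodies c (ι ∘ (_↑ˡ _))) (bodies e (ι ∘ (calls c ↑ʳ_)))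

    bodiesApp (e ∷ es) ι = merge (calls e) (bodies e (ι ∘ (_↑ˡ _))) (bodiesApp es (ι ∘ (calls e ↑ʳ_)))

  valuePoly : ∀ {v} → Code v → Poly
  valuePoly c = sizePoly c ⊞ X

  argsPoly : ∀ {v w} → Codes v w → Poly
  argsPoly []       = con 0
  argsPoly (e ∷ es) = valuePoly e ⊞ argsPoly es

  storePoly : ∀ {v} → Code (1 + v) → Code (3 + v) → Code (4 + v) → Code v → Code v → Poly
  storePoly {v} g s h d e =
    D ⊞ (E ⊞ D ⊠ ((S ⊞ X) ⟨ D ⊞ X ⟩)) ⊞ (recPoly (sizePoly g) S (sizePoly h) ⟨ X ⊞ D ⊞ E ⟩ ⊞ E) ⊞ (con (5 + v) ⊞ X)
    where
    D = valuePoly d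
    E = valuePoly e
    S = sizePoly s

  timePoly : ∀ {v} → Code v → Poly
  timeArgs : ∀ {v w} → Codes v w → Poly
  timePoly (var i)              = con (3 + 2 * toℕ i)
  timePoly nil                  = con 1
  timePoly (cons d e)           = con 1 ⊞ valuePoly d ⊞ valuePoly e ⊞ timePoly d ⊞ timePoly e
  timePoly (case {v} c d e)     =
    timePoly c ⊞ timePoly d ⊞ (con 5 ⊞ (con (3 + v) ⊞ valuePoly c ⊞ X) ⊠ con 2 ⊞ timePoly e ⟨ valuePoly c ⊞ X ⟩)
  timePoly (app c es)           = con 1 ⊞ timeArgs es ⊞ timePoly c ⟨ argsPoly es ⟩
  timePoly (rec g s h d e)      =
    con 2 ⊞ timePoly d ⊞ timePoly e ⊞ M ⊠ con 2 ⊞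
    (valuePoly d ⊠ (con 17 ⊞ M ⊠ con 5 ⊞ timePoly s ⟨ M ⟩ ⊞ timePoly h ⟨ M ⟩) ⊞ (con 6 ⊞ timePoly g ⟨ M ⟩))
    where M = storePoly g s h d e
  timePoly (tight c _ _ e)      = con 4 ⊞ valuePoly e ⊞ timePoly e ⊞ timePoly c ⟨ valuePoly e ⟩
  timeArgs []                   = con 1
  timeArgs (_∷_ {w} e es)       = con (2 + w) ⊞ valuePoly e ⊞ argsPoly es ⊞ timePoly e ⊞ timeArgs es

  size-value : ∀ {v} (c : Code v) ρ → size (⟦ c ⟧ ρ) ≤ eval (valuePoly c) (total ρ)
  size-value c ρ = ≤-trans (size≤ c ρ) (bound-total (growth c) (sizePoly c) ρ)

  total-args : ∀ {v w} (es : Codes v w) ρ → total (⟦ es ⟧* ρ) ≤ eval (argsPoly es) (total ρ)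
  total-args []       ρ = z≤n
  total-args (e ∷ es) ρ = +-mono-≤ (size-value e ρ) (total-args es ρ)

  module Correctness {F : ℕ} (body : Fin F → Exp F 1) where
    open Semantics body

    infix 4 _⊢_⇓_within_

    _⊢_⇓_within_ : ∀ {v} → Vec Tree v → Exp F v → Tree → ℕ → Set
    ρ ⊢ e ⇓ x within b = ∃[ t ] ρ ⊢ e ⇓ x [ t ] × t ≤ b

    Implements : ∀ {m} → (Fin m → Fin F) → (Fin m → Exp F 1) → Set
    Implements ι f = ∀ j → body (ι j) ≡ f j

    mergeˡ : ∀ m {n} {ι : Fin (m + n) → Fin F} {f g} → Implements ι (merge m f g) → Implements (ι ∘ (_↑ˡ n)) f
    mergeˡ m {n} {f = f} {g} impl j = trans (impl (j ↑ˡ n)) (cong [ f , g ]′ (splitAt-↑ˡ m j n))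

    mergeʳ : ∀ m {n} {ι : Fin (m + n) → Fin F} {f g} → Implements ι (merge m f g) → Implements (ι ∘ (m ↑ʳ_)) g
    mergeʳ m {n} {f = f} {g} impl j = trans (impl (m ↑ʳ j)) (cong [ f , g ]′ (splitAt-↑ʳ m n j))

    var-≡ : ∀ {v} {σ : Vec Tree v} {x} j → lookup σ j ≡ x → σ ⊢ var j ⇓ x [ 1 ]
    var-≡ j refl = var

    access-correct : ∀ {v w} (σ : Vec Tree w) (ρ : Vec Tree v) i j → lookup σ j ≡ env ρ →
                     σ ⊢ access i j ⇓ lookup ρ i [ 3 + 2 * toℕ i ]
    access-correct σ (x ∷ ρ) zero    j eq = case-∙ (var-≡ j eq) var
    access-correct σ (x ∷ ρ) (suc i) j eq =
      subst (σ ⊢ access (suc i) j ⇓ lookup ρ i [_]) (shuffle (toℕ i))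
        (case-∙ (var-≡ j eq) (access-correct (x ∷ env ρ ∷ σ) ρ i 1F refl))
      where
      shuffle : ∀ i → 1 + 1 + (3 + 2 * i) ≡ 3 + 2 * suc i
      shuffle = solve-∀

    module RecTime {v} (f : Fin F) (g : Exp F 4) (s : Exp F 6) (h : Exp F 8) (body-f : body f ≡ recBody f g s h)
      (ρ : Vec Tree v) (g′ : Tree → Tree) (s′ : Tree → Tree → Tree → Tree) (h′ : Tree → Tree → Tree → Tree → Tree)
      (X₀ G Pm H L M TG TS TH : ℕ)
      (s≤ : ∀ a b p → size a + size b ≤ X₀ → size (s′ a b p) ≤ size p + G)
      (h≤ : ∀ r a b p → size a + size b ≤ X₀ → size p ≤ Pm → size (h′ r a b p) ≤ size r + H)
      (g≤ : ∀ p → size p ≤ Pm → size (g′ p) ≤ L)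
      (M≥ : X₀ + Pm + (X₀ * H + L) + (5 + v + total ρ) ≤ M)
      (g⇓ : ∀ p (σ : Vec Tree 3) → size p ≤ Pm → (env (p ∷ ρ) ∷ σ) ⊢ g ⇓ g′ p within TG)
      (s⇓ : ∀ a b p (σ : Vec Tree 5) → size a + size b ≤ X₀ → size p ≤ Pm →
            (env (a ∷ b ∷ p ∷ ρ) ∷ σ) ⊢ s ⇓ s′ a b p within TS)
      (h⇓ : ∀ r a b p (σ : Vec Tree 7) → size a + size b ≤ X₀ → size p ≤ Pm → size r ≤ X₀ * H + L →
            (env (r ∷ a ∷ b ∷ p ∷ ρ) ∷ σ) ⊢ h ⇓ h′ r a b p within TH) where

      open RecSize g′ s′ h′ X₀ G Pm H L s≤ h≤ g≤

      Step : ℕ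
      Step = 17 + M * 5 + TS + TH

      private
        e = size (env ρ)
        e≡ : e ≡ suc v + total ρ
        e≡ = size-env ρ

        fit : ∀ ab p r c → ab ≤ X₀ → p ≤ Pm → r ≤ X₀ * H + L → c ≤ 4 → ab + p + r + (c + e) ≤ M
        fit ab p r c ab≤ p≤ r≤ c≤ = ≤-trans
          (+-mono-≤ (+-mono-≤ (+-mono-≤ ab≤ p≤) r≤)
            (≤-trans (≤-reflexive (cong (c +_) e≡)) (≤-trans (+-monoˡ-≤ (suc v + total ρ) c≤) (≤-reflexive refl)))) M≥

      unfold : ∀ {σ z t} → σ ⊢ recBody f g s h ⇓ z [ t ] → σ ⊢ body f ⇓ z [ t ]
      unfold {σ} {z} {t} = subst (λ E → σ ⊢ E ⇓ z [ t ]) (sym body-f)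

      run : ∀ x p → size x ≤ X₀ → size p + size x * G ≤ Pm →
            ((x ∙ (p ∙ env ρ)) ∷ []) ⊢ body f ⇓ recTree g′ s′ h′ x p within (size x * Step + (6 + TG))
      run nil p x≤ p≤ with g⇓ p (nil ∷ (p ∙ env ρ) ∷ (nil ∙ (p ∙ env ρ)) ∷ []) (m+n≤o⇒m≤o (size p) p≤)
      ... | t , ⇓g , t≤ =
        _ , unfold (case-∙ var (case-nil var (bind var ⇓g))) , ≤-trans (+-monoʳ-≤ 6 t≤) (m≤n+m (6 + TG) (Step + 0))
      run (a ∙ b) p x≤ p≤ =
        let ab≤ = m+n≤o⇒n≤o 1 x≤
            pm≤ = m+n≤o⇒m≤o (size p) p≤
            q = p ∙ env ρ
            x = a ∙ b
            p′ = s′ a b p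
            p′≤ = param≤ a b p x≤ p≤
            r = recTree g′ s′ h′ b p′
            es = a ∙ (b ∙ q)
            ts , ⇓s , ts≤ = s⇓ a b p (a ∷ b ∷ x ∷ q ∷ (x ∙ q) ∷ []) ab≤ pm≤
            tr , ⇓r , tr≤ = run b p′ (tail≤ a b x≤) p′≤
            r≤ = ≤-trans (recTree≤ b p′ (tail≤ a b x≤) p′≤) (+-monoˡ-≤ L (*-monoˡ-≤ H (tail≤ a b x≤)))
            th , ⇓h , th≤ = h⇓ r a b p (r ∷ es ∷ a ∷ b ∷ x ∷ q ∷ (x ∙ q) ∷ []) ab≤ pm≤ r≤
            A = size a
            B = size b
            P = size p
            P′ = size p′
            R = size r
            m₁ : 1 + B + (1 + P + e) ≤ M
            m₁ = ≤-trans (≤-reflexive (sh₁ B P e)) (fit B P 0 2 (m+n≤o⇒n≤o A ab≤) pm≤ z≤n (s≤s (s≤s z≤n)))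
            m₂ : 1 + A + (1 + B + (1 + P + e)) ≤ M
            m₂ = ≤-trans (≤-reflexive (sh₂ A B P e)) (fit (A + B) P 0 3 ab≤ pm≤ z≤n (s≤s (s≤s (s≤s z≤n))))
            m₃ : 1 + P′ + e ≤ M
            m₃ = ≤-trans (≤-reflexive (sh₃ P′ e)) (fit 0 P′ 0 1 z≤n (m+n≤o⇒m≤o P′ p′≤) z≤n (s≤s z≤n))
            m₄ : 1 + B + (1 + P′ + e) ≤ M
            m₄ = ≤-trans (≤-reflexive (sh₁ B P′ e)) (fit B P′ 0 2 (m+n≤o⇒n≤o A ab≤) (m+n≤o⇒m≤o P′ p′≤) z≤n (s≤s (s≤s z≤n)))
            m₅ : 1 + R + (1 + A + (1 + B + (1 + P + e))) ≤ M
            m₅ = ≤-trans (≤-reflexive (sh₅ R A B P e)) (fit (A + B) P R 4 ab≤ pm≤ r≤ ≤-refl)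
        in
        _ ,
        unfold
          (case-∙ var (case-∙ var (bind (cons var (cons var var))
            (bind (call (cons var (cons ⇓s (case-∙ var var))) ⇓r) (bind (cons var var) ⇓h))))) ,
        (begin
          2 + (2 + (1 + (1 + A + (1 + B + (1 + P + e)) + 1 + (1 + B + (1 + P + e) + 1 + 1)) +
            (1 + (1 + (1 + B + (1 + P′ + e) + 1 + (1 + P′ + e + ts + 3)) + tr) +
              (1 + (1 + R + (1 + A + (1 + B + (1 + P + e))) + 1 + 1) + th))))
            ≤⟨ +-monoʳ-≤ 2 (+-monoʳ-≤ 2 (+-mono-≤
                 (+-monoʳ-≤ 1 (+-mono-≤ (+-monoˡ-≤ 1 m₂) (+-monoˡ-≤ 1 (+-monoˡ-≤ 1 m₁))))
                 (+-mono-≤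
                   (+-monoʳ-≤ 1 (+-mono-≤ (+-monoʳ-≤ 1 (+-mono-≤ (+-monoˡ-≤ 1 m₄) (+-monoˡ-≤ 3 (+-mono-≤ m₃ ts≤)))) tr≤))
                   (+-mono-≤ (+-monoʳ-≤ 1 (+-monoˡ-≤ 1 (+-monoˡ-≤ 1 m₅))) th≤)))) ⟩
          2 + (2 + (1 + (M + 1 + (M + 1 + 1)) +
            (1 + (1 + (M + 1 + (M + TS + 3)) + (B * Step + (6 + TG))) + (1 + (M + 1 + 1) + TH))))
            ≡⟨ final M TS TH (B * Step) (6 + TG) ⟩
          suc B * Step + (6 + TG)
            ≤⟨ +-monoˡ-≤ (6 + TG) (*-monoˡ-≤ Step (s≤s (m≤n+m B A))) ⟩
          size x * Step + (6 + TG) ∎)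
        where
        sh₁ : ∀ b p e → 1 + b + (1 + p + e) ≡ b + p + 0 + (2 + e)
        sh₁ = solve-∀
        sh₂ : ∀ a b p e → 1 + a + (1 + b + (1 + p + e)) ≡ a + b + p + 0 + (3 + e)
        sh₂ = solve-∀
        sh₃ : ∀ p e → 1 + p + e ≡ 0 + p + 0 + (1 + e)
        sh₃ = solve-∀
        sh₅ : ∀ r a b p e → 1 + r + (1 + a + (1 + b + (1 + p + e))) ≡ a + b + p + r + (4 + e)
        sh₅ = solve-∀
        final : ∀ M TS TH r g → 2 + (2 + (1 + (M + 1 + (M + 1 + 1)) +
            (1 + (1 + (M + 1 + (M + TS + 3)) + (r + g)) + (1 + (M + 1 + 1) + TH)))) ≡ (17 + M * 5 + TS + TH) + r + g
        final = solve-∀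

    correct : ∀ {v} (c : Code v) (ι : Fin (calls c) → Fin F) → Implements ι (bodies c ι) → ∀ ρ {w} (σ : Vec Tree w) →
              (env ρ ∷ σ) ⊢ compile c ι ⇓ ⟦ c ⟧ ρ within eval (timePoly c) (total ρ)
    correctArgs : ∀ {v u} (es : Codes v u) (ι : Fin (callsApp es) → Fin F) → Implements ι (bodiesApp es ι) →
                  ∀ ρ {w} (σ : Vec Tree w) →
                  (env ρ ∷ σ) ⊢ compileApp es ι ⇓ env (⟦ es ⟧* ρ) within eval (timeArgs es) (total ρ)

    correct (var i) ι impl ρ σ = _ , access-correct (env ρ ∷ σ) ρ i zero refl , ≤-refl
    correct nil ι impl ρ σ = _ , nil , ≤-refl
    correct (cons d e) ι impl ρ σ =
      let s , ⇓d , s≤ = correct d _ (mergeˡ (calls d) impl) ρ σ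
          t , ⇓e , t≤ = correct e _ (mergeʳ (calls d) impl) ρ σ
      in _ , cons ⇓d ⇓e ,
         +-mono-≤ (+-mono-≤ (+-mono-≤ (+-monoʳ-≤ 1 (size-value d ρ)) (size-value e ρ)) s≤) t≤
    correct {v} (case c d e) ι impl ρ σ = go (⟦ c ⟧ ρ) refl
      where
      tc = correct c _ (mergeˡ (calls c) impl) ρ σ
      td = correct d _ (mergeˡ (calls d) (mergeʳ (calls c) impl)) ρ σ
      T₀ = total ρ
      V = eval (valuePoly c) T₀
      W = 3 + v + V + T₀
      rest = eval (con 5 ⊞ (con (3 + v) ⊞ valuePoly c ⊞ X) ⊠ con 2 ⊞ timePoly e ⟨ valuePoly c ⊞ X ⟩) T₀
      go : ∀ x → ⟦ c ⟧ ρ ≡ x → (env ρ ∷ σ) ⊢ compile (case c d e) ι ⇓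
           caseTree x (⟦ d ⟧ ρ) (λ x y → ⟦ e ⟧ (x ∷ y ∷ ρ)) within eval (timePoly (case c d e)) T₀
      go nil eq = _ , case-nil (subst (λ x → (env ρ ∷ σ) ⊢ compile c (ι ∘ (_↑ˡ _)) ⇓ x [ proj₁ tc ]) eq (proj₁ (proj₂ tc))) (proj₁ (proj₂ td)) ,
        (begin
          1 + proj₁ tc + proj₁ td
            ≤⟨ +-mono-≤ (+-monoʳ-≤ 1 (proj₂ (proj₂ tc))) (proj₂ (proj₂ td)) ⟩
          1 + eval (timePoly c) T₀ + eval (timePoly d) T₀
            ≡⟨ shuffle (eval (timePoly c) T₀) (eval (timePoly d) T₀) ⟩
          eval (timePoly c) T₀ + eval (timePoly d) T₀ + 1
            ≤⟨ +-monoʳ-≤ (eval (timePoly c) T₀ + eval (timePoly d) T₀) (s≤s z≤n) ⟩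
          eval (timePoly c) T₀ + eval (timePoly d) T₀ + rest ∎)
        where
        shuffle : ∀ a b → 1 + a + b ≡ a + b + 1
        shuffle = solve-∀
      go (x ∙ y) eq =
        let te , ⇓e , te≤ = correct e _ (mergeʳ (calls d) (mergeʳ (calls c) impl)) (x ∷ y ∷ ρ) (x ∷ y ∷ env ρ ∷ σ)
        in _ , case-∙ (subst (λ x → (env ρ ∷ σ) ⊢ compile c (ι ∘ (_↑ˡ _)) ⇓ x [ proj₁ tc ]) eq (proj₁ (proj₂ tc))) (bind (cons var (cons var var)) ⇓e) ,
        (begin
          1 + proj₁ tc + (1 + (1 + size x + (1 + size y + size (env ρ)) + 1 + (1 + size y + size (env ρ) + 1 + 1)) + te)
            ≤⟨ +-mono-≤ (+-monoʳ-≤ 1 (proj₂ (proj₂ tc))) (+-mono-≤ (+-monoʳ-≤ 1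
                 (+-mono-≤ (+-monoˡ-≤ 1 xy≤) (+-monoˡ-≤ 1 (+-monoˡ-≤ 1 y≤)))) te≤) ⟩
          1 + eval (timePoly c) T₀ + (1 + (W + 1 + (W + 1 + 1)) + eval (timePoly e) (total (x ∷ y ∷ ρ)))
            ≤⟨ +-monoʳ-≤ (1 + eval (timePoly c) T₀) (+-monoʳ-≤ (1 + (W + 1 + (W + 1 + 1)))
                 (eval-⟨⟩-mono (timePoly e) (valuePoly c ⊞ X) total≤)) ⟩
          1 + eval (timePoly c) T₀ + (1 + (W + 1 + (W + 1 + 1)) + eval (timePoly e ⟨ valuePoly c ⊞ X ⟩) T₀)
            ≡⟨ shuffle (eval (timePoly c) T₀) W (eval (timePoly e ⟨ valuePoly c ⊞ X ⟩) T₀) ⟩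
          eval (timePoly c) T₀ + rest
            ≤⟨ +-monoˡ-≤ rest (m≤m+n (eval (timePoly c) T₀) (eval (timePoly d) T₀)) ⟩
          eval (timePoly c) T₀ + eval (timePoly d) T₀ + rest ∎)
        where
        V≥ : 1 + size x + size y ≤ V
        V≥ = subst (λ t → size t ≤ V) eq (size-value c ρ)
        e≡ = size-env ρ
        sh₁ : ∀ x y v t → 1 + x + (1 + y + suc (v + t)) ≡ 2 + v + (1 + x + y) + t
        sh₁ = solve-∀
        sh₂ : ∀ y v t → 1 + y + suc (v + t) ≡ 2 + v + y + t
        sh₂ = solve-∀
        xy≤ : 1 + size x + (1 + size y + size (env ρ)) ≤ W
        xy≤ = begin
          1 + size x + (1 + size y + size (env ρ))   ≡⟨ cong (λ e → 1 + size x + (1 + size y + e)) e≡ ⟩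
          1 + size x + (1 + size y + suc (v + T₀))   ≡⟨ sh₁ (size x) (size y) v T₀ ⟩
          2 + v + (1 + size x + size y) + T₀         ≤⟨ +-monoˡ-≤ T₀ (+-mono-≤ (n≤1+n (2 + v)) V≥) ⟩
          W                                          ∎
        y≤ : 1 + size y + size (env ρ) ≤ W
        y≤ = ≤-trans (m≤n+m _ (1 + size x)) xy≤
        total≤ : total (x ∷ y ∷ ρ) ≤ V + T₀
        total≤ = begin
          size x + (size y + T₀)   ≡⟨ +-assoc (size x) (size y) T₀ ⟨
          size x + size y + T₀     ≤⟨ +-monoˡ-≤ T₀ (≤-trans (n≤1+n _) V≥) ⟩
          V + T₀                   ∎
        shuffle : ∀ c W e → 1 + c + (1 + (W + 1 + (W + 1 + 1)) + e) ≡ c + (5 + W * 2 + e)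
        shuffle = solve-∀
    correct (app c es) ι impl ρ σ =
      let s , ⇓es , s≤ = correctArgs es _ (mergeʳ (calls c) impl) ρ σ
          t , ⇓c , t≤ = correct c _ (mergeˡ (calls c) impl) (⟦ es ⟧* ρ) (env ρ ∷ σ)
      in _ , bind ⇓es ⇓c ,
         +-mono-≤ (+-monoʳ-≤ 1 s≤) (≤-trans t≤ (eval-⟨⟩-mono (timePoly c) (argsPoly es) (total-args es ρ)))
    correct {v} (rec g s h {ok-s} {ok-h} d e) ι impl ρ σ =
      let td , ⇓d , td≤ = correct d _ (mergeˡ (calls d) impl-de) ρ σ
          te , ⇓e , te≤ = correct e _ (mergeʳ (calls d) impl-de) ρ σ
          tr , ⇓r , tr≤ = R.run (⟦ d ⟧ ρ) (⟦ e ⟧ ρ) ≤-refl ≤-refl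
      in _ , call (cons ⇓d (cons ⇓e var)) ⇓r ,
      (begin
        1 + (1 + X₀ + (1 + p₀ + size (env ρ)) + td + (1 + p₀ + size (env ρ) + te + 1)) + tr
          ≤⟨ +-mono-≤ (+-monoʳ-≤ 1 (+-mono-≤ (+-mono-≤ xpe≤ td≤) (+-monoˡ-≤ 1 (+-mono-≤ pe≤ te≤)))) tr≤ ⟩
        1 + (M + TD + (M + TE + 1)) + (X₀ * R.Step + (6 + TG))
          ≤⟨ +-monoʳ-≤ (1 + (M + TD + (M + TE + 1))) (+-monoˡ-≤ (6 + TG) (*-monoˡ-≤ R.Step X₀≤)) ⟩
        1 + (M + TD + (M + TE + 1)) + (D * R.Step + (6 + TG))
          ≡⟨ shuffle M TD TE (D * R.Step + (6 + TG)) ⟩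
        eval (timePoly (rec g s h {ok-s} {ok-h} d e)) T₀ ∎)
      where
      module B = RecBounds (growth g) (growth s) (growth h) (sizePoly g) (sizePoly s) (sizePoly h) ρ ok-s ok-h
      T₀ = total ρ
      X₀ = size (⟦ d ⟧ ρ)
      p₀ = size (⟦ e ⟧ ρ)
      open B.Total X₀ p₀
      D = eval (valuePoly d) T₀
      E = eval (valuePoly e) T₀
      TD = eval (timePoly d) T₀
      TE = eval (timePoly e) T₀
      MP = storePoly g s h d e
      M = eval MP T₀
      TG = eval (timePoly g ⟨ MP ⟩) T₀
      TS = eval (timePoly s ⟨ MP ⟩) T₀
      TH = eval (timePoly h ⟨ MP ⟩) T₀
      X₀≤ : X₀ ≤ D
      X₀≤ = size-value d ρ
      p₀≤ : p₀ ≤ E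
      p₀≤ = size-value e ρ
      N≤ : B.N ≤ T₀
      N≤ = polys-≤ B.κo ρ
      impl-h = mergeʳ (calls s) (mergeʳ (calls g) (impl ∘ suc))
      impl-de = mergeʳ (calls h) impl-h
      Q = recPoly (sizePoly g) (sizePoly s) (sizePoly h)
      Pm≤ : Pm ≤ eval (valuePoly e ⊞ valuePoly d ⊠ ((sizePoly s ⊞ X) ⟨ valuePoly d ⊞ X ⟩)) T₀
      Pm≤ = +-mono-≤ p₀≤ (*-mono-≤ X₀≤ (eval-⟨⟩-mono (sizePoly s ⊞ X) (valuePoly d ⊞ X) (+-mono-≤ X₀≤ N≤)))
      R≤ : X₀ * H + L ≤ eval (Q ⟨ X ⊞ valuePoly d ⊞ valuePoly e ⟩ ⊞ valuePoly e) T₀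
      R≤ = ≤-trans total≤ (+-mono-≤
        (eval-⟨⟩-mono Q (X ⊞ valuePoly d ⊞ valuePoly e) {n = T₀}
          (+-mono-≤ (+-mono-≤ N≤ X₀≤) (≤-trans (poly-≤ B.kp p₀) p₀≤)))
        (≤-trans (lin-≤ B.kp p₀) p₀≤))
      M≥ : X₀ + Pm + (X₀ * H + L) + (5 + v + T₀) ≤ M
      M≥ = +-monoˡ-≤ (5 + v + T₀) (+-mono-≤ (+-mono-≤ X₀≤ Pm≤) R≤)
      fits : ∀ {n} (c : Code n) (τ : Vec Tree n) → total τ ≤ X₀ + Pm + (X₀ * H + L) + (5 + v + T₀) →
             eval (timePoly c) (total τ) ≤ eval (timePoly c ⟨ MP ⟩) T₀
      fits c τ le = eval-⟨⟩-mono (timePoly c) MP (≤-trans le M≥)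
      sum≤ : ∀ {a b p r} → a + b ≤ X₀ → p ≤ Pm → r ≤ X₀ * H + L →
             r + (a + (b + (p + T₀))) ≤ X₀ + Pm + (X₀ * H + L) + (5 + v + T₀)
      sum≤ {a} {b} {p} {r} ab≤ p≤ r≤ = begin
        r + (a + (b + (p + T₀)))                   ≡⟨ sh r a b p T₀ ⟩
        a + b + p + r + T₀                         ≤⟨ +-mono-≤ (+-mono-≤ (+-mono-≤ ab≤ p≤) r≤) (m≤n+m T₀ (5 + v)) ⟩
        X₀ + Pm + (X₀ * H + L) + (5 + v + T₀)      ∎
        where
        sh : ∀ r a b p t → r + (a + (b + (p + t))) ≡ a + b + p + r + t
        sh = solve-∀
      within : ∀ {n} (c : Code n) (τ : Vec Tree n) {w} {σ : Vec Tree (suc w)} {ι} →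
               total τ ≤ X₀ + Pm + (X₀ * H + L) + (5 + v + T₀) →
               σ ⊢ compile c ι ⇓ ⟦ c ⟧ τ within eval (timePoly c) (total τ) →
               σ ⊢ compile c ι ⇓ ⟦ c ⟧ τ within eval (timePoly c ⟨ MP ⟩) T₀
      within c τ le (t , ⇓ , t≤) = t , ⇓ , ≤-trans t≤ (fits c τ le)
      module R = RecTime (ι zero) _ _ _ (impl zero) ρ
        (λ p → ⟦ g ⟧ (p ∷ ρ)) (λ a b p → ⟦ s ⟧ (a ∷ b ∷ p ∷ ρ)) (λ r a b p → ⟦ h ⟧ (r ∷ a ∷ b ∷ p ∷ ρ))
        X₀ G Pm H L M TG TS TH
        (λ a b p ab≤ → B.s-bound a b p (⟦ s ⟧ (a ∷ b ∷ p ∷ ρ)) (size≤ s (a ∷ b ∷ p ∷ ρ)) ab≤)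
        (λ r a b p ab≤ p≤ → B.h-bound r a b p (⟦ h ⟧ (r ∷ a ∷ b ∷ p ∷ ρ)) (size≤ h (r ∷ a ∷ b ∷ p ∷ ρ)) ab≤ p≤ A≥)
        (λ p p≤ → B.g-bound p (⟦ g ⟧ (p ∷ ρ)) (size≤ g (p ∷ ρ)) p≤ (m+n≤o⇒n≤o X₀ A≥))
        M≥
        (λ p τ p≤ → within g (p ∷ ρ) (sum≤ {0} {0} {size p} {0} z≤n p≤ z≤n)
          (correct g _ (mergeˡ (calls g) (impl ∘ suc)) (p ∷ ρ) τ))
        (λ a b p τ ab≤ p≤ → within s (a ∷ b ∷ p ∷ ρ) (sum≤ {size a} {size b} {size p} {0} ab≤ p≤ z≤n)
          (correct s _ (mergeˡ (calls s) (mergeʳ (calls g) (impl ∘ suc))) (a ∷ b ∷ p ∷ ρ) τ))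
        (λ r a b p τ ab≤ p≤ r≤ → within h (r ∷ a ∷ b ∷ p ∷ ρ) (sum≤ {size a} {size b} {size p} {size r} ab≤ p≤ r≤)
          (correct h _ (mergeˡ (calls h) impl-h) (r ∷ a ∷ b ∷ p ∷ ρ) τ))
      e≡ = size-env ρ
      xpe≤ : 1 + X₀ + (1 + p₀ + size (env ρ)) ≤ M
      xpe≤ = begin
        1 + X₀ + (1 + p₀ + size (env ρ))          ≡⟨ cong (λ e → 1 + X₀ + (1 + p₀ + e)) e≡ ⟩
        1 + X₀ + (1 + p₀ + (suc v + T₀))          ≡⟨ sh X₀ p₀ v T₀ ⟩
        X₀ + p₀ + 0 + (3 + v + T₀)                ≤⟨ +-mono-≤ (+-mono-≤ (+-monoʳ-≤ X₀ (m≤m+n p₀ (X₀ * G))) z≤n)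
                                                       (+-monoˡ-≤ T₀ (+-monoˡ-≤ v (s≤s (s≤s (s≤s z≤n))))) ⟩
        X₀ + Pm + (X₀ * H + L) + (5 + v + T₀)     ≤⟨ M≥ ⟩
        M                                         ∎
        where
        sh : ∀ x p v t → 1 + x + (1 + p + (suc v + t)) ≡ x + p + 0 + (3 + v + t)
        sh = solve-∀
      pe≤ : 1 + p₀ + size (env ρ) ≤ M
      pe≤ = ≤-trans (m≤n+m _ (1 + X₀)) xpe≤
      shuffle : ∀ M d e r → 1 + (M + d + (M + e + 1)) + r ≡ 2 + d + e + M * 2 + r
      shuffle = solve-∀
    correct (tight c b c≤ e) ι impl ρ σ =
      let s , ⇓e , s≤ = correct e _ (mergeʳ (calls c) impl) ρ σ
          t , ⇓c , t≤ = correct c _ (mergeˡ (calls c) impl) (⟦ e ⟧ ρ ∷ []) (env ρ ∷ σ)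
          S = size (⟦ e ⟧ ρ)
      in _ , bind (cons ⇓e nil) ⇓c ,
      (begin
        1 + (1 + S + 1 + s + 1) + t
          ≤⟨ +-mono-≤ (+-monoʳ-≤ 1 (+-monoˡ-≤ 1 (+-mono-≤ (+-monoˡ-≤ 1 (s≤s (size-value e ρ))) s≤)))
               (≤-trans t≤ (eval-⟨⟩-mono (timePoly c) (valuePoly e)
                 (≤-trans (≤-reflexive (+-identityʳ S)) (size-value e ρ)))) ⟩
        1 + (1 + eval (valuePoly e) (total ρ) + 1 + eval (timePoly e) (total ρ) + 1) +
          eval (timePoly c ⟨ valuePoly e ⟩) (total ρ)
          ≡⟨ shuffle (eval (valuePoly e) (total ρ)) (eval (timePoly e) (total ρ)) _ ⟩
        eval (timePoly (tight c b c≤ e)) (total ρ) ∎)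
      where
      shuffle : ∀ v t r → 1 + (1 + v + 1 + t + 1) + r ≡ 4 + v + t + r
      shuffle = solve-∀

    correctArgs [] ι impl ρ σ = _ , nil , ≤-refl
    correctArgs (_∷_ {w} e es) ι impl ρ σ =
      let s , ⇓e , s≤ = correct e _ (mergeˡ (calls e) impl) ρ σ
          t , ⇓es , t≤ = correctArgs es _ (mergeʳ (calls e) impl) ρ σ
          S = size (⟦ e ⟧ ρ)
      in _ , cons ⇓e ⇓es ,
      (begin
        1 + S + size (env (⟦ es ⟧* ρ)) + s + t
          ≡⟨ cong (λ e → 1 + S + e + s + t) (size-env (⟦ es ⟧* ρ)) ⟩
        1 + S + (suc w + total (⟦ es ⟧* ρ)) + s + t
          ≡⟨ shuffle S w (total (⟦ es ⟧* ρ)) s t ⟩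
        2 + w + S + total (⟦ es ⟧* ρ) + s + t
          ≤⟨ +-mono-≤ (+-mono-≤ (+-mono-≤ (+-monoʳ-≤ (2 + w) (size-value e ρ)) (total-args es ρ)) s≤) t≤ ⟩
        eval (timeArgs (e ∷ es)) (total ρ) ∎)
      where
      shuffle : ∀ x w t a b → 1 + x + (suc w + t) + a + b ≡ 2 + w + x + t + a + b
      shuffle = solve-∀

  program : Code 1 → Program
  program c = record
    { F    = calls c
    ; body = bodies c (λ j → j)
    ; main = bind (cons (var zero) nil) (compile c (λ j → j))
    }

  polyTime : (c : Code 1) → ∃[ a ] ∃[ d ] ∀ x → ∃[ t ] Runs (program c) x (⟦ c ⟧ (x ∷ [])) t × t ≤ a * size x ^ d
  polyTime c = coefficient P , degree P , λ x →
    let t , ⇓c , t≤ = correct c (λ j → j) (λ _ → refl) (x ∷ []) (x ∷ [])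
    in _ , bind (cons var nil) ⇓c , (begin
      1 + (1 + size x + 1 + 1 + 1) + t
        ≤⟨ +-monoʳ-≤ (1 + (1 + size x + 1 + 1 + 1)) (≤-trans t≤
             (≤-reflexive (cong (eval (timePoly c)) (+-identityʳ (size x))))) ⟩
      1 + (1 + size x + 1 + 1 + 1) + eval (timePoly c) (size x)
        ≡⟨ shuffle (size x) (eval (timePoly c) (size x)) ⟩
      eval P (size x)
        ≤⟨ eval-monomial P (size≥1 x) ⟩
      coefficient P * size x ^ degree P ∎)
    where
    open Correctness (bodies c (λ j → j))
    open Semantics (bodies c (λ j → j))
    P = con 5 ⊞ X ⊞ timePoly c
    shuffle : ∀ x t → 1 + (1 + x + 1 + 1 + 1) + t ≡ 5 + x + t
    shuffle = solve-∀
    size≥1 : ∀ x → 1 ≤ size x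
    size≥1 nil     = s≤s z≤n
    size≥1 (x ∙ y) = s≤s z≤n

module Arithmetic where

  open Language
  open import Data.Bool using (Bool; true; false; T; _∧_; _∨_; not)
  open import Data.Fin using (zero; suc)
  open import Data.Nat using (ℕ; zero; suc; _+_; _*_; _≤_; _<_; _≤ᵇ_; z≤n; s≤s)
  open import Data.Nat.Properties
  open import Data.Nat.Binary using (ℕᵇ; zero; 2[1+_]; 1+[2_]; fromℕ) renaming (toℕ to toNat; suc to sucᵇ; _+_ to _+ᵇ_; double to doubleᵇ)
  open import Data.Nat.Binary.Properties using (toℕ-fromℕ; fromℕ-toℕ; toℕ-suc; toℕ-double; toℕ-homo-+)
  open import Data.Nat.Tactic.RingSolver using (solve-∀)
  open import Data.Unit using (tt)
  open import Data.Vec using (Vec; []; _∷_)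
  open import Relation.Binary.PropositionalEquality using (_≡_; refl; sym; trans; cong; cong₂; subst)

  loop : ∀ {v} → Code (1 + v) → Code (3 + v) → Code (4 + v) → Vec Tree v → Tree → Tree → Tree
  loop g s h ρ = recTree (λ p → ⟦ g ⟧ (p ∷ ρ)) (λ a b p → ⟦ s ⟧ (a ∷ b ∷ p ∷ ρ)) (λ r a b p → ⟦ h ⟧ (r ∷ a ∷ b ∷ p ∷ ρ))

  T-ext : ∀ {a b} → (T a → T b) → (T b → T a) → a ≡ b
  T-ext {false} {false} f g = refl
  T-ext {false} {true}  f g with () ← g tt
  T-ext {true}  {false} f g with () ← f tt
  T-ext {true}  {true}  f g = refl

  trueC falseC : ∀ {v} → Code v
  trueC  = cons nil nil
  falseC = nil

  notC : Code 1
  notC = case (var 0F) trueC falseC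

  -- The results do not share structure with the arguments, so they count as
  -- independent of the arguments' sizes.
  andC orC : Code 2
  andC = case (var 0F) falseC (case (var 3F) falseC trueC)
  orC  = case (var 0F) (case (var 1F) falseC trueC) trueC

  notC-correct : ∀ a → ⟦ notC ⟧ (encodeBool a ∷ []) ≡ encodeBool (not a)
  notC-correct false = refl
  notC-correct true  = refl

  andC-correct : ∀ a b → ⟦ andC ⟧ (encodeBool a ∷ encodeBool b ∷ []) ≡ encodeBool (a ∧ b)
  andC-correct false b     = refl
  andC-correct true  false = refl
  andC-correct true  true  = refl

  orC-correct : ∀ a b → ⟦ orC ⟧ (encodeBool a ∷ encodeBool b ∷ []) ≡ encodeBool (a ∨ b)
  orC-correct false false = refl
  orC-correct false true  = refl
  orC-correct true  b     = refl

  head tail : ∀ {v} → Code v → Code v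
  head e = case e nil (var 0F)
  tail e = case e nil (var 1F)

  -- Numbers, internally with digit trees of equal size, so that adding a carry
  -- enlarges a number by at most one digit

  num : ℕᵇ → Tree
  num zero     = nil
  num 2[1+ x ] = (nil ∙ (nil ∙ nil)) ∙ num x
  num 1+[2 x ] = ((nil ∙ nil) ∙ nil) ∙ num x

  abstract
    N : ℕ → Tree
    N a = num (fromℕ a)

    N-num : ∀ a → N a ≡ num (fromℕ a)
    N-num a = refl

    N-zero : N 0 ≡ nil
    N-zero = refl

  fromℕ-unique : ∀ x {a} → toNat x ≡ a → x ≡ fromℕ a
  fromℕ-unique x refl = sym (fromℕ-toℕ x)

  one two : ∀ {v} → Code v
  one = cons (cons nil nil) nil
  two = cons nil (cons nil nil)

  sucH : Code 5
  sucH = case (var 1F) (cons two (var 2F))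
    (case (var 0F)
      (case (var 1F) (cons two (var 4F)) (cons one (var 4F)))
      (cons two (var 6F)))

  sucBare : Code 1
  sucBare = rec (cons one nil) nil sucH (var 0F) nil

  sucH-loop≤ : ∀ (ρ : Vec Tree 1) x → size (loop (cons one nil) nil sucH ρ x nil) ≤ 6 + size x
  sucH-loop≤ ρ nil = ≤-refl
  sucH-loop≤ ρ (nil ∙ b) = +-monoʳ-≤ 6 (m≤n+m (size b) 2)
  sucH-loop≤ ρ ((nil ∙ nil) ∙ b) = +-monoʳ-≤ 6 (m≤n+m (size b) 4)
  sucH-loop≤ ρ ((nil ∙ (x ∙ y)) ∙ b) = +-monoʳ-≤ 6 (≤-trans (sucH-loop≤ ρ b) (+-monoˡ-≤ (size b) (s≤s (s≤s (s≤s (s≤s (+-mono-≤ (size≥1 x) (size≥1 y))))))))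
    where
    size≥1 : ∀ x → 1 ≤ size x
    size≥1 nil     = s≤s z≤n
    size≥1 (x ∙ y) = s≤s z≤n
  sucH-loop≤ ρ (((x ∙ y) ∙ z) ∙ b) = +-monoʳ-≤ 6 (m≤n+m (size b) _)

  sucC : Code 1
  sucC = tight sucBare 6 (λ x → sucH-loop≤ (x ∷ []) x) (var 0F)

  sucC-num : ∀ x → ⟦ sucC ⟧ (num x ∷ []) ≡ num (sucᵇ x)
  sucC-num x = go (num x ∷ []) x
    where
    go : ∀ (ρ : Vec Tree 1) x → loop (cons one nil) nil sucH ρ (num x) nil ≡ num (sucᵇ x)
    go ρ zero     = refl
    go ρ 2[1+ x ] = cong (((nil ∙ nil) ∙ nil) ∙_) (go ρ x)
    go ρ 1+[2 x ] = refl

  abstract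
    sucC-correct : ∀ a → ⟦ sucC ⟧ (N a ∷ []) ≡ N (suc a)
    sucC-correct a = trans (sucC-num (fromℕ a))
      (cong num (fromℕ-unique (sucᵇ (fromℕ a)) (trans (toℕ-suc (fromℕ a)) (cong suc (toℕ-fromℕ a)))))

  doubleH : Code 5
  doubleH = case (var 1F) nil
    (case (var 0F)
      (case (var 1F) nil (cons two (cons one (var 6F))))
      (cons two (var 4F)))

  doubleH-loop≤ : ∀ (ρ : Vec Tree 1) x → size (loop nil nil doubleH ρ x nil) ≤ 6 + size x
  doubleH-loop≤ ρ nil = s≤s z≤n
  doubleH-loop≤ ρ (nil ∙ b) = s≤s z≤n
  doubleH-loop≤ ρ ((nil ∙ nil) ∙ b) = s≤s z≤n
  doubleH-loop≤ ρ ((nil ∙ (x ∙ y)) ∙ b) = +-monoʳ-≤ 10 (+-monoˡ-≤ (size b) (+-mono-≤ (size≥1 x) (size≥1 y)))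
    where
    size≥1 : ∀ x → 1 ≤ size x
    size≥1 nil     = s≤s z≤n
    size≥1 (x ∙ y) = s≤s z≤n
  doubleH-loop≤ ρ (((x ∙ y) ∙ z) ∙ b) = +-monoʳ-≤ 6 (≤-trans (doubleH-loop≤ ρ b) (+-monoˡ-≤ (size b)
    (s≤s (s≤s (s≤s (+-mono-≤ (+-mono-≤ (size≥1 x) (size≥1 y)) (size≥1 z)))))))
    where
    size≥1 : ∀ x → 1 ≤ size x
    size≥1 nil     = s≤s z≤n
    size≥1 (x ∙ y) = s≤s z≤n

  doubleC : Code 1
  doubleC = tight (rec nil nil doubleH (var 0F) nil) 6 (λ x → doubleH-loop≤ (x ∷ []) x) (var 0F)

  doubleC-num : ∀ x → ⟦ doubleC ⟧ (num x ∷ []) ≡ num (doubleᵇ x)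
  doubleC-num x = go (num x ∷ []) x
    where
    go : ∀ (ρ : Vec Tree 1) x → loop nil nil doubleH ρ (num x) nil ≡ num (doubleᵇ x)
    go ρ zero     = refl
    go ρ 2[1+ x ] = refl
    go ρ 1+[2 x ] = cong ((nil ∙ (nil ∙ nil)) ∙_) (go ρ x)

  isTwo : ∀ {v} → Code v → Code v
  isTwo e = app (case (var 0F) nil (case (var 0F) trueC falseC)) (e ∷ [])

  addS : Code 5
  addS = tail (var 2F)

  addH : Code 6
  addH = case (var 3F) (cons (var 1F) (var 2F))
    (case (isTwo (var 3F))
      (case (isTwo (var 0F))
        (cons two (var 2F))
        (cons one (app sucC (var 4F ∷ []))))
      (case (isTwo (var 2F))
        (cons one (app sucC (var 4F ∷ [])))
        (cons two (app sucC (var 6F ∷ [])))))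

  addC : Code 2
  addC = rec (var 0F) addS addH (var 0F) (var 1F)

  addC-loop : ∀ (ρ : Vec Tree 2) x y → loop (var 0F) addS addH ρ (num x) (num y) ≡ num (x +ᵇ y)
  addC-loop ρ zero     y        = refl
  addC-loop ρ 2[1+ x ] zero     = refl
  addC-loop ρ 1+[2 x ] zero     = refl
  addC-loop ρ 2[1+ x ] 2[1+ y ] = cong ((nil ∙ (nil ∙ nil)) ∙_)
    (trans (cong (λ t → ⟦ sucC ⟧ (t ∷ [])) (addC-loop ρ x y)) (sucC-num (x +ᵇ y)))
  addC-loop ρ 2[1+ x ] 1+[2 y ] = cong (((nil ∙ nil) ∙ nil) ∙_)
    (trans (cong (λ t → ⟦ sucC ⟧ (t ∷ [])) (addC-loop ρ x y)) (sucC-num (x +ᵇ y)))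
  addC-loop ρ 1+[2 x ] 2[1+ y ] = cong (((nil ∙ nil) ∙ nil) ∙_)
    (trans (cong (λ t → ⟦ sucC ⟧ (t ∷ [])) (addC-loop ρ x y)) (sucC-num (x +ᵇ y)))
  addC-loop ρ 1+[2 x ] 1+[2 y ] = cong ((nil ∙ (nil ∙ nil)) ∙_) (addC-loop ρ x y)

  addC-num : ∀ x y → ⟦ addC ⟧ (num x ∷ num y ∷ []) ≡ num (x +ᵇ y)
  addC-num x y = addC-loop (num x ∷ num y ∷ []) x y

  abstract
    addC-correct : ∀ a b → ⟦ addC ⟧ (N a ∷ N b ∷ []) ≡ N (a + b)
    addC-correct a b = trans (addC-num (fromℕ a) (fromℕ b))
      (cong num (fromℕ-unique (fromℕ a +ᵇ fromℕ b)
        (trans (toℕ-homo-+ (fromℕ a) (fromℕ b)) (cong₂ _+_ (toℕ-fromℕ a) (toℕ-fromℕ b)))))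

  abstract
    doubleC-correct : ∀ a → ⟦ doubleC ⟧ (N a ∷ []) ≡ N (2 * a)
    doubleC-correct a = trans (doubleC-num (fromℕ a))
      (cong num (fromℕ-unique (doubleᵇ (fromℕ a)) (trans (toℕ-double (fromℕ a)) (cong (2 *_) (toℕ-fromℕ a)))))

  mulH : Code 6
  mulH = case (isTwo (var 1F))
    (app addC (var 3F ∷ app doubleC (var 0F ∷ []) ∷ []))
    (app doubleC (app addC (var 5F ∷ var 2F ∷ []) ∷ []))

  mulC : Code 2
  mulC = rec nil (var 2F) mulH (var 0F) (var 1F)

  abstract
    mulC-correct : ∀ a b → ⟦ mulC ⟧ (N a ∷ N b ∷ []) ≡ N (a * b)
    mulC-correct a b = trans (go (N a ∷ N b ∷ []) (fromℕ a)) (cong (λ a → N (a * b)) (toℕ-fromℕ a))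
      where
      sh₁ : ∀ b r → 2 * (b + r * b) ≡ 2 * suc r * b
      sh₁ = solve-∀
      sh₂ : ∀ b r → b + 2 * (r * b) ≡ b + 2 * r * b
      sh₂ = solve-∀
      go : ∀ (ρ : Vec Tree 2) x → loop nil (var 2F) mulH ρ (num x) (N b) ≡ N (toNat x * b)
      go ρ zero     = refl
      go ρ 2[1+ x ] = trans (cong (λ t → ⟦ doubleC ⟧ (⟦ addC ⟧ (N b ∷ t ∷ []) ∷ [])) (go ρ x))
        (trans (cong (λ t → ⟦ doubleC ⟧ (t ∷ [])) (addC-correct b (toNat x * b)))
          (trans (doubleC-correct (b + toNat x * b)) (cong N (sh₁ b (toNat x)))))
      go ρ 1+[2 x ] = trans (cong (λ t → ⟦ addC ⟧ (N b ∷ ⟦ doubleC ⟧ (t ∷ []) ∷ [])) (go ρ x))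
        (trans (cong (λ t → ⟦ addC ⟧ (N b ∷ t ∷ [])) (doubleC-correct (toNat x * b)))
          (trans (addC-correct b (2 * (toNat x * b))) (cong N (sh₂ b (toNat x)))))

  -- The flag says whether the digits read so far are ≤; longer numbers are larger.

  leᵇ : Bool → ℕᵇ → ℕᵇ → Bool
  leᵇ f zero     zero     = f
  leᵇ f zero     2[1+ y ] = true
  leᵇ f zero     1+[2 y ] = true
  leᵇ f 2[1+ x ] zero     = false
  leᵇ f 1+[2 x ] zero     = false
  leᵇ f 2[1+ x ] 2[1+ y ] = leᵇ f x y
  leᵇ f 2[1+ x ] 1+[2 y ] = leᵇ false x y
  leᵇ f 1+[2 x ] 2[1+ y ] = leᵇ true x y
  leᵇ f 1+[2 x ] 1+[2 y ] = leᵇ f x y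

  ltᵇ-sound : ∀ x y → T (leᵇ false x y) → toNat x < toNat y
  leᵇ-sound : ∀ x y → T (leᵇ true x y) → toNat x ≤ toNat y
  ltᵇ-sound zero     2[1+ y ] _ = s≤s z≤n
  ltᵇ-sound zero     1+[2 y ] _ = s≤s z≤n
  ltᵇ-sound 2[1+ x ] 2[1+ y ] t = *-monoʳ-< 2 (s≤s (ltᵇ-sound x y t))
  ltᵇ-sound 2[1+ x ] 1+[2 y ] t = s≤s (*-monoʳ-≤ 2 (ltᵇ-sound x y t))
  ltᵇ-sound 1+[2 x ] 2[1+ y ] t = ≤-trans (s≤s (s≤s (*-monoʳ-≤ 2 (leᵇ-sound x y t)))) (≤-reflexive (sym (*-suc 2 (toNat y))))
  ltᵇ-sound 1+[2 x ] 1+[2 y ] t = s≤s (*-monoʳ-< 2 (ltᵇ-sound x y t))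
  leᵇ-sound zero     y        _ = z≤n
  leᵇ-sound 2[1+ x ] 2[1+ y ] t = *-monoʳ-≤ 2 (s≤s (leᵇ-sound x y t))
  leᵇ-sound 2[1+ x ] 1+[2 y ] t = ≤-trans (*-monoʳ-≤ 2 (ltᵇ-sound x y t)) (n≤1+n _)
  leᵇ-sound 1+[2 x ] 2[1+ y ] t = ≤-trans (s≤s (*-monoʳ-≤ 2 (leᵇ-sound x y t))) (≤-trans (n≤1+n _) (≤-reflexive (sym (*-suc 2 (toNat y)))))
  leᵇ-sound 1+[2 x ] 1+[2 y ] t = s≤s (*-monoʳ-≤ 2 (leᵇ-sound x y t))

  leᵇ-total : ∀ x y → leᵇ true x y ≡ not (leᵇ false y x)
  leᵇ-total′ : ∀ x y → leᵇ false x y ≡ not (leᵇ true y x)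
  leᵇ-total zero zero         = refl
  leᵇ-total zero 2[1+ y ]     = refl
  leᵇ-total zero 1+[2 y ]     = refl
  leᵇ-total 2[1+ x ] zero     = refl
  leᵇ-total 1+[2 x ] zero     = refl
  leᵇ-total 2[1+ x ] 2[1+ y ] = leᵇ-total x y
  leᵇ-total 2[1+ x ] 1+[2 y ] = leᵇ-total′ x y
  leᵇ-total 1+[2 x ] 2[1+ y ] = leᵇ-total x y
  leᵇ-total 1+[2 x ] 1+[2 y ] = leᵇ-total x y
  leᵇ-total′ zero zero         = refl
  leᵇ-total′ zero 2[1+ y ]     = refl
  leᵇ-total′ zero 1+[2 y ]     = refl
  leᵇ-total′ 2[1+ x ] zero     = refl
  leᵇ-total′ 1+[2 x ] zero     = refl
  leᵇ-total′ 2[1+ x ] 2[1+ y ] = leᵇ-total′ x y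
  leᵇ-total′ 2[1+ x ] 1+[2 y ] = leᵇ-total′ x y
  leᵇ-total′ 1+[2 x ] 2[1+ y ] = leᵇ-total x y
  leᵇ-total′ 1+[2 x ] 1+[2 y ] = leᵇ-total′ x y

  leᵇ-≤ᵇ : ∀ x y → leᵇ true x y ≡ (toNat x ≤ᵇ toNat y)
  leᵇ-≤ᵇ x y = T-ext (λ t → ≤⇒≤ᵇ (leᵇ-sound x y t)) complete
    where
    complete : T (toNat x ≤ᵇ toNat y) → T (leᵇ true x y)
    complete t with leᵇ false y x in eq
    ... | false = subst T (sym (trans (leᵇ-total x y) (cong not eq))) tt
    ... | true with () ← <-irrefl refl (≤-trans (ltᵇ-sound y x (subst T (sym eq) tt)) (≤ᵇ⇒≤ (toNat x) (toNat y) t))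

  leS : Code 5
  leS = case (var 2F) nil
    (case (var 1F) nil
      (case (app compareC (var 4F ∷ var 0F ∷ var 2F ∷ []))
        (cons falseC (var 1F))
        (cons trueC (var 3F))))
    where
    compareC : Code 3
    compareC = case (isTwo (var 0F))
      (case (isTwo (var 1F)) (var 2F) trueC)
      (case (isTwo (var 3F)) falseC (var 6F))

  leG : Code 3
  leG = case (var 0F) nil (case (var 1F) (var 0F) trueC)

  leH : Code 6
  leH = case (var 3F) nil (case (var 1F) falseC (var 4F))

  leC : Code 2
  leC = rec leG leS leH (var 0F) (cons trueC (var 1F))

  leC-loop : ∀ (ρ : Vec Tree 2) f x y → loop leG leS leH ρ (num x) (encodeBool f ∙ num y) ≡ encodeBool (leᵇ f x y)
  leC-loop ρ f     zero     zero     = refl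
  leC-loop ρ f     zero     2[1+ y ] = refl
  leC-loop ρ f     zero     1+[2 y ] = refl
  leC-loop ρ f     2[1+ x ] zero     = refl
  leC-loop ρ f     1+[2 x ] zero     = refl
  leC-loop ρ false 2[1+ x ] 2[1+ y ] = leC-loop ρ false x y
  leC-loop ρ true  2[1+ x ] 2[1+ y ] = leC-loop ρ true x y
  leC-loop ρ f     2[1+ x ] 1+[2 y ] = leC-loop ρ false x y
  leC-loop ρ f     1+[2 x ] 2[1+ y ] = leC-loop ρ true x y
  leC-loop ρ false 1+[2 x ] 1+[2 y ] = leC-loop ρ false x y
  leC-loop ρ true  1+[2 x ] 1+[2 y ] = leC-loop ρ true x y

  abstract
    leC-correct : ∀ a b → ⟦ leC ⟧ (N a ∷ N b ∷ []) ≡ encodeBool (a ≤ᵇ b)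
    leC-correct a b = trans (leC-loop (N a ∷ N b ∷ []) true (fromℕ a) (fromℕ b))
      (cong encodeBool (trans (leᵇ-≤ᵇ (fromℕ a) (fromℕ b)) (cong₂ _≤ᵇ_ (toℕ-fromℕ a) (toℕ-fromℕ b))))

module Families where

  open Language
  open Arithmetic
  open import Data.Bool using (Bool; true; false; T; _∧_; _∨_; if_then_else_)
  open import Data.Fin using (Fin; zero; suc; toℕ)
  open import Data.Fin.Properties using (_≟_)
  open import Data.List using (List; []; _∷_; foldl; tabulate; _++_; length; replicate)
  import Data.List as List
  open import Data.List.Properties using (map-tabulate; tabulate-cong)
  open import Data.Nat using (ℕ; zero; suc; _+_; _*_; _^_; _∸_)
  open import Data.Nat.ListAction using (sum)
  open import Data.Nat.Properties hiding (_≟_)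
  open import Data.Vec using (Vec; []; _∷_; lookup)
  open import Function using (_∘_)
  open import Relation.Binary.PropositionalEquality using (_≡_; refl; sym; trans; cong; cong₂)
  open import Relation.Nullary using (does)

  when : Bool → ℕ → ℕ
  when b x = if b then x else 0

  ∑ : ∀ {k} → (Fin k → ℕ) → ℕ
  ∑ f = sum (tabulate f)

  anyF : ∀ {k} → (Fin k → Bool) → Bool
  anyF {zero}  f = false
  anyF {suc k} f = f zero ∨ anyF (f ∘ suc)

  family-cong : ∀ {k} {f g : Fin k → Tree} → (∀ i → f i ≡ g i) → encodeFamily f ≡ encodeFamily g
  family-cong eq = cong encodeList (tabulate-cong eq)

  mask : ∀ {k} → (Fin k → Bool) → Tree
  mask f = encodeFamily (λ i → encodeBool (f i))

  mask-cong : ∀ {k} {f g : Fin k → Bool} → (∀ i → f i ≡ g i) → mask f ≡ mask g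
  mask-cong eq = family-cong (λ i → cong encodeBool (eq i))

  nums : ∀ {k} → (Fin k → ℕ) → Tree
  nums f = encodeFamily (λ i → N (f i))

  matrix : ∀ {k n} → (Fin k → Fin n → Bool) → Tree
  matrix f = encodeFamily (λ i → mask (f i))

  point : ∀ {k} → Fin k → Fin k → Bool
  point i j = does (i ≟ j)

  hot : ∀ {k} → Fin k → Tree
  hot i = mask (point i)

  point-suc : ∀ {k} (i j : Fin k) → point (suc i) (suc j) ≡ point i j
  point-suc i j with i ≟ j
  ... | record { does = true } = refl
  ... | record { does = false } = refl

  foldl-loop : ∀ {A B : Set} {v} (s : Code (3 + v)) (ρ : Vec Tree v) (e : B → Tree) (enc : A → Tree) (f : A → B → A) →
               (∀ x b a → ⟦ s ⟧ (e x ∷ b ∷ enc a ∷ ρ) ≡ enc (f a x)) →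
               ∀ xs a → loop (var 0F) s (var 0F) ρ (encodeList (List.map e xs)) (enc a) ≡ enc (foldl f a xs)
  foldl-loop s ρ e enc f step []       a = refl
  foldl-loop s ρ e enc f step (x ∷ xs) a =
    trans (cong (loop (var 0F) s (var 0F) ρ (encodeList (List.map e xs))) (step x _ a)) (foldl-loop s ρ e enc f step xs (f a x))

  map-loop : ∀ {v k} (c : Code (4 + v)) (ρ : Vec Tree v) (x y : Fin k → Tree) →
             (∀ i r b p → ⟦ c ⟧ (r ∷ x i ∷ b ∷ p ∷ ρ) ≡ y i) →
             loop nil nil (cons c (var 0F)) ρ (encodeFamily x) nil ≡ encodeFamily y
  map-loop {k = zero}  c ρ x y eq = refl
  map-loop {k = suc k} c ρ x y eq = cong₂ _∙_ (eq zero _ _ _) (map-loop c ρ (x ∘ suc) (y ∘ suc) (λ i → eq (suc i)))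

  family-map : ∀ {A : Set} {k} (e : A → Tree) (f : Fin k → A) → encodeFamily (e ∘ f) ≡ encodeList (List.map e (tabulate f))
  family-map e f = cong encodeList (sym (map-tabulate f e))

  mapC : ∀ {v} (c : Code (4 + v)) {_ : T (linear? (lookup (growth (cons c (var 0F))) 0F))} →
         Code v → Code v
  mapC c {ok} e = rec nil nil (cons c (var 0F)) {_} {ok} e nil

  zerosC : Code 1
  zerosC = mapC falseC (var 0F)

  zerosC-correct : ∀ {k} (x : Fin k → Tree) → ⟦ zerosC ⟧ (encodeFamily x ∷ []) ≡ mask {k} (λ _ → false)
  zerosC-correct x = map-loop falseC (encodeFamily x ∷ []) x (λ _ → nil) (λ _ _ _ _ → refl)

  -- The recursion runs over a third list of the same length, so that the sizes
  -- of the two masks do not count.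
  disjS : Code 6
  disjS = case (var 2F) nil (cons (tail (var 0F)) (tail (var 1F)))

  disjH : Code 7
  disjH = cons (case (var 3F) nil (app orC (head (var 0F) ∷ head (var 1F) ∷ []))) (var 0F)

  disjC : Code 3
  disjC = rec nil disjS disjH (var 0F) (cons (var 1F) (var 2F))

  disjC-correct : ∀ {k} (x : Fin k → Tree) (f g : Fin k → Bool) →
                  ⟦ disjC ⟧ (encodeFamily x ∷ mask f ∷ mask g ∷ []) ≡ mask (λ i → f i ∨ g i)
  disjC-correct x f g = go (encodeFamily x ∷ mask f ∷ mask g ∷ []) x f g
    where
    go : ∀ {k} (ρ : Vec Tree 3) (x : Fin k → Tree) (f g : Fin k → Bool) →
         loop nil disjS disjH ρ (encodeFamily x) (mask f ∙ mask g) ≡ mask (λ i → f i ∨ g i)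
    go {zero}  ρ x f g = refl
    go {suc k} ρ x f g = cong₂ _∙_ (orC-correct (f zero) (g zero)) (go ρ (x ∘ suc) (f ∘ suc) (g ∘ suc))

  meetsH : Code 6
  meetsH = app orC (app andC (var 1F ∷ head (var 3F) ∷ []) ∷ var 0F ∷ [])

  meetsC : Code 2
  meetsC = rec falseC (tail (var 2F)) meetsH (var 0F) (var 1F)

  meetsC-correct : ∀ {k} (f g : Fin k → Bool) → ⟦ meetsC ⟧ (mask f ∷ mask g ∷ []) ≡ encodeBool (anyF (λ i → f i ∧ g i))
  meetsC-correct f g = go (mask f ∷ mask g ∷ []) f g
    where
    go : ∀ {k} (ρ : Vec Tree 2) (f g : Fin k → Bool) →
         loop falseC (tail (var 2F)) meetsH ρ (mask f) (mask g) ≡ encodeBool (anyF (λ i → f i ∧ g i))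
    go {zero}  ρ f g = refl
    go {suc k} ρ f g =
      trans (cong₂ (λ a b → ⟦ orC ⟧ (a ∷ b ∷ [])) (andC-correct (f zero) (g zero)) (go ρ (f ∘ suc) (g ∘ suc)))
            (orC-correct (f zero ∧ g zero) _)

  sumH : Code 6
  sumH = case (head (var 3F)) (var 0F) (app addC (var 3F ∷ var 2F ∷ []))

  sumC : Code 2
  sumC = rec nil (tail (var 2F)) sumH (var 0F) (var 1F)

  sumC-correct : ∀ {k} (w : Fin k → ℕ) (f : Fin k → Bool) → ⟦ sumC ⟧ (nums w ∷ mask f ∷ []) ≡ N (∑ (λ i → when (f i) (w i)))
  sumC-correct w f = go (nums w ∷ mask f ∷ []) w f
    where
    go : ∀ {k} (ρ : Vec Tree 2) (w : Fin k → ℕ) (f : Fin k → Bool) →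
         loop nil (tail (var 2F)) sumH ρ (nums w) (mask f) ≡ N (∑ (λ i → when (f i) (w i)))
    go {zero}  ρ w f = sym N-zero
    go {suc k} ρ w f with f zero
    ... | false = go ρ (w ∘ suc) (f ∘ suc)
    ... | true  = trans (cong (λ t → ⟦ addC ⟧ (N (w zero) ∷ t ∷ [])) (go ρ (w ∘ suc) (f ∘ suc))) (addC-correct (w zero) _)

  countH : Code 5
  countH = case (var 1F) (var 0F) (app sucC (var 2F ∷ []))

  countC : Code 1
  countC = rec nil nil countH (var 0F) nil

  countC-correct : ∀ {k} (f : Fin k → Bool) → ⟦ countC ⟧ (mask f ∷ []) ≡ N (∑ (λ i → when (f i) 1))
  countC-correct f = go (mask f ∷ []) f
    where
    go : ∀ {k} (ρ : Vec Tree 1) (f : Fin k → Bool) → loop nil nil countH ρ (mask f) nil ≡ N (∑ (λ i → when (f i) 1))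
    go {zero}  ρ f = sym N-zero
    go {suc k} ρ f with f zero
    ... | false = go ρ (f ∘ suc)
    ... | true  = trans (cong (λ t → ⟦ sucC ⟧ (t ∷ [])) (go ρ (f ∘ suc))) (sucC-correct _)

  pickH : Code 6
  pickH = case (head (var 3F)) (var 0F) (var 3F)

  pickC : Code 2
  pickC = rec nil (tail (var 2F)) pickH (var 0F) (var 1F)

  pickC-correct : ∀ {k} (x : Fin k → Tree) i → ⟦ pickC ⟧ (encodeFamily x ∷ hot i ∷ []) ≡ x i
  pickC-correct x i = go (encodeFamily x ∷ hot i ∷ []) x i (point i) (λ _ → refl)
    where
    go : ∀ {k} (ρ : Vec Tree 2) (x : Fin k → Tree) i (f : Fin k → Bool) → (∀ j → f j ≡ point i j) →
         loop nil (tail (var 2F)) pickH ρ (encodeFamily x) (mask f) ≡ x i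
    go {suc k} ρ x zero    f eq with f zero | eq zero
    ... | true | _ = refl
    go {suc k} ρ x (suc i) f eq with f zero | eq zero
    ... | false | _ = go ρ (x ∘ suc) i (f ∘ suc) (λ j → trans (eq (suc j)) (point-suc i j))

  -- arguments: a list of length k, a list of length n, the selection, the rows
  unionS : Code 7
  unionS = case (var 2F) nil (cons (tail (var 0F)) (tail (var 1F)))

  unionH : Code 8
  unionH = case (var 3F) nil
    (case (head (var 0F)) (var 2F) (app disjC (var 9F ∷ head (var 3F) ∷ var 4F ∷ [])))

  unionC : Code 4
  unionC = rec (app zerosC (var 2F ∷ [])) unionS unionH (var 0F) (cons (var 2F) (var 3F))

  unionC-correct : ∀ {k n} (x : Fin k → Tree) (y : Fin n → Tree) (f : Fin k → Bool) (R : Fin k → Fin n → Bool) →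
                   ⟦ unionC ⟧ (encodeFamily x ∷ encodeFamily y ∷ mask f ∷ matrix R ∷ []) ≡ mask (λ u → anyF (λ i → f i ∧ R i u))
  unionC-correct {n = n} x y f R = go (encodeFamily x) (mask f) (matrix R) x f R
    where
    go : ∀ {k} e₀ e₂ e₃ (x : Fin k → Tree) (f : Fin k → Bool) (R : Fin k → Fin n → Bool) →
         loop (app zerosC (var 2F ∷ [])) unionS unionH (e₀ ∷ encodeFamily y ∷ e₂ ∷ e₃ ∷ []) (encodeFamily x) (mask f ∙ matrix R)
         ≡ mask (λ u → anyF (λ i → f i ∧ R i u))
    go {zero}  e₀ e₂ e₃ x f R = zerosC-correct y
    go {suc k} e₀ e₂ e₃ x f R with f zero
    ... | false = go e₀ e₂ e₃ (x ∘ suc) (f ∘ suc) (R ∘ suc)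
    ... | true  = trans (cong (λ t → ⟦ disjC ⟧ (encodeFamily y ∷ mask (R zero) ∷ t ∷ [])) (go e₀ e₂ e₃ (x ∘ suc) (f ∘ suc) (R ∘ suc)))
                        (disjC-correct y (R zero) (λ u → anyF (λ i → f (suc i) ∧ R (suc i) u)))

  -- The identity matrix; the parameter holds the zeros to the left.

  identityH : Code 5
  identityH = cons (rec (var 0F) (var 2F) (cons falseC (var 0F)) (var 3F) (cons trueC (app zerosC (var 2F ∷ [])))) (var 0F)

  identityC : Code 1
  identityC = rec nil (cons falseC (var 2F)) identityH (var 0F) nil

  falses : ℕ → Tree
  falses j = encodeList (replicate j nil)

  identityC-correct : ∀ {k} (x : Fin k → Tree) → ⟦ identityC ⟧ (encodeFamily x ∷ []) ≡ encodeFamily (hot {k})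
  identityC-correct {k} x = trans (go (encodeFamily x ∷ []) 0 x) (family-cong {k} (λ i → sym (row i)))
    where
    entry : ∀ {k} → ℕ → Fin k → Tree
    entry {k} j i = encodeList (replicate (j + toℕ i) nil ++ (nil ∙ nil) ∷ replicate (k ∸ suc (toℕ i)) nil)
    prefix : ∀ ρ j t → loop (var 0F) (var 2F) (cons {9} falseC (var 0F)) ρ (falses j) (encodeList t) ≡ encodeList (replicate j nil ++ t)
    prefix ρ zero    t = refl
    prefix ρ (suc j) t = cong (nil ∙_) (prefix ρ j t)
    zeros : ∀ {k} (x : Fin k → Tree) → ⟦ zerosC ⟧ (encodeFamily x ∷ []) ≡ falses k
    zeros {zero}  x = refl
    zeros {suc k} x = trans (zerosC-correct x) (cong (nil ∙_) (trans (sym (zerosC-correct (x ∘ suc))) (zeros (x ∘ suc))))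
    go : ∀ {k} (ρ : Vec Tree 1) j (x : Fin k → Tree) →
         loop nil (cons falseC (var 2F)) identityH ρ (encodeFamily x) (falses j) ≡ encodeFamily (entry {k} j)
    go {zero}  ρ j x = refl
    go {suc k} ρ j x = cong₂ _∙_
      (trans (cong (λ t → loop (var 0F) (var 2F) (cons falseC (var 0F)) (nil ∷ nil ∷ nil ∷ nil ∷ ρ) (falses j) ((nil ∙ nil) ∙ t)) (zeros (x ∘ suc)))
        (trans (prefix (nil ∷ nil ∷ nil ∷ nil ∷ ρ) j ((nil ∙ nil) ∷ replicate k nil)) (cong (λ l → encodeList (replicate l nil ++ (nil ∙ nil) ∷ replicate k nil)) (sym (+-identityʳ j)))))
      (trans (go ρ (suc j) (x ∘ suc))
        (family-cong {k} (λ i → cong (λ l → encodeList (replicate l nil ++ (nil ∙ nil) ∷ replicate (k ∸ suc (toℕ i)) nil)) (sym (+-suc j (toℕ i))))))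
    allFalse : ∀ {k} (f : Fin k → Bool) → (∀ i → f i ≡ false) → mask f ≡ falses k
    allFalse {zero}  f eq = refl
    allFalse {suc k} f eq = cong₂ _∙_ (cong encodeBool (eq zero)) (allFalse (f ∘ suc) (λ i → eq (suc i)))
    row : ∀ {k} (i : Fin k) → hot i ≡ entry 0 i
    row {suc k} zero = cong ((nil ∙ nil) ∙_) (allFalse {k} _ (λ _ → refl))
    row {suc k} (suc i) = cong (nil ∙_) (trans (mask-cong (point-suc i)) (row i))

  lengthH : Code 5
  lengthH = app sucC (var 0F ∷ [])

  lengthC : Code 1
  lengthC = rec nil nil lengthH (var 0F) nil

  lengthC-correct : ∀ xs → ⟦ lengthC ⟧ (encodeList xs ∷ []) ≡ N (length xs)
  lengthC-correct xs = go (encodeList xs ∷ []) xs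
    where
    go : ∀ (ρ : Vec Tree 1) xs → loop nil nil lengthH ρ (encodeList xs) nil ≡ N (length xs)
    go ρ []       = sym N-zero
    go ρ (x ∷ xs) = trans (cong (λ t → ⟦ sucC ⟧ (t ∷ [])) (go ρ xs)) (sucC-correct (length xs))

  N-one : ⟦ sucC ⟧ (nil ∷ []) ≡ N 1
  N-one = trans (cong (λ t → ⟦ sucC ⟧ (t ∷ [])) (sym N-zero)) (sucC-correct 0)

  fromOne : Code 1
  fromOne = rec nil (app sucC (var 2F ∷ [])) (cons (var 3F) (var 0F)) (var 0F) (app sucC (nil ∷ []))

  fromOne-correct : ∀ {k} (x : Fin k → Tree) → ⟦ fromOne ⟧ (encodeFamily x ∷ []) ≡ nums {k} (λ i → suc (toℕ i))
  fromOne-correct x = trans (cong (loop nil (app sucC (var 2F ∷ [])) (cons (var 3F) (var 0F)) (encodeFamily x ∷ []) (encodeFamily x)) N-one)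
    (go (encodeFamily x ∷ []) 1 x)
    where
    go : ∀ {k} (ρ : Vec Tree 1) c (x : Fin k → Tree) →
         loop nil (app sucC (var 2F ∷ [])) (cons (var 3F) (var 0F)) ρ (encodeFamily x) (N c) ≡ nums {k} (λ i → c + toℕ i)
    go {zero}  ρ c x = refl
    go {suc k} ρ c x = cong₂ _∙_ (cong N (sym (+-identityʳ c)))
      (trans (cong (loop nil (app sucC (var 2F ∷ [])) (cons (var 3F) (var 0F)) ρ (encodeFamily (x ∘ suc))) (sucC-correct c))
        (trans (go ρ (suc c) (x ∘ suc)) (family-cong {k} (λ i → cong N (sym (+-suc c (toℕ i)))))))

  powers : Code 1
  powers = rec nil (app doubleC (var 2F ∷ [])) (cons (var 3F) (var 0F)) (var 0F) (app sucC (nil ∷ []))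

  powers-correct : ∀ xs → ⟦ powers ⟧ (encodeList xs ∷ []) ≡ nums {length xs} (λ i → 2 ^ toℕ i)
  powers-correct xs =
    trans (cong (loop nil (app doubleC (var 2F ∷ [])) (cons (var 3F) (var 0F)) (encodeList xs ∷ []) (encodeList xs)) N-one) (trans (go (encodeList xs ∷ []) 1 xs) (family-cong {length xs} (λ i → cong N (*-identityˡ (2 ^ toℕ i)))))
    where
    go : ∀ (ρ : Vec Tree 1) c xs →
         loop nil (app doubleC (var 2F ∷ [])) (cons (var 3F) (var 0F)) ρ (encodeList xs) (N c) ≡ nums {length xs} (λ i → c * 2 ^ toℕ i)
    go ρ c []       = refl
    go ρ c (x ∷ xs) = cong₂ _∙_ (cong N (sym (*-identityʳ c)))
      (trans (cong (loop nil (app doubleC (var 2F ∷ [])) (cons (var 3F) (var 0F)) ρ (encodeList xs)) (doubleC-correct c))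
        (trans (go ρ (2 * c) xs) (family-cong {length xs} (λ i → cong N (trans (cong (_* 2 ^ toℕ i) (*-comm 2 c)) (*-assoc c 2 (2 ^ toℕ i)))))))

module Masks where

  open Arithmetic using (T-ext)
  open Families using (∑; when; anyF; point)
  open import Data.Bool using (Bool; true; false; T; _∧_; _∨_; not)
  open import Data.Empty using (⊥-elim)
  open import Data.Fin using (Fin; zero; suc)
  open import Data.Fin.Properties using (_≟_)
  open import Data.Nat using (ℕ; zero; suc; _+_; _*_; _≤_; z≤n)
  open import Data.Nat.Properties hiding (_≟_)
  open import Data.Nat.Tactic.RingSolver using (solve-∀)
  open import Data.Product using (_×_; _,_; ∃-syntax)
  open import Data.Sum using (_⊎_; inj₁; inj₂)
  open import Data.Unit using (tt)
  open import Function using (_∘_)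
  open import Relation.Binary.PropositionalEquality using (_≡_; refl; sym; trans; cong; cong₂; subst)
  open import Relation.Nullary using (¬_; yes; no)

  open ≤-Reasoning

  combine : ∀ {A B} x y → A ≤ B → x + B ≡ y + A → x ≤ y
  combine {A} {B} x y A≤B eq = +-cancelʳ-≤ A x y (≤-trans (+-monoʳ-≤ x A≤B) (≤-reflexive eq))

  ∧⁺ : ∀ {a b} → T a → T b → T (a ∧ b)
  ∧⁺ {true} {true} _ _ = tt

  ∧ˡ : ∀ {a b} → T (a ∧ b) → T a
  ∧ˡ {true} {true} _ = tt

  ∧ʳ : ∀ {a b} → T (a ∧ b) → T b
  ∧ʳ {true} {true} _ = tt

  ∨ˡ : ∀ {a b} → T a → T (a ∨ b)
  ∨ˡ {true} _ = tt

  ∨ʳ : ∀ {a b} → T b → T (a ∨ b)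
  ∨ʳ {true}  {true} _ = tt
  ∨ʳ {false} {true} _ = tt

  ∨⁻ : ∀ {a b} → T (a ∨ b) → T a ⊎ T b
  ∨⁻ {true}  t = inj₁ t
  ∨⁻ {false} t = inj₂ t

  not⁺ : ∀ {a} → ¬ T a → T (not a)
  not⁺ {true}  f = f tt
  not⁺ {false} f = tt

  not⁻ : ∀ {a} → T (not a) → ¬ T a
  not⁻ {false} t ()

  T⊎ : ∀ b → T b ⊎ ¬ T b
  T⊎ true  = inj₁ tt
  T⊎ false = inj₂ λ ()

  when-mono : ∀ {a b x} → (T a → T b) → when a x ≤ when b x
  when-mono {false}         imp = z≤n
  when-mono {true}  {true}  imp = ≤-refl
  when-mono {true}  {false} imp = ⊥-elim (imp tt)

  when-true : ∀ {b} x → T b → when b x ≡ x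
  when-true {true} x _ = refl

  when-false : ∀ {b} x → ¬ T b → when b x ≡ 0
  when-false {true}  x f = ⊥-elim (f tt)
  when-false {false} x f = refl

  when-≤ : ∀ b x → when b x ≤ x
  when-≤ true  x = ≤-refl
  when-≤ false x = z≤n

  ∑-cong : ∀ {k} {f g : Fin k → ℕ} → (∀ i → f i ≡ g i) → ∑ f ≡ ∑ g
  ∑-cong {zero}  eq = refl
  ∑-cong {suc k} eq = cong₂ _+_ (eq zero) (∑-cong (eq ∘ suc))

  ∑-mono : ∀ {k} {f g : Fin k → ℕ} → (∀ i → f i ≤ g i) → ∑ f ≤ ∑ g
  ∑-mono {zero}  le = z≤n
  ∑-mono {suc k} le = +-mono-≤ (le zero) (∑-mono (le ∘ suc))

  ∑-+ : ∀ {k} (f g : Fin k → ℕ) → ∑ (λ i → f i + g i) ≡ ∑ f + ∑ g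
  ∑-+ {zero}  f g = refl
  ∑-+ {suc k} f g = trans (cong (f zero + g zero +_) (∑-+ (f ∘ suc) (g ∘ suc))) (shuffle (f zero) (g zero) _ _)
    where
    shuffle : ∀ a b c d → (a + b) + (c + d) ≡ (a + c) + (b + d)
    shuffle = solve-∀

  ∑-* : ∀ {k} c (f : Fin k → ℕ) → ∑ (λ i → c * f i) ≡ c * ∑ f
  ∑-* {zero}  c f = sym (*-zeroʳ c)
  ∑-* {suc k} c f = trans (cong (c * f zero +_) (∑-* c (f ∘ suc))) (sym (*-distribˡ-+ c (f zero) _))

  ∑-zero : ∀ {k} → ∑ {k} (λ _ → 0) ≡ 0
  ∑-zero {zero}  = refl
  ∑-zero {suc k} = ∑-zero {k}

  ∑-const : ∀ k c → ∑ {k} (λ _ → c) ≡ k * c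
  ∑-const zero    c = refl
  ∑-const (suc k) c = cong (c +_) (∑-const k c)

  ∑-swap : ∀ {k l} (f : Fin k → Fin l → ℕ) → ∑ (λ i → ∑ (f i)) ≡ ∑ (λ j → ∑ (λ i → f i j))
  ∑-swap {zero}  {l} f = sym (∑-zero {l})
  ∑-swap {suc k} f = trans (cong (∑ (f zero) +_) (∑-swap (f ∘ suc))) (sym (∑-+ (f zero) _))

  ∑-≥ : ∀ {k} (f : Fin k → ℕ) i → f i ≤ ∑ f
  ∑-≥ f zero    = m≤m+n (f zero) _
  ∑-≥ f (suc i) = ≤-trans (∑-≥ (f ∘ suc) i) (m≤n+m _ (f zero))

  ∑-unique : ∀ {k} (t : Fin k → Bool) y → (∀ i j → T (t i) → T (t j) → i ≡ j) → ∑ (λ i → when (t i) y) ≤ y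
  ∑-unique {zero}  t y uniq = z≤n
  ∑-unique {suc k} t y uniq with t zero in eq
  ... | false = ∑-unique (t ∘ suc) y (λ i j ti tj → suc-inj (uniq (suc i) (suc j) ti tj))
    where
    suc-inj : ∀ {i j : Fin k} → Fin.suc i ≡ suc j → i ≡ j
    suc-inj refl = refl
  ... | true = ≤-reflexive (trans (cong (y +_) (trans (∑-cong none) (∑-zero {k}))) (+-identityʳ y))
    where
    none : ∀ i → when (t (suc i)) y ≡ 0
    none i with t (suc i) in eq′
    ... | false = refl
    ... | true with () ← uniq zero (suc i) (subst T (sym eq) tt) (subst T (sym eq′) tt)

  point⇒≡ : ∀ {k} {i j : Fin k} → T (point i j) → i ≡ j
  point⇒≡ {i = i} {j} t with i ≟ j
  ... | yes eq = eq

  point-refl : ∀ {k} (i : Fin k) → T (point i i)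
  point-refl i with i ≟ i
  ... | yes _ = tt
  ... | no ne = ne refl

  ∑-point : ∀ {k} (f : Fin k → ℕ) i → ∑ (λ j → when (point i j) (f j)) ≡ f i
  ∑-point f i = ≤-antisym
    (≤-trans (∑-mono at) (∑-unique (point i) (f i) (λ j l pj pl → trans (sym (point⇒≡ {i = i} pj)) (point⇒≡ {i = i} pl))))
    (≤-trans (≤-reflexive (sym (when-true (f i) (point-refl i)))) (∑-≥ _ i))
    where
    at : ∀ j → when (point i j) (f j) ≤ when (point i j) (f i)
    at j with i ≟ j
    ... | yes refl = ≤-refl
    ... | no _ = z≤n

  anyF⁺ : ∀ {k} (f : Fin k → Bool) i → T (f i) → T (anyF f)
  anyF⁺ f zero    t = ∨ˡ t
  anyF⁺ f (suc i) t = ∨ʳ {f zero} (anyF⁺ (f ∘ suc) i t)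

  anyF⁻ : ∀ {k} (f : Fin k → Bool) → T (anyF f) → ∃[ i ] T (f i)
  anyF⁻ {suc k} f t with ∨⁻ {f zero} t
  ... | inj₁ t₀ = zero , t₀
  ... | inj₂ t₁ = let i , ti = anyF⁻ (f ∘ suc) t₁ in suc i , ti

  Mask : ℕ → Set
  Mask k = Fin k → Bool

  infix 4 _⊆_
  infixr 6 _∪_
  infixr 7 _∩_

  _⊆_ : ∀ {k} → Mask k → Mask k → Set
  C ⊆ D = ∀ i → T (C i) → T (D i)

  _∪_ _∩_ : ∀ {k} → Mask k → Mask k → Mask k
  (C ∪ D) i = C i ∨ D i
  (C ∩ D) i = C i ∧ D i

  ∪-lub : ∀ {k} {C D E : Mask k} → C ⊆ E → D ⊆ E → C ∪ D ⊆ E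
  ∪-lub {C = C} c d i t with ∨⁻ {C i} t
  ... | inj₁ l = c i l
  ... | inj₂ r = d i r

  ⊆-∪ˡ : ∀ {k} (C D : Mask k) → C ⊆ C ∪ D
  ⊆-∪ˡ C D i t = ∨ˡ t

  ⊆-∪ʳ : ∀ {k} (C D : Mask k) → D ⊆ C ∪ D
  ⊆-∪ʳ C D i t = ∨ʳ {C i} t

  ⊆-trans : ∀ {k} {C D E : Mask k} → C ⊆ D → D ⊆ E → C ⊆ E
  ⊆-trans cd de i t = de i (cd i t)

  weigh : ∀ {k} → (Fin k → ℕ) → Mask k → ℕ
  weigh w C = ∑ (λ i → when (C i) (w i))

  weigh-mono : ∀ {k} (w : Fin k → ℕ) {C D : Mask k} → C ⊆ D → weigh w C ≤ weigh w D
  weigh-mono w {C} {D} sub = ∑-mono (λ i → when-mono {C i} {D i} (sub i))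

  weigh-≤ : ∀ {k} (w : Fin k → ℕ) (C : Mask k) → weigh w C ≤ ∑ w
  weigh-≤ w C = ∑-mono (λ i → when-≤ (C i) (w i))

  weigh-point : ∀ {k} (w : Fin k → ℕ) i → weigh w (point i) ≡ w i
  weigh-point = ∑-point

  weigh-∪ : ∀ {k} (w : Fin k → ℕ) (C D : Mask k) → weigh w (C ∪ D) ≤ weigh w C + weigh w D
  weigh-∪ w C D = ≤-trans (∑-mono (λ i → at (C i) (D i) (w i))) (≤-reflexive (∑-+ (λ i → when (C i) (w i)) (λ i → when (D i) (w i))))
    where
    at : ∀ c d x → when (c ∨ d) x ≤ when c x + when d x
    at true  d x = m≤m+n x _
    at false d x = ≤-refl

  weigh-∪-disjoint : ∀ {k} (w : Fin k → ℕ) (C D : Mask k) → (∀ i → T (C i) → ¬ T (D i)) →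
                     weigh w (C ∪ D) ≡ weigh w C + weigh w D
  weigh-∪-disjoint w C D disj = trans (∑-cong (λ i → at (C i) (D i) (w i) (disj i))) (∑-+ (λ i → when (C i) (w i)) (λ i → when (D i) (w i)))
    where
    at : ∀ c d x → (T c → ¬ T d) → when (c ∨ d) x ≡ when c x + when d x
    at true  true  x ne = ⊥-elim (ne tt tt)
    at true  false x ne = sym (+-identityʳ x)
    at false d     x ne = refl

  weigh-strict : ∀ {k} (w : Fin k → ℕ) {C D : Mask k} v → C ⊆ D → ¬ T (C v) → T (D v) → weigh w C + w v ≤ weigh w D
  weigh-strict w {C} {D} v sub ¬c d = begin
    weigh w C + w v                  ≡⟨ cong (weigh w C +_) (weigh-point w v) ⟨
    weigh w C + weigh w (point v)    ≡⟨ weigh-∪-disjoint w C (point v) (λ i ci pi → ¬c (subst (T ∘ C) (sym (point⇒≡ {i = v} pi)) ci)) ⟨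
    weigh w (C ∪ point v)            ≤⟨ weigh-mono w (∪-lub {C = C} {D = point v} sub (λ i pi → subst (T ∘ D) (point⇒≡ {i = v} pi) d)) ⟩
    weigh w D                        ∎

  count : ∀ {k} → Mask k → ℕ
  count = weigh (λ _ → 1)

  count-≤ : ∀ {k} (C : Mask k) → count C ≤ k
  count-≤ {k} C = ≤-trans (weigh-≤ (λ _ → 1) C) (≤-reflexive (trans (∑-const k 1) (*-identityʳ k)))

  weigh-disjoint : ∀ {k l} (w : Fin k → ℕ) (P : Mask k) (part : Fin l → Mask k) →
                   (∀ x i j → T (part i x) → T (part j x) → i ≡ j) → (∀ i → part i ⊆ P) →
                   ∑ (λ i → weigh w (part i)) ≤ weigh w P
  weigh-disjoint {l = l} w P part disj sub = begin
    ∑ (λ i → ∑ (λ x → when (part i x) (w x)))   ≡⟨ ∑-swap (λ i x → when (part i x) (w x)) ⟩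
    ∑ (λ x → ∑ (λ i → when (part i x) (w x)))   ≤⟨ ∑-mono at ⟩
    weigh w P                                   ∎
    where
    at : ∀ x → ∑ (λ i → when (part i x) (w x)) ≤ when (P x) (w x)
    at x with T⊎ (P x)
    ... | inj₁ px = ≤-trans (∑-unique (λ i → part i x) (w x) (disj x)) (≤-reflexive (sym (when-true (w x) px)))
    ... | inj₂ ¬px = ≤-trans (≤-reflexive (trans (∑-cong (λ i → when-false (w x) (λ t → ¬px (sub i x t)))) (∑-zero {l}))) z≤n

  module Coverage {k n} (S : Fin k → Fin n → Bool) (w : Fin n → ℕ) where

    cov : Mask k → Mask n
    cov C u = anyF (λ i → C i ∧ S i u)

    value : Mask k → ℕ
    value C = weigh w (cov C)

    cov⁺ : ∀ {C : Mask k} i {u} → T (C i) → T (S i u) → T (cov C u)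
    cov⁺ {C} i {u} c s = anyF⁺ (λ i → C i ∧ S i u) i (∧⁺ c s)

    cov⁻ : ∀ {C : Mask k} {u} → T (cov C u) → ∃[ i ] T (C i) × T (S i u)
    cov⁻ {C} {u} t = let i , ci = anyF⁻ (λ i → C i ∧ S i u) t in i , ∧ˡ ci , ∧ʳ {C i} ci

    cov-mono : ∀ {C D : Mask k} → C ⊆ D → cov C ⊆ cov D
    cov-mono {C} {D} sub u t = let i , c , s = cov⁻ {C} t in cov⁺ {D} i (sub i c) s

    cov-∪ : ∀ (C D : Mask k) u → cov (C ∪ D) u ≡ cov C u ∨ cov D u
    cov-∪ C D u = T-ext forward backward
      where
      forward : T (cov (C ∪ D) u) → T (cov C u ∨ cov D u)
      forward t with cov⁻ {C ∪ D} t
      ... | i , cd , s with ∨⁻ {C i} cd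
      ... | inj₁ c = ∨ˡ (cov⁺ {C} i c s)
      ... | inj₂ d = ∨ʳ {cov C u} (cov⁺ {D} i d s)
      backward : T (cov C u ∨ cov D u) → T (cov (C ∪ D) u)
      backward t with ∨⁻ {cov C u} t
      ... | inj₁ c = cov-mono {C} {C ∪ D} (⊆-∪ˡ C D) u c
      ... | inj₂ d = cov-mono {D} {C ∪ D} (⊆-∪ʳ C D) u d

    value-mono : ∀ {C D : Mask k} → C ⊆ D → value C ≤ value D
    value-mono {C} {D} sub = weigh-mono w (cov-mono {C} {D} sub)

    value-submodular : ∀ (C D P : Mask k) → C ⊆ D → value (D ∪ P) + value C ≤ value (C ∪ P) + value D
    value-submodular C D P sub = begin
      value (D ∪ P) + value C                                  ≡⟨ ∑-+ _ (λ u → when (cov C u) (w u)) ⟨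
      ∑ (λ u → when (cov (D ∪ P) u) (w u) + when (cov C u) (w u)) ≤⟨ ∑-mono at ⟩
      ∑ (λ u → when (cov (C ∪ P) u) (w u) + when (cov D u) (w u)) ≡⟨ ∑-+ _ (λ u → when (cov D u) (w u)) ⟩
      value (C ∪ P) + value D                                  ∎
      where
      bool : ∀ c d p x → (T c → T d) → when (d ∨ p) x + when c x ≤ when (c ∨ p) x + when d x
      bool true  true  p x imp = ≤-refl
      bool true  false p x imp = ⊥-elim (imp tt)
      bool false false p x imp = ≤-refl
      bool false true true  x imp = +-monoʳ-≤ x z≤n
      bool false true false x imp = ≤-reflexive (+-comm x 0)
      at : ∀ u → when (cov (D ∪ P) u) (w u) + when (cov C u) (w u) ≤ when (cov (C ∪ P) u) (w u) + when (cov D u) (w u)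
      at u rewrite cov-∪ D P u | cov-∪ C P u = bool (cov C u) (cov D u) (cov P u) (w u) (cov-mono {C} {D} sub u)

module Digraphs where

  open Families using (∑; when; anyF; point)
  open Masks
  open import Data.Bool using (Bool; false; T; _∧_; not)
  open import Data.Empty using (⊥; ⊥-elim)
  open import Data.Fin using (Fin; zero; suc; toℕ)
  open import Data.Fin.Properties using (pigeonhole)
  import Data.Fin as Fin
  open import Data.Nat using (ℕ; zero; suc; _+_; _*_; _^_; _≤_; _<_; z≤n; s≤s; s≤s⁻¹)
  open import Data.Nat.Binary using (ℕᵇ; zero; 2[1+_]; 1+[2_]; fromℕ) renaming (size to lengthᵇ; toℕ to toNat)
  open import Data.Nat.Binary.Properties using (toℕ-fromℕ)
  open import Data.Nat.Properties
  open import Data.Nat.Tactic.RingSolver using (solve-∀)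
  open import Data.Product using (_×_; _,_; ∃-syntax; proj₂)
  open import Data.Sum using (_⊎_; inj₁; inj₂)
  open import Function using (_∘_)
  open import Relation.Binary.Construct.Closure.Transitive using (TransClosure; [_]; _∷_)
  open import Relation.Binary.PropositionalEquality using (_≡_; refl; sym; trans; cong; cong₂; subst; subst₂)
  open import Relation.Nullary using (¬_; yes; no)

  open ≤-Reasoning

  bits : ℕ → ℕ
  bits a = lengthᵇ (fromℕ a)

  length-lower : ∀ x → 2 ^ lengthᵇ x ≤ suc (toNat x)
  length-lower zero     = ≤-refl
  length-lower 2[1+ x ] = ≤-trans (*-monoʳ-≤ 2 (length-lower x)) (n≤1+n _)
  length-lower 1+[2 x ] = ≤-trans (*-monoʳ-≤ 2 (length-lower x)) (≤-reflexive (*-suc 2 (toNat x)))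

  length-upper : ∀ x → suc (suc (toNat x)) ≤ 2 ^ suc (lengthᵇ x)
  length-upper zero     = ≤-refl
  length-upper 2[1+ x ] = ≤-trans (≤-reflexive (sh (toNat x))) (*-monoʳ-≤ 2 (length-upper x))
    where
    sh : ∀ a → suc (suc (2 * suc a)) ≡ 2 * suc (suc a)
    sh = solve-∀
  length-upper 1+[2 x ] = ≤-trans (n≤1+n _) (≤-trans (≤-reflexive (sh (toNat x))) (*-monoʳ-≤ 2 (length-upper x)))
    where
    sh : ∀ a → suc (suc (suc (suc (2 * a)))) ≡ 2 * suc (suc a)
    sh = solve-∀

  bits-lower : ∀ a → 2 ^ bits a ≤ suc a
  bits-lower a = ≤-trans (length-lower (fromℕ a)) (≤-reflexive (cong suc (toℕ-fromℕ a)))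

  bits-upper : ∀ a → suc (suc a) ≤ 2 ^ suc (bits a)
  bits-upper a = ≤-trans (≤-reflexive (cong (2 +_) (sym (toℕ-fromℕ a)))) (length-upper (fromℕ a))

  2^-cancel : ∀ a b → 2 ^ a < 2 ^ suc b → a ≤ b
  2^-cancel a b lt with a ≤? b
  ... | yes le = le
  ... | no ¬le = ⊥-elim (<⇒≱ lt (^-monoʳ-≤ 2 (≰⇒> ¬le)))

  bits-mono : ∀ {a b} → a ≤ b → bits a ≤ bits b
  bits-mono {a} {b} a≤b = 2^-cancel (bits a) (bits b)
    (≤-trans (s≤s (≤-trans (bits-lower a) (s≤s a≤b))) (bits-upper b))

  bits-≥1 : ∀ {a} → 1 ≤ a → 1 ≤ bits a
  bits-≥1 {a} a≥1 = bits-mono a≥1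

  -- A node with two children of its own length class would be too large.
  bits-split : ∀ {a b c} → suc (a + b) ≤ c → bits a ≡ bits c → bits b ≡ bits c → ⊥
  bits-split {a} {b} {c} le eqa eqb = <⇒≱ (bits-upper c) (begin
    2 ^ suc (bits c)               ≡⟨ cong (2 ^ bits c +_) (+-identityʳ _) ⟩
    2 ^ bits c + 2 ^ bits c        ≡⟨ cong₂ (λ x y → 2 ^ x + 2 ^ y) eqa eqb ⟨
    2 ^ bits a + 2 ^ bits b        ≤⟨ +-mono-≤ (bits-lower a) (bits-lower b) ⟩
    suc a + suc b                  ≡⟨ cong suc (+-suc a b) ⟩
    suc (suc (a + b))              ≤⟨ s≤s le ⟩
    suc c                          ∎)

  module Graph {k} (edge : Fin k → Fin k → Bool) where

    Edge : Fin k → Fin k → Set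
    Edge i j = T (edge i j)

    reach : ℕ → Fin k → Mask k
    reach zero    u = point u
    reach (suc t) u = point u ∪ (λ v → anyF (λ x → edge u x ∧ reach t x v))

    desc : Fin k → Mask k
    desc = reach k

    rank width : Fin k → ℕ
    rank v = count (λ x → desc x v)
    width v = count (desc v)

    data Path : ℕ → Fin k → Fin k → Set where
      []  : ∀ {v} → Path 0 v v
      _∷_ : ∀ {t u x v} → Edge u x → Path t x v → Path (suc t) u v

    snoc : ∀ {t u x v} → Path t u x → Edge x v → Path (suc t) u v
    snoc []       e = e ∷ []
    snoc (d ∷ p)  e = d ∷ snoc p e

    reach-sound : ∀ t u v → T (reach t u v) → ∃[ s ] Path s u v
    reach-sound zero u v r with refl ← point⇒≡ {i = u} {v} r = 0 , []
    reach-sound (suc t) u v r with ∨⁻ {point u v} r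
    ... | inj₁ p with refl ← point⇒≡ {i = u} {v} p = 0 , []
    ... | inj₂ q = let x , ex = anyF⁻ (λ x → edge u x ∧ reach t x v) q
                       s , p = reach-sound t x v (∧ʳ {edge u x} ex)
                   in suc s , ∧ˡ ex ∷ p

    reach-complete : ∀ {s t u v} → Path s u v → s ≤ t → T (reach t u v)
    reach-complete {t = zero}  {u} [] le = point-refl u
    reach-complete {t = suc t} {u} [] le = ∨ˡ (point-refl u)
    reach-complete {t = suc t} {u} {v} (_∷_ {x = x} e p) (s≤s le) =
      ∨ʳ {point u v} (anyF⁺ (λ x → edge u x ∧ reach t x v) x (∧⁺ e (reach-complete p le)))

    closure : ∀ {t u v} → Path (suc t) u v → TransClosure Edge u v
    closure (e ∷ [])      = [ e ]
    closure (e ∷ (d ∷ p)) = e ∷ closure (d ∷ p)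

    vertex : ∀ {t u v} → Path t u v → Fin (suc t) → Fin k
    vertex {u = u} p       zero    = u
    vertex         (e ∷ p) (suc i) = vertex p i

    segment : ∀ {t u v} (p : Path t u v) {i j} → i Fin.< j → ∃[ s ] Path (suc s) (vertex p i) (vertex p j)
    segment (e ∷ p) {zero}  {suc zero}    lt       = 0 , e ∷ []
    segment (e ∷ p) {zero}  {suc (suc j)} lt       = let s , q = segment p {zero} {suc j} (s≤s z≤n) in suc s , e ∷ q
    segment (e ∷ p) {suc i} {suc j}       (s≤s lt) = segment p lt

    module Acyclic (acyclic : ∀ i → ¬ TransClosure Edge i i) where

      short : ∀ {t u v} → Path t u v → t < k
      short {t} p with suc t ≤? k
      ... | yes le = le
      ... | no ¬le =
        let i , j , i<j , eq = pigeonhole (≰⇒> ¬le) (vertex p)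
            s , q = segment p i<j
        in ⊥-elim (acyclic (vertex p i) (subst (TransClosure Edge (vertex p i)) (sym eq) (closure q)))

      path⇒desc : ∀ {t u v} → Path t u v → T (desc u v)
      path⇒desc p = reach-complete p (<⇒≤ (short p))

      desc⇒path : ∀ {u v} → T (desc u v) → ∃[ t ] Path t u v
      desc⇒path {u} {v} = reach-sound k u v

      desc-refl : ∀ v → T (desc v v)
      desc-refl v = path⇒desc []

      desc-∷ : ∀ {u x v} → Edge u x → T (desc x v) → T (desc u v)
      desc-∷ {u} {x} e d = let _ , p = desc⇒path d in path⇒desc {u = u} (_∷_ {x = x} e p)

      desc-∷ʳ : ∀ {u x v} → T (desc u x) → Edge x v → T (desc u v)
      desc-∷ʳ d e = let _ , p = desc⇒path d in path⇒desc (snoc p e)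

      desc-trans : ∀ {u x v} → T (desc u x) → T (desc x v) → T (desc u v)
      desc-trans {u} {x} {v} d d′ = let _ , p = desc⇒path d in go p
        where
        go : ∀ {t u} → Path t u x → T (desc u v)
        go []      = d′
        go (e ∷ p) = desc-∷ e (go p)

      first-step : ∀ {u v} → T (desc u v) → u ≡ v ⊎ ∃[ x ] Edge u x × T (desc x v)
      first-step d with desc⇒path d
      ... | _ , []    = inj₁ refl
      ... | _ , e ∷ p = inj₂ (_ , e , path⇒desc p)

      last-step : ∀ {u v} → T (desc u v) → u ≡ v ⊎ ∃[ x ] T (desc u x) × Edge x v
      last-step d = go (proj₂ (desc⇒path d))
        where
        go : ∀ {t u v} → Path t u v → u ≡ v ⊎ ∃[ x ] T (desc u x) × Edge x v
        go [] = inj₁ refl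
        go (e ∷ p) with go p
        ... | inj₁ refl = inj₂ (_ , desc-refl _ , e)
        ... | inj₂ (x , d , e′) = inj₂ (x , desc-∷ e d , e′)

      no-cycle : ∀ {u x} → Edge u x → T (desc x u) → ⊥
      no-cycle {u} e d = acyclic u (closure (e ∷ proj₂ (desc⇒path d)))

      rank-≥1 : ∀ v → 1 ≤ rank v
      rank-≥1 v = ≤-trans (≤-reflexive (sym (when-true 1 (desc-refl v)))) (∑-≥ (λ x → when (desc x v) 1) v)

      width-≥1 : ∀ v → 1 ≤ width v
      width-≥1 v = ≤-trans (≤-reflexive (sym (when-true 1 (desc-refl v)))) (∑-≥ (λ x → when (desc v x) 1) v)

      rank-≤ : ∀ v → rank v ≤ k
      rank-≤ v = count-≤ (λ x → desc x v)

      width-≤ : ∀ v → width v ≤ k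
      width-≤ v = count-≤ (desc v)

      rank-edge : ∀ {u v} → Edge u v → rank u < rank v
      rank-edge {u} {v} e = ≤-trans (≤-reflexive (+-comm 1 (rank u)))
        (weigh-strict (λ _ → 1) {λ x → desc x u} {λ x → desc x v} v (λ x d → desc-∷ʳ d e) (no-cycle e) (desc-refl v))

      rank-desc : ∀ {u v} → T (desc u v) → u ≡ v ⊎ rank u < rank v
      rank-desc {u} {v} d with last-step d
      ... | inj₁ eq = inj₁ eq
      ... | inj₂ (x , d′ , e) = inj₂ (≤-trans (s≤s (weigh-mono (λ _ → 1) {λ y → desc y u} {λ y → desc y x} (λ y dy → desc-trans dy d′))) (rank-edge e))

      width-edge : ∀ {u v} → Edge u v → width v < width u
      width-edge {u} {v} e = ≤-trans (≤-reflexive (+-comm 1 (width v)))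
        (weigh-strict (λ _ → 1) {desc v} {desc u} u (λ x d → desc-∷ e d) (no-cycle e) (desc-refl u))

      -- Layers: the nodes all of whose chains of predecessors are short

      layer : ℕ → Mask k
      layer zero    v = false
      layer (suc t) v = not (anyF (λ u → edge u v ∧ not (layer t u)))

      layer⁻ : ∀ {t u v} → T (layer (suc t) v) → Edge u v → T (layer t u)
      layer⁻ {t} {u} {v} l e with T⊎ (layer t u)
      ... | inj₁ lu = lu
      ... | inj₂ ¬lu = ⊥-elim (not⁻ l (anyF⁺ (λ u → edge u v ∧ not (layer t u)) u (∧⁺ e (not⁺ ¬lu))))

      layer⁺ : ∀ {t v} → (∀ u → Edge u v → T (layer t u)) → T (layer (suc t) v)
      layer⁺ {t} {v} all = not⁺ λ t′ → let u , eu = anyF⁻ (λ u → edge u v ∧ not (layer t u)) t′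
                                       in not⁻ (∧ʳ {edge u v} eu) (all u (∧ˡ eu))

      layer-mono : ∀ t → layer t ⊆ layer (suc t)
      layer-mono (suc t) v l = layer⁺ {suc t} λ u e → layer-mono t u (layer⁻ {t} l e)

      layer-≤ : ∀ {s t} → s ≤ t → layer s ⊆ layer t
      layer-≤ {s} {t} le v l with m≤n⇒m<n∨m≡n le
      ... | inj₂ refl = l
      ... | inj₁ (s≤s {n = t′} le′) = layer-mono t′ v (layer-≤ {s} {t′} le′ v l)

      layer-rank : ∀ t v → rank v ≤ t → T (layer t v)
      layer-rank zero    v le = ⊥-elim (<⇒≱ (rank-≥1 v) le)
      layer-rank (suc t) v le = layer⁺ {t} λ u e → layer-rank t u (s≤s⁻¹ (≤-trans (rank-edge e) le))

      depth : Fin k → ℕ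
      depth v = ∑ {k} (λ t → when (not (layer (toℕ t) v)) 1)

      below : (ℕ → Bool) → ℕ → ℕ
      below f zero    = 0
      below f (suc n) = when (f 0) 1 + below (f ∘ suc) n

      below-∑ : ∀ f n → ∑ {n} (λ t → when (f (toℕ t)) 1) ≡ below f n
      below-∑ f zero    = refl
      below-∑ f (suc n) = cong (when (f 0) 1 +_) (below-∑ (f ∘ suc) n)

      below-mono : ∀ {f g} n → (∀ t → T (f t) → T (g t)) → below f n ≤ below g n
      below-mono zero    imp = z≤n
      below-mono {f} {g} (suc n) imp = +-mono-≤ (when-mono {f 0} {g 0} (imp 0)) (below-mono n (imp ∘ suc))

      below-last : ∀ f n → ¬ T (f n) → below f (suc n) ≡ below f n
      below-last f zero    ¬t = cong (_+ 0) (when-false 1 ¬t)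
      below-last f (suc n) ¬t = cong (when (f 0) 1 +_) (below-last (f ∘ suc) n ¬t)

      below-bound : ∀ f n b → (∀ t → T (f t) → t < b) → below f n ≤ b
      below-bound f zero    b       imp = z≤n
      below-bound f (suc n) zero    imp = ≤-trans (+-mono-≤ (≤-reflexive (when-false 1 (λ t → n≮0 (imp 0 t))))
                                            (below-bound (f ∘ suc) n zero λ t ft → ⊥-elim (n≮0 (imp (suc t) ft)))) z≤n
      below-bound f (suc n) (suc b) imp = +-mono-≤ (when-≤ (f 0) 1) (below-bound (f ∘ suc) n b λ t ft → s≤s⁻¹ (imp (suc t) ft))

      depth-layer : ∀ {t v} → T (layer t v) → depth v ≤ t
      depth-layer {t} {v} l = ≤-trans (≤-reflexive (below-∑ (λ s → not (layer s v)) k))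
        (below-bound (λ s → not (layer s v)) k t λ s ¬l → ≰⇒> λ t≤s → not⁻ ¬l (layer-≤ t≤s v l))

      depth-edge : ∀ {u v} → Edge u v → depth u < depth v
      depth-edge {u} {v} e = subst₂ _<_ (sym (below-∑ nu k)) (sym (below-∑ nv k)) (go k refl)
        where
        nu nv : ℕ → Bool
        nu t = not (layer t u)
        nv t = not (layer t v)
        go : ∀ k′ → k′ ≡ k → below nu k′ < below nv k′
        go zero eq = ⊥-elim (n≮0 (≤-trans (rank-≥1 u) (≤-trans (rank-≤ u) (≤-reflexive (sym eq)))))
        go (suc n) eq = begin-strict
          below nu (suc n)      ≡⟨ below-last nu n (λ ¬l → not⁻ ¬l (layer-rank n u rank≤)) ⟩
          below nu n            ≤⟨ below-mono n (λ t ¬l → not⁺ λ l → not⁻ ¬l (layer⁻ {t} l e)) ⟩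
          below (nv ∘ suc) n    <⟨ ≤-refl ⟩
          below nv (suc n)      ∎
          where
          rank≤ : rank u ≤ n
          rank≤ = s≤s⁻¹ (≤-trans (rank-edge e) (≤-trans (rank-≤ v) (≤-reflexive (sym eq))))

      depth-≥1 : ∀ v → 1 ≤ depth v
      depth-≥1 v = ≤-trans (go k (≤-trans (rank-≥1 v) (rank-≤ v))) (≤-reflexive (sym (below-∑ (λ t → not (layer t v)) k)))
        where
        go : ∀ n → 1 ≤ n → 1 ≤ below (λ t → not (layer t v)) n
        go (suc n) _ = s≤s z≤n

      depth-≤ : ∀ v → depth v ≤ k
      depth-≤ v = depth-layer (layer-rank k v (rank-≤ v))

      module Forest (out : ∀ {i i′ j} → Edge i j → Edge i′ j → i ≡ i′) where

        comparable : ∀ {a b x} → T (desc a x) → T (desc b x) → T (desc a b) ⊎ T (desc b a)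
        comparable {a} {b} {x} da db = go k (rank-≤ x) da db
          where
          go : ∀ n {x} → rank x ≤ n → T (desc a x) → T (desc b x) → T (desc a b) ⊎ T (desc b a)
          go zero {x} le _ _ = ⊥-elim (<⇒≱ (rank-≥1 x) le)
          go (suc n) le da db with last-step da | last-step db
          ... | inj₁ refl | _ = inj₂ db
          ... | inj₂ _ | inj₁ refl = inj₁ da
          ... | inj₂ (y , da′ , e) | inj₂ (z , db′ , e′) with refl ← out e e′ =
            go n (s≤s⁻¹ (≤-trans (rank-edge e) le)) da′ db′

        siblings-disjoint : ∀ {v c c′ x} → Edge v c → Edge v c′ → T (desc c x) → T (desc c′ x) → c ≡ c′
        siblings-disjoint e e′ d d′ with comparable d d′
        ... | inj₁ cc′ = below-sibling e e′ cc′
          where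
          below-sibling : ∀ {v c c′} → Edge v c → Edge v c′ → T (desc c c′) → c ≡ c′
          below-sibling e e′ d with last-step d
          ... | inj₁ eq = eq
          ... | inj₂ (y , dy , ey) with refl ← out ey e′ = ⊥-elim (no-cycle e dy)
        ... | inj₂ c′c with last-step c′c
        ... | inj₁ eq = sym eq
        ... | inj₂ (y , dy , ey) with refl ← out ey e = ⊥-elim (no-cycle e′ dy)

        root : Fin k → Bool
        root v = rank v Data.Nat.≤ᵇ 1

        root-no-edge : ∀ {u v} → T (root v) → ¬ Edge u v
        root-no-edge {u} {v} r e = <⇒≱ (≤-trans (s≤s (rank-≥1 u)) (rank-edge e)) (≤ᵇ⇒≤ (rank v) 1 r)

        roots-disjoint : ∀ {r s x} → T (root r) → T (root s) → T (desc r x) → T (desc s x) → r ≡ s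
        roots-disjoint tr ts dr ds with comparable dr ds
        ... | inj₁ d with last-step d
        ...   | inj₁ eq = eq
        ...   | inj₂ (_ , _ , e) = ⊥-elim (root-no-edge ts e)
        roots-disjoint tr ts dr ds | inj₂ d with last-step d
        ...   | inj₁ eq = sym eq
        ...   | inj₂ (_ , _ , e) = ⊥-elim (root-no-edge tr e)

        root-of : ∀ y → ∃[ r ] T (root r) × T (desc r y)
        root-of y = go k (rank-≤ y)
          where
          go : ∀ n {y} → rank y ≤ n → ∃[ r ] T (root r) × T (desc r y)
          go zero {y} le = ⊥-elim (<⇒≱ (rank-≥1 y) le)
          go (suc n) {y} le with T⊎ (anyF (λ u → edge u y))
          ... | inj₁ t = let u , e = anyF⁻ (λ u → edge u y) t
                             r , tr , d = go n (s≤s⁻¹ (≤-trans (rank-edge e) le))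
                         in r , tr , desc-∷ʳ d e
          ... | inj₂ none = y , ≤⇒≤ᵇ rank≤1 , desc-refl y
            where
            only : (λ x → desc x y) ⊆ point y
            only x d with last-step d
            ... | inj₁ refl = point-refl y
            ... | inj₂ (u , _ , e) = ⊥-elim (none (anyF⁺ (λ u → edge u y) u e))
            rank≤1 : rank y ≤ 1
            rank≤1 = ≤-trans (weigh-mono (λ _ → 1) only) (≤-reflexive (weigh-point (λ _ → 1) y))

        children-disjoint : ∀ (w : Fin k → ℕ) (P : Mask k) v → P ⊆ desc v → T (P v) →
                            w v + ∑ (λ c → when (edge v c) (weigh w (P ∩ desc c))) ≤ weigh w P
        children-disjoint w P v sub pv = begin
          w v + ∑ (λ c → when (edge v c) (weigh w (P ∩ desc c)))
            ≤⟨ +-mono-≤ (≤-reflexive (sym (weigh-point w v))) (∑-mono inside) ⟩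
          weigh w (point v) + ∑ (λ c → weigh w (part c))
            ≤⟨ +-monoʳ-≤ (weigh w (point v)) (weigh-disjoint w below-v part
                 (λ x i j ti tj → siblings-disjoint (∧ˡ ti) (∧ˡ tj) (∧ʳ {P x} (∧ʳ {edge v i} ti)) (∧ʳ {P x} (∧ʳ {edge v j} tj)))
                 (λ c x t → ∧⁺ (∧ˡ (∧ʳ {edge v c} t))
                   (not⁺ λ p → no-cycle (∧ˡ t) (subst (λ z → T (desc c z)) (sym (point⇒≡ {i = v} p)) (∧ʳ {P x} (∧ʳ {edge v c} t)))))) ⟩
          weigh w (point v) + weigh w below-v
            ≡⟨ weigh-∪-disjoint w (point v) below-v (λ x p t → not⁻ (∧ʳ {P x} t) p) ⟨
          weigh w (point v ∪ below-v)
            ≤⟨ weigh-mono w (∪-lub {C = point v} {D = below-v} (λ x p → subst (T ∘ P) (point⇒≡ {i = v} p) pv) (λ x t → ∧ˡ t)) ⟩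
          weigh w P ∎
          where
          part : Fin k → Mask k
          part c x = edge v c ∧ (P x ∧ desc c x)
          below-v : Mask k
          below-v x = P x ∧ not (point v x)
          inside : ∀ c → when (edge v c) (weigh w (P ∩ desc c)) ≤ weigh w (part c)
          inside c with T⊎ (edge v c)
          ... | inj₁ e = ≤-trans (≤-reflexive (when-true _ e)) (weigh-mono w λ x t → ∧⁺ e t)
          ... | inj₂ ¬e = ≤-trans (≤-reflexive (when-false _ ¬e)) z≤n

        roots-disjoint-weigh : ∀ (w : Fin k → ℕ) (P : Mask k) →
                               ∑ (λ r → when (root r) (weigh w (P ∩ desc r))) ≤ weigh w P
        roots-disjoint-weigh w P = ≤-trans (∑-mono inside) (weigh-disjoint w P part
            (λ x i j ti tj → roots-disjoint (∧ˡ ti) (∧ˡ tj) (∧ʳ {P x} (∧ʳ {root i} ti)) (∧ʳ {P x} (∧ʳ {root j} tj)))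
            (λ r x t → ∧ˡ (∧ʳ {root r} t)))
          where
          part : Fin k → Mask k
          part r x = root r ∧ (P x ∧ desc r x)
          inside : ∀ r → when (root r) (weigh w (P ∩ desc r)) ≤ weigh w (part r)
          inside r with T⊎ (root r)
          ... | inj₁ e = ≤-trans (≤-reflexive (when-true _ e)) (weigh-mono w λ x t → ∧⁺ e t)
          ... | inj₂ ¬e = ≤-trans (≤-reflexive (when-false _ ¬e)) z≤n

        widths : ∀ v → 1 + ∑ (λ c → when (edge v c) (width c)) ≤ width v
        widths v = ≤-trans (+-monoʳ-≤ 1 (∑-mono at)) (children-disjoint (λ _ → 1) (desc v) v (λ _ d → d) (desc-refl v))
          where
          at : ∀ c → when (edge v c) (width c) ≤ when (edge v c) (weigh (λ _ → 1) (desc v ∩ desc c))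
          at c with T⊎ (edge v c)
          ... | inj₁ e = ≤-trans (when-≤ (edge v c) (width c))
            (≤-trans (weigh-mono (λ _ → 1) {desc c} {desc v ∩ desc c} λ x d → ∧⁺ (desc-∷ e d) d) (≤-reflexive (sym (when-true _ e))))
          ... | inj₂ ¬e = ≤-trans (≤-reflexive (when-false _ ¬e)) z≤n

        two-widths : ∀ {v c c′} → Edge v c → Edge v c′ → (c ≡ c′ → ⊥) → suc (width c + width c′) ≤ width v
        two-widths {v} {c} {c′} e e′ ne = ≤-trans (s≤s (begin
          width c + width c′
            ≡⟨ cong₂ _+_ (∑-point width c) (∑-point width c′) ⟨
          ∑ (λ i → when (point c i) (width i)) + ∑ (λ i → when (point c′ i) (width i))
            ≡⟨ ∑-+ (λ i → when (point c i) (width i)) (λ i → when (point c′ i) (width i)) ⟨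
          ∑ (λ i → when (point c i) (width i) + when (point c′ i) (width i))
            ≤⟨ ∑-mono at ⟩
          ∑ (λ i → when (edge v i) (width i)) ∎)) (widths v)
          where
          at : ∀ i → when (point c i) (width i) + when (point c′ i) (width i) ≤ when (edge v i) (width i)
          at i with T⊎ (point c i) | T⊎ (point c′ i)
          ... | inj₁ p | inj₁ p′ = ⊥-elim (ne (trans (point⇒≡ {i = c} p) (sym (point⇒≡ {i = c′} p′))))
          ... | inj₁ p | inj₂ ¬p′ = ≤-trans (≤-reflexive (trans (cong₂ _+_ (when-true _ p) (when-false _ ¬p′)) (+-identityʳ _)))
            (≤-reflexive (sym (when-true _ (subst (Edge v) (point⇒≡ {i = c} p) e))))
          ... | inj₂ ¬p | inj₁ p′ = ≤-trans (≤-reflexive (cong₂ _+_ (when-false _ ¬p) (when-true _ p′)))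
            (≤-reflexive (sym (when-true _ (subst (Edge v) (point⇒≡ {i = c′} p′) e′))))
          ... | inj₂ ¬p | inj₂ ¬p′ = ≤-trans (≤-reflexive (cong₂ _+_ (when-false _ ¬p) (when-false _ ¬p′))) z≤n

        -- The class of a node: nodes of one class form vertical paths

        class : Fin k → ℕ
        class v = bits (width v)

        class-edge : ∀ {u v} → Edge u v → class v ≤ class u
        class-edge e = bits-mono (<⇒≤ (width-edge e))

        class-desc : ∀ {u v} → T (desc u v) → class v ≤ class u
        class-desc {u} {v} d = bits-mono {width v} {width u} (weigh-mono (λ _ → 1) {desc v} {desc u} λ x dx → desc-trans d dx)

        class-≥1 : ∀ v → 1 ≤ class v
        class-≥1 v = bits-≥1 (width-≥1 v)

        class-≤ : ∀ v → class v ≤ bits k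
        class-≤ v = bits-mono (width-≤ v)

        heavy-unique : ∀ {v c c′} → Edge v c → Edge v c′ → class c ≡ class v → class c′ ≡ class v → c ≡ c′
        heavy-unique {v} {c} {c′} e e′ eq eq′ with T⊎ (point c c′)
        ... | inj₁ p = point⇒≡ {i = c} p
        ... | inj₂ ¬p = ⊥-elim (bits-split {width c} {width c′} (two-widths e e′ λ { refl → ¬p (point-refl c) }) eq eq′)

        path-comparable : ∀ {h v v′} → T (desc h v) → T (desc h v′) → class v ≡ class h → class v′ ≡ class h →
                          T (desc v v′) ⊎ T (desc v′ v)
        path-comparable {h} d d′ eq eq′ = go (proj₂ (desc⇒path d)) d′ eq eq′
          where
          go : ∀ {t h v v′} → Path t h v → T (desc h v′) → class v ≡ class h → class v′ ≡ class h →
               T (desc v v′) ⊎ T (desc v′ v)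
          go [] d′ _ _ = inj₁ d′
          go {h = h} {v} {v′} (_∷_ {x = c} e p) d′ eq eq′ with first-step d′
          ... | inj₁ refl = inj₂ (desc-∷ e (path⇒desc p))
          ... | inj₂ (c′ , e′ , dc′) with heavy-unique e e′ ceq ceq′
            where
            ceq : class c ≡ class h
            ceq = ≤-antisym (class-edge e) (≤-trans (≤-reflexive (sym eq)) (class-desc (path⇒desc p)))
            ceq′ : class c′ ≡ class h
            ceq′ = ≤-antisym (class-edge e′) (≤-trans (≤-reflexive (sym eq′)) (class-desc dc′))
          ... | refl = go p dc′ (trans eq (sym ceq)) (trans eq′ (sym ceq))
            where
            ceq : class c ≡ class h
            ceq = ≤-antisym (class-edge e) (≤-trans (≤-reflexive (sym eq)) (class-desc (path⇒desc p)))

module ForestPlanning where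

  open Families using (∑; when; point)
  open Masks
  open Digraphs
  open import Data.Bool using (Bool; true; false; T; _∧_; _∨_; not; if_then_else_)
  open import Data.Empty using (⊥-elim)
  open import Data.Fin using (Fin; zero; suc)
  open import Data.List using (List; []; _∷_; allFin; map)
  open import Data.List.Membership.Propositional using (_∈_)
  open import Data.List.Membership.Propositional.Properties using (∈-allFin)
  open import Data.List.Properties using (map-tabulate)
  open import Data.List.Relation.Unary.All using (All; []; _∷_)
  import Data.List.Relation.Unary.All as All
  open import Data.List.Relation.Unary.AllPairs using ([]; _∷_)
  open import Data.List.Relation.Unary.Any using (here; there)
  open import Data.List.Relation.Unary.Unique.Propositional using (Unique)
  open import Data.List.Relation.Unary.Unique.Propositional.Properties using (allFin⁺)
  open import Data.Nat using (ℕ; zero; suc; _+_; _*_; _≤_; _∸_; _≤ᵇ_; _≡ᵇ_; s≤s⁻¹)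
  open import Data.Nat.ListAction using (sum)
  open import Data.Nat.Properties
  open import Data.Nat.Tactic.RingSolver using (solve-∀)
  open import Data.Product using (_×_; _,_; proj₁; proj₂)
  open import Data.Sum using (_⊎_; inj₁; inj₂)
  open import Function using (_∘_; id)
  open import Relation.Binary.Construct.Closure.Transitive using (TransClosure)
  open import Relation.Binary.PropositionalEquality using (_≡_; refl; sym; trans; cong; cong₂; subst)
  open import Relation.Nullary using (¬_; yes; no)

  open ≤-Reasoning

  module ForestPlan {k n} (edge : Fin k → Fin k → Bool) (S : Fin k → Fin n → Bool) (w : Fin n → ℕ) (cost : Fin k → ℕ)
    (acyclic : ∀ i → ¬ TransClosure (Graph.Edge edge) i i)
    (out : ∀ {i i′ j} → Graph.Edge edge i j → Graph.Edge edge i′ j → i ≡ i′)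
    (a F T₀ : ℕ) where

    open Graph edge
    open Acyclic acyclic
    open Forest out
    open Coverage S w

    g h : Mask k → ℕ
    g C = a * value C
    h C = F * weigh cost C

    elig : Mask k
    elig v = weigh cost (λ x → desc x v) ≤ᵇ T₀

    accept : Fin k → Mask k → Mask k → Bool
    accept v C D = elig v ∧ not (class v * g D + h C ≤ᵇ class v * g C + h D)

    light heavy : Fin k → Fin k → Bool
    light v c = edge v c ∧ not (class c ≡ᵇ class v)
    heavy v c = edge v c ∧ (class c ≡ᵇ class v)

    settle : Fin k → Mask k → Mask k → Mask k
    settle v C D = if accept v C D then D else C

    walk : ℕ → Fin k → Mask k → Mask k
    sweep : ℕ → (Fin k → Bool) → List (Fin k) → Mask k → Mask k
    walk zero    v C = C
    walk (suc n) v C = settle v C (sweep n (heavy v) (allFin k) (sweep n (light v) (allFin k) (C ∪ point v)))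
    sweep n t []       C = C
    sweep n t (c ∷ cs) C = sweep n t cs (if t c then walk n c C else C)

    pass : Mask k → Mask k
    pass C = sweep k root (allFin k) C

    passes : ℕ → Mask k → Mask k
    passes zero    C = C
    passes (suc j) C = passes j (pass C)

    Closed : Mask k → Set
    Closed C = ∀ {x y} → Edge x y → T (C y) → T (C x)

    record Step (C D : Mask k) : Set where
      field
        grows    : C ⊆ D
        eligible : ∀ x → T (D x) → ¬ T (C x) → T (elig x)

    open Step

    step-refl : ∀ {C} → Step C C
    step-refl = record { grows = λ _ → id ; eligible = λ _ c ¬c → ⊥-elim (¬c c) }

    step-trans : ∀ {C D E} → Step C D → Step D E → Step C E
    step-trans {C} {D} s t = record
      { grows    = λ x c → grows t x (grows s x c)
      ; eligible = λ x e ¬c → eligible-late x e ¬c (T⊎ (D x))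
      }
      where
      eligible-late : ∀ x → _ → _ → T (D x) ⊎ ¬ T (D x) → T (elig x)
      eligible-late x e ¬c (inj₁ d) = eligible s x d ¬c
      eligible-late x e ¬c (inj₂ ¬d) = eligible t x e ¬d

    sweep-step : ∀ m t cs C → (∀ c C → Step C (walk m c C)) → Step C (sweep m t cs C)
    sweep-step m t []       C ws = step-refl
    sweep-step m t (c ∷ cs) C ws with t c
    ... | true  = step-trans (ws c C) (sweep-step m t cs (walk m c C) ws)
    ... | false = sweep-step m t cs C ws

    walk-step : ∀ m v C → Step C (walk m v C)
    walk-step zero    v C = step-refl
    walk-step (suc m) v C with T⊎ (accept v C D)
      where
      D₀ = sweep m (light v) (allFin k) (C ∪ point v)
      D = sweep m (heavy v) (allFin k) D₀
    ... | inj₂ ¬t = subst (Step C) (sym (if-false ¬t)) step-refl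
      where
      if-false : ∀ {b} {D : Mask k} → ¬ T b → (if b then D else C) ≡ C
      if-false {false} _ = refl
      if-false {true} ¬t = ⊥-elim (¬t _)
    ... | inj₁ t = subst (Step C) (sym (if-true t)) (step-trans first
          (step-trans (sweep-step m (light v) (allFin k) (C ∪ point v) (walk-step m)) (sweep-step m (heavy v) (allFin k) _ (walk-step m))))
      where
      if-true : ∀ {b} {D : Mask k} → T b → (if b then D else C) ≡ D
      if-true {true} _ = refl
      first : Step C (C ∪ point v)
      first = record
        { grows    = ⊆-∪ˡ C (point v)
        ; eligible = λ x t′ ¬c → new x (∨⁻ {C x} t′) ¬c
        }
        where
        new : ∀ x → T (C x) ⊎ T (point v x) → ¬ T (C x) → T (elig x)
        new x (inj₁ c) ¬c = ⊥-elim (¬c c)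
        new x (inj₂ p) ¬c = subst (T ∘ elig) (point⇒≡ {i = v} p) (∧ˡ t)

    sweep-closed : ∀ m t cs C → Closed C → (∀ c → T (t c) → ∀ u → Edge u c → T (C u)) →
                   (∀ c C → Closed C → (∀ u → Edge u c → T (C u)) → Closed (walk m c C)) → Closed (sweep m t cs C)
    sweep-closed m t []       C cl pre ws = cl
    sweep-closed m t (c ∷ cs) C cl pre ws with t c in eq
    ... | true  = sweep-closed m t cs (walk m c C) (ws c C cl (pre c (subst T (sym eq) _)))
                    (λ d td u e → grows (walk-step m c C) u (pre d td u e)) ws
    ... | false = sweep-closed m t cs C cl pre ws

    walk-closed : ∀ m v C → Closed C → (∀ u → Edge u v → T (C u)) → Closed (walk m v C)
    walk-closed zero    v C cl pre = cl
    walk-closed (suc m) v C cl pre = if-closed (accept v C D)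
      where
      D₀ = sweep m (light v) (allFin k) (C ∪ point v)
      D = sweep m (heavy v) (allFin k) D₀
      cl₀ : Closed (C ∪ point v)
      cl₀ {x} {y} e t with ∨⁻ {C y} t
      ... | inj₁ c = ∨ˡ (cl e c)
      ... | inj₂ p with refl ← point⇒≡ {i = v} {y} p = ∨ˡ (pre x e)
      v∈ : T ((C ∪ point v) v)
      v∈ = ∨ʳ {C v} (point-refl v)
      clD₀ : Closed D₀
      clD₀ = sweep-closed m (light v) (allFin k) (C ∪ point v) cl₀
        (λ c t u e → subst (T ∘ (C ∪ point v)) (out (∧ˡ t) e) v∈) (walk-closed m)
      clD : Closed D
      clD = sweep-closed m (heavy v) (allFin k) D₀ clD₀
        (λ c t u e → subst (T ∘ D₀) (out (∧ˡ t) e) (grows (sweep-step m (light v) (allFin k) (C ∪ point v) (walk-step m)) v v∈)) (walk-closed m)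
      if-closed : ∀ b → Closed (if b then D else C)
      if-closed true  = clD
      if-closed false = cl

    g-mono : ∀ {C D} → C ⊆ D → g C ≤ g D
    g-mono {C} {D} sub = *-monoʳ-≤ a (value-mono {C} {D} sub)

    g-submodular : ∀ C D P → C ⊆ D → g (D ∪ P) + g C ≤ g (C ∪ P) + g D
    g-submodular C D P sub = begin
      a * value (D ∪ P) + a * value C   ≡⟨ *-distribˡ-+ a (value (D ∪ P)) (value C) ⟨
      a * (value (D ∪ P) + value C)     ≤⟨ *-monoʳ-≤ a (value-submodular C D P sub) ⟩
      a * (value (C ∪ P) + value D)     ≡⟨ *-distribˡ-+ a (value (C ∪ P)) (value D) ⟩
      a * value (C ∪ P) + a * value D   ∎

    ClosedBelow : Fin k → Mask k → Set
    ClosedBelow v P = ∀ {x y} → Edge x y → T (desc v x) → T (P y) → T (P x)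

    -- α(g′ − g) − (h′ − h) ≥ g(C ∪ P) − g − h(P), moved to avoid subtraction
    Claim : ℕ → Fin k → Set
    Claim m v = ∀ C P → P ⊆ desc v → ClosedBelow v P → P ⊆ elig → let C′ = walk m v C in
      g (C ∪ P) + (class v * g C + h C′) ≤ class v * g C′ + h C + (g C + h P)

    parts : (Fin k → Bool) → Mask k → List (Fin k) → Mask k
    parts t P []       x = false
    parts t P (c ∷ cs) x = (t c ∧ (P x ∧ desc c x)) ∨ parts t P cs x

    partCosts : (Fin k → Bool) → Mask k → List (Fin k) → ℕ
    partCosts t P []       = 0
    partCosts t P (c ∷ cs) = when (t c) (weigh cost (P ∩ desc c)) + partCosts t P cs

    partCosts-∑ : ∀ t P → partCosts t P (allFin k) ≡ ∑ (λ c → when (t c) (weigh cost (P ∩ desc c)))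
    partCosts-∑ t P = trans (go (allFin k)) (cong sum (map-tabulate id f))
      where
      f : Fin k → ℕ
      f c = when (t c) (weigh cost (P ∩ desc c))
      go : ∀ cs → partCosts t P cs ≡ sum (map f cs)
      go []       = refl
      go (c ∷ cs) = cong (f c +_) (go cs)

    parts⁺ : ∀ t P {c cs x} → c ∈ cs → T (t c) → T (P x) → T (desc c x) → T (parts t P cs x)
    parts⁺ t P (here refl) tc p d = ∨ˡ (∧⁺ tc (∧⁺ p d))
    parts⁺ t P {x = x} (there {x = c′} c∈) tc p d = ∨ʳ {t c′ ∧ (P x ∧ desc c′ x)} (parts⁺ t P c∈ tc p d)

    part-claim : ∀ m c → Claim m c → ∀ C P → ClosedBelow c P → P ⊆ elig → let C′ = walk m c C in
      g (C ∪ (P ∩ desc c)) + (class c * g C + h C′) ≤ class c * g C′ + h C + (g C + h (P ∩ desc c))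
    part-claim m c claim C P closed el = claim C (P ∩ desc c) (λ x t → ∧ʳ {P x} t)
      (λ e d t → ∧⁺ (closed e d (∧ˡ t)) d) (λ x t → el x (∧ˡ t))

    raise : ∀ {α β x y} → α ≤ β → x ≤ y → α * y + β * x ≤ β * y + α * x
    raise {α} {β} {x} {y} α≤β x≤y = begin
      α * y + β * x                  ≡⟨ cong (λ b → α * y + b * x) (m+[n∸m]≡n α≤β) ⟨
      α * y + (α + δ) * x            ≡⟨ sh₁ α δ x y ⟩
      α * y + α * x + δ * x          ≤⟨ +-monoʳ-≤ (α * y + α * x) (*-monoʳ-≤ δ x≤y) ⟩
      α * y + α * x + δ * y          ≡⟨ sh₂ α δ x y ⟩
      (α + δ) * y + α * x            ≡⟨ cong (λ b → b * y + α * x) (m+[n∸m]≡n α≤β) ⟩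
      β * y + α * x                  ∎
      where
      δ = β ∸ α
      sh₁ : ∀ α δ x y → α * y + (α + δ) * x ≡ α * y + α * x + δ * x
      sh₁ = solve-∀
      sh₂ : ∀ α δ x y → α * y + α * x + δ * y ≡ (α + δ) * y + α * x
      sh₂ = solve-∀

    sweep-claim : ∀ m β t cs P → (∀ c → T (t c) → class c ≤ β) → (∀ c → T (t c) → Claim m c) →
                  (∀ c → T (t c) → ClosedBelow c P) → P ⊆ elig →
                  ∀ C D → let C′ = sweep m t cs C in C′ ⊆ D →
                  g (D ∪ parts t P cs) + (β * g C + h C′) ≤ g D + F * partCosts t P cs + (β * g C′ + h C)
    sweep-claim m β t [] P cβ cl cb el C D sub = +-monoˡ-≤ (β * g C + h C)
      (≤-trans (g-mono {D ∪ (λ _ → false)} {D} (∪-lub {C = D} {D = λ _ → false} (λ _ d → d) (λ _ ()))) (m≤m+n (g D) (F * 0)))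
    sweep-claim m β t (c ∷ cs) P cβ cl cb el C D sub with t c in teq
    ... | false = sweep-claim m β t cs P cβ cl cb el C D sub
    ... | true = combine _ _
        (+-mono-≤ (part-claim m c (cl c tc) C P (cb c tc) el)
          (+-mono-≤ (raise {class c} {β} {g C} {g C₁} (cβ c tc) (g-mono {C} {C₁} (grows (walk-step m c C))))
            (+-mono-≤ (sweep-claim m β t cs P cβ cl cb el C₁ D sub)
              (+-mono-≤ (≤-trans (+-monoˡ-≤ (g D) (g-mono {D ∪ (Pc ∪ U)} {(D ∪ Pc) ∪ U} assoc))
                  (≤-trans (g-submodular D (D ∪ Pc) U (⊆-∪ˡ D Pc)) (≤-reflexive (+-comm (g (D ∪ U)) (g (D ∪ Pc))))))
                (g-submodular C D Pc (⊆-trans {C = C} {D = C₁} {E = D} (grows (walk-step m c C))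
                  (⊆-trans {C = C₁} {D = C′} {E = D} (grows (sweep-step m t cs C₁ (walk-step m))) sub)))))))
        (eq (g (D ∪ (Pc ∪ U))) (β * g C) (h C′) (class c * g C₁) (h C) (g C) F (weigh cost Pc) (β * g C₁) (class c * g C)
            (g D) (partCosts t P cs) (β * g C′) (h C₁) (g (D ∪ Pc)) (g (D ∪ U)) (g (C ∪ Pc)))
        where
        tc : T (t c)
        tc = subst T (sym teq) _
        C₁ = walk m c C
        C′ = sweep m t cs C₁
        Pc = P ∩ desc c
        U = parts t P cs
        assoc : D ∪ (Pc ∪ U) ⊆ (D ∪ Pc) ∪ U
        assoc x t with ∨⁻ {D x} t
        ... | inj₁ d = ∨ˡ (∨ˡ d)
        ... | inj₂ pu with ∨⁻ {Pc x} pu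
        ... | inj₁ p = ∨ˡ (∨ʳ {D x} p)
        ... | inj₂ u = ∨ʳ {(D ∪ Pc) x} u
        eq : ∀ A βC h′ αC₁ hC C F kP βC₁ αC G K βC′ h₁ B E H →
             (A + (βC + h′)) + ((αC₁ + hC + (C + F * kP)) + ((βC₁ + αC) + ((G + F * K + (βC′ + h₁)) + ((B + E) + (H + G)))))
             ≡ (G + F * (kP + K) + (βC′ + hC)) + ((H + (αC + h₁)) + ((αC₁ + βC) + ((E + (βC₁ + h′)) + ((A + G) + (B + C)))))
        eq = solve-∀

    none-selected : ∀ m t cs P C → All (λ c → ¬ T (t c)) cs → sweep m t cs C ≡ C × (∀ x → ¬ T (parts t P cs x))
    none-selected m t []       P C [] = refl , λ x ()
    none-selected m t (c ∷ cs) P C (¬tc ∷ all) with t c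
    ... | true  = ⊥-elim (¬tc _)
    ... | false = none-selected m t cs P C all

    sweep-one-claim : ∀ m α t cs P → (∀ c → T (t c) → class c ≡ α) → (∀ c → T (t c) → Claim m c) →
                      (∀ c → T (t c) → ClosedBelow c P) → P ⊆ elig →
                      Unique cs → (∀ c d → T (t c) → T (t d) → c ≡ d) →
                      ∀ C → let C′ = sweep m t cs C in
                      g (C ∪ parts t P cs) + (α * g C + h C′) ≤ α * g C′ + h C + (g C + F * partCosts t P cs)
    sweep-one-claim m α t [] P cα cl cb el uq one C = combine _ _
      (g-mono {C ∪ (λ _ → false)} {C} (∪-lub {C = C} {D = λ _ → false} (λ _ d → d) (λ _ ())))
      (eq (g (C ∪ (λ _ → false))) (α * g C) (h C) (g C) F)
      where
      eq : ∀ A x y G F → A + (x + y) + G ≡ x + y + (G + F * 0) + A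
      eq = solve-∀
    sweep-one-claim m α t (c ∷ cs) P cα cl cb el (c∉ ∷ uq) one C with t c in teq
    ... | false = sweep-one-claim m α t cs P cα cl cb el uq one C
    ... | true = subst (λ C′ → g (C ∪ (Pc ∪ U)) + (α * g C + h C′) ≤ α * g C′ + h C + (g C + F * (weigh cost Pc + partCosts t P cs)))
        (sym (proj₁ rest))
        (≤-trans (+-monoˡ-≤ (α * g C + h C₁) (g-mono {C ∪ (Pc ∪ U)} {C ∪ Pc} drop))
          (≤-trans (subst (λ α → g (C ∪ Pc) + (α * g C + h C₁) ≤ α * g C₁ + h C + (g C + h Pc)) (cα c tc)
                          (part-claim m c (cl c tc) C P (cb c tc) el))
            (+-monoʳ-≤ (α * g C₁ + h C) (+-monoʳ-≤ (g C) (*-monoʳ-≤ F (m≤m+n (weigh cost Pc) _))))))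
        where
        tc : T (t c)
        tc = subst T (sym teq) _
        C₁ = walk m c C
        Pc = P ∩ desc c
        U = parts t P cs
        rest : sweep m t cs C₁ ≡ C₁ × (∀ x → ¬ T (parts t P cs x))
        rest = none-selected m t cs P C₁ (All.map (λ c≢d td → c≢d (one c _ tc td)) c∉)
        drop : C ∪ (Pc ∪ U) ⊆ C ∪ Pc
        drop x t with ∨⁻ {C x} t
        ... | inj₁ c = ∨ˡ c
        ... | inj₂ pu with ∨⁻ {Pc x} pu
        ... | inj₁ p = ∨ʳ {C x} p
        ... | inj₂ u = ⊥-elim (proj₂ rest x u)

    light-class : ∀ {v c} → T (light v c) → suc (class c) ≤ class v
    light-class {v} {c} t = ≤∧≢⇒< (class-edge (∧ˡ t)) λ eq → not⁻ (∧ʳ {edge v c} t) (≡⇒≡ᵇ (class c) (class v) eq)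

    heavy-class : ∀ {v c} → T (heavy v c) → class c ≡ class v
    heavy-class {v} {c} t = ≡ᵇ⇒≡ (class c) (class v) (∧ʳ {edge v c} t)

    light⊎heavy : ∀ {v c} → Edge v c → T (light v c) ⊎ T (heavy v c)
    light⊎heavy {v} {c} e with T⊎ (class c ≡ᵇ class v)
    ... | inj₁ eq = inj₂ (∧⁺ e eq)
    ... | inj₂ ne = inj₁ (∧⁺ e (not⁺ ne))

    up-closed : ∀ {v} P → ClosedBelow v P → P ⊆ desc v → ∀ {x} → T (P x) → T (P v)
    up-closed {v} P closed sub {x} px = go k (rank-≤ x) px
      where
      go : ∀ n {x} → rank x ≤ n → T (P x) → T (P v)
      go zero {x} le px = ⊥-elim (<⇒≱ (rank-≥1 x) le)
      go (suc n) {x} le px with last-step (sub x px)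
      ... | inj₁ refl = px
      ... | inj₂ (y , d , e) = go n (s≤s⁻¹ (≤-trans (rank-edge e) le)) (closed e d px)

    walk-claim : ∀ m v → width v ≤ m → Claim m v
    walk-claim zero    v le = ⊥-elim (<⇒≱ (width-≥1 v) le)
    walk-claim (suc m) v le C P sub closed el = decide (T⊎ (accept v C C₂)) (T⊎ (P v))
      where
      C₀ = C ∪ point v
      C₁ = sweep m (light v) (allFin k) C₀
      C₂ = sweep m (heavy v) (allFin k) C₁
      α = class v
      β = α ∸ 1
      α≡ : suc β ≡ α
      α≡ = m+[n∸m]≡n (class-≥1 v)

      child : ∀ {c} → Edge v c → Claim m c
      child e = walk-claim m _ (s≤s⁻¹ (≤-trans (width-edge e) le))
      child-closed : ∀ {c} → Edge v c → ClosedBelow c P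
      child-closed e e′ d p = closed e′ (desc-∷ e d) p

      Ul = parts (light v) P (allFin k)
      Uh = parts (heavy v) P (allFin k)
      Kl = partCosts (light v) P (allFin k)
      Kh = partCosts (heavy v) P (allFin k)

      C⊆C₀ : C ⊆ C₀
      C⊆C₀ = ⊆-∪ˡ C (point v)
      C₀⊆C₁ : C₀ ⊆ C₁
      C₀⊆C₁ = grows (sweep-step m (light v) (allFin k) C₀ (walk-step m))
      v∈C₁ : T (C₁ v)
      v∈C₁ = C₀⊆C₁ v (∨ʳ {C v} (point-refl v))

      covered : T (P v) → C ∪ P ⊆ (C₁ ∪ Ul) ∪ Uh
      covered pv x t with ∨⁻ {C x} t
      ... | inj₁ c = ∨ˡ (∨ˡ (C₀⊆C₁ x (C⊆C₀ x c)))
      ... | inj₂ p with first-step (sub x p)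
      ... | inj₁ refl = ∨ˡ (∨ˡ v∈C₁)
      ... | inj₂ (c , e , d) with light⊎heavy e
      ... | inj₁ l = ∨ˡ (∨ʳ {C₁ x} (parts⁺ (light v) P (∈-allFin c) l p d))
      ... | inj₂ hv = ∨ʳ {(C₁ ∪ Ul) x} (parts⁺ (heavy v) P (∈-allFin c) hv p d)

      partition : ∀ e b x → when (e ∧ not b) x + when (e ∧ b) x ≡ when e x
      partition true  true  x = refl
      partition true  false x = +-identityʳ x
      partition false b     x = refl

      costs : T (P v) → cost v + (Kl + Kh) ≤ weigh cost P
      costs pv = begin
        cost v + (Kl + Kh)
          ≡⟨ cong (cost v +_) (cong₂ _+_ (partCosts-∑ (light v) P) (partCosts-∑ (heavy v) P)) ⟩
        cost v + (∑ (λ c → when (light v c) (K c)) + ∑ (λ c → when (heavy v c) (K c)))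
          ≡⟨ cong (cost v +_) (∑-+ (λ c → when (light v c) (K c)) (λ c → when (heavy v c) (K c))) ⟨
        cost v + ∑ (λ c → when (light v c) (K c) + when (heavy v c) (K c))
          ≡⟨ cong (cost v +_) (∑-cong (λ c → partition (edge v c) (class c ≡ᵇ class v) (K c))) ⟩
        cost v + ∑ (λ c → when (edge v c) (K c))
          ≤⟨ children-disjoint cost P v sub pv ⟩
        weigh cost P ∎
        where
        K : Fin k → ℕ
        K c = weigh cost (P ∩ desc c)

      full : T (P v) → g (C ∪ P) + (α * g C + h C₂) ≤ α * g C₂ + h C + (g C + h P)
      full pv = subst (λ α → g (C ∪ P) + (α * g C + h C₂) ≤ α * g C₂ + h C + (g C + h P)) α≡ (combine _ _
        (+-mono-≤ (sweep-claim m β (light v) (allFin k) P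
                    (λ c t → s≤s⁻¹ (≤-trans (light-class {v} {c} t) (≤-reflexive (sym α≡)))) (λ c t → child (∧ˡ t)) (λ c t → child-closed (∧ˡ t)) el
                    C₀ C₁ (λ _ x → x))
          (+-mono-≤ (subst (λ α → g (C₁ ∪ Uh) + (α * g C₁ + h C₂) ≤ α * g C₂ + h C₁ + (g C₁ + F * Kh)) (sym α≡)
                      (sweep-one-claim m α (heavy v) (allFin k) P (λ c t → heavy-class {v} {c} t) (λ c t → child (∧ˡ t))
                        (λ c t → child-closed (∧ˡ t)) el (allFin⁺ k)
                        (λ c d tc td → heavy-unique (∧ˡ tc) (∧ˡ td) (heavy-class {v} {c} tc) (heavy-class {v} {d} td)) C₁))
            (+-mono-≤ (≤-trans (+-monoˡ-≤ (g C₁) (g-mono {C ∪ P} {(C₁ ∪ Ul) ∪ Uh} (covered pv)))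
                         (g-submodular C₁ (C₁ ∪ Ul) Uh (⊆-∪ˡ C₁ Ul)))
              (+-mono-≤ (*-monoʳ-≤ F (costs pv))
                (+-mono-≤ (*-monoʳ-≤ F (≤-trans (weigh-∪ cost C (point v)) (≤-reflexive (cong (weigh cost C +_) (weigh-point cost v)))))
                  (*-monoʳ-≤ β (g-mono {C} {C₀} C⊆C₀)))))))
        (eq β F (g (C ∪ P)) (g C) (g C₀) (g C₁) (g C₂) (h C₁) (h C₂) (weigh cost P) (weigh cost C) (weigh cost C₀)
            (cost v) Kl Kh (g (C₁ ∪ Ul)) (g (C₁ ∪ Uh))))
        where
        eq : ∀ β F gP g₋ g₀ g₁ g₂ h₁ h₂ kP kC kC₀ c Kl Kh gl gh →
             (gP + (suc β * g₋ + h₂)) +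
             ((g₁ + F * Kl + (β * g₁ + F * kC₀)) + ((suc β * g₂ + h₁ + (g₁ + F * Kh)) + ((gh + gl) + (F * kP + (F * (kC + c) + β * g₀)))))
             ≡
             (suc β * g₂ + F * kC + (g₋ + F * kP)) +
             ((gl + (β * g₀ + h₁)) + ((gh + (suc β * g₁ + h₂)) + ((gP + g₁) + (F * (c + (Kl + Kh)) + (F * kC₀ + β * g₋)))))
        eq = solve-∀

      empty : ¬ T (P v) → g (C ∪ P) ≤ g C
      empty ¬pv = g-mono {C ∪ P} {C} (∪-lub {C = C} {D = P} (λ _ c → c) λ x p → ⊥-elim (¬pv (up-closed P closed sub p)))

      keep : g (C ∪ P) ≤ g C + h P → g (C ∪ P) + (α * g C + h C) ≤ α * g C + h C + (g C + h P)
      keep le = ≤-trans (+-monoˡ-≤ (α * g C + h C) le) (≤-reflexive (+-comm (g C + h P) _))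

      Goal : Mask k → Set
      Goal D = g (C ∪ P) + (α * g C + h D) ≤ α * g D + h C + (g C + h P)

      accepted : ∀ {b} → T b → Goal C₂ → Goal (if b then C₂ else C)
      accepted {true} _ goal = goal

      rejected : ∀ {b} → ¬ T b → Goal C → Goal (if b then C₂ else C)
      rejected {true}  ¬t goal = ⊥-elim (¬t _)
      rejected {false} ¬t goal = goal

      decide : T (accept v C C₂) ⊎ ¬ T (accept v C C₂) → T (P v) ⊎ ¬ T (P v) → Goal (walk (suc m) v C)
      decide (inj₁ t) (inj₁ pv) = accepted t (full pv)
      decide (inj₁ t) (inj₂ ¬pv) = accepted t (begin
        g (C ∪ P) + (α * g C + h C₂)        ≤⟨ +-mono-≤ (≤-trans (empty ¬pv) (m≤m+n (g C) (h P))) (<⇒≤ (≰⇒> (λ le → not⁻ (∧ʳ {elig v} t) (≤⇒≤ᵇ le)))) ⟩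
        g C + h P + (α * g C₂ + h C)        ≡⟨ +-comm (g C + h P) _ ⟩
        α * g C₂ + h C + (g C + h P)        ∎)
      decide (inj₂ ¬t) (inj₂ ¬pv) = rejected ¬t (keep (≤-trans (empty ¬pv) (m≤m+n (g C) (h P))))
      decide (inj₂ ¬t) (inj₁ pv) = rejected ¬t (keep (combine _ _ (+-mono-≤ (full pv) (≤ᵇ⇒≤ _ _ refused))
          (eq (g (C ∪ P)) (α * g C) (h C₂) (α * g C₂) (h C) (g C) (h P))))
        where
        refused : T (α * g C₂ + h C ≤ᵇ α * g C + h C₂)
        refused with T⊎ (α * g C₂ + h C ≤ᵇ α * g C + h C₂)
        ... | inj₁ r = r
        ... | inj₂ ¬r = ⊥-elim (¬t (∧⁺ (el v pv) (not⁺ ¬r)))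
        eq : ∀ A x y z u G H → A + ((z + u + (G + H)) + (x + y)) ≡ G + H + ((A + (x + y)) + (z + u))
        eq = solve-∀

    λmax : ℕ
    λmax = bits k

    pass-step : ∀ C → Step C (pass C)
    pass-step C = sweep-step k root (allFin k) C (walk-step k)

    pass-claim : ∀ C P → Closed P → P ⊆ elig →
                 g (pass C ∪ P) + (λmax * g C + h (pass C)) ≤ g (pass C) + h P + (λmax * g (pass C) + h C)
    pass-claim C P closed el = begin
      g (D ∪ P) + (λmax * g C + h D)
        ≤⟨ +-monoˡ-≤ (λmax * g C + h D) (g-mono {D ∪ P} {D ∪ U} (∪-lub {C = D} {D = P} (⊆-∪ˡ D U) λ x p → ∨ʳ {D x} (inU x p))) ⟩
      g (D ∪ U) + (λmax * g C + h D)
        ≤⟨ sweep-claim k λmax root (allFin k) P (λ c _ → class-≤ c) (λ c _ → walk-claim k c (width-≤ c))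
             (λ c _ e _ p → closed e p) el C D (λ _ x → x) ⟩
      g D + F * partCosts root P (allFin k) + (λmax * g D + h C)
        ≤⟨ +-monoˡ-≤ (λmax * g D + h C) (+-monoʳ-≤ (g D) (*-monoʳ-≤ F
             (≤-trans (≤-reflexive (partCosts-∑ root P)) (roots-disjoint-weigh cost P)))) ⟩
      g D + h P + (λmax * g D + h C) ∎
      where
      D = pass C
      U = parts root P (allFin k)
      inU : P ⊆ U
      inU x p = let r , tr , d = root-of x in parts⁺ root P (∈-allFin r) tr p d

    passes-step : ∀ j C → Step C (passes j C)
    passes-step zero    C = step-refl
    passes-step (suc j) C = step-trans (pass-step C) (passes-step j (pass C))

    pass-closed : ∀ C → Closed C → Closed (pass C)
    pass-closed C cl = sweep-closed k root (allFin k) C cl (λ c r u e → ⊥-elim (root-no-edge r e)) (walk-closed k)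

    passes-closed : ∀ j C → Closed C → Closed (passes j C)
    passes-closed zero    C cl = cl
    passes-closed (suc j) C cl = passes-closed j (pass C) (pass-closed C cl)

    passes-cost : ∀ j C → h (passes j C) + λmax * g C ≤ h C + λmax * g (passes j C)
    passes-cost zero    C = ≤-refl
    passes-cost (suc j) C = combine _ _ (+-mono-≤ (pass-claim C (λ _ → false) (λ _ ()) (λ _ ()))
        (+-mono-≤ (passes-cost j D) (g-mono {D} {D ∪ (λ _ → false)} (⊆-∪ˡ D (λ _ → false)))))
      (trans (cong (λ z → h E + λmax * g C + (g D + F * z + (λmax * g D + h C) + (h D + λmax * g E + g (D ∪ (λ _ → false))))) (∑-zero {k}))
        (eq (h E) (λmax * g C) (g D) F (λmax * g D) (h C) (h D) (λmax * g E) (g (D ∪ (λ _ → false)))))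
      where
      D = pass C
      E = passes j D
      eq : ∀ hE gC gD F lD hC hD lE gD′ →
           hE + gC + (gD + F * 0 + (lD + hC) + (hD + lE + gD′)) ≡ hC + lE + (gD′ + (gC + hD) + (hE + lD + gD))
      eq = solve-∀

    Good : ℕ → Mask k → Set
    Good B C = ∀ P → Closed P → P ⊆ elig → weigh cost P ≤ B → g (C ∪ P) ≤ g C + F * B

    good-mono : ∀ {B C D} → C ⊆ D → Good B C → Good B D
    good-mono {B} {C} {D} sub good P cl el le = combine _ _ (+-mono-≤ (g-submodular C D P sub) (good P cl el le))
      (eq (g (D ∪ P)) (g (C ∪ P)) (g D) (g C) (F * B))
      where
      eq : ∀ x y d c b → x + ((y + d) + (c + b)) ≡ d + b + ((x + c) + y)
      eq = solve-∀

    good-passes : ∀ B j C → k ≤ count C + j → Good B (passes j C)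
    good-passes B zero C le P cl el kP≤ = ≤-trans (g-mono {C ∪ P} {C} (∪-lub {C = C} {D = P} (λ _ c → c) (λ x _ → full x))) (m≤m+n (g C) _)
      where
      full : ∀ x → T (C x)
      full x with T⊎ (C x)
      ... | inj₁ c = c
      ... | inj₂ ¬c = ⊥-elim (<⇒≱ (≤-trans (≤-reflexive (+-comm 1 (count C)))
          (≤-trans (weigh-strict (λ _ → 1) {C} {λ _ → true} x (λ _ _ → _) ¬c _) (count-≤ {k} (λ _ → true))))
        (≤-trans le (≤-reflexive (+-identityʳ (count C)))))
    good-passes B (suc j) C le with count C <? count (pass C)
    ... | yes lt = good-passes B j (pass C) (≤-trans le (≤-trans (≤-reflexive (+-suc (count C) j)) (+-monoˡ-≤ j lt)))
    ... | no ¬lt = good-mono {B} {pass C} {passes j (pass C)} (grows (passes-step j (pass C))) stable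
      where
      D = pass C
      back : D ⊆ C
      back x d with T⊎ (C x)
      ... | inj₁ c = c
      ... | inj₂ ¬c = ⊥-elim (¬lt (≤-trans (≤-reflexive (+-comm 1 (count C)))
        (weigh-strict (λ _ → 1) {C} {D} x (grows (pass-step C)) ¬c d)))
      stable : Good B D
      stable P cl el kP≤ = ≤-trans (combine _ _ (+-mono-≤ (pass-claim C P cl el)
          (+-mono-≤ (*-monoʳ-≤ λmax (g-mono {D} {C} back)) (*-monoʳ-≤ F (weigh-mono cost {C} {D} (grows (pass-step C))))))
          (eq (g (D ∪ P)) (λmax * g C) (h D) (g D) (h P) (λmax * g D) (h C)))
        (+-monoʳ-≤ (g D) (*-monoʳ-≤ F kP≤))
        where
        eq : ∀ A lC hD gD hP lD hC → A + (gD + hP + (lD + hC) + (lC + hD)) ≡ gD + hP + (A + (lC + hD) + (lD + hC))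
        eq = solve-∀

module UnitPlanning where

  open Families using (when)
  open Masks
  open Digraphs
  open import Data.Bool using (Bool; true; false; T; _∧_; _∨_; not; if_then_else_)
  open import Data.Empty using (⊥-elim)
  open import Data.Fin using (Fin; suc)
  open import Data.List using (List; []; _∷_; allFin; map)
  open import Data.List.Membership.Propositional using (_∈_)
  open import Data.List.Membership.Propositional.Properties using (∈-allFin)
  open import Data.List.Properties using (map-tabulate)
  open import Data.List.Relation.Unary.Any using (here; there)
  open import Data.Nat using (ℕ; suc; _+_; _*_; _≤_; _<_; _≤ᵇ_)
  open import Data.Nat.ListAction using (sum)
  open import Data.Nat.Properties
  open import Data.Nat.Tactic.RingSolver using (solve-∀)
  open import Data.Product using (_×_; _,_; ∃-syntax; proj₂)
  open import Data.Sum using (inj₁; inj₂)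
  open import Function using (id)
  open import Relation.Binary.Construct.Closure.Transitive using (TransClosure)
  open import Relation.Binary.PropositionalEquality using (_≡_; refl; sym; trans; cong; subst)
  open import Relation.Nullary using (¬_)

  open ≤-Reasoning

  module UnitPlan {k n} (edge : Fin k → Fin k → Bool) (S : Fin k → Fin n → Bool) (w : Fin n → ℕ)
    (acyclic : ∀ i → ¬ TransClosure (Graph.Edge edge) i i) (a F T₀ B : ℕ) where

    open Graph edge
    open Acyclic acyclic
    open Coverage S w

    g : Mask k → ℕ
    g C = a * value C

    g-mono : ∀ {C D} → C ⊆ D → g C ≤ g D
    g-mono {C} {D} sub = *-monoʳ-≤ a (value-mono {C} {D} sub)

    g-submodular : ∀ C D P → C ⊆ D → g (D ∪ P) + g C ≤ g (C ∪ P) + g D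
    g-submodular C D P sub = begin
      a * value (D ∪ P) + a * value C   ≡⟨ *-distribˡ-+ a (value (D ∪ P)) (value C) ⟨
      a * (value (D ∪ P) + value C)     ≤⟨ *-monoʳ-≤ a (value-submodular C D P sub) ⟩
      a * (value (C ∪ P) + value D)     ≡⟨ *-distribˡ-+ a (value (C ∪ P)) (value D) ⟩
      a * value (C ∪ P) + a * value D   ∎

    elig : Mask k
    elig v = depth v ≤ᵇ T₀

    up : Fin k → Mask k
    up v x = desc x v

    worth : Fin k → Mask k → Bool
    worth v C = elig v ∧ ((rank v ≤ᵇ B) ∧ not (g (C ∪ up v) ≤ᵇ g C + F))

    add : Mask k → Fin k → Mask k
    add C v = if worth v C then C ∪ up v else C

    select : List (Fin k) → Mask k → Mask k
    select []       C = C
    select (v ∷ vs) C = select vs (add C v)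

    Closed : Mask k → Set
    Closed C = ∀ {x y} → Edge x y → T (C y) → T (C x)

    data Add (C : Mask k) (v : Fin k) : Mask k → Set where
      taken   : T (elig v) → rank v ≤ B → g C + F < g (C ∪ up v) → Add C v (C ∪ up v)
      skipped : (T (elig v) → rank v ≤ B → g (C ∪ up v) ≤ g C + F) → Add C v C

    add-view : ∀ C v → Add C v (add C v)
    add-view C v with worth v C in eq
    ... | true = taken (∧ˡ t) (≤ᵇ⇒≤ _ _ (∧ˡ (∧ʳ {elig v} t))) (≰⇒> λ le → not⁻ (∧ʳ {rank v ≤ᵇ B} (∧ʳ {elig v} t)) (≤⇒≤ᵇ le))
      where
      t : T (worth v C)
      t = subst T (sym eq) _
    ... | false = skipped bound
      where
      bound : T (elig v) → rank v ≤ B → g (C ∪ up v) ≤ g C + F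
      bound e r with T⊎ (g (C ∪ up v) ≤ᵇ g C + F)
      ... | inj₁ t = ≤ᵇ⇒≤ _ _ t
      ... | inj₂ ¬t = ⊥-elim (subst T eq (∧⁺ e (∧⁺ (≤⇒≤ᵇ r) (not⁺ ¬t))))

    depth-desc : ∀ {x v} → T (desc x v) → depth x ≤ depth v
    depth-desc {x} {v} d = go (proj₂ (desc⇒path d))
      where
      go : ∀ {t u v} → Path t u v → depth u ≤ depth v
      go []      = ≤-refl
      go (e ∷ p) = ≤-trans (<⇒≤ (depth-edge e)) (go p)

    add-grows : ∀ C v → C ⊆ add C v
    add-grows C v with add C v | add-view C v
    ... | _ | taken _ _ _ = ⊆-∪ˡ C (up v)
    ... | _ | skipped _ = λ _ c → c

    select-grows : ∀ vs C → C ⊆ select vs C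
    select-grows []       C x c = c
    select-grows (v ∷ vs) C x c = select-grows vs (add C v) x (add-grows C v x c)

    add-elig : ∀ C v x → T (add C v x) → ¬ T (C x) → T (elig x)
    add-elig C v x t ¬c with add C v | add-view C v
    ... | _ | skipped _ = ⊥-elim (¬c t)
    ... | _ | taken e _ _ with ∨⁻ {C x} t
    ... | inj₁ c = ⊥-elim (¬c c)
    ... | inj₂ d = ≤⇒≤ᵇ (≤-trans (depth-desc d) (≤ᵇ⇒≤ (depth v) T₀ e))

    select-elig : ∀ vs C x → T (select vs C x) → ¬ T (C x) → T (elig x)
    select-elig []       C x t ¬c = ⊥-elim (¬c t)
    select-elig (v ∷ vs) C x t ¬c with T⊎ (add C v x)
    ... | inj₁ c = add-elig C v x c ¬c
    ... | inj₂ ¬d = select-elig vs (add C v) x t ¬d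

    add-closed : ∀ C v → Closed C → Closed (add C v)
    add-closed C v cl with add C v | add-view C v
    ... | _ | skipped _ = cl
    ... | _ | taken _ _ _ = closed
      where
      closed : Closed (C ∪ up v)
      closed {x} {y} e t with ∨⁻ {C y} t
      ... | inj₁ c = ∨ˡ (cl e c)
      ... | inj₂ d = ∨ʳ {C x} (desc-∷ e d)

    select-closed : ∀ vs C → Closed C → Closed (select vs C)
    select-closed []       C cl = cl
    select-closed (v ∷ vs) C cl = select-closed vs (add C v) (add-closed C v cl)

    -- The number q of closures taken
    select-count : ∀ vs C → ∃[ q ] F * q + g C ≤ g (select vs C) × count (select vs C) ≤ count C + q * B
    select-count [] C = 0 , ≤-reflexive (cong (_+ g C) (*-zeroʳ F)) , m≤m+n (count C) 0
    select-count (v ∷ vs) C with add C v | add-view C v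
    ... | _ | skipped _ = select-count vs C
    ... | _ | taken _ r gain =
      let q , le , cnt = select-count vs (C ∪ up v) in
      suc q ,
      combine _ _ (+-mono-≤ le (<⇒≤ gain)) (eq₁ F q (g C) (g (select vs (C ∪ up v))) (g (C ∪ up v))) ,
      ≤-trans cnt (≤-trans (+-monoˡ-≤ (q * B) (≤-trans (weigh-∪ (λ _ → 1) C (up v)) (+-monoʳ-≤ (count C) r)))
        (≤-reflexive (+-assoc (count C) B (q * B))))
      where
      eq₁ : ∀ F q x y z → F * suc q + x + (y + z) ≡ y + (F * q + z + (x + F))
      eq₁ = solve-∀

    select-covers : ∀ vs C {v} → v ∈ vs → T (elig v) → rank v ≤ B → let D = select vs C in g (D ∪ up v) ≤ g D + F
    select-covers (u ∷ vs) C (there v∈) e r = select-covers vs (add C u) v∈ e r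
    select-covers (v ∷ vs) C (here refl) e r = combine _ _
        (+-mono-≤ (g-submodular E (select vs E) (up v) (select-grows vs E)) now)
        (eq (g (select vs E ∪ up v)) (g (E ∪ up v)) (g (select vs E)) (g E) F)
      where
      E = add C v
      eq : ∀ x y d e f → x + ((y + d) + (e + f)) ≡ d + f + ((x + e) + y)
      eq = solve-∀
      now : g (E ∪ up v) ≤ g E + F
      now with add C v | add-view C v
      ... | _ | skipped bound = bound e r
      ... | _ | taken _ _ _ = ≤-trans (g-mono {(C ∪ up v) ∪ up v} {C ∪ up v}
        (∪-lub {C = C ∪ up v} {D = up v} (λ _ c → c) (⊆-∪ʳ C (up v)))) (m≤m+n _ F)

    good : ∀ C P → let D = select (allFin k) C in
           Closed P → P ⊆ elig → count P ≤ B → g (D ∪ P) ≤ g D + F * B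
    good C P cl el cnt = ≤-trans (g-mono {D ∪ P} {D ∪ ups (allFin k)} (∪-lub {C = D} {D = P} (⊆-∪ˡ D (ups (allFin k)))
        λ x p → ∨ʳ {D x} (ups⁺ (∈-allFin x) p)))
      (≤-trans (bound (allFin k)) (+-monoʳ-≤ (g D) (*-monoʳ-≤ F (≤-trans (≤-reflexive total) cnt))))
      where
      D = select (allFin k) C
      ups : List (Fin k) → Mask k
      ups []       x = false
      ups (c ∷ cs) x = (P c ∧ up c x) ∨ ups cs x
      number : List (Fin k) → ℕ
      number []       = 0
      number (c ∷ cs) = when (P c) 1 + number cs
      total : number (allFin k) ≡ count P
      total = trans (go (allFin k)) (cong sum (map-tabulate id (λ c → when (P c) 1)))
        where
        go : ∀ cs → number cs ≡ sum (map (λ c → when (P c) 1) cs)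
        go []       = refl
        go (c ∷ cs) = cong (when (P c) 1 +_) (go cs)
      ups⁺ : ∀ {c cs} → c ∈ cs → T (P c) → T (ups cs c)
      ups⁺ {c} (here refl) p = ∨ˡ (∧⁺ p (desc-refl c))
      ups⁺ {c} (there {x = c′} c∈) p = ∨ʳ {P c′ ∧ up c′ c} (ups⁺ c∈ p)
      upP : ∀ {c} → T (P c) → up c ⊆ P
      upP {c} p x d = go (proj₂ (desc⇒path d)) p
        where
        go : ∀ {t u v} → Path t u v → T (P v) → T (P u)
        go []       p = p
        go (e ∷ q) p = cl e (go q p)
      bound : ∀ cs → g (D ∪ ups cs) ≤ g D + F * number cs
      bound [] = ≤-trans (g-mono {D ∪ (λ _ → false)} {D} (∪-lub {C = D} {D = λ _ → false} (λ _ d → d) λ _ ())) (m≤m+n (g D) _)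
      bound (c ∷ cs) with P c in eq
      ... | false = bound cs
      ... | true = combine _ _
          (+-mono-≤ (≤-trans (+-monoˡ-≤ (g D) (g-mono {D ∪ (up c ∪ ups cs)} {(D ∪ up c) ∪ ups cs} assoc))
                      (g-submodular D (D ∪ up c) (ups cs) (⊆-∪ˡ D (up c))))
            (+-mono-≤ (select-covers (allFin k) C (∈-allFin c) (el c pc) (≤-trans (weigh-mono (λ _ → 1) (upP pc)) cnt)) (bound cs)))
          (sh (g (D ∪ (up c ∪ ups cs))) (g (D ∪ ups cs)) (g (D ∪ up c)) (g D) F (number cs))
        where
        pc : T (P c)
        pc = subst T (sym eq) _
        assoc : D ∪ (up c ∪ ups cs) ⊆ (D ∪ up c) ∪ ups cs
        assoc x t with ∨⁻ {D x} t
        ... | inj₁ d = ∨ˡ (∨ˡ d)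
        ... | inj₂ r with ∨⁻ {up c x} r
        ... | inj₁ u = ∨ˡ (∨ʳ {D x} u)
        ... | inj₂ u = ∨ʳ {(D ∪ up c) x} u
        sh : ∀ x y z d F n → x + ((y + z) + ((d + F) + (d + F * n))) ≡ d + F * suc n + ((x + d) + (z + y))
        sh = solve-∀

module Scheduling where

  open Arithmetic using (T-ext)
  open Families using (when; point)
  open Masks
  open Digraphs
  open import Data.Bool using (Bool; true; false; T; _∧_; not; if_then_else_)
  open import Data.Empty using (⊥-elim)
  open import Data.Fin using (Fin; zero; suc)
  open import Data.List using (List; []; _∷_; allFin; foldl; _++_; filterᵇ; [_])
  open import Data.List.Membership.Propositional using (_∈_)
  open import Data.List.Membership.Propositional.Properties using (∈-allFin; ∈-++⁺ˡ; ∈-++⁺ʳ; ∈-++⁻; ∈-filter⁺; ∈-filter⁻)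
  open import Data.List.Properties using (++-assoc; ++-identityʳ; ∷-injectiveʳ)
  open import Data.List.Relation.Unary.All using (All; []; _∷_)
  import Data.List.Relation.Unary.All as All
  open import Data.List.Relation.Unary.Any using (here; there)
  open import Data.Maybe using (Maybe; just; is-just)
  open import Data.Maybe.Properties using (just-injective)
  open import Data.Nat using (ℕ; zero; suc; _+_; _*_; _≤_; _<_; _∸_; _≤ᵇ_; _≡ᵇ_; z≤n; s≤s; s≤s⁻¹)
  open import Data.Nat.Properties
  open import Data.Nat.Tactic.RingSolver using (solve-∀)
  open import Data.Product using (_×_; _,_; ∃-syntax; proj₁; proj₂)
  open import Data.Sum using (_⊎_; inj₁; inj₂)
  open import Data.Unit using (tt)
  open import Function using (_∘_; case_of_)
  open import Relation.Binary.Definitions using (tri<; tri≈; tri>)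
  open import Data.Bool.Properties using (∨-zeroʳ; ∨-identityʳ)
  open import Relation.Binary.Construct.Closure.Transitive using (TransClosure)
  open import Relation.Binary.PropositionalEquality using (_≡_; _≢_; refl; sym; trans; cong; cong₂; subst; subst₂)
  open import Relation.Nullary using (¬_)

  open ≤-Reasoning

  foldl-invariant : ∀ {A B : Set} (I : List B → A → Set) (f : A → B → A) all →
    (∀ xs x ys a → all ≡ xs ++ x ∷ ys → I xs a → I (xs ++ [ x ]) (f a x)) →
    ∀ xs ys a → all ≡ xs ++ ys → I xs a → I all (foldl f a ys)
  foldl-invariant I f all step xs [] a eq i = subst (λ l → I l a) (sym (trans eq (++-identityʳ xs))) i
  foldl-invariant I f all step xs (y ∷ ys) a eq i =
    foldl-invariant I f all step (xs ++ [ y ]) ys (f a y) (trans eq (sym (++-assoc xs [ y ] ys))) (step xs y ys a eq i)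

  module Order {k} (rank : Fin k → ℕ) (rank≥1 : ∀ v → 1 ≤ rank v) (rank≤ : ∀ v → rank v ≤ k) where

    level : ℕ → List (Fin k)
    level c = filterᵇ (λ v → rank v ≡ᵇ c) (allFin k)

    levels : ℕ → ℕ → List (Fin k)
    levels c zero    = []
    levels c (suc n) = level c ++ levels (suc c) n

    order : List (Fin k)
    order = levels 1 k

    ∈-level⁺ : ∀ {v} c → rank v ≡ c → v ∈ level c
    ∈-level⁺ {v} c eq = ∈-filter⁺ (Data.Bool.T? ∘ (λ v → rank v ≡ᵇ c)) (∈-allFin v) (≡⇒≡ᵇ (rank v) c eq)

    ∈-level⁻ : ∀ {v} c → v ∈ level c → rank v ≡ c
    ∈-level⁻ {v} c v∈ = ≡ᵇ⇒≡ (rank v) c (proj₂ (∈-filter⁻ (Data.Bool.T? ∘ (λ v → rank v ≡ᵇ c)) {xs = allFin k} v∈))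

    ∈-levels⁺ : ∀ {v} c n → c ≤ rank v → rank v < c + n → v ∈ levels c n
    ∈-levels⁺ {v} c zero    le lt = ⊥-elim (<⇒≱ lt (≤-trans (≤-reflexive (+-identityʳ c)) le))
    ∈-levels⁺ {v} c (suc n) le lt with m≤n⇒m<n∨m≡n le
    ... | inj₂ eq = ∈-++⁺ˡ (∈-level⁺ c (sym eq))
    ... | inj₁ c<r = ∈-++⁺ʳ (level c) (∈-levels⁺ (suc c) n c<r (≤-trans lt (≤-reflexive (+-suc c n))))

    ∈-levels⁻ : ∀ {v} c n → v ∈ levels c n → c ≤ rank v
    ∈-levels⁻ c (suc n) v∈ with ∈-++⁻ (level c) v∈
    ... | inj₁ v∈c = ≤-reflexive (sym (∈-level⁻ c v∈c))
    ... | inj₂ v∈′ = <⇒≤ (∈-levels⁻ (suc c) n v∈′)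

    ∈-order : ∀ v → v ∈ order
    ∈-order v = ∈-levels⁺ 1 k (rank≥1 v) (s≤s (rank≤ v))

    Sorted : List (Fin k) → Set
    Sorted vs = ∀ xs v ys → vs ≡ xs ++ v ∷ ys → ∀ {u} → u ∈ ys → rank v ≤ rank u

    sorted-++ : ∀ c vs ws → (∀ {u} → u ∈ vs → rank u ≡ c) → (∀ {u} → u ∈ ws → c ≤ rank u) → Sorted ws → Sorted (vs ++ ws)
    sorted-++ c []       ws vc wc sw = sw
    sorted-++ c (x ∷ vs) ws vc wc sw [] v ys refl u∈ = ≤-trans (≤-reflexive (vc (here refl))) (bound (∈-++⁻ vs u∈))
      where
      bound : ∀ {u} → u ∈ vs ⊎ u ∈ ws → c ≤ rank u
      bound (inj₁ u∈) = ≤-reflexive (sym (vc (there u∈)))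
      bound (inj₂ u∈) = wc u∈
    sorted-++ c (x ∷ vs) ws vc wc sw (_ ∷ xs) v ys eq = sorted-++ c vs ws (vc ∘ there) wc sw xs v ys (∷-injectiveʳ eq)

    sorted-levels : ∀ c n → Sorted (levels c n)
    sorted-levels c zero    [] v ys ()
    sorted-levels c zero    (x ∷ xs) v ys ()
    sorted-levels c (suc n) = sorted-++ c (level c) (levels (suc c) n) (∈-level⁻ c) (λ u∈ → <⇒≤ (∈-levels⁻ (suc c) n u∈)) (sorted-levels (suc c) n)

    earlier : ∀ {xs v ys u} → order ≡ xs ++ v ∷ ys → rank u < rank v → u ∈ xs
    earlier {xs} {v} {ys} {u} eq lt with ∈-++⁻ xs (subst (u ∈_) eq (∈-order u))
    ... | inj₁ u∈ = u∈
    ... | inj₂ (here refl) = ⊥-elim (<-irrefl refl lt)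
    ... | inj₂ (there u∈) = ⊥-elim (<⇒≱ lt (sorted-levels 1 k xs v ys eq u∈))

  -- Machine, start of the row, and offset in the row

  Slot : Set
  Slot = ℕ × ℕ × ℕ

  begins : Slot → ℕ
  begins (q , b , r) = b + r

  record State (k : ℕ) : Set where
    constructor state
    field
      base machine offset : ℕ
      slots : Fin k → Maybe Slot

  open State public

  done : ∀ {k} → State k → Mask k
  done S i = is-just (slots S i)

  module Scheduler {k} (edge : Fin k → Fin k → Bool) (acyclic : ∀ i → ¬ TransClosure (Graph.Edge edge) i i)
    (cost : Fin k → ℕ) (m : ℕ) (stg : Fin k → ℕ) where

    open Graph edge
    open Acyclic acyclic
    open Order rank rank-≥1 rank-≤

    place : Fin k → State k → State k
    place v (state b p r σ) = state b p (r + cost v) (λ i → if point v i then just (p , b , r) else σ i)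

    wanted : Mask k → ℕ → Fin k → State k → Fin k → Bool
    wanted C s h S v = not (done S v) ∧ (C v ∧ ((stg v ≡ᵇ s) ∧ desc h v))

    visit : Mask k → ℕ → Fin k → State k → Fin k → State k
    visit C s h S v = if wanted C s h S v then place v S else S

    advance : ℕ → State k → State k
    advance D (state b p r σ) =
      if D ≤ᵇ r then (if m ≤ᵇ suc p then state (b + (D + D)) 0 0 σ else state b (suc p) 0 σ) else state b p r σ

    chunk : Mask k → ℕ → ℕ → State k → Fin k → State k
    chunk C D s S h = if stg h ≡ᵇ s then foldl (visit C s h) (advance D S) order else S

    newRow : ℕ → State k → State k
    newRow D (state b p r σ) = if (p ≤ᵇ 0) ∧ (r ≤ᵇ 0) then state b p r σ else state (b + (D + D)) 0 0 σ

    stage : Mask k → ℕ → State k → ℕ → State k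
    stage C D S s = newRow D (foldl (chunk C D s) S order)

    stages : Mask k → ℕ → ℕ → ℕ → State k → State k
    stages C D s zero    S = S
    stages C D s (suc n) S = stages C D (suc s) n (stage C D S s)

    phase : Mask k → ℕ → State k → State k
    phase C D S = stages C D 0 k S

    ends : Fin k → Slot → ℕ
    ends i x = begins x + cost i

    record Valid (D : ℕ) (S : State k) : Set where
      field
        machine<  : machine S < m
        offset≤   : offset S ≤ D + D
        slot<     : ∀ {i x} → slots S i ≡ just x → proj₁ x < m
        before    : ∀ {i x} → slots S i ≡ just x → proj₁ x < machine S → ends i x ≤ base S + (D + D)
        current   : ∀ {i x} → slots S i ≡ just x → proj₁ x ≡ machine S → ends i x ≤ base S + offset S
        after     : ∀ {i x} → slots S i ≡ just x → machine S < proj₁ x → ends i x ≤ base S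
        disjoint  : ∀ {i j x y} → i ≢ j → slots S i ≡ just x → slots S j ≡ just y → proj₁ x ≡ proj₁ y →
                    ends i x ≤ begins y ⊎ ends j y ≤ begins x
        preceding : ∀ {i j y} → Edge i j → slots S j ≡ just y → ∃[ x ] slots S i ≡ just x × ends i x ≤ begins y

    open Valid

    by-end : ∀ {D S i x} → Valid D S → slots S i ≡ just x → ends i x ≤ base S + (D + D)
    by-end {D} {S} {i} {x} V eq with <-cmp (proj₁ x) (machine S)
    ... | tri< lt _ _ = before V eq lt
    ... | tri≈ _ same _ = ≤-trans (current V eq same) (+-monoʳ-≤ (base S) (offset≤ V))
    ... | tri> _ _ gt = ≤-trans (after V eq gt) (m≤m+n (base S) (D + D))

    at-row : ∀ {D S i x} → Valid D S → machine S ≡ 0 → offset S ≡ 0 → slots S i ≡ just x → ends i x ≤ base S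
    at-row {D} {S} {i} {x} V p≡0 r≡0 eq with proj₁ x in q≡
    ... | zero = ≤-trans (current V eq (trans q≡ (sym p≡0))) (≤-reflexive (trans (cong (base S +_) r≡0) (+-identityʳ (base S))))
    ... | suc q = after V eq (subst₂ _<_ (sym p≡0) (sym q≡) (s≤s z≤n))

    fresh-row : ∀ {D S} → Valid D S → 1 ≤ m → ∀ D′ → Valid D′ (state (base S + (D + D)) 0 0 (slots S))
    fresh-row {D} {S} V m≥1 D′ = record
      { machine<  = m≥1
      ; offset≤   = z≤n
      ; slot<     = slot< V
      ; before    = λ _ ()
      ; current   = λ eq _ → ≤-trans (by-end V eq) (m≤m+n _ 0)
      ; after     = λ eq _ → by-end V eq
      ; disjoint  = disjoint V
      ; preceding = preceding V
      }

    change-row : ∀ {D S} → Valid D S → machine S ≡ 0 → offset S ≡ 0 → ∀ D′ → Valid D′ S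
    change-row {D} {S} V p≡0 r≡0 D′ = record
      { machine<  = machine< V
      ; offset≤   = ≤-trans (≤-reflexive r≡0) z≤n
      ; slot<     = slot< V
      ; before    = λ eq lt → ⊥-elim (n≮0 (≤-trans lt (≤-reflexive p≡0)))
      ; current   = current V
      ; after     = after V
      ; disjoint  = disjoint V
      ; preceding = preceding V
      }

    Extends : State k → State k → Set
    Extends S S′ = ∀ {i x} → slots S i ≡ just x → slots S′ i ≡ just x

    just-done : ∀ (S : State k) {i x} → slots S i ≡ just x → T (done S i)
    just-done S {i} eq with slots S i | eq
    ... | just _ | _ = tt

    done-just : ∀ (S : State k) {i} → T (done S i) → ∃[ x ] slots S i ≡ just x
    done-just S {i} t with slots S i
    ... | just x = x , refl

    extends-done : ∀ (S S′ : State k) → Extends S S′ → done S ⊆ done S′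
    extends-done S S′ ext i t = let x , eq = done-just S t in just-done S′ (ext eq)

    place-slots : ∀ v S {i x} → slots (place v S) i ≡ just x →
                  (i ≡ v × x ≡ (machine S , base S , offset S)) ⊎ (i ≢ v × slots S i ≡ just x)
    place-slots v S {i} eq with point v i in peq
    ... | true  = inj₁ (sym (point⇒≡ {i = v} (subst T (sym peq) tt)) , sym (just-injective eq))
    ... | false = inj₂ ((λ { refl → subst T peq (point-refl v) }) , eq)

    place-at : ∀ v S → slots (place v S) v ≡ just (machine S , base S , offset S)
    place-at v S with point v v | point-refl v
    ... | true | _ = refl

    place-other : ∀ v S {i} → i ≢ v → slots (place v S) i ≡ slots S i
    place-other v S {i} ne with T⊎ (point v i)
    ... | inj₁ t = ⊥-elim (ne (sym (point⇒≡ {i = v} t)))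
    ... | inj₂ ¬t with point v i
    ...   | true = ⊥-elim (¬t tt)
    ...   | false = refl

    place-extends : ∀ v S → ¬ T (done S v) → Extends S (place v S)
    place-extends v S ¬d {i} {x} eq = trans (place-other v S λ { refl → ¬d (just-done S {v} {x} eq) }) eq

    place-done : ∀ v S i → done (place v S) i ≡ (done S ∪ point v) i
    place-done v S i with point v i
    ... | true = sym (∨-zeroʳ (done S i))
    ... | false = sym (∨-identityʳ (done S i))

    place-weight : ∀ v S → ¬ T (done S v) → weigh cost (done (place v S)) ≡ weigh cost (done S) + cost v
    place-weight v S ¬d = trans (∑-cong λ i → cong (λ b → when b (cost i)) (place-done v S i))
      (trans (weigh-∪-disjoint cost (done S) (point v) λ i d p → ¬d (subst (T ∘ done S) (sym (point⇒≡ {i = v} {i} p)) d))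
        (cong (weigh cost (done S) +_) (weigh-point cost v)))

    place-valid : ∀ {D} v S → Valid D S → ¬ T (done S v) → offset S + cost v ≤ D + D →
                  (∀ {u} → Edge u v → ∃[ x ] slots S u ≡ just x × ends u x ≤ base S + offset S) →
                  Valid D (place v S)
    place-valid {D} v S V ¬d fits preds = record
      { machine<  = machine< V
      ; offset≤   = fits
      ; slot<     = λ eq → case place-slots v S eq of λ { (inj₁ (refl , refl)) → machine< V ; (inj₂ (_ , eq′)) → slot< V eq′ }
      ; before    = λ eq lt → case place-slots v S eq of λ { (inj₁ (refl , refl)) → ⊥-elim (<-irrefl refl lt) ; (inj₂ (_ , eq′)) → before V eq′ lt }
      ; current   = λ eq same → case place-slots v S eq of λ
          { (inj₁ (refl , refl)) → ≤-reflexive (+-assoc (base S) (offset S) (cost v))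
          ; (inj₂ (_ , eq′)) → ≤-trans (current V eq′ same) (+-monoʳ-≤ (base S) (m≤m+n (offset S) (cost v))) }
      ; after     = λ eq gt → case place-slots v S eq of λ { (inj₁ (refl , refl)) → ⊥-elim (<-irrefl refl gt) ; (inj₂ (_ , eq′)) → after V eq′ gt }
      ; disjoint  = λ {i} {j} {x} {y} ne eqi eqj same → apart ne (place-slots v S eqi) (place-slots v S eqj) same
      ; preceding = λ {i} {j} {y} e eqj → earlier-slot e (place-slots v S eqj)
      }
      where
      apart : ∀ {i j x y} → i ≢ j → (i ≡ v × x ≡ (machine S , base S , offset S)) ⊎ (i ≢ v × slots S i ≡ just x) →
              (j ≡ v × y ≡ (machine S , base S , offset S)) ⊎ (j ≢ v × slots S j ≡ just y) → proj₁ x ≡ proj₁ y →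
              ends i x ≤ begins y ⊎ ends j y ≤ begins x
      apart ne (inj₁ (refl , _)) (inj₁ (refl , _)) same = ⊥-elim (ne refl)
      apart ne (inj₁ (refl , refl)) (inj₂ (_ , eqj)) same = inj₂ (current V eqj (sym same))
      apart ne (inj₂ (_ , eqi)) (inj₁ (refl , refl)) same = inj₁ (current V eqi same)
      apart ne (inj₂ (_ , eqi)) (inj₂ (_ , eqj)) same = disjoint V ne eqi eqj same
      earlier-slot : ∀ {i j y} → Edge i j → (j ≡ v × y ≡ (machine S , base S , offset S)) ⊎ (j ≢ v × slots S j ≡ just y) →
                     ∃[ x ] slots (place v S) i ≡ just x × ends i x ≤ begins y
      earlier-slot e (inj₁ (refl , refl)) = let x , eq , le = preds e in x , place-extends v S ¬d eq , le
      earlier-slot e (inj₂ (_ , eqj)) = let x , eq , le = preceding V e eqj in x , place-extends v S ¬d eq , le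

    advance-view : ∀ {D S} → Valid D S → 1 ≤ m → let S′ = advance D S in
      Valid D S′ × offset S′ ≤ D × base S ≤ base S′ × slots S′ ≡ slots S ×
      m * base S′ + (D + D) * machine S′ + (offset S′ + offset S′) ≤ m * base S + (D + D) * machine S + (offset S + offset S) ×
      (1 ≤ D → machine S ≡ 0 → offset S ≡ 0 → S′ ≡ S)
    advance-view {D} {S@(state b p r σ)} V m≥1 with D ≤ᵇ r in Dr
    ... | false = V , <⇒≤ (≰⇒> λ le → subst T Dr (≤⇒≤ᵇ le)) , ≤-refl , refl , ≤-refl , λ _ _ _ → refl
    ... | true with m ≤ᵇ suc p in mp
    ...   | true = fresh-row V m≥1 D , z≤n , m≤m+n b _ , refl , area , λ D≥1 _ r≡0 → ⊥-elim (<⇒≱ D≥1 (≤-trans D≤r (≤-reflexive r≡0)))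
      where
      D≤r : D ≤ r
      D≤r = ≤ᵇ⇒≤ D r (subst T (sym Dr) tt)
      area : m * (b + (D + D)) + (D + D) * 0 + 0 ≤ m * b + (D + D) * p + (r + r)
      area = begin
        m * (b + (D + D)) + (D + D) * 0 + 0   ≡⟨ sh m b D ⟩
        m * b + m * (D + D)                   ≤⟨ +-monoʳ-≤ (m * b) (*-monoˡ-≤ (D + D) (≤ᵇ⇒≤ m (suc p) (subst T (sym mp) tt))) ⟩
        m * b + (D + D + p * (D + D))         ≤⟨ +-monoʳ-≤ (m * b) (+-monoˡ-≤ (p * (D + D)) (+-mono-≤ D≤r D≤r)) ⟩
        m * b + (r + r + p * (D + D))         ≡⟨ sh₂ (m * b) r p D ⟩
        m * b + (D + D) * p + (r + r)         ∎
        where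
        sh : ∀ m b D → m * (b + (D + D)) + (D + D) * 0 + 0 ≡ m * b + m * (D + D)
        sh = solve-∀
        sh₂ : ∀ x r p D → x + (r + r + p * (D + D)) ≡ x + (D + D) * p + (r + r)
        sh₂ = solve-∀
    ...   | false = valid , z≤n , ≤-refl , refl , area , λ D≥1 _ r≡0 → ⊥-elim (<⇒≱ D≥1 (≤-trans D≤r (≤-reflexive r≡0)))
      where
      D≤r : D ≤ r
      D≤r = ≤ᵇ⇒≤ D r (subst T (sym Dr) tt)
      valid : Valid D (state b (suc p) 0 σ)
      valid = record
        { machine<  = ≰⇒> λ le → subst T mp (≤⇒≤ᵇ le)
        ; offset≤   = z≤n
        ; slot<     = slot< V
        ; before    = λ eq _ → by-end V eq
        ; current   = λ { eq refl → ≤-trans (after V eq ≤-refl) (m≤m+n b 0) }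
        ; after     = λ eq lt → after V eq (<-trans ≤-refl lt)
        ; disjoint  = disjoint V
        ; preceding = preceding V
        }
      area : m * b + (D + D) * suc p + 0 ≤ m * b + (D + D) * p + (r + r)
      area = begin
        m * b + (D + D) * suc p + 0           ≡⟨ sh (m * b) D p ⟩
        m * b + (D + D) * p + (D + D)         ≤⟨ +-monoʳ-≤ (m * b + (D + D) * p) (+-mono-≤ D≤r D≤r) ⟩
        m * b + (D + D) * p + (r + r)         ∎
        where
        sh : ∀ x D p → x + (D + D) * suc p + 0 ≡ x + (D + D) * p + (D + D)
        sh = solve-∀

    module Phase (m≥1 : 1 ≤ m) (C : Mask k) (D : ℕ) (D≥1 : 1 ≤ D) (elig : Mask k) (lo len : ℕ)
      (closed : ∀ {x y} → Edge x y → T (C y) → T (C x))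
      (stg-edge : ∀ {u v} → Edge u v → stg u ≤ stg v)
      (stg-chain : ∀ {h u v} → Edge u v → stg u ≡ stg v → stg v ≡ stg h → T (desc h v) → T (desc h u) ⊎ T (desc u h))
      (stg-cost : ∀ h (Z : Mask k) → (∀ x → T (Z x) → stg x ≡ stg h × T (desc h x) × T (elig x)) → weigh cost Z ≤ D)
      (stg-live : ∀ v → T (elig v) → lo ≤ stg v × stg v < lo + len)
      (stg< : ∀ v → stg v < k)
      where

      module Chunk (s : ℕ) (h : Fin k) (h∈s : stg h ≡ s) (S₀ S₁ : State k)
        (valid₀ : Valid D S₀) (row₀ : machine S₀ ≡ 0 × offset S₀ ≡ 0)
        (new₀ : ∀ x → T (C x) → ¬ T (done S₀ x) → T (elig x))
        (complete₀ : ∀ x → T (C x) → stg x < s → T (done S₀ x))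
        (valid₁ : Valid D S₁) (offset₁ : offset S₁ ≤ D) (base₁ : base S₀ ≤ base S₁) (ext₁ : Extends S₀ S₁)
        (heads : List (Fin k)) (heads-first : ∀ u → rank u < rank h → u ∈ heads)
        (from₁ : ∀ x → T (done S₁ x) → ¬ T (done S₀ x) → ∃[ h′ ] h′ ∈ heads × stg h′ ≡ s × T (desc h′ x))
        (visited₁ : ∀ h′ → h′ ∈ heads → stg h′ ≡ s → ∀ x → T (C x) → stg x ≡ s → T (desc h′ x) → T (done S₁ x))
        where

        record Inv (xs : List (Fin k)) (S : State k) : Set where
          field
            valid    : Valid D S
            same     : base S ≡ base S₁ × machine S ≡ machine S₁
            ext      : Extends S₁ S
            added    : ∀ {i x} → slots S i ≡ just x → ¬ T (done S₁ i) →
                       T (C i) × stg i ≡ s × T (desc h i) × proj₁ x ≡ machine S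
            weight   : offset S + weigh cost (done S₁) ≡ offset S₁ + weigh cost (done S)
            visited  : ∀ x → x ∈ xs → T (C x) → stg x ≡ s → T (desc h x) → T (done S x)
            idle     : slots S ≡ slots S₁ × offset S ≡ offset S₁ ⊎ lo ≤ s × s < lo + len

        open Inv

        visit-inv : ∀ xs v ys S → order ≡ xs ++ v ∷ ys → Inv xs S → Inv (xs ++ [ v ]) (visit C s h S v)
        visit-inv xs v ys S eq I with wanted C s h S v in weq
        ... | false = record
          { valid = valid I ; same = same I ; ext = ext I ; added = added I ; weight = weight I ; idle = idle I
          ; visited = λ x x∈ c sx d → case ∈-++⁻ xs x∈ of λ
              { (inj₁ x∈xs) → visited I x x∈xs c sx d
              ; (inj₂ (here refl)) → by-test (T⊎ (done S v)) c sx d } }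
          where
          by-test : T (done S v) ⊎ ¬ T (done S v) → T (C v) → stg v ≡ s → T (desc h v) → T (done S v)
          by-test (inj₁ d) _ _ _ = d
          by-test (inj₂ ¬d) c sx d = ⊥-elim (subst T weq (∧⁺ (not⁺ ¬d) (∧⁺ c (∧⁺ (≡⇒≡ᵇ (stg v) s sx) d))))
        ... | true = record
          { valid   = place-valid v S (valid I) ¬dv fits preds
          ; same    = same I
          ; ext     = λ e → place-extends v S ¬dv (ext I e)
          ; added   = λ {i} {x} e ¬d₁ → case place-slots v S e of λ
              { (inj₁ (refl , refl)) → cv , sv , dv , refl
              ; (inj₂ (_ , e′)) → added I e′ ¬d₁ }
          ; weight  = trans (sh (offset S) (cost v) (weigh cost (done S₁)))
                        (trans (cong (_+ cost v) (weight I))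
                          (trans (+-assoc (offset S₁) _ (cost v)) (cong (offset S₁ +_) (sym (place-weight v S ¬dv)))))
          ; visited = λ x x∈ c sx d → case ∈-++⁻ xs x∈ of λ
              { (inj₁ x∈xs) → extends-done S (place v S) (place-extends v S ¬dv) x (visited I x x∈xs c sx d)
              ; (inj₂ (here refl)) → just-done (place v S) (place-at v S) }
          ; idle    = inj₂ (subst (λ s → lo ≤ s × s < lo + len) sv (stg-live v ev))
          }
          where
          test : T (wanted C s h S v)
          test = subst T (sym weq) tt
          ¬dv : ¬ T (done S v)
          ¬dv = not⁻ (∧ˡ test)
          cv : T (C v)
          cv = ∧ˡ (∧ʳ {not (done S v)} test)
          sv : stg v ≡ s
          sv = ≡ᵇ⇒≡ (stg v) s (∧ˡ (∧ʳ {C v} (∧ʳ {not (done S v)} test)))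
          dv : T (desc h v)
          dv = ∧ʳ {stg v ≡ᵇ s} (∧ʳ {C v} (∧ʳ {not (done S v)} test))
          done₁⇒done : ∀ x → T (done S₁ x) → T (done S x)
          done₁⇒done = extends-done S₁ S (ext I)
          done₀⇒done₁ : ∀ x → T (done S₀ x) → T (done S₁ x)
          done₀⇒done₁ = extends-done S₀ S₁ ext₁
          ev : T (elig v)
          ev = new₀ v cv (λ d₀ → ¬dv (done₁⇒done v (done₀⇒done₁ v d₀)))
          sh : ∀ r c w → r + c + w ≡ r + w + c
          sh = solve-∀
          Z : Mask k
          Z x = (done S ∪ point v) x ∧ not (done S₁ x)
          Z-chunk : ∀ x → T (Z x) → stg x ≡ stg h × T (desc h x) × T (elig x)
          Z-chunk x t with ∨⁻ {done S x} (∧ˡ t)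
          ... | inj₂ p with refl ← point⇒≡ {i = v} {x} p = trans sv (sym h∈s) , dv , ev
          ... | inj₁ d =
            let y , e = done-just S d
                ¬d₁ = not⁻ (∧ʳ {(done S ∪ point v) x} t)
                c , sx , dx , _ = added I e ¬d₁
            in trans sx (sym h∈s) , dx , new₀ x c (λ d₀ → ¬d₁ (done₀⇒done₁ x d₀))
          Z-weight : weigh cost (done S₁) + weigh cost Z ≡ weigh cost (done S) + cost v
          Z-weight = trans (sym (weigh-∪-disjoint cost (done S₁) Z λ x d z → not⁻ (∧ʳ {(done S ∪ point v) x} z) d))
            (trans (∑-cong λ x → cong (λ b → when b (cost x)) (T-ext (to x) (from x))) (place-weight v S ¬dv))
            where
            to : ∀ x → T ((done S₁ ∪ Z) x) → T (done (place v S) x)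
            to x t with ∨⁻ {done S₁ x} t
            ... | inj₁ d = subst T (sym (place-done v S x)) (∨ˡ (done₁⇒done x d))
            ... | inj₂ z = subst T (sym (place-done v S x)) (∧ˡ z)
            from : ∀ x → T (done (place v S) x) → T ((done S₁ ∪ Z) x)
            from x t with T⊎ (done S₁ x)
            ... | inj₁ d = ∨ˡ d
            ... | inj₂ ¬d = ∨ʳ {done S₁ x} (∧⁺ (subst T (place-done v S x) t) (not⁺ ¬d))
          fits : offset S + cost v ≤ D + D
          fits = ≤-trans (combine _ (offset S₁ + weigh cost Z) (≤-reflexive (trans (weight I) refl))
              (trans (sh₂ (offset S) (cost v) (offset S₁) (weigh cost (done S)))
                (trans (cong (λ w → offset S + (offset S₁ + w)) (sym Z-weight)) (sh₃ (offset S) (offset S₁) (weigh cost (done S₁)) (weigh cost Z)))))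
            (+-mono-≤ offset₁ (stg-cost h Z Z-chunk))
            where
            sh₂ : ∀ r c r₁ w → r + c + (r₁ + w) ≡ r + (r₁ + (w + c))
            sh₂ = solve-∀
            sh₃ : ∀ r r₁ w z → r + (r₁ + (w + z)) ≡ r₁ + z + (r + w)
            sh₃ = solve-∀
          preds : ∀ {u} → Edge u v → ∃[ x ] slots S u ≡ just x × ends u x ≤ base S + offset S
          preds {u} e = decide (T⊎ (done S₀ u))
            where
            cu : T (C u)
            cu = closed e cv
            du : stg u ≡ s → T (done S u)
            du su with stg-chain e (trans su (sym sv)) (trans sv (sym h∈s)) dv
            ... | inj₁ hu = visited I u (earlier eq (rank-edge e)) cu su hu
            ... | inj₂ uh with rank-desc uh
            ...   | inj₁ refl = visited I u (earlier eq (rank-edge e)) cu su (desc-refl u)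
            ...   | inj₂ lt = ⊥-elim (¬dv (done₁⇒done v (visited₁ u (heads-first u lt) su v cv sv (desc-∷ e (desc-refl v)))))
            decide : T (done S₀ u) ⊎ ¬ T (done S₀ u) → ∃[ x ] slots S u ≡ just x × ends u x ≤ base S + offset S
            decide (inj₁ d₀) =
              let x , ex = done-just S₀ d₀
              in x , ext I (ext₁ ex) , ≤-trans (at-row valid₀ (proj₁ row₀) (proj₂ row₀) ex)
                   (≤-trans base₁ (≤-trans (≤-reflexive (sym (proj₁ (same I)))) (m≤m+n _ _)))
            decide (inj₂ ¬d₀) =
              let x , ex = done-just S (du su)
              in x , ex , current (valid I) ex (proj₂ (proj₂ (proj₂ (added I ex ¬d₁))))
              where
              su : stg u ≡ s
              su = ≤-antisym (≤-trans (stg-edge e) (≤-reflexive sv)) (≮⇒≥ λ lt → ¬d₀ (complete₀ u cu lt))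
              ¬d₁ : ¬ T (done S₁ u)
              ¬d₁ d₁ = let h′ , h′∈ , sh′ , d = from₁ u d₁ ¬d₀
                       in ¬dv (done₁⇒done v (visited₁ h′ h′∈ sh′ v cv sv (desc-∷ʳ d e)))

        result : Inv order (foldl (visit C s h) S₁ order)
        result = foldl-invariant Inv (visit C s h) order visit-inv [] order S₁ refl (record
          { valid = valid₁ ; same = refl , refl ; ext = λ e → e ; added = λ {i} e ¬d → ⊥-elim (¬d (just-done S₁ {i} e))
          ; weight = refl ; visited = λ x () ; idle = inj₁ (refl , refl) })

      module Stage (s : ℕ) (S₀ : State k)
        (valid₀ : Valid D S₀) (row₀ : machine S₀ ≡ 0 × offset S₀ ≡ 0)
        (new₀ : ∀ x → T (C x) → ¬ T (done S₀ x) → T (elig x))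
        (complete₀ : ∀ x → T (C x) → stg x < s → T (done S₀ x))
        (inside₀ : done S₀ ⊆ C) where

        area : State k → ℕ
        area S = m * base S + (D + D) * machine S + (offset S + offset S)

        record Inv (xs : List (Fin k)) (S : State k) : Set where
          field
            valid   : Valid D S
            floor   : base S₀ ≤ base S
            ext     : Extends S₀ S
            inside  : done S ⊆ C
            from    : ∀ x → T (done S x) → ¬ T (done S₀ x) → ∃[ h′ ] h′ ∈ xs × stg h′ ≡ s × T (desc h′ x)
            visited : ∀ h′ → h′ ∈ xs → stg h′ ≡ s → ∀ x → T (C x) → stg x ≡ s → T (desc h′ x) → T (done S x)
            areas   : area S + (weigh cost (done S₀) + weigh cost (done S₀)) ≤ area S₀ + (weigh cost (done S) + weigh cost (done S))
            idle    : S ≡ S₀ ⊎ lo ≤ s × s < lo + len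

        open Inv

        chunk-inv : ∀ xs h ys S → order ≡ xs ++ h ∷ ys → Inv xs S → Inv (xs ++ [ h ]) (chunk C D s S h)
        chunk-inv xs h ys S eq I with stg h ≡ᵇ s in seq
        ... | false = record
          { valid = valid I ; floor = floor I ; ext = ext I ; inside = inside I ; areas = areas I ; idle = idle I
          ; from = λ x d ¬d₀ → let h′ , h′∈ , r = from I x d ¬d₀ in h′ , ∈-++⁺ˡ h′∈ , r
          ; visited = λ h′ h′∈ sh → case ∈-++⁻ xs h′∈ of λ
              { (inj₁ h′∈xs) → visited I h′ h′∈xs sh
              ; (inj₂ (here refl)) → ⊥-elim (subst T seq (≡⇒≡ᵇ (stg h) s sh)) } }
        ... | true = go (advance D S) (advance-view (valid I) m≥1)
          where
          h∈s : stg h ≡ s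
          h∈s = ≡ᵇ⇒≡ (stg h) s (subst T (sym seq) tt)
          go : ∀ S₁ → Valid D S₁ × offset S₁ ≤ D × base S ≤ base S₁ × slots S₁ ≡ slots S × area S₁ ≤ area S ×
               (1 ≤ D → machine S ≡ 0 → offset S ≡ 0 → S₁ ≡ S) → Inv (xs ++ [ h ]) (foldl (visit C s h) S₁ order)
          go (state b p r σ) (valid₁ , offset₁ , base₁ , refl , area₁ , still) = record
            { valid   = Ch.valid
            ; floor   = ≤-trans floor₁ (≤-reflexive (sym (proj₁ Ch.same)))
            ; ext     = λ e → Ch.ext (ext I e)
            ; inside  = inside′
            ; from    = from′
            ; visited = λ h′ h′∈ sh x c sx d → case ∈-++⁻ xs h′∈ of λ
                { (inj₁ h′∈xs) → extends-done S₁ S₂ Ch.ext x (visited I h′ h′∈xs sh x c sx d)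
                ; (inj₂ (here refl)) → Ch.visited x (∈-order x) c sx d }
            ; areas   = areas′
            ; idle    = idle′
            }
            where
            S₁ = state b p r (slots S)
            S₂ = foldl (visit C s h) S₁ order
            floor₁ : base S₀ ≤ b
            floor₁ = ≤-trans (floor I) base₁
            ext₁ : Extends S₀ S₁
            ext₁ = ext I
            module Ch = Chunk.Inv (Chunk.result s h h∈s S₀ S₁ valid₀ row₀ new₀ complete₀ valid₁ offset₁ floor₁ ext₁ xs
              (λ u lt → earlier eq lt) (from I) (visited I))
            inside′ : done S₂ ⊆ C
            inside′ x d with T⊎ (done S x)
            ... | inj₁ d₁ = inside I x d₁
            ... | inj₂ ¬d₁ = let y , e = done-just S₂ d in proj₁ (Ch.added e ¬d₁)
            from′ : ∀ x → T (done S₂ x) → ¬ T (done S₀ x) → ∃[ h′ ] h′ ∈ xs ++ [ h ] × stg h′ ≡ s × T (desc h′ x)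
            from′ x d ¬d₀ with T⊎ (done S x)
            ... | inj₁ d₁ = let h′ , h′∈ , r = from I x d₁ ¬d₀ in h′ , ∈-++⁺ˡ h′∈ , r
            ... | inj₂ ¬d₁ = let y , e = done-just S₂ d
                                 _ , _ , dx , _ = Ch.added e ¬d₁
                             in h , ∈-++⁺ʳ xs (here refl) , h∈s , dx
            W₀ = weigh cost (done S₀)
            W₁ = weigh cost (done S)
            W₂ = weigh cost (done S₂)
            areas′ : area S₂ + (W₀ + W₀) ≤ area S₀ + (W₂ + W₂)
            areas′ = combine _ _ (+-mono-≤ (areas I) (+-mono-≤ area₁ (+-mono-≤ (≤-reflexive Ch.weight) (≤-reflexive Ch.weight))))
              (trans (cong₂ (λ b p → m * b + (D + D) * p + (offset S₂ + offset S₂) + (W₀ + W₀) +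
                        (area S₀ + (W₁ + W₁) + (area S + ((r + W₂) + (r + W₂))))) (proj₁ Ch.same) (proj₂ Ch.same))
                (sh (m * b + (D + D) * p) (offset S₂) W₀ (area S₀) W₁ (area S) r W₂))
              where
              sh : ∀ x o W₀ A₀ W₁ A r W₂ → x + (o + o) + (W₀ + W₀) + (A₀ + (W₁ + W₁) + (A + ((r + W₂) + (r + W₂)))) ≡
                   A₀ + (W₂ + W₂) + (A + (W₀ + W₀) + (x + (r + r) + ((o + W₁) + (o + W₁))))
              sh = solve-∀
            idle′ : S₂ ≡ S₀ ⊎ lo ≤ s × s < lo + len
            idle′ with idle I
            ... | inj₂ live = inj₂ live
            ... | inj₁ refl with still D≥1 (proj₁ row₀) (proj₂ row₀) | Ch.idle
            ...   | _ | inj₂ live = inj₂ live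
            ...   | refl | inj₁ (eσ , er) = inj₁ (same-state S₂ (proj₁ Ch.same) (proj₂ Ch.same) er eσ)
              where
              same-state : ∀ S₂ → base S₂ ≡ b → machine S₂ ≡ p → offset S₂ ≡ r → slots S₂ ≡ slots S → S₂ ≡ state b p r (slots S)
              same-state (state _ _ _ _) refl refl refl refl = refl

        end : Inv order (foldl (chunk C D s) S₀ order)
        end = foldl-invariant Inv (chunk C D s) order chunk-inv [] order S₀ refl (record
          { valid = valid₀ ; floor = ≤-refl ; ext = λ e → e ; inside = inside₀ ; from = λ x d ¬d → ⊥-elim (¬d d)
          ; visited = λ h′ () ; areas = ≤-refl ; idle = inj₁ refl })

      record Reached (S^ : State k) (s : ℕ) (S : State k) : Set where
        field
          valid    : Valid D S
          row      : machine S ≡ 0 × offset S ≡ 0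
          floor    : base S^ ≤ base S
          ext      : Extends S^ S
          inside   : done S ⊆ C
          complete : ∀ x → T (C x) → stg x < s → T (done S x)
          rows     : ℕ
          rows≤    : rows ≤ s ∸ lo × rows ≤ len
          areas    : m * base S + (weigh cost (done S^) + weigh cost (done S^)) ≤
                     m * base S^ + (weigh cost (done S) + weigh cost (done S)) + m * (D + D) * rows

      stage-reached : ∀ {S^ s S} → (∀ x → T (C x) → ¬ T (done S^ x) → T (elig x)) →
                      Reached S^ s S → Reached S^ (suc s) (stage C D S s)
      stage-reached {S^} {s} {S} new R = close (foldl (chunk C D s) S order) St.end
        where
        module R = Reached R
        new₀ : ∀ x → T (C x) → ¬ T (done S x) → T (elig x)
        new₀ x c ¬d = new x c λ d^ → ¬d (extends-done S^ S R.ext x d^)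
        module St = Stage s S R.valid R.row new₀ R.complete R.inside
        W^ = weigh cost (done S^)
        W = weigh cost (done S)
        area₀ : St.area S ≡ m * base S
        area₀ = trans (cong₂ (λ p r → m * base S + (D + D) * p + (r + r)) (proj₁ R.row) (proj₂ R.row))
          (trans (+-identityʳ _) (trans (cong (m * base S +_) (*-zeroʳ (D + D))) (+-identityʳ _)))
        close : ∀ S₂ → St.Inv order S₂ → Reached S^ (suc s) (newRow D S₂)
        close S₂@(state b p r σ) I = finish ((p ≤ᵇ 0) ∧ (r ≤ᵇ 0)) refl
          where
          module I = St.Inv I
          W₂ = weigh cost (done S₂)
          complete′ : ∀ x → T (C x) → stg x < suc s → T (done S₂ x)
          complete′ x c lt with m≤n⇒m<n∨m≡n (s≤s⁻¹ lt)
          ... | inj₁ lt′ = extends-done S S₂ I.ext x (R.complete x c lt′)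
          ... | inj₂ sx = I.visited x (∈-order x) sx x c sx (desc-refl x)
          areas₂ : m * b + (W + W) ≤ m * base S + (W₂ + W₂)
          areas₂ = begin
            m * b + (W + W)                ≤⟨ +-monoˡ-≤ (W + W) (≤-trans (m≤m+n (m * b) ((D + D) * p)) (m≤m+n _ (r + r))) ⟩
            St.area S₂ + (W + W)           ≤⟨ I.areas ⟩
            St.area S + (W₂ + W₂)          ≡⟨ cong (_+ (W₂ + W₂)) area₀ ⟩
            m * base S + (W₂ + W₂)         ∎
          sh : ∀ B W^ B^ W R B₀ W₂ X → B + X + (W^ + W^) + (B^ + (W + W) + R + (B₀ + (W₂ + W₂))) ≡
               B^ + (W₂ + W₂) + (X + R) + (B₀ + (W^ + W^) + (B + (W + W)))
          sh = solve-∀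
          finish : ∀ t → t ≡ (p ≤ᵇ 0) ∧ (r ≤ᵇ 0) → Reached S^ (suc s) (if t then S₂ else state (b + (D + D)) 0 0 σ)
          finish true eq = record
            { valid = I.valid ; row = n≤0⇒n≡0 (≤ᵇ⇒≤ p 0 (∧ˡ t)) , n≤0⇒n≡0 (≤ᵇ⇒≤ r 0 (∧ʳ {p ≤ᵇ 0} t))
            ; floor = ≤-trans R.floor I.floor ; ext = λ e → I.ext (R.ext e) ; inside = I.inside
            ; complete = complete′ ; rows = R.rows
            ; rows≤ = ≤-trans (proj₁ R.rows≤) (∸-monoˡ-≤ lo (n≤1+n s)) , proj₂ R.rows≤
            ; areas = combine _ _ (+-mono-≤ R.areas areas₂)
                (trans (cong (λ B → B + (W^ + W^) + (m * base S^ + (W + W) + m * (D + D) * R.rows + (m * base S + (W₂ + W₂))))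
                             (sym (+-identityʳ (m * b))))
                  (sh (m * b) W^ (m * base S^) W (m * (D + D) * R.rows) (m * base S) W₂ 0)) }
            where
            t : T ((p ≤ᵇ 0) ∧ (r ≤ᵇ 0))
            t = subst T eq tt
          finish false eq = record
            { valid = fresh-row I.valid m≥1 D ; row = refl , refl ; floor = ≤-trans R.floor (≤-trans I.floor (m≤m+n b _))
            ; ext = λ e → I.ext (R.ext e) ; inside = I.inside ; complete = complete′ ; rows = suc R.rows
            ; rows≤ = ≤-trans (s≤s (proj₁ R.rows≤)) (≤-reflexive (sym (+-∸-assoc 1 (proj₁ live)))) ,
                      ≤-trans (s≤s (proj₁ R.rows≤)) (≤-trans (≤-reflexive (sym (+-∸-assoc 1 (proj₁ live))))
                        (≤-trans (∸-monoˡ-≤ lo (proj₂ live)) (≤-reflexive (m+n∸m≡n lo len))))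
            ; areas = combine _ _ (+-mono-≤ R.areas areas₂)
                (trans (cong (λ B → B + (W^ + W^) + (m * base S^ + (W + W) + m * (D + D) * R.rows + (m * base S + (W₂ + W₂))))
                             (*-distribˡ-+ m b (D + D)))
                  (trans (sh (m * b) W^ (m * base S^) W (m * (D + D) * R.rows) (m * base S) W₂ (m * (D + D)))
                    (cong (λ X → m * base S^ + (W₂ + W₂) + X + (m * base S + (W^ + W^) + (m * b + (W + W))))
                          (sym (*-suc (m * (D + D)) R.rows))))) }
            where
            live : lo ≤ s × s < lo + len
            live with I.idle
            ... | inj₂ l = l
            ... | inj₁ refl = ⊥-elim (subst T (sym eq) (∧⁺ (≤⇒≤ᵇ (≤-reflexive (proj₁ R.row))) (≤⇒≤ᵇ (≤-reflexive (proj₂ R.row)))))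

      stages-reached : ∀ {S^} n s S → (∀ x → T (C x) → ¬ T (done S^ x) → T (elig x)) →
                       Reached S^ s S → Reached S^ (n + s) (stages C D s n S)
      stages-reached zero    s S new R = R
      stages-reached {S^} (suc n) s S new R =
        subst (λ t → Reached S^ t (stages C D (suc s) n (stage C D S s))) (+-suc n s)
          (stages-reached n (suc s) (stage C D S s) new (stage-reached new R))

      record Finished (S^ S : State k) : Set where
        field
          valid : Valid D S
          row   : machine S ≡ 0 × offset S ≡ 0
          floor : base S^ ≤ base S
          ext   : Extends S^ S
          done-≡ : ∀ x → done S x ≡ C x
          areas : m * base S + 2 * weigh cost (done S^) ≤ m * base S^ + 2 * weigh cost C + m * (2 * (D * len))

      phase-finished : ∀ S^ → Valid D S^ → machine S^ ≡ 0 × offset S^ ≡ 0 → done S^ ⊆ C →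
                       (∀ x → T (C x) → ¬ T (done S^ x) → T (elig x)) → Finished S^ (phase C D S^)
      phase-finished S^ V row inside new = record
        { valid = R.valid ; row = R.row ; floor = R.floor ; ext = R.ext ; done-≡ = done≡
        ; areas = begin
            m * base S + 2 * W^
              ≡⟨ sh₁ (m * base S) W^ ⟩
            m * base S + (W^ + W^)
              ≤⟨ R.areas ⟩
            m * base S^ + (weigh cost (done S) + weigh cost (done S)) + m * (D + D) * R.rows
              ≤⟨ +-mono-≤ (+-monoʳ-≤ (m * base S^) (+-mono-≤ done≤ done≤)) (*-monoʳ-≤ (m * (D + D)) (proj₂ R.rows≤)) ⟩
            m * base S^ + (weigh cost C + weigh cost C) + m * (D + D) * len
              ≡⟨ sh₂ (m * base S^) (weigh cost C) m D len ⟩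
            m * base S^ + 2 * weigh cost C + m * (2 * (D * len)) ∎ }
        where
        S = phase C D S^
        W^ = weigh cost (done S^)
        begun : Reached S^ 0 S^
        begun = record
          { valid = V ; row = row ; floor = ≤-refl ; ext = λ e → e ; inside = inside ; complete = λ x c () ; rows = 0
          ; rows≤ = z≤n , z≤n ; areas = m≤m+n _ _ }
        module R = Reached (stages-reached {S^} k 0 S^ new begun)
        done≡ : ∀ x → done S x ≡ C x
        done≡ x = T-ext (R.inside x) λ c → R.complete x c (≤-trans (stg< x) (≤-reflexive (sym (+-identityʳ k))))
        done≤ : weigh cost (done S) ≤ weigh cost C
        done≤ = weigh-mono cost {done S} {C} R.inside
        sh₁ : ∀ x w → x + 2 * w ≡ x + (w + w)
        sh₁ = solve-∀
        sh₂ : ∀ x w m D l → x + (w + w) + m * (D + D) * l ≡ x + 2 * w + m * (2 * (D * l))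
        sh₂ = solve-∀

module LowerBounds where

  open Families using (∑; when; point)
  open Masks
  open import Data.Bool using (Bool; true; false; T; _∧_; if_then_else_)
  open import Data.Empty using (⊥-elim)
  open import Data.Fin using (Fin; zero; suc; toℕ)
  open import Data.Fin.Subset using (_∈_)
  open import Data.Fin.Subset.Properties using (_∈?_)
  open import Data.List using (List; []; _∷_; allFin; mapMaybe)
  import Data.List.Membership.Propositional as List
  open import Data.List.Membership.Propositional.Properties using (∈-allFin)
  open import Data.List.Relation.Unary.Any using (here; there)
  open import Data.Maybe using (Maybe; just; nothing)
  open import Data.Maybe.Properties using (just-injective)
  open import Data.Nat using (ℕ; zero; suc; _+_; _*_; _≤_; _<_; _<ᵇ_; _≤ᵇ_; z≤n; s≤s; s≤s⁻¹)
  open import Data.Nat.Properties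
  open import Data.Product using (_×_; _,_; ∃-syntax)
  open import Data.Sum using (inj₁; inj₂)
  open import Data.Unit using (tt)
  open import Data.Vec using (lookup)
  open import Data.Vec.Properties using ([]=⇒lookup; lookup⇒[]=)
  open import Relation.Binary.Construct.Closure.Transitive using ([_]; _∷_)
  open import Relation.Binary.PropositionalEquality using (_≡_; refl; sym; trans; cong; subst)
  open import Relation.Nullary using (does; yes; no)

  open ≤-Reasoning

  earliest-≤ : ∀ {t ts} → t List.∈ ts → earliest ts ≤ t
  earliest-≤ {ts = t ∷ []}     (here refl) = ≤-refl
  earliest-≤ {ts = t ∷ s ∷ ts} (here refl) = m⊓n≤m t (earliest (s ∷ ts))
  earliest-≤ {ts = t ∷ s ∷ ts} (there t∈)  = ≤-trans (m⊓n≤n t (earliest (s ∷ ts))) (earliest-≤ t∈)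

  earliest-∈ : ∀ t ts → earliest (t ∷ ts) List.∈ (t ∷ ts)
  earliest-∈ t []       = here refl
  earliest-∈ t (s ∷ ts) with ⊓-sel t (earliest (s ∷ ts))
  ... | inj₁ eq = here eq
  ... | inj₂ eq = subst (List._∈ t ∷ s ∷ ts) (sym eq) (there (earliest-∈ s ts))

  ∈-mapMaybe⁺ : ∀ {A B : Set} (f : A → Maybe B) {x y xs} → x List.∈ xs → f x ≡ just y → y List.∈ mapMaybe f xs
  ∈-mapMaybe⁺ f {xs = x ∷ xs} (here refl) eq with f x | eq
  ... | just _ | refl = here refl
  ∈-mapMaybe⁺ f {xs = x ∷ xs} (there x∈) eq with f x
  ... | just _  = there (∈-mapMaybe⁺ f x∈ eq)
  ... | nothing = ∈-mapMaybe⁺ f x∈ eq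

  ∈-mapMaybe⁻ : ∀ {A B : Set} (f : A → Maybe B) {y} xs → y List.∈ mapMaybe f xs → ∃[ x ] f x ≡ just y
  ∈-mapMaybe⁻ f (x ∷ xs) y∈ with f x in eq
  ∈-mapMaybe⁻ f (x ∷ xs) y∈ | nothing = ∈-mapMaybe⁻ f xs y∈
  ∈-mapMaybe⁻ f (x ∷ xs) (here refl) | just _ = x , eq
  ∈-mapMaybe⁻ f (x ∷ xs) (there y∈) | just _ = ∈-mapMaybe⁻ f xs y∈

  module _ (I : Instance) where
    open Instance I

    incidence : Fin k → Fin n → Bool
    incidence i u = lookup (sets i) u

    ∈⇒incidence : ∀ {i u} → u ∈ sets i → T (incidence i u)
    ∈⇒incidence {i} {u} u∈ = subst T (sym ([]=⇒lookup u∈)) tt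

    incidence⇒∈ : ∀ {i u} → T (incidence i u) → u ∈ sets i
    incidence⇒∈ {i} {u} t = lookup⇒[]= u (sets i) (T⇒≡ t)
      where
      T⇒≡ : ∀ {b} → T b → b ≡ true
      T⇒≡ {true} _ = refl

    time : Schedule I → Fin n → Fin k → Maybe ℕ
    time σ u i = if does (u ∈? sets i) then completion I σ i else nothing

    coveringTime-≤ : ∀ σ {u i p s} → u ∈ sets i → σ i ≡ just (p , s) → coveringTime I σ u ≤ s + cost i
    coveringTime-≤ σ {u} {i} {p} {s} u∈ eq = earliest-≤ (∈-mapMaybe⁺ (time σ u) (∈-allFin i) at)
      where
      at : time σ u i ≡ just (s + cost i)
      at with u ∈? sets i
      ... | no u∉ = ⊥-elim (u∉ u∈)
      ... | yes _ rewrite eq = refl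

    coveringTime-attained : ∀ σ → Feasible I σ → ∀ u →
      ∃[ i ] ∃[ p ] ∃[ s ] u ∈ sets i × σ i ≡ just (p , s) × coveringTime I σ u ≡ s + cost i
    coveringTime-attained σ feasible u = attained (mapMaybe (time σ u) (allFin k)) refl
      where
      attained : ∀ ts → mapMaybe (time σ u) (allFin k) ≡ ts →
                 ∃[ i ] ∃[ p ] ∃[ s ] u ∈ sets i × σ i ≡ just (p , s) × coveringTime I σ u ≡ s + cost i
      attained [] eq with Feasible.covers feasible u
      ... | i , u∈ , (p , s) , σi with ∈-mapMaybe⁺ (time σ u) (∈-allFin i) at
        where
        at : time σ u i ≡ just (s + cost i)
        at with u ∈? sets i
        ... | no u∉ = ⊥-elim (u∉ u∈)
        ... | yes _ rewrite σi = refl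
      ... | t∈ with () ← subst (_ List.∈_) eq t∈
      attained (t ∷ ts) eq with ∈-mapMaybe⁻ (time σ u) {earliest (t ∷ ts)} (allFin k) (subst (_ List.∈_) (sym eq) (earliest-∈ t ts))
      ... | i , ti with u ∈? sets i
      ... | yes u∈ with σ i in σi
      ... | just (p , s) = i , p , s , u∈ , σi , trans (cong earliest eq) (sym (just-injective ti))

    completedBy : Schedule I → ℕ → Mask k
    completedBy τ t i with τ i
    ... | nothing      = false
    ... | just (p , s) = s + cost i ≤ᵇ t

    completed⁻ : ∀ τ t i → T (completedBy τ t i) → ∃[ p ] ∃[ s ] τ i ≡ just (p , s) × s + cost i ≤ t
    completed⁻ τ t i c with τ i
    ... | just (p , s) = p , s , refl , ≤ᵇ⇒≤ (s + cost i) t c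

    completed⁺ : ∀ τ t {i p s} → τ i ≡ just (p , s) → s + cost i ≤ t → T (completedBy τ t i)
    completed⁺ τ t {i} eq le with τ i | eq
    ... | just _ | refl = ≤⇒≤ᵇ le

    completed-closed : ∀ τ → Feasible I τ → ∀ t {x y} → Edge x y → T (completedBy τ t y) → T (completedBy τ t x)
    completed-closed τ feasible t {x} {y} e c =
      let q , s′ , τy , le = completed⁻ τ t y c
          p , s , τx , le′ = Feasible.precedences feasible [ e ] τy
      in completed⁺ τ t τx (≤-trans le′ (≤-trans (m≤m+n s′ (cost y)) le))

    interval : ∀ s c l → s + c ≤ l → c ≤ ∑ {l} (λ t → when ((s ≤ᵇ toℕ t) ∧ (toℕ t <ᵇ s + c)) 1)
    interval zero    zero    l       le = z≤n
    interval zero    (suc c) (suc l) le = s≤s (interval zero c l (s≤s⁻¹ le))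
    interval (suc s) c       (suc l) le = ≤-trans (interval s c l (s≤s⁻¹ le)) (∑-mono {l} λ t →
      when-mono {(s ≤ᵇ toℕ t) ∧ (toℕ t <ᵇ s + c)} {(s <ᵇ suc (toℕ t)) ∧ (toℕ t <ᵇ s + c)} λ h → ∧⁺ (≤⇒≤ᵇ (s≤s (≤ᵇ⇒≤ s (toℕ t) (∧ˡ h)))) (∧ʳ {s ≤ᵇ toℕ t} h))

    completed-cost : ∀ τ → Feasible I τ → ∀ t → weigh cost (completedBy τ t) ≤ m * t
    completed-cost τ feasible l = begin
      ∑ (λ i → when (completedBy τ l i) (cost i))         ≤⟨ ∑-mono occupies ⟩
      ∑ (λ i → ∑ {l} (λ t → when (busy i t) 1))           ≡⟨ ∑-swap (λ i t → when (busy i t) 1) ⟩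
      ∑ {l} (λ t → ∑ (λ i → when (busy i t) 1))           ≤⟨ ∑-mono spread ⟩
      ∑ {l} (λ t → ∑ (λ i → ∑ (λ q → when (on i q t) 1))) ≡⟨ ∑-cong (λ t → ∑-swap (λ i q → when (on i q t) 1)) ⟩
      ∑ {l} (λ t → ∑ (λ q → ∑ (λ i → when (on i q t) 1))) ≤⟨ ∑-mono (λ t → ∑-mono {m} λ q → ∑-unique (λ i → on i q t) 1 (one q t)) ⟩
      ∑ {l} (λ t → ∑ {m} (λ q → 1))                       ≡⟨ ∑-cong {l} (λ t → trans (∑-const m 1) (*-identityʳ m)) ⟩
      ∑ {l} (λ t → m)                                     ≡⟨ trans (∑-const l m) (*-comm l m) ⟩
      m * l                                               ∎
      where
      within : ℕ → ℕ → Fin l → Bool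
      within s c t = (s + c ≤ᵇ l) ∧ ((s ≤ᵇ toℕ t) ∧ (toℕ t <ᵇ s + c))
      busy : Fin k → Fin l → Bool
      busy i t with τ i
      ... | nothing      = false
      ... | just (p , s) = within s (cost i) t
      on : Fin k → Fin m → Fin l → Bool
      on i q t with τ i
      ... | nothing      = false
      ... | just (p , s) = point p q ∧ within s (cost i) t
      occupies : ∀ i → when (completedBy τ l i) (cost i) ≤ ∑ (λ t → when (busy i t) 1)
      occupies i with τ i
      ... | nothing = z≤n
      ... | just (p , s) with T⊎ (s + cost i ≤ᵇ l)
      ...   | inj₂ ¬c = ≤-trans (≤-reflexive (when-false (cost i) ¬c)) z≤n
      ...   | inj₁ c = ≤-trans (when-≤ (s + cost i ≤ᵇ l) (cost i)) (≤-trans (interval s (cost i) l (≤ᵇ⇒≤ _ l c))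
                (∑-mono {l} λ t → when-mono {(s ≤ᵇ toℕ t) ∧ (toℕ t <ᵇ s + cost i)} {within s (cost i) t} λ h → ∧⁺ c h))
      spread : ∀ t → ∑ (λ i → when (busy i t) 1) ≤ ∑ (λ i → ∑ (λ q → when (on i q t) 1))
      spread t = ∑-mono at
        where
        at : ∀ i → when (busy i t) 1 ≤ ∑ (λ q → when (on i q t) 1)
        at i with τ i
        ... | nothing = z≤n
        ... | just (p , s) = ≤-trans (when-mono {within s (cost i) t} {point p p ∧ within s (cost i) t} λ h → ∧⁺ (point-refl p) h) (∑-≥ (λ q → when (point p q ∧ within s (cost i) t) 1) p)
      on⁻ : ∀ i q t → T (on i q t) → ∃[ s ] τ i ≡ just (q , s) × s ≤ toℕ t × toℕ t < s + cost i
      on⁻ i q t h with τ i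
      ... | just (p , s) with refl ← point⇒≡ {i = p} {q} (∧ˡ h) =
        let h′ = ∧ʳ {s + cost i ≤ᵇ l} (∧ʳ {point p q} h)
        in s , refl , ≤ᵇ⇒≤ s (toℕ t) (∧ˡ h′) , <ᵇ⇒< (toℕ t) (s + cost i) (∧ʳ {s ≤ᵇ toℕ t} h′)
      one : ∀ q t i j → T (on i q t) → T (on j q t) → i ≡ j
      one q t i j hi hj with T⊎ (point i j)
      ... | inj₁ p = point⇒≡ {i = i} p
      ... | inj₂ ¬p with on⁻ i q t hi | on⁻ j q t hj
      ... | s , τi , s≤ , <s | s′ , τj , s′≤ , <s′
        with Feasible.no-overlap feasible (λ { refl → ¬p (point-refl i) }) τi τj
      ... | inj₁ le = ⊥-elim (<⇒≱ <s (≤-trans le s′≤))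
      ... | inj₂ le = ⊥-elim (<⇒≱ <s′ (≤-trans le s≤))

module Accounting where

  open Families using (∑; when)
  open Masks
  open import Data.Bool using (Bool; true; false; T; not)
  open import Data.Empty using (⊥-elim)
  open import Data.Fin using (Fin; zero; suc)
  open import Data.Nat using (ℕ; zero; suc; _+_; _*_; _^_; _≤_; _<ᵇ_; z≤n)
  open import Data.Nat.Properties
  open import Data.Nat.Tactic.RingSolver using (solve-∀)
  open import Data.Sum using (inj₁; inj₂)
  open import Function using (_∘_)
  open import Relation.Binary.PropositionalEquality using (_≡_; refl; sym; trans; cong; cong₂)
  open import Relation.Nullary using (¬_)

  open ≤-Reasoning

  sumTo : (ℕ → ℕ) → ℕ → ℕ
  sumTo f zero    = 0
  sumTo f (suc j) = sumTo f j + f j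

  sumTo-mono : ∀ {f g} j → (∀ i → f i ≤ g i) → sumTo f j ≤ sumTo g j
  sumTo-mono zero    le = z≤n
  sumTo-mono (suc j) le = +-mono-≤ (sumTo-mono j le) (le j)

  sumTo-+ : ∀ f g j → sumTo (λ i → f i + g i) j ≡ sumTo f j + sumTo g j
  sumTo-+ f g zero    = refl
  sumTo-+ f g (suc j) = trans (cong (_+ (f j + g j)) (sumTo-+ f g j)) (sh (sumTo f j) (sumTo g j) (f j) (g j))
    where
    sh : ∀ a b c d → (a + b) + (c + d) ≡ (a + c) + (b + d)
    sh = solve-∀

  sumTo-* : ∀ c f j → sumTo (λ i → c * f i) j ≡ c * sumTo f j
  sumTo-* c f zero    = sym (*-zeroʳ c)
  sumTo-* c f (suc j) = trans (cong (_+ c * f j) (sumTo-* c f j)) (sym (*-distribˡ-+ c (sumTo f j) (f j)))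

  sumTo-head : ∀ f j → sumTo f (suc j) ≡ f 0 + sumTo (f ∘ suc) j
  sumTo-head f zero    = +-comm 0 (f 0)
  sumTo-head f (suc j) = trans (cong (_+ f (suc j)) (sumTo-head f j)) (+-assoc (f 0) _ _)

  ∑-sumTo : ∀ {n} (f : Fin n → ℕ → ℕ) j → ∑ (λ u → sumTo (f u) j) ≡ sumTo (λ i → ∑ (λ u → f u i)) j
  ∑-sumTo {n} f zero    = ∑-zero {n}
  ∑-sumTo {n} f (suc j) = trans (∑-+ (λ u → sumTo (f u) j) (λ u → f u j)) (cong (_+ ∑ (λ u → f u j)) (∑-sumTo f j))

  powers-below : ∀ c j → sumTo (λ i → when (2 ^ i <ᵇ c) (2 ^ i)) j ≤ 2 * c
  powers-below c zero    = z≤n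
  powers-below c (suc j) with T⊎ (2 ^ j <ᵇ c)
  ... | inj₂ ¬t = ≤-trans (≤-reflexive (trans (cong (sumTo _ j +_) (when-false (2 ^ j) ¬t)) (+-identityʳ _))) (powers-below c j)
  ... | inj₁ t = begin
    sumTo (λ i → when (2 ^ i <ᵇ c) (2 ^ i)) j + when (2 ^ j <ᵇ c) (2 ^ j)
      ≤⟨ +-mono-≤ (sumTo-mono j (λ i → when-≤ (2 ^ i <ᵇ c) (2 ^ i))) (when-≤ (2 ^ j <ᵇ c) (2 ^ j)) ⟩
    sumTo (2 ^_) j + 2 ^ j
      ≤⟨ +-monoˡ-≤ (2 ^ j) (≤-trans (n≤1+n _) (geometric j)) ⟩
    2 ^ j + 2 ^ j
      ≤⟨ +-mono-≤ lt (≤-trans lt (m≤m+n c 0)) ⟩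
    2 * c ∎
    where
    lt : 2 ^ j ≤ c
    lt = <⇒≤ (<ᵇ⇒< (2 ^ j) c t)
    geometric : ∀ j → suc (sumTo (2 ^_) j) ≤ 2 ^ j
    geometric zero    = ≤-refl
    geometric (suc j) = ≤-trans (+-monoˡ-≤ (2 ^ j) (geometric j)) (≤-reflexive (cong (2 ^ j +_) (sym (+-identityʳ (2 ^ j)))))

  -- An element not covered in the first j phases is charged 2, 4, …, 2^j.
  charges : ∀ (c : ℕ → Bool) j → (∀ i → T (c i) → T (c (suc i))) → ¬ T (c j) →
            2 ^ suc j ≤ 2 + sumTo (λ i → when (not (c (suc i))) (2 ^ suc i)) j
  charges c zero    up ¬c = ≤-refl
  charges c (suc j) up ¬c = begin
    2 ^ suc j + (2 ^ suc j + 0)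
      ≡⟨ cong (2 ^ suc j +_) (+-identityʳ _) ⟩
    2 ^ suc j + 2 ^ suc j
      ≤⟨ +-mono-≤ (charges c j up (¬c ∘ up j)) (≤-reflexive (sym (when-true (2 ^ suc j) (not⁺ ¬c)))) ⟩
    2 + sumTo _ j + when (not (c (suc j))) (2 ^ suc j)
      ≡⟨ +-assoc 2 (sumTo (λ i → when (not (c (suc i))) (2 ^ suc i)) j) _ ⟩
    2 + sumTo (λ i → when (not (c (suc i))) (2 ^ suc i)) (suc j) ∎

  charged : ∀ (c : ℕ → Bool) ρ t j → (∀ i → T (c i) → T (c (suc i))) → ¬ T (c 0) →
            (∀ i → T (c (suc i)) → t ≤ ρ * 2 ^ suc i) → T (c j) →
            t ≤ ρ * (2 + sumTo (λ i → when (not (c (suc i))) (2 ^ suc i)) j)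
  charged c ρ t zero    up ¬c₀ late cj = ⊥-elim (¬c₀ cj)
  charged c ρ t (suc j) up ¬c₀ late cj with T⊎ (c j)
  ... | inj₁ c′ = ≤-trans (charged c ρ t j up ¬c₀ late c′) (*-monoʳ-≤ ρ (+-monoʳ-≤ 2 (m≤m+n _ _)))
  ... | inj₂ ¬c′ = ≤-trans (late j cj) (*-monoʳ-≤ ρ (≤-trans (charges c j up ¬c′) (+-monoʳ-≤ 2 (m≤m+n _ _))))

  module Account {n} (w t t* : Fin n → ℕ) (c : ℕ → Mask n) (ρ J : ℕ)
    (t*≥1 : ∀ u → 1 ≤ t* u)
    (start : ∀ u → ¬ T (c 0 u)) (up : ∀ i → c i ⊆ c (suc i)) (finish : ∀ u → T (c J u))
    (late : ∀ i u → T (c (suc i) u) → t u ≤ ρ * 2 ^ suc i)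
    (shrink : ∀ i → 8 * weigh w (not ∘ c (suc i)) ≤ weigh w (not ∘ c i) + 8 * weigh w (λ u → 2 ^ i <ᵇ t* u))
    where

    U O : ℕ → ℕ
    U i = weigh w (not ∘ c i)
    O i = weigh w (λ u → 2 ^ i <ᵇ t* u)

    opt W s : ℕ
    opt = ∑ (λ u → w u * t* u)
    W = ∑ w
    s = sumTo (λ i → 2 ^ suc i * U (suc i)) J

    when-* : ∀ b x y → x * when b y ≡ y * when b x
    when-* true  x y = *-comm x y
    when-* false x y = trans (*-zeroʳ x) (sym (*-zeroʳ y))

    W≤opt : W ≤ opt
    W≤opt = ∑-mono λ u → ≤-trans (≤-reflexive (sym (*-identityʳ (w u)))) (*-monoʳ-≤ (w u) (t*≥1 u))

    O≤ : sumTo (λ i → 2 ^ i * O i) J ≤ 2 * opt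
    O≤ = begin
      sumTo (λ i → 2 ^ i * O i) J
        ≤⟨ sumTo-mono J (λ i → ≤-reflexive (trans (sym (∑-* (2 ^ i) (λ u → when (2 ^ i <ᵇ t* u) (w u))))
             (∑-cong λ u → when-* (2 ^ i <ᵇ t* u) (2 ^ i) (w u)))) ⟩
      sumTo (λ i → ∑ (λ u → w u * when (2 ^ i <ᵇ t* u) (2 ^ i))) J
        ≡⟨ ∑-sumTo (λ u i → w u * when (2 ^ i <ᵇ t* u) (2 ^ i)) J ⟨
      ∑ (λ u → sumTo (λ i → w u * when (2 ^ i <ᵇ t* u) (2 ^ i)) J)
        ≤⟨ ∑-mono (λ u → ≤-trans (≤-reflexive (sumTo-* (w u) _ J)) (*-monoʳ-≤ (w u) (powers-below (t* u) J))) ⟩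
      ∑ (λ u → w u * (2 * t* u))
        ≡⟨ ∑-cong (λ u → sh (w u) (t* u)) ⟩
      ∑ (λ u → 2 * (w u * t* u))
        ≡⟨ ∑-* 2 (λ u → w u * t* u) ⟩
      2 * opt ∎
      where
      sh : ∀ a b → a * (2 * b) ≡ 2 * (a * b)
      sh = solve-∀

    4s≤ : 4 * s ≤ W + s + 16 * opt
    4s≤ = begin
      4 * s
        ≡⟨ sumTo-* 4 (λ i → 2 ^ suc i * U (suc i)) J ⟨
      sumTo (λ i → 4 * (2 ^ suc i * U (suc i))) J
        ≤⟨ sumTo-mono J (λ i → ≤-trans (≤-reflexive (sh (2 ^ i) (U (suc i))))
             (≤-trans (*-monoʳ-≤ (2 ^ i) (shrink i)) (≤-reflexive (sh₂ (2 ^ i) (U i) (O i))))) ⟩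
      sumTo (λ i → 2 ^ i * U i + 8 * (2 ^ i * O i)) J
        ≡⟨ trans (sumTo-+ (λ i → 2 ^ i * U i) (λ i → 8 * (2 ^ i * O i)) J)
             (cong (sumTo (λ i → 2 ^ i * U i) J +_) (sumTo-* 8 (λ i → 2 ^ i * O i) J)) ⟩
      sumTo (λ i → 2 ^ i * U i) J + 8 * sumTo (λ i → 2 ^ i * O i) J
        ≤⟨ +-mono-≤ (≤-trans (m≤m+n _ (2 ^ J * U J)) (≤-trans (≤-reflexive (sumTo-head (λ i → 2 ^ i * U i) J))
             (+-monoˡ-≤ s (≤-trans (≤-reflexive (*-identityˡ (U 0))) (weigh-≤ w (not ∘ c 0)))))) (*-monoʳ-≤ 8 O≤) ⟩
      W + s + 8 * (2 * opt)
        ≡⟨ cong (W + s +_) (*-assoc 8 2 opt) ⟨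
      W + s + 16 * opt ∎
      where
      sh : ∀ p u → 4 * (2 * p * u) ≡ p * (8 * u)
      sh = solve-∀
      sh₂ : ∀ p u o → p * (u + 8 * o) ≡ p * u + 8 * (p * o)
      sh₂ = solve-∀

    s≤ : s ≤ 6 * opt
    s≤ = *-cancelˡ-≤ 3 (combine (3 * s) (3 * (6 * opt)) (+-mono-≤ 4s≤ (+-mono-≤ W≤opt (m≤m+n (17 * opt) opt))) (sh s W opt))
      where
      sh : ∀ s W o → 3 * s + (W + s + 16 * o + (o + (17 * o + o))) ≡ 3 * (6 * o) + (4 * s + (W + 17 * o))
      sh = solve-∀

    total-cost : ∑ (λ u → w u * t u) ≤ 8 * ρ * opt
    total-cost = begin
      ∑ (λ u → w u * t u)
        ≤⟨ ∑-mono (λ u → *-monoʳ-≤ (w u) (charged (λ i → c i u) ρ (t u) J (λ i → up i u) (start u) (λ i → late i u) (finish u))) ⟩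
      ∑ (λ u → w u * (ρ * (2 + charge u)))
        ≡⟨ ∑-cong (λ u → sh (w u) ρ (charge u)) ⟩
      ∑ (λ u → ρ * (2 * w u + w u * charge u))
        ≡⟨ trans (∑-* ρ (λ u → 2 * w u + w u * charge u)) (cong (ρ *_) (trans (∑-+ (λ u → 2 * w u) (λ u → w u * charge u)) (cong₂ _+_ (∑-* 2 w) swap))) ⟩
      ρ * (2 * W + s)
        ≤⟨ *-monoʳ-≤ ρ (+-mono-≤ (*-monoʳ-≤ 2 W≤opt) s≤) ⟩
      ρ * (2 * opt + 6 * opt)
        ≡⟨ sh₂ ρ opt ⟩
      8 * ρ * opt ∎
      where
      charge : Fin n → ℕ
      charge u = sumTo (λ i → when (not (c (suc i) u)) (2 ^ suc i)) J
      sh : ∀ w ρ x → w * (ρ * (2 + x)) ≡ ρ * (2 * w + w * x)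
      sh = solve-∀
      sh₂ : ∀ ρ o → ρ * (2 * o + 6 * o) ≡ 8 * ρ * o
      sh₂ = solve-∀
      swap : ∑ (λ u → w u * charge u) ≡ s
      swap = trans (∑-cong λ u → sym (sumTo-* (w u) _ J))
        (trans (∑-sumTo (λ u i → w u * when (not (c (suc i) u)) (2 ^ suc i)) J)
          (sumTo-cong J λ i → trans (∑-cong λ u → when-* (not (c (suc i) u)) (w u) (2 ^ suc i)) (∑-* (2 ^ suc i) (λ u → when (not (c (suc i) u)) (w u)))))
        where
        sumTo-cong : ∀ {f g} j → (∀ i → f i ≡ g i) → sumTo f j ≡ sumTo g j
        sumTo-cong zero    eq = refl
        sumTo-cong (suc j) eq = cong₂ _+_ (sumTo-cong j eq) (eq j)

module Phases where

  open Families using (∑; when)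
  open Masks
  open Digraphs
  open Scheduling
  open LowerBounds
  open Accounting
  open import Data.Bool using (true; false; T; not)
  open import Data.Empty using (⊥-elim)
  open import Data.Fin using (Fin; zero; suc; toℕ; fromℕ<)
  open import Data.Fin.Properties using (toℕ-fromℕ<)
  open import Data.Fin.Subset using (_∈_)
  open import Data.Maybe using (Maybe; just; nothing; _>>=_)
  open import Data.Nat using (ℕ; zero; suc; _+_; _*_; _^_; _⊔_; _≤_; _<_; _<ᵇ_; z≤n; s≤s; >-nonZero)
  open import Data.Nat.Properties
  open import Data.Nat.Tactic.RingSolver using (solve-∀)
  open import Data.Product using (_×_; _,_; ∃-syntax; proj₁; proj₂)
  open import Data.Sum using (_⊎_; inj₁; inj₂)
  open import Data.Unit using (tt)
  open import Function using (_∘_)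
  open import Relation.Binary.Construct.Closure.Transitive using ([_]; _∷_)
  open import Relation.Binary.PropositionalEquality using (_≡_; refl; sym; trans; cong; subst; subst₂)
  open import Relation.Nullary using (¬_; yes; no)

  open ≤-Reasoning

  onMachine : ∀ {m} → Slot → Maybe (Fin m × ℕ)
  onMachine {m} x with proj₁ x <? m
  ... | yes lt = just (fromℕ< lt , begins x)
  ... | no _   = nothing

  onMachine⁺ : ∀ {m} x → proj₁ x < m → ∃[ p ] onMachine {m} x ≡ just (p , begins x) × toℕ p ≡ proj₁ x
  onMachine⁺ {m} x lt with proj₁ x <? m
  ... | yes lt′ = fromℕ< lt′ , refl , toℕ-fromℕ< lt′
  ... | no ¬lt = ⊥-elim (¬lt lt)

  onMachine⁻ : ∀ {m} x {p s} → onMachine {m} x ≡ just (p , s) → toℕ p ≡ proj₁ x × s ≡ begins x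
  onMachine⁻ {m} x eq with proj₁ x <? m
  onMachine⁻ {m} x refl | yes lt = toℕ-fromℕ< lt , refl

  module Algorithm (I : Instance) (stg : Fin (Instance.k I) → ℕ)
    (plan : ℕ → Mask (Instance.k I) → Mask (Instance.k I)) (D : ℕ → ℕ) where

    open Instance I
    open Scheduler edge acyclic cost m stg
    open Graph edge hiding (Edge)
    open Coverage (incidence I) weight

    family : ℕ → Mask k
    family zero    = λ _ → false
    family (suc j) = plan (2 ^ j) (family j)

    at : ℕ → State k
    at zero    = state 0 0 0 (λ _ → nothing)
    at (suc j) = phase (family (suc j)) (D (2 ^ j)) (at j)

    schedule : ℕ → Schedule I
    schedule J i = slots (at J) i >>= onMachine

    uncovered : Mask k → ℕ
    uncovered C = weigh weight (not ∘ cov C)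

    Closed : Mask k → Set
    Closed C = ∀ {x y} → Edge x y → T (C y) → T (C x)

    record Guarantee : Set where
      field
        R rows : ℕ
        elig   : ℕ → Mask k
        lo len : ℕ → ℕ
        plan-grows  : ∀ t C → C ⊆ plan t C
        plan-closed : ∀ t C → Closed C → Closed (plan t C)
        plan-elig   : ∀ t C x → T (plan t C x) → ¬ T (C x) → T (elig t x)
        plan-cost   : ∀ t C → 1 ≤ t → weigh cost (plan t C) ≤ weigh cost C + R * (m * t)
        plan-good   : ∀ t C P → 1 ≤ t → Closed P → P ⊆ elig t → weigh cost P ≤ m * t →
                      8 * value (plan t C ∪ P) ≤ 8 * value (plan t C) + (1 ⊔ uncovered C)
        elig-completed : ∀ τ → Feasible I τ → ∀ t i → T (completedBy I τ t i) → T (elig t i)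
        elig-all    : ∀ t i → ∑ cost ≤ t → T (elig t i)
        D≥1         : ∀ t → 1 ≤ t → 1 ≤ D t
        stg-edge    : ∀ {u v} → Edge u v → stg u ≤ stg v
        stg-chain   : ∀ {h u v} → Edge u v → stg u ≡ stg v → stg v ≡ stg h → T (desc h v) →
                      T (desc h u) ⊎ T (desc u h)
        stg-cost    : ∀ t h (Z : Mask k) → (∀ x → T (Z x) → stg x ≡ stg h × T (desc h x) × T (elig t x)) →
                      weigh cost Z ≤ D t
        stg-live    : ∀ t v → T (elig t v) → lo t ≤ stg v × stg v < lo t + len t
        stg<        : ∀ v → stg v < k
        rows-time   : ∀ t → D t * len t ≤ rows * t

    module Analysis (G : Guarantee) where
      open Guarantee G

      ρ : ℕ
      ρ = 2 * (R + rows)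

      2^≥1 : ∀ j → 1 ≤ 2 ^ j
      2^≥1 j = m^n>0 2 j

      closed : ∀ j → Closed (family j)
      closed zero    e ()
      closed (suc j) = plan-closed (2 ^ j) (family j) (closed j)

      grows : ∀ j → family j ⊆ family (suc j)
      grows j = plan-grows (2 ^ j) (family j)

      record After (j : ℕ) : Set where
        field
          valid  : ∀ D′ → Valid D′ (at j)
          row    : machine (at j) ≡ 0 × offset (at j) ≡ 0
          done-≡ : ∀ x → done (at j) x ≡ family j x

      module Step (j : ℕ) (A : After j) where
        open After A
        open Phase m≥1 (family (suc j)) (D (2 ^ j)) (D≥1 (2 ^ j) (2^≥1 j)) (elig (2 ^ j)) (lo (2 ^ j)) (len (2 ^ j))
          (closed (suc j)) stg-edge stg-chain (stg-cost (2 ^ j)) (stg-live (2 ^ j)) stg<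

        finished : Finished (at j) (at (suc j))
        finished = phase-finished (at j) (valid (D (2 ^ j))) row
          (λ x d → grows j x (subst T (done-≡ x) d))
          (λ x c ¬d → plan-elig (2 ^ j) (family j) x c (λ c′ → ¬d (subst T (sym (done-≡ x)) c′)))

        open Finished finished public using (ext; floor)

        next : After (suc j)
        next = record
          { valid = change-row (Finished.valid finished) (proj₁ (Finished.row finished)) (proj₂ (Finished.row finished))
          ; row = Finished.row finished ; done-≡ = Finished.done-≡ finished }

        base-step : base (at (suc j)) ≤ base (at j) + ρ * 2 ^ j
        base-step = *-cancelˡ-≤ m {{>-nonZero m≥1}} (combine _ _
            (+-mono-≤ (Finished.areas finished) (+-mono-≤ (*-monoʳ-≤ 2 (plan-cost (2 ^ j) (family j) (2^≥1 j))) (*-monoʳ-≤ m (*-monoʳ-≤ 2 (rows-time (2 ^ j))))))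
            (trans (cong (λ w → m * b′ + (m * b + 2 * K′ + m * (2 * dl) + (2 * (w + R * (m * 2 ^ j)) + m * (2 * (rows * 2 ^ j))))) (sym same))
              (sh m b′ b K′ dl K R rows (2 ^ j))))
          where
          b = base (at j)
          b′ = base (at (suc j))
          K = weigh cost (done (at j))
          K′ = weigh cost (family (suc j))
          dl = D (2 ^ j) * len (2 ^ j)
          same : K ≡ weigh cost (family j)
          same = ∑-cong λ x → cong (λ c → when c (cost x)) (done-≡ x)
          sh : ∀ m b′ b K′ dl K R rows t → m * b′ + (m * b + 2 * K′ + m * (2 * dl) + (2 * (K + R * (m * t)) + m * (2 * (rows * t)))) ≡
               m * (b + 2 * (R + rows) * t) + (m * b′ + 2 * K + (2 * K′ + m * (2 * dl)))
          sh = solve-∀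

      after : ∀ j → After j
      after zero = record
        { valid = λ D′ → record
            { machine< = m≥1 ; offset≤ = z≤n ; slot< = λ () ; before = λ () ; current = λ () ; after = λ ()
            ; disjoint = λ _ () ; preceding = λ _ () }
        ; row = refl , refl ; done-≡ = λ x → refl }
      after (suc j) = Step.next j (after j)

      base-bound : ∀ j → base (at j) ≤ ρ * 2 ^ j
      base-bound zero    = z≤n
      base-bound (suc j) = ≤-trans (Step.base-step j (after j)) (≤-trans (+-monoˡ-≤ (ρ * 2 ^ j) (base-bound j)) (≤-reflexive (sh ρ (2 ^ j))))
        where
        sh : ∀ r t → r * t + r * t ≡ r * (2 * t)
        sh = solve-∀

      extends : ∀ {i j} → i ≤ j → Extends (at i) (at j)
      extends {i} {j} le with m≤n⇒m<n∨m≡n le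
      ... | inj₂ refl = λ e → e
      ... | inj₁ (s≤s {n = j′} le′) = λ e → Step.ext j′ (after j′) (extends le′ e)

      F : ℕ → ℕ
      F j = 1 ⊔ uncovered (family j)

      U : ℕ → ℕ
      U j = uncovered (family j)

      covers-more : ∀ j → cov (family j) ⊆ cov (family (suc j))
      covers-more j = cov-mono {family j} {family (suc j)} (grows j)

      U-mono : ∀ j → U (suc j) ≤ U j
      U-mono j = weigh-mono weight λ u ¬c → not⁺ λ c → not⁻ ¬c (covers-more j u c)

      progress : ∀ j P (Q : Mask n) → Closed P → P ⊆ elig (2 ^ j) → weigh cost P ≤ m * 2 ^ j →
                 (∀ u → ¬ T (Q u) → T (cov P u)) → 8 * U (suc j) ≤ U j + 8 * weigh weight Q
      progress j P Q cl el kP covered with U j in eq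
      ... | zero = ≤-trans (*-monoʳ-≤ 8 (≤-trans (U-mono j) (≤-reflexive eq))) z≤n
      ... | suc u = combine _ _ (+-mono-≤ (*-monoʳ-≤ 8 split) (plan-good (2 ^ j) (family j) P (2^≥1 j) cl el kP))
          (trans (cong (λ f → 8 * U (suc j) + (8 * (value (C ∪ P) + weigh weight Q) + (8 * value C + (1 ⊔ f)))) eq)
            (sh (U (suc j)) (value (C ∪ P)) (weigh weight Q) (value C) (suc u)))
        where
        C = family (suc j)
        sh : ∀ U′ v q c f → 8 * U′ + (8 * (v + q) + (8 * c + f)) ≡ f + 8 * q + (8 * (U′ + c) + 8 * v)
        sh = solve-∀
        split : U (suc j) + value C ≤ value (C ∪ P) + weigh weight Q
        split = begin
          U (suc j) + value C
            ≡⟨ ∑-+ (λ u → when (not (cov C u)) (weight u)) (λ u → when (cov C u) (weight u)) ⟨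
          ∑ (λ u → when (not (cov C u)) (weight u) + when (cov C u) (weight u))
            ≤⟨ ∑-mono each ⟩
          ∑ (λ u → when (cov (C ∪ P) u) (weight u) + when (Q u) (weight u))
            ≡⟨ ∑-+ (λ u → when (cov (C ∪ P) u) (weight u)) (λ u → when (Q u) (weight u)) ⟩
          value (C ∪ P) + weigh weight Q ∎
          where
          whole : ∀ b x → when (not b) x + when b x ≡ x
          whole true  x = refl
          whole false x = +-identityʳ x
          each : ∀ u → when (not (cov C u)) (weight u) + when (cov C u) (weight u) ≤ when (cov (C ∪ P) u) (weight u) + when (Q u) (weight u)
          each u = ≤-trans (≤-reflexive (whole (cov C u) (weight u))) (enough (T⊎ (Q u)))
            where
            enough : T (Q u) ⊎ ¬ T (Q u) → weight u ≤ when (cov (C ∪ P) u) (weight u) + when (Q u) (weight u)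
            enough (inj₁ q) = ≤-trans (≤-reflexive (sym (when-true (weight u) q))) (m≤n+m _ _)
            enough (inj₂ ¬q) = ≤-trans (≤-reflexive (sym (when-true (weight u) (cov-mono {P} {C ∪ P} (⊆-∪ʳ C P) u (covered u ¬q))))) (m≤m+n _ _)

      halving : ∀ j → ∑ cost ≤ 2 ^ j → 2 * U (suc j) ≤ U j
      halving j le = begin
        2 * U (suc j)                              ≤⟨ *-monoˡ-≤ (U (suc j)) {2} {8} (s≤s (s≤s z≤n)) ⟩
        8 * U (suc j)                              ≤⟨ progress j (λ _ → true) (λ _ → false) (λ _ _ → tt) (λ i _ → elig-all (2 ^ j) i le)
                                                        (≤-trans (weigh-≤ cost (λ _ → true)) (≤-trans le (m≤n*m (2 ^ j) m {{>-nonZero m≥1}})))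
                                                        (λ u _ → let i , u∈ = covered u in cov⁺ {λ _ → true} i tt (∈⇒incidence I u∈)) ⟩
        U j + 8 * weigh weight (λ _ → false)       ≡⟨ cong (λ z → U j + 8 * z) (∑-zero {n}) ⟩
        U j + 8 * 0                                ≡⟨ +-identityʳ (U j) ⟩
        U j                                        ∎

      halvings : ∀ j i → ∑ cost ≤ 2 ^ j → 2 ^ i * U (i + j) ≤ ∑ weight
      halvings j zero    le = ≤-trans (≤-reflexive (+-identityʳ (U j))) (weigh-≤ weight (not ∘ cov (family j)))
      halvings j (suc i) le = begin
        2 * 2 ^ i * U (suc i + j)     ≡⟨ sh (2 ^ i) (U (suc i + j)) ⟩
        2 ^ i * (2 * U (suc i + j))   ≤⟨ *-monoʳ-≤ (2 ^ i) (halving (i + j) (≤-trans le (^-monoʳ-≤ 2 (m≤n+m j i)))) ⟩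
        2 ^ i * U (i + j)             ≤⟨ halvings j i le ⟩
        ∑ weight                      ∎
        where
        sh : ∀ p u → 2 * p * u ≡ p * (2 * u)
        sh = solve-∀

      module Result (J₁ J₂ : ℕ) (long : ∑ cost ≤ 2 ^ J₁) (many : ∑ weight < 2 ^ J₂) where

        J : ℕ
        J = J₂ + J₁

        U≡0 : U J ≡ 0
        U≡0 with U J in eq
        ... | zero = refl
        ... | suc u = ⊥-elim (<⇒≱ many (≤-trans (m≤m*n (2 ^ J₂) (suc u)) (subst (λ x → 2 ^ J₂ * x ≤ ∑ weight) eq (halvings J₁ J₂ long))))

        all-covered : ∀ u → T (cov (family J) u)
        all-covered u with T⊎ (cov (family J) u)
        ... | inj₁ c = c
        ... | inj₂ ¬c = ⊥-elim (<⇒≱ (weight≥1 u) (≤-trans (≤-reflexive (sym (when-true (weight u) (not⁺ ¬c))))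
                          (≤-trans (∑-≥ (λ u → when (not (cov (family J) u)) (weight u)) u) (≤-reflexive U≡0))))

        V : ∀ D′ → Valid D′ (at J)
        V = After.valid (after J)

        σ : Schedule I
        σ = schedule J

        σ⁺ : ∀ {i x} → slots (at J) i ≡ just x → ∃[ p ] σ i ≡ just (p , begins x) × toℕ p ≡ proj₁ x
        σ⁺ {i} {x} eq = let p , on , p≡ = onMachine⁺ x (Valid.slot< (V 0) eq)
                        in p , trans (cong (_>>= onMachine) eq) on , p≡

        σ⁻ : ∀ {i p s} → σ i ≡ just (p , s) → ∃[ x ] slots (at J) i ≡ just x × toℕ p ≡ proj₁ x × s ≡ begins x
        σ⁻ {i} eq with slots (at J) i
        ... | just x = x , refl , onMachine⁻ x eq

        covered-by : ∀ j u → T (cov (family j) u) → ∃[ i ] ∃[ x ] u ∈ sets i × slots (at j) i ≡ just x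
        covered-by j u c = let i , ci , s = cov⁻ {family j} c
                               x , eq = done-just (at j) {i} (subst T (sym (After.done-≡ (after j) i)) ci)
                           in i , x , incidence⇒∈ I s , eq

        precede : ∀ {i j y} → Predecessor i j → slots (at J) j ≡ just y → ∃[ x ] slots (at J) i ≡ just x × ends i x ≤ begins y
        precede [ e ]   eq = Valid.preceding (V 0) e eq
        precede (e ∷ p) eq =
          let z , ez , le = precede p eq
              x , ex , le′ = Valid.preceding (V 0) e ez
          in x , ex , ≤-trans le′ (≤-trans (m≤m+n (begins z) _) le)

        feasible : Feasible I σ
        feasible = record
          { covers = λ u → let i , x , u∈ , eq = covered-by J u (all-covered u)
                               p , on , _ = σ⁺ eq
                           in i , u∈ , _ , on
          ; no-overlap = λ ne eqi eqj →
              let x , ex , px , sx = σ⁻ eqi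
                  y , ey , py , sy = σ⁻ eqj
              in subst₂ (λ s t → s + cost _ ≤ t ⊎ t + cost _ ≤ s) (sym sx) (sym sy)
                   (Valid.disjoint (V 0) ne ex ey (trans (sym px) py))
          ; precedences = λ pr eq →
              let y , ey , _ , sy = σ⁻ eq
                  x , ex , le = precede pr ey
                  p , on , _ = σ⁺ ex
              in p , begins x , on , ≤-trans le (≤-reflexive (sym sy))
          }

        covered-time : ∀ j u → j ≤ J → T (cov (family j) u) → coveringTime I σ u ≤ ρ * 2 ^ j
        covered-time j u le c =
          let i , x , u∈ , eq = covered-by j u c
              p , on , _ = σ⁺ {i} {x} (extends le eq)
              row = After.row (after j)
          in ≤-trans (coveringTime-≤ I σ u∈ on) (≤-trans (at-row (After.valid (after j) 0) (proj₁ row) (proj₂ row) eq) (base-bound j))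

        late : ∀ i u → T (cov (family (suc i)) u) → coveringTime I σ u ≤ ρ * 2 ^ suc i
        late i u c with suc i ≤? J
        ... | yes le = covered-time (suc i) u le c
        ... | no ¬le = ≤-trans (covered-time J u ≤-refl (all-covered u)) (*-monoʳ-≤ ρ (^-monoʳ-≤ 2 (<⇒≤ (≰⇒> ¬le))))

        approximate : ∀ τ → Feasible I τ → scheduleCost I σ ≤ 8 * ρ * scheduleCost I τ
        approximate τ feas = Account.total-cost weight (coveringTime I σ) (coveringTime I τ) (λ j → cov (family j)) ρ J
          (λ u → let i , p , s , _ , _ , eq = coveringTime-attained I τ feas u
                 in ≤-trans (cost≥1 i) (≤-trans (m≤n+m (cost i) s) (≤-reflexive (sym eq))))
          nothing-covered covers-more all-covered late
          (λ j → progress j (completedBy I τ (2 ^ j)) (λ u → 2 ^ j <ᵇ coveringTime I τ u) (completed-closed I τ feas (2 ^ j))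
            (elig-completed τ feas (2 ^ j)) (completed-cost I τ feas (2 ^ j))
            (λ u ¬late → let i , p , s , u∈ , τi , eq = coveringTime-attained I τ feas u
                         in cov⁺ {completedBy I τ (2 ^ j)} i
                              (completed⁺ I τ (2 ^ j) τi (≤-trans (≤-reflexive (sym eq)) (≮⇒≥ λ lt → ¬late (<⇒<ᵇ lt))))
                              (∈⇒incidence I u∈)))
          where
          nothing-covered : ∀ u → ¬ T (cov (family 0) u)
          nothing-covered u c = proj₁ (proj₂ (cov⁻ {family 0} {u} c))

module Guarantees where

  open Families using (∑; when; point; anyF)
  open Masks
  open Digraphs
  open ForestPlanning
  open UnitPlanning
  open LowerBounds
  open Phases
  open import Data.Bool using (true; false; T; not)
  open import Data.Empty using (⊥-elim)
  open import Data.Fin using (Fin; zero; suc)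
  open import Data.List using (allFin)
  open import Data.Maybe using (just)
  open import Data.Nat using (ℕ; zero; suc; _+_; _*_; _^_; _⊔_; _≤_; _<_; _≤ᵇ_; _∸_; z≤n; s≤s; s≤s⁻¹; >-nonZero; NonZero)
  open import Data.Nat.Logarithm using (⌊log₂_⌋; ⌊log₂⌋-mono-≤; ⌊log₂[2^n]⌋≡n)
  open import Data.Nat.Properties
  open import Data.Nat.Tactic.RingSolver using (solve-∀)
  open import Data.Product using (_×_; _,_; ∃-syntax; proj₁; proj₂)
  open import Data.Sum using (_⊎_; inj₁; inj₂)
  open import Function using (_∘_)
  open import Relation.Binary.Construct.Closure.Transitive using ([_]; _∷_)
  open import Relation.Binary.PropositionalEquality using (_≡_; refl; sym; trans; cong)
  open import Relation.Nullary using (¬_; yes; no)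

  open ≤-Reasoning

  module _ (I : Instance) where
    open Instance I
    open Coverage (incidence I) weight

    remaining : Mask k → ℕ
    remaining C = 1 ⊔ weigh weight (not ∘ cov C)

    gain-≤ : ∀ C D → value D ≤ value C + remaining C
    gain-≤ C D = begin
      value D                                            ≤⟨ weigh-≤ weight (cov D) ⟩
      ∑ weight                                           ≡⟨ ∑-cong (λ u → whole (cov C u) (weight u)) ⟨
      ∑ (λ u → when (cov C u) (weight u) + when (not (cov C u)) (weight u))
        ≡⟨ ∑-+ (λ u → when (cov C u) (weight u)) (λ u → when (not (cov C u)) (weight u)) ⟩
      value C + weigh weight (not ∘ cov C)               ≤⟨ +-monoʳ-≤ (value C) (m≤n⊔m 1 _) ⟩
      value C + remaining C                              ∎
      where
      whole : ∀ b x → when b x + when (not b) x ≡ x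
      whole true  x = +-identityʳ x
      whole false x = refl

    remaining≥1 : ∀ C → NonZero (remaining C)
    remaining≥1 C = >-nonZero (m≤m⊔n 1 (weigh weight (not ∘ cov C)))

    8mt : ℕ → ℕ
    8mt t = 8 * (m * t)

    mt≥1 : ∀ {t} → 1 ≤ t → NonZero (m * t)
    mt≥1 t≥1 = >-nonZero (*-mono-≤ m≥1 t≥1)

    -- From the scaled comparison a · value ≤ a · value + F · B with a = 8 B
    unscale : ∀ {x y f t} → 1 ≤ t → 8mt t * x ≤ 8mt t * y + f * (m * t) → 8 * x ≤ 8 * y + f
    unscale {x} {y} {f} {t} t≥1 le = *-cancelˡ-≤ (m * t) {{mt≥1 t≥1}} (begin
      m * t * (8 * x)                 ≡⟨ sh (m * t) x ⟩
      8mt t * x                       ≤⟨ le ⟩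
      8mt t * y + f * (m * t)         ≡⟨ sh₂ (m * t) y f ⟩
      m * t * (8 * y + f)             ∎)
      where
      sh : ∀ b x → b * (8 * x) ≡ 8 * b * x
      sh = solve-∀
      sh₂ : ∀ b y f → 8 * b * y + f * b ≡ b * (8 * y + f)
      sh₂ = solve-∀

    module ForestCase (out : OutForest I) where
      open Graph edge hiding (Edge)
      open Acyclic acyclic
      open Forest out

      module Planner (t : ℕ) (C : Mask k) = ForestPlan edge (incidence I) weight cost acyclic out (8mt t) (remaining C) t

      plan : ℕ → Mask k → Mask k
      plan t C = Planner.passes t C k C

      stg : Fin k → ℕ
      stg v = k ∸ class v

      L : ℕ
      L = bits k

      n<2^n : ∀ n → n < 2 ^ n
      n<2^n zero    = s≤s z≤n
      n<2^n (suc n) = ≤-trans (s≤s (n<2^n n)) (≤-trans (+-monoˡ-≤ (2 ^ n) (m^n>0 2 n)) (≤-reflexive (cong (2 ^ n +_) (sym (+-identityʳ _)))))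

      L≤k : L ≤ k
      L≤k = s≤s⁻¹ (≤-trans (n<2^n L) (bits-lower k))

      cl : Fin k → Mask k
      cl v x = desc x v

      chain-cost : ∀ τ → Feasible I τ → ∀ n v {p s} → rank v ≤ n → τ v ≡ just (p , s) → weigh cost (cl v) ≤ s + cost v
      chain-cost τ feas zero    v le eq = ⊥-elim (<⇒≱ (rank-≥1 v) le)
      chain-cost τ feas (suc n) v {p} {s} le eq with T⊎ (anyF (λ u → edge u v))
      ... | inj₂ none = begin
        weigh cost (cl v)        ≤⟨ weigh-mono cost {cl v} {point v} only ⟩
        weigh cost (point v)     ≡⟨ weigh-point cost v ⟩
        cost v                   ≤⟨ m≤n+m (cost v) s ⟩
        s + cost v               ∎
        where
        only : cl v ⊆ point v
        only x d with last-step d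
        ... | inj₁ refl = point-refl x
        ... | inj₂ (u , _ , e) = ⊥-elim (none (anyF⁺ (λ u → edge u v) u e))
      ... | inj₁ some =
        let u , e = anyF⁻ (λ u → edge u v) some
            q , s′ , τu , le′ = Feasible.precedences feas [ e ] eq
        in begin
        weigh cost (cl v)                      ≤⟨ weigh-mono cost {cl v} {cl u ∪ point v} (split u e) ⟩
        weigh cost (cl u ∪ point v)            ≤⟨ weigh-∪ cost (cl u) (point v) ⟩
        weigh cost (cl u) + weigh cost (point v) ≡⟨ cong (weigh cost (cl u) +_) (weigh-point cost v) ⟩
        weigh cost (cl u) + cost v             ≤⟨ +-monoˡ-≤ (cost v) (≤-trans (chain-cost τ feas n u (s≤s⁻¹ (≤-trans (rank-edge e) le)) τu) le′) ⟩
        s + cost v                             ∎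
        where
        split : ∀ u → T (edge u v) → cl v ⊆ cl u ∪ point v
        split u e x d with last-step d
        ... | inj₁ refl = ∨ʳ {cl u x} (point-refl x)
        ... | inj₂ (y , d′ , e′) with refl ← out e e′ = ∨ˡ d′

      largest : ∀ {l} (Z : Mask l) (r : Fin l → ℕ) → (∀ x → ¬ T (Z x)) ⊎ ∃[ z ] T (Z z) × (∀ x → T (Z x) → r x ≤ r z)
      largest {zero}  Z r = inj₁ λ ()
      largest {suc l} Z r with largest (Z ∘ suc) (r ∘ suc) | T⊎ (Z zero)
      ... | inj₁ none | inj₂ ¬z = inj₁ λ { zero → ¬z ; (suc x) → none x }
      ... | inj₁ none | inj₁ z = inj₂ (zero , z , λ { zero _ → ≤-refl ; (suc x) t → ⊥-elim (none x t) })
      ... | inj₂ (y , zy , top) | inj₂ ¬z = inj₂ (suc y , zy , λ { zero t → ⊥-elim (¬z t) ; (suc x) t → top x t })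
      ... | inj₂ (y , zy , top) | inj₁ z with r zero ≤? r (suc y)
      ...   | yes le = inj₂ (suc y , zy , λ { zero _ → le ; (suc x) t → top x t })
      ...   | no ¬le = inj₂ (zero , z , λ { zero _ → ≤-refl ; (suc x) t → ≤-trans (top x t) (<⇒≤ (≰⇒> ¬le)) })

      stg⇒class : ∀ {u v} → stg u ≡ stg v → class u ≡ class v
      stg⇒class {u} {v} eq = ∸-cancelˡ-≡ (≤-trans (class-≤ u) L≤k) (≤-trans (class-≤ v) L≤k) eq

      elig : ℕ → Mask k
      elig t v = weigh cost (cl v) ≤ᵇ t

      chunk-cost : ∀ t h (Z : Mask k) → (∀ x → T (Z x) → stg x ≡ stg h × T (desc h x) × T (elig t x)) → weigh cost Z ≤ t
      chunk-cost t h Z z with largest Z rank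
      ... | inj₁ none = ≤-trans (≤-reflexive (trans (∑-cong λ x → when-false (cost x) (none x)) (∑-zero {k}))) z≤n
      ... | inj₂ (y , zy , top) = ≤-trans (weigh-mono cost {Z} {cl y} inside) (≤ᵇ⇒≤ _ t (proj₂ (proj₂ (z y zy))))
        where
        inside : Z ⊆ cl y
        inside x zx with path-comparable (proj₁ (proj₂ (z x zx))) (proj₁ (proj₂ (z y zy))) (stg⇒class (proj₁ (z x zx))) (stg⇒class (proj₁ (z y zy)))
        ... | inj₁ d = d
        ... | inj₂ d with rank-desc d
        ...   | inj₁ refl = d
        ...   | inj₂ lt = ⊥-elim (<⇒≱ lt (top x zx))

      open Algorithm I stg plan (λ t → t) using (Guarantee; module Analysis)

      guarantee : Guarantee
      guarantee = record
        { R = 8 * L ; rows = L ; elig = elig ; lo = λ _ → k ∸ L ; len = λ _ → L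
        ; plan-grows = λ t C → Planner.Step.grows (Planner.passes-step t C k C)
        ; plan-closed = λ t C → Planner.passes-closed t C k C
        ; plan-elig = λ t C → Planner.Step.eligible (Planner.passes-step t C k C)
        ; plan-cost = λ t C _ → plan-cost t C
        ; plan-good = λ t C P t≥1 cl el le → unscale t≥1 (Planner.good-passes t C (m * t) k C (m≤n+m k (count C)) P cl el le)
        ; elig-completed = λ τ feas t i c → let p , s , τi , le = completed⁻ I τ t i c
                                            in ≤⇒≤ᵇ (≤-trans (chain-cost τ feas k i (rank-≤ i) τi) le)
        ; elig-all = λ t i le → ≤⇒≤ᵇ (≤-trans (weigh-≤ cost (cl i)) le)
        ; D≥1 = λ t le → le
        ; stg-edge = λ e → ∸-monoʳ-≤ k (class-edge e)
        ; stg-chain = λ e _ _ d → comparable d (desc-∷ e (desc-refl _))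
        ; stg-cost = chunk-cost
        ; stg-live = λ t v _ → ∸-monoʳ-≤ k (class-≤ v) , ≤-trans (stg<k v) (≤-reflexive (sym (m∸n+n≡m L≤k)))
        ; stg< = stg<k
        ; rows-time = λ t → ≤-reflexive (*-comm t L)
        }
        where
        stg<k : ∀ v → stg v < k
        stg<k v = ∸-monoʳ-< (class-≥1 v) (≤-trans (class-≤ v) L≤k)
        plan-cost : ∀ t C → weigh cost (plan t C) ≤ weigh cost C + 8 * L * (m * t)
        plan-cost t C = *-cancelˡ-≤ F {{remaining≥1 C}} (combine _ _
            (+-mono-≤ (Planner.passes-cost t C k C) (*-monoʳ-≤ (L * 8mt t) (gain-≤ C E)))
            (sh F (weigh cost E) (weigh cost C) L (m * t) (value E) (value C)))
          where
          F = remaining C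
          E = plan t C
          sh : ∀ F kE kC L b vE vC → F * kE + (F * kC + L * (8 * b * vE) + L * (8 * b) * (vC + F)) ≡
               F * (kC + 8 * L * b) + (F * kE + L * (8 * b * vC) + L * (8 * b) * vE)
          sh = solve-∀

      L≤log : 2 ≤ k → L ≤ 2 * ⌊log₂ k ⌋
      L≤log k≥2 = ≤-trans (pred≤ L refl) (≤-trans (+-monoˡ-≤ ⌊log₂ k ⌋ log≥1) (≤-reflexive (cong (⌊log₂ k ⌋ +_) (sym (+-identityʳ _)))))
        where
        log≥1 : 1 ≤ ⌊log₂ k ⌋
        log≥1 = ⌊log₂⌋-mono-≤ k≥2
        pred≤ : ∀ l → l ≡ L → L ≤ 1 + ⌊log₂ k ⌋
        pred≤ zero    eq = ≤-trans (≤-reflexive (sym eq)) z≤n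
        pred≤ (suc l) eq = ≤-trans (≤-reflexive (sym eq)) (s≤s (≤-trans (≤-reflexive (sym (⌊log₂[2^n]⌋≡n l)))
          (⌊log₂⌋-mono-≤ {2 ^ l} {k} (*-cancelˡ-≤ 2 (≤-trans (≤-reflexive (cong (2 ^_) eq)) (≤-trans (bits-lower k)
            (≤-trans (+-monoˡ-≤ k (≤-trans (s≤s z≤n) k≥2)) (≤-reflexive (cong (k +_) (sym (+-identityʳ k)))))))))))

      ratio : 2 ≤ k → ∀ {a b} → a ≤ 8 * (2 * (8 * L + L)) * b → Within-log 288 k a b
      ratio k≥2 {a} {b} le = ≤-trans le (*-monoˡ-≤ b (≤-trans (≤-reflexive (sh L)) (≤-trans (*-monoʳ-≤ 144 (L≤log k≥2))
        (≤-reflexive (sym (*-assoc 144 2 ⌊log₂ k ⌋))))))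
        where
        sh : ∀ l → 8 * (2 * (8 * l + l)) ≡ 144 * l
        sh = solve-∀

    square-cancel : ∀ {x y} → x * x ≤ y * y → x ≤ y
    square-cancel {x} {y} le with x ≤? y
    ... | yes x≤y = x≤y
    ... | no ¬x≤y = ⊥-elim (<⇒≱ (*-mono-< (≰⇒> ¬x≤y) (≰⇒> ¬x≤y)) le)

    root : ∀ n → 1 ≤ n → ∃[ r ] 1 ≤ r × n ≤ r * r × r * r ≤ 4 * n
    root (suc zero) _ = 1 , ≤-refl , ≤-refl , s≤s z≤n
    root (suc n@(suc _)) _ with root n (s≤s z≤n)
    ... | r , r≥1 , lower , upper with suc n ≤? r * r
    ...   | yes le = r , r≥1 , le , ≤-trans upper (*-monoʳ-≤ 4 (n≤1+n n))
    ...   | no ¬le = suc r , s≤s z≤n , ≤-trans (s≤s (≤-trans lower (m≤m+n (r * r) (r + r)))) (≤-reflexive (sh r)) , (begin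
      suc r * suc r            ≡⟨ sh r ⟨
      suc (r * r + (r + r))    ≤⟨ s≤s (+-mono-≤ rr≤ (+-mono-≤ r≤ r≤)) ⟩
      suc (n + (n + n))        ≤⟨ m≤m+n _ (n + 3) ⟩
      suc (n + (n + n)) + (n + 3) ≡⟨ sh₂ n ⟩
      4 * suc n                ∎)
      where
      rr≤ : r * r ≤ n
      rr≤ = s≤s⁻¹ (≰⇒> ¬le)
      r≤ : r ≤ n
      r≤ = ≤-trans (m≤m*n r r {{>-nonZero r≥1}}) rr≤
      sh : ∀ r → suc (r * r + (r + r)) ≡ suc r * suc r
      sh = solve-∀
      sh₂ : ∀ n → suc (n + (n + n)) + (n + 3) ≡ 4 * suc n
      sh₂ = solve-∀

    module UnitCase (unit : UnitCost I) (k≥2 : 2 ≤ k) where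
      open Graph edge hiding (Edge)
      open Acyclic acyclic

      module Planner (t : ℕ) (C : Mask k) = UnitPlan edge (incidence I) weight acyclic (8mt t) (remaining C) t (m * t)

      plan : ℕ → Mask k → Mask k
      plan t C = Planner.select t C (allFin k) C

      stg : Fin k → ℕ
      stg v = depth v ∸ 1

      k≥1 : 1 ≤ k
      k≥1 = ≤-trans (s≤s z≤n) k≥2

      R : ℕ
      R = proj₁ (root (8 * k) (≤-trans k≥1 (m≤n*m k 8)))

      R≥1 : 1 ≤ R
      R≥1 = proj₁ (proj₂ (root (8 * k) (≤-trans k≥1 (m≤n*m k 8))))

      R-lower : 8 * k ≤ R * R
      R-lower = proj₁ (proj₂ (proj₂ (root (8 * k) (≤-trans k≥1 (m≤n*m k 8)))))

      R-upper : R * R ≤ 32 * k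
      R-upper = ≤-trans (proj₂ (proj₂ (proj₂ (root (8 * k) (≤-trans k≥1 (m≤n*m k 8)))))) (≤-reflexive (sym (*-assoc 4 8 k)))

      weigh-cost : ∀ C → weigh cost C ≡ count C
      weigh-cost C = ∑-cong λ i → cong (when (C i)) (unit i)

      elig : ℕ → Mask k
      elig t v = depth v ≤ᵇ t

      layered : ∀ τ → Feasible I τ → ∀ t v {p s} → τ v ≡ just (p , s) → s + cost v ≤ t → T (layer t v)
      layered τ feas zero    v {p} {s} eq le = ⊥-elim (<⇒≱ (cost≥1 v) (≤-trans (m≤n+m (cost v) s) le))
      layered τ feas (suc t) v {p} {s} eq le = layer⁺ {t} λ u e →
        let q , s′ , τu , le′ = Feasible.precedences feas [ e ] eq
        in layered τ feas t u τu (≤-trans le′ (s≤s⁻¹ (≤-trans (≤-reflexive (+-comm 1 s)) (≤-trans (+-monoʳ-≤ s (cost≥1 v)) le))))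

      open Algorithm I stg plan (λ _ → 1) using (Guarantee; module Analysis)

      suc-stg : ∀ v → suc (stg v) ≡ depth v
      suc-stg v = m+[n∸m]≡n (depth-≥1 v)

      stg-edge : ∀ {u v} → T (edge u v) → stg u < stg v
      stg-edge {u} {v} e = s≤s⁻¹ (≤-trans (s≤s (≤-reflexive (suc-stg u))) (≤-trans (depth-edge e) (≤-reflexive (sym (suc-stg v)))))

      stg-desc : ∀ {u v} → T (desc u v) → u ≡ v ⊎ stg u < stg v
      stg-desc {u} {v} d = go (proj₂ (desc⇒path d))
        where
        go : ∀ {t u v} → Path t u v → u ≡ v ⊎ stg u < stg v
        go [] = inj₁ refl
        go (e ∷ p) with go p
        ... | inj₁ refl = inj₂ (stg-edge e)
        ... | inj₂ lt = inj₂ (<-trans (stg-edge e) lt)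

      guarantee : Guarantee
      guarantee = record
        { R = R ; rows = 1 ; elig = elig ; lo = λ _ → 0 ; len = λ t → t
        ; plan-grows = λ t C → Planner.select-grows t C (allFin k) C
        ; plan-closed = λ t C → Planner.select-closed t C (allFin k) C
        ; plan-elig = λ t C → Planner.select-elig t C (allFin k) C
        ; plan-cost = plan-cost
        ; plan-good = λ t C P t≥1 cl el le → unscale t≥1 (Planner.good t C C P cl el (≤-trans (≤-reflexive (sym (weigh-cost P))) le))
        ; elig-completed = λ τ feas t i c → let p , s , τi , le = completed⁻ I τ t i c
                                            in ≤⇒≤ᵇ (depth-layer (layered τ feas t i τi le))
        ; elig-all = λ t i le → ≤⇒≤ᵇ (≤-trans (depth-≤ i) (≤-trans k≤∑ le))
        ; D≥1 = λ _ _ → ≤-refl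
        ; stg-edge = λ e → <⇒≤ (stg-edge e)
        ; stg-chain = λ e eq _ _ → ⊥-elim (<-irrefl eq (stg-edge e))
        ; stg-cost = λ t h Z z → ≤-trans (weigh-mono cost {Z} {point h} λ x zx → single {t} h x (z x zx))
                                   (≤-reflexive (trans (weigh-point cost h) (unit h)))
        ; stg-live = λ t v e → z≤n , ≤-trans (≤-reflexive (suc-stg v)) (≤ᵇ⇒≤ (depth v) t e)
        ; stg< = λ v → ≤-trans (≤-reflexive (suc-stg v)) (depth-≤ v)
        ; rows-time = λ t → ≤-refl
        }
        where
        k≤∑ : k ≤ ∑ cost
        k≤∑ = ≤-trans (≤-reflexive (sym (trans (∑-const k 1) (*-identityʳ k)))) (∑-mono cost≥1)
        single : ∀ {t} h x → stg x ≡ stg h × T (desc h x) × T (elig t x) → T (point h x)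
        single {t} h x (eq , d , _) with stg-desc d
        ... | inj₁ refl = point-refl h
        ... | inj₂ lt = ⊥-elim (<-irrefl (sym eq) lt)
        plan-cost : ∀ t C → 1 ≤ t → weigh cost (plan t C) ≤ weigh cost C + R * (m * t)
        plan-cost t C t≥1 = begin
          weigh cost E                    ≡⟨ weigh-cost E ⟩
          count E                         ≤⟨ m≤n+m∸n (count E) (count C) ⟩
          count C + (count E ∸ count C)   ≤⟨ +-monoʳ-≤ (count C) (square-cancel squares) ⟩
          count C + R * B                 ≡⟨ cong (_+ R * B) (weigh-cost C) ⟨
          weigh cost C + R * B            ∎
          where
          E = plan t C
          B = m * t
          F = remaining C
          q = proj₁ (Planner.select-count t C (allFin k) C)
          q≤ : q ≤ 8 * B
          q≤ = *-cancelˡ-≤ F {{remaining≥1 C}} (combine _ _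
            (+-mono-≤ (proj₁ (proj₂ (Planner.select-count t C (allFin k) C))) (*-monoʳ-≤ (8 * B) (gain-≤ C E)))
            (sh F q B (value E) (value C)))
            where
            sh : ∀ F q B e c → F * q + (8 * B * e + 8 * B * (c + F)) ≡ F * (8 * B) + (F * q + 8 * B * c + 8 * B * e)
            sh = solve-∀
          new = count E ∸ count C
          squares : new * new ≤ R * B * (R * B)
          squares = begin
            new * new             ≤⟨ *-mono-≤ (≤-trans (m∸n≤m (count E) (count C)) (count-≤ E))
                                      (≤-trans (m≤n+o⇒m∸n≤o (count E) (count C) (proj₂ (proj₂ (Planner.select-count t C (allFin k) C)))) (*-monoˡ-≤ B q≤)) ⟩
            k * (8 * B * B)       ≡⟨ sh k B ⟩
            8 * k * (B * B)       ≤⟨ *-monoˡ-≤ (B * B) R-lower ⟩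
            R * R * (B * B)       ≡⟨ sh₂ R B ⟩
            R * B * (R * B)       ∎
            where
            sh : ∀ k B → k * (8 * B * B) ≡ 8 * k * (B * B)
            sh = solve-∀
            sh₂ : ∀ R B → R * R * (B * B) ≡ R * B * (R * B)
            sh₂ = solve-∀

      cube : ∀ d → R * R ≤ d * d * k → R * R * R ≤ d * d * d * (k * k)
      cube d le = square-cancel (begin
        R * R * R * (R * R * R)                     ≡⟨ sh R ⟩
        R * R * (R * R) * (R * R)                   ≤⟨ *-mono-≤ (*-mono-≤ le le) le ⟩
        d * d * k * (d * d * k) * (d * d * k)       ≡⟨ sh₂ d k ⟩
        d * d * k * (d * d * k) * (d * d * k) * 1   ≤⟨ *-monoʳ-≤ (d * d * k * (d * d * k) * (d * d * k)) k≥1 ⟩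
        d * d * k * (d * d * k) * (d * d * k) * k   ≡⟨ sh₃ d k ⟩
        d * d * d * (k * k) * (d * d * d * (k * k)) ∎)
        where
        sh : ∀ R → R * R * R * (R * R * R) ≡ R * R * (R * R) * (R * R)
        sh = solve-∀
        sh₂ : ∀ d k → d * d * k * (d * d * k) * (d * d * k) ≡ d * d * k * (d * d * k) * (d * d * k) * 1
        sh₂ = solve-∀
        sh₃ : ∀ d k → d * d * k * (d * d * k) * (d * d * k) * k ≡ d * d * d * (k * k) * (d * d * d * (k * k))
        sh₃ = solve-∀

      scaled : ∀ d e {a b} → R * R ≤ d * d * k → a ≤ e * R * b → a ^ 3 ≤ (e * d * b) ^ 3 * k ^ 2
      scaled d e {a} {b} R≤ le = begin
        a ^ 3                                              ≤⟨ ^-monoˡ-≤ 3 le ⟩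
        (e * R * b) ^ 3                                    ≡⟨ sh e R b ⟩
        e * e * e * (R * R * R) * (b * b * b)              ≤⟨ *-monoˡ-≤ (b * b * b) (*-monoʳ-≤ (e * e * e) (cube d R≤)) ⟩
        e * e * e * (d * d * d * (k * k)) * (b * b * b)    ≡⟨ sh₂ e d k b ⟩
        (e * d * b) ^ 3 * k ^ 2                            ∎
        where
        sh : ∀ e R b → e * R * b * (e * R * b * (e * R * b * 1)) ≡ e * e * e * (R * R * R) * (b * b * b)
        sh = solve-∀
        sh₂ : ∀ e d k b → e * e * e * (d * d * d * (k * k)) * (b * b * b) ≡ e * d * b * (e * d * b * (e * d * b * 1)) * (k * (k * 1))
        sh₂ = solve-∀

      ratio : ∀ {a b} → a ≤ 8 * (2 * (R + 1)) * b → Within-k^⅔ 192 k a b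
      ratio {a} {b} le = scaled 6 32 (≤-trans R-upper (*-monoˡ-≤ k {32} {36} (m≤m+n 32 4)))
        (≤-trans le (*-monoˡ-≤ b (≤-trans (*-monoʳ-≤ 8 (*-monoʳ-≤ 2 (+-monoʳ-≤ R R≥1))) (≤-reflexive (sh R)))))
        where
        sh : ∀ R → 8 * (2 * (R + R)) ≡ 32 * R
        sh = solve-∀

module SchedulingPrograms where

  open Language
  open Arithmetic
  open Families
  open Masks hiding (_∩_)
  open Digraphs
  open Scheduling
  open import Data.Bool using (Bool; true; false; T; _∧_; not; if_then_else_)
  open import Data.Bool.Properties using (∨-comm)
  open import Data.Fin using (Fin; zero; suc; toℕ)
  open import Data.List using (List; []; _∷_; foldl)
  import Data.List as List
  open import Data.Maybe using (just; nothing)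
  open import Data.Nat using (ℕ; zero; suc; _+_; _*_; _≤ᵇ_; _≡ᵇ_)
  open import Data.Nat.Properties hiding (_≟_)
  open import Data.Product using (_,_)
  open import Data.Vec using (Vec; []; _∷_; lookup)
  open import Function using (_∘_)
  open import Relation.Binary.Construct.Closure.Transitive using (TransClosure)
  open import Relation.Binary.PropositionalEquality using (_≡_; refl; sym; trans; cong; cong₂; subst)
  open import Relation.Nullary using (¬_)

  pattern 10F = suc 9F
  pattern 11F = suc 10F
  pattern 12F = suc 11F
  pattern 13F = suc 12F
  pattern 14F = suc 13F
  pattern 15F = suc 14F
  pattern 16F = suc 15F
  pattern 17F = suc 16F

  and≡ : ∀ {x y a b} → x ≡ encodeBool a → y ≡ encodeBool b → ⟦ andC ⟧ (x ∷ y ∷ []) ≡ encodeBool (a ∧ b)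
  and≡ {a = a} {b} refl refl = andC-correct a b

  not≡ : ∀ {x a} → x ≡ encodeBool a → ⟦ notC ⟧ (x ∷ []) ≡ encodeBool (not a)
  not≡ {a = a} refl = notC-correct a

  meets≡ : ∀ {k x y} {f g : Fin k → Bool} → x ≡ mask f → y ≡ mask g → ⟦ meetsC ⟧ (x ∷ y ∷ []) ≡ encodeBool (anyF (λ i → f i ∧ g i))
  meets≡ {f = f} {g} refl refl = meetsC-correct f g

  disj≡ : ∀ {k x y z} (e : Fin k → Tree) {f g : Fin k → Bool} → x ≡ encodeFamily e → y ≡ mask f → z ≡ mask g →
          ⟦ disjC ⟧ (x ∷ y ∷ z ∷ []) ≡ mask (f ∪ g)
  disj≡ e {f} {g} refl refl refl = disjC-correct e f g

  add≡ : ∀ {x y a b} → x ≡ N a → y ≡ N b → ⟦ addC ⟧ (x ∷ y ∷ []) ≡ N (a + b)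
  add≡ {a = a} {b} refl refl = addC-correct a b

  mul≡ : ∀ {x y a b} → x ≡ N a → y ≡ N b → ⟦ mulC ⟧ (x ∷ y ∷ []) ≡ N (a * b)
  mul≡ {a = a} {b} refl refl = mulC-correct a b

  suc≡ : ∀ {x a} → x ≡ N a → ⟦ sucC ⟧ (x ∷ []) ≡ N (suc a)
  suc≡ {a = a} refl = sucC-correct a

  le≡ : ∀ {x y a b} → x ≡ N a → y ≡ N b → ⟦ leC ⟧ (x ∷ y ∷ []) ≡ encodeBool (a ≤ᵇ b)
  le≡ {a = a} {b} refl refl = leC-correct a b

  pick≡ : ∀ {k x y} (e : Fin k → Tree) {i : Fin k} → x ≡ encodeFamily e → y ≡ hot i → ⟦ pickC ⟧ (x ∷ y ∷ []) ≡ e i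
  pick≡ e {i} refl refl = pickC-correct e i

  if≡ : ∀ {x y y′ z z′} b → x ≡ encodeBool b → y ≡ y′ → z ≡ z′ → caseTree x z (λ _ _ → y) ≡ (if b then y′ else z′)
  if≡ false refl y≡ z≡ = z≡
  if≡ true  refl y≡ z≡ = y≡

  any-point : ∀ {k} (i : Fin k) (f : Fin k → Bool) → anyF (λ j → point i j ∧ f j) ≡ f i
  any-point i f = T-ext
    (λ t → let j , p = anyF⁻ (λ j → point i j ∧ f j) t in subst (T ∘ f) (sym (point⇒≡ {i = i} (∧ˡ p))) (∧ʳ {point i j} p))
    (λ t → anyF⁺ (λ j → point i j ∧ f j) i (∧⁺ (point-refl i) t))

  member≡ : ∀ {k x y} {i : Fin k} {f : Fin k → Bool} → x ≡ hot i → y ≡ mask f → ⟦ meetsC ⟧ (x ∷ y ∷ []) ≡ encodeBool (f i)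
  member≡ {i = i} {f} p q = trans (meets≡ {f = point i} {g = f} p q) (cong encodeBool (any-point i f))

  eqC : Code 2
  eqC = app andC (app leC (var 0F ∷ var 1F ∷ []) ∷ app leC (var 1F ∷ var 0F ∷ []) ∷ [])

  eq≡ : ∀ {x y a b} → x ≡ N a → y ≡ N b → ⟦ eqC ⟧ (x ∷ y ∷ []) ≡ encodeBool (a ≡ᵇ b)
  eq≡ {a = a} {b} p q = trans (and≡ (le≡ p q) (le≡ q p)) (cong encodeBool (T-ext
    (λ t → ≡⇒≡ᵇ a b (≤-antisym (≤ᵇ⇒≤ a b (∧ˡ t)) (≤ᵇ⇒≤ b a (∧ʳ {a ≤ᵇ b} t))))
    (λ t → let eq = ≡ᵇ⇒≡ a b t in ∧⁺ (≤⇒≤ᵇ (≤-reflexive eq)) (≤⇒≤ᵇ (≤-reflexive (sym eq))))))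

  -- Unlike the equation, this type can be compared without evaluating the program.
  record Computes {v} (c : Code v) (ρ : Vec Tree v) (y : Tree) : Set where
    constructor computes
    field
      computed : ⟦ c ⟧ ρ ≡ y

  open Computes public

  app≡ : ∀ {v w} (c : Code w) (es : Codes v w) ρ {ρ′ y} → ⟦ es ⟧* ρ ≡ ρ′ → Computes c ρ′ y → Computes (app c es) ρ y
  app≡ c es ρ refl (computes eq) = computes eq

  and-computes : ∀ {v} {c d : Code v} {ρ a b} → Computes c ρ (encodeBool a) → Computes d ρ (encodeBool b) →
                 Computes (app andC (c ∷ d ∷ [])) ρ (encodeBool (a ∧ b))
  and-computes (computes p) (computes q) = computes (and≡ p q)

  not-computes : ∀ {v} {c : Code v} {ρ a} → Computes c ρ (encodeBool a) → Computes (app notC (c ∷ [])) ρ (encodeBool (not a))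
  not-computes (computes p) = computes (not≡ p)

  le-computes : ∀ {v} {c d : Code v} {ρ a b} → Computes c ρ (N a) → Computes d ρ (N b) →
                Computes (app leC (c ∷ d ∷ [])) ρ (encodeBool (a ≤ᵇ b))
  le-computes (computes p) (computes q) = computes (le≡ p q)

  item : ∀ {v} → ℕ → Code v → Code v
  item zero    e = head e
  item (suc i) e = item i (tail e)

  loopC : ∀ {v} (s : Code (3 + v)) {_ : T (linear? (lookup (growth s) 2F))} → Code v → Code v → Code v
  loopC s {ok} e d = rec (var 0F) s (var 0F) {ok} e d

  iterate : ∀ {A : Set} → (ℕ → A → A) → ℕ → ℕ → A → A
  iterate f c zero    a = a
  iterate f c (suc n) a = iterate f (suc c) n (f c a)

  iterate-loop : ∀ {A : Set} {v} (s : Code (3 + v)) (ρ : Vec Tree v) (e : ℕ → Tree) (enc : A → Tree) (f : ℕ → A → A) →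
                 (∀ i b a → ⟦ s ⟧ (e i ∷ b ∷ enc a ∷ ρ) ≡ enc (f i a)) →
                 ∀ c n a → loop (var 0F) s (var 0F) ρ (encodeFamily {n} (λ i → e (c + toℕ i))) (enc a) ≡ enc (iterate f c n a)
  iterate-loop s ρ e enc f step c zero    a = refl
  iterate-loop s ρ e enc f step c (suc n) a =
    trans (cong (loop (var 0F) s (var 0F) ρ tail′) (trans (cong (λ x → ⟦ s ⟧ (x ∷ tail′ ∷ enc a ∷ ρ)) (cong e (+-identityʳ c))) (step c tail′ a)))
      (trans (cong (λ t → loop (var 0F) s (var 0F) ρ t (enc (f c a))) (family-cong {n} λ i → cong e (+-suc c (toℕ i))))
        (iterate-loop s ρ e enc f step (suc c) n (f c a)))
    where
    tail′ = encodeFamily {n} (λ i → e (c + suc (toℕ i)))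

  -- The scheduler, simulated until a target set is placed.  In this way every
  -- number of the state is moved and never copied.

  frozenT : Slot → Tree
  frozenT (q , b , r) = nil ∙ (N q ∙ (N b ∙ N r))

  liveT : Tree → ℕ → ℕ → ℕ → Tree
  liveT d b p r = (nil ∙ nil) ∙ (d ∙ (N b ∙ (N p ∙ N r)))

  simulated : ∀ {k} → Fin k → State k → Tree
  simulated t S with slots S t
  ... | nothing = liveT (mask (done S)) (base S) (machine S) (offset S)
  ... | just x  = frozenT x

  simulated-live : ∀ {k} (t : Fin k) S → slots S t ≡ nothing → simulated t S ≡ liveT (mask (done S)) (base S) (machine S) (offset S)
  simulated-live t S eq with slots S t
  ... | nothing = refl

  simulated-frozen : ∀ {k} (t : Fin k) S {x} → slots S t ≡ just x → simulated t S ≡ frozenT x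
  simulated-frozen t S eq with slots S t | eq
  ... | just _ | refl = refl

  -- In the body: 0 machine, 1 offset, 2 base, 4 the mask of the sets done;
  -- the outer variables are shifted by 10.
  whenLive : ∀ {v} → Code v → Code (10 + v) → Code v
  whenLive e body =
    case e nil (case (var 0F) (cons nil (var 1F)) (case (var 3F) nil (case (var 1F) nil (case (var 1F) nil body))))

  liveC : ∀ {v} → Code v → Code v → Code v → Code v → Code v
  liveC d b p r = cons trueC (cons d (cons b (cons p r)))

  -- constants: keys, descendant matrix, costs, zeros, number of machines, order, range

  wantedC : Code 6
  wantedC = app andC (app notC (app meetsC (var 0F ∷ var 1F ∷ []) ∷ []) ∷
    app andC (app meetsC (var 0F ∷ var 2F ∷ []) ∷
    app andC (app eqC (app pickC (item 0 (var 5F) ∷ var 0F ∷ []) ∷ var 3F ∷ []) ∷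
      app meetsC (var 0F ∷ app pickC (item 1 (var 5F) ∷ var 4F ∷ []) ∷ []) ∷ []) ∷ []) ∷ [])

  -- arguments: set, state, target, family, stage, head, constants
  visitC : Code 7
  visitC = whenLive (var 1F)
    (case (app wantedC (var 10F ∷ var 4F ∷ var 13F ∷ var 14F ∷ var 15F ∷ var 16F ∷ []))
      (liveC (var 4F) (var 2F) (var 0F) (var 1F))
      (case (app meetsC (var 14F ∷ var 12F ∷ []))
        (liveC (app disjC (item 3 (var (suc 17F)) ∷ var 12F ∷ var 6F ∷ [])) (var 4F) (var 2F)
          (app addC (app pickC (item 2 (var (suc 17F)) ∷ var 12F ∷ []) ∷ var 3F ∷ [])))
        (cons nil (cons (var 4F) (cons (var 6F) (var 5F))))))

  -- arguments: row height, state, constants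
  advanceC : Code 3
  advanceC = whenLive (var 1F)
    (case (app leC (var 10F ∷ var 1F ∷ []))
      (liveC (var 4F) (var 2F) (var 0F) (var 1F))
      (case (app leC (item 4 (var 14F) ∷ app sucC (var 2F ∷ []) ∷ []))
        (liveC (var 6F) (var 4F) (app sucC (var 2F ∷ [])) nil)
        (liveC (var 8F) (app addC (var 14F ∷ app addC (var 14F ∷ var 6F ∷ []) ∷ [])) nil nil)))

  positiveC : Code 1
  positiveC = app leC (app sucC (nil ∷ []) ∷ var 0F ∷ [])

  newRowC : Code 2
  newRowC = whenLive (var 1F)
    (case (app andC (app notC (app positiveC (var 0F ∷ []) ∷ []) ∷ app notC (app positiveC (var 1F ∷ []) ∷ []) ∷ []))
      (liveC (var 4F) (app addC (var 10F ∷ app addC (var 10F ∷ var 2F ∷ []) ∷ [])) nil nil)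
      (liveC (var 6F) (var 4F) (var 2F) (var 3F)))

  visitStep : Code 12
  visitStep = app visitC (var 0F ∷ var 2F ∷ var 7F ∷ var 8F ∷ var 10F ∷ var 5F ∷ var 11F ∷ [])

  -- arguments: head, state, target, family, row height, stage, constants
  chunkC : Code 7
  chunkC = case (app eqC (app pickC (item 0 (var 6F) ∷ var 0F ∷ []) ∷ var 5F ∷ []))
    (var 1F)
    (loopC visitStep (item 5 (var 8F)) (app advanceC (var 6F ∷ var 3F ∷ var 8F ∷ [])))

  chunkStep : Code 9
  chunkStep = app chunkC (var 0F ∷ var 2F ∷ var 5F ∷ var 6F ∷ var 7F ∷ var 3F ∷ var 8F ∷ [])

  -- arguments: stage, state, target, family, row height, constants
  stageC : Code 6
  stageC = app newRowC (var 4F ∷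
    loopC chunkStep (item 5 (var 5F)) (var 1F) ∷ [])

  stageStep : Code 7
  stageStep = app stageC (var 0F ∷ var 2F ∷ var 5F ∷ tail (var 3F) ∷ head (var 3F) ∷ var 6F ∷ [])

  -- arguments: row height and family, state, target, constants
  phaseC : Code 4
  phaseC = loopC stageStep (item 6 (var 3F)) (var 1F)

  phaseStep : Code 6
  phaseStep = app phaseC (var 0F ∷ var 2F ∷ var 3F ∷ var 5F ∷ [])

  -- arguments: target, phases, constants
  simulateC : Code 3
  simulateC = loopC phaseStep (var 1F) (liveC (item 3 (var 2F)) nil nil nil)

  positive≡ : ∀ {x a} → x ≡ N a → ⟦ app notC (app positiveC (var 0F ∷ []) ∷ []) ⟧ (x ∷ []) ≡ encodeBool (a ≤ᵇ 0)
  positive≡ {a = a} eq = trans (not≡ (le≡ N-one eq)) (cong encodeBool (zero? a))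
    where
    zero? : ∀ a → not (1 ≤ᵇ a) ≡ (a ≤ᵇ 0)
    zero? zero    = refl
    zero? (suc a) = refl

  module SchedulingCorrectness {k} (edge : Fin k → Fin k → Bool) (acyclic : ∀ i → ¬ TransClosure (Graph.Edge edge) i i)
    (cost : Fin k → ℕ) (m : ℕ) (stg : Fin k → ℕ) where

    open Graph edge
    open Acyclic acyclic
    open Order rank rank-≥1 rank-≤
    open Scheduler edge acyclic cost m stg

    keysT rangeT orderT constants : Tree
    keysT = nums (λ v → suc (stg v))
    rangeT = nums {k} (λ i → suc (toℕ i))
    orderT = encodeList (List.map hot order)
    constants = encodeList (keysT ∷ matrix desc ∷ nums cost ∷ mask {k} (λ _ → false) ∷ N m ∷ orderT ∷ rangeT ∷ [])

    wanted≡ : ∀ C s h S v → ⟦ wantedC ⟧ (hot v ∷ mask (done S) ∷ mask C ∷ N (suc s) ∷ hot h ∷ constants ∷ []) ≡ encodeBool (wanted C s h S v)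
    wanted≡ C s h S v = and≡ (not≡ (member≡ {i = v} {done S} refl refl))
      (and≡ (member≡ {i = v} {C} refl refl)
        (and≡ (eq≡ (pick≡ (λ v → N (suc (stg v))) {v} refl refl) refl)
          (member≡ {i = v} {desc h} refl (pick≡ (λ h → mask (desc h)) {h} refl refl))))

    visit≡ : ∀ t C s h S v → ⟦ visitC ⟧ (hot v ∷ simulated t S ∷ hot t ∷ mask C ∷ N (suc s) ∷ hot h ∷ constants ∷ []) ≡
             simulated t (visit C s h S v)
    visit≡ t C s h S v with slots S t in eq
    ... | just x = sym (simulated-frozen t (visit C s h S v) still)
      where
      still : slots (visit C s h S v) t ≡ just x
      still with wanted C s h S v in weq
      ... | false = eq
      ... | true = place-extends v S (not⁻ (∧ˡ (subst T (sym weq) _))) eq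
    ... | nothing = trans
        (if≡ (wanted C s h S v) (wanted≡ C s h S v) (if≡ (point v t) (member≡ {i = t} {point v} refl refl) refl live) refl)
        (result (wanted C s h S v))
      where
      x : Slot
      x = machine S , base S , offset S
      P = place v S
      live : (nil ∙ nil) ∙ (⟦ disjC ⟧ (mask {k} (λ _ → false) ∷ hot v ∷ mask (done S) ∷ []) ∙ (N (base S) ∙ (N (machine S) ∙
               ⟦ addC ⟧ (⟦ pickC ⟧ (nums cost ∷ hot v ∷ []) ∷ N (offset S) ∷ [])))) ≡ liveT (mask (done P)) (base P) (machine P) (offset P)
      live = cong₂ (λ d r → (nil ∙ nil) ∙ (d ∙ (N (base S) ∙ (N (machine S) ∙ r))))
        (trans (disj≡ (λ _ → nil) {point v} {done S} refl refl refl)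
          (mask-cong λ i → trans (∨-comm (point v i) (done S i)) (sym (place-done v S i))))
        (trans (add≡ (pick≡ (λ v → N (cost v)) {v} refl refl) refl) (cong N (+-comm (cost v) (offset S))))
      result : ∀ w → (if w then (if point v t then frozenT x else liveT (mask (done P)) (base P) (machine P) (offset P))
                           else liveT (mask (done S)) (base S) (machine S) (offset S)) ≡ simulated t (if w then P else S)
      result false = sym (simulated-live t S eq)
      result true  = placed (point v t) refl
        where
        placed : ∀ b → point v t ≡ b → (if b then frozenT x else liveT (mask (done P)) (base P) (machine P) (offset P)) ≡ simulated t P
        placed true  e = sym (simulated-frozen t P (cong (λ b → if b then just x else slots S t) e))
        placed false e = sym (simulated-live t P (trans (cong (λ b → if b then just x else slots S t) e) eq))

    whenLive≡ : ∀ (t : Fin k) (S : State k) b′ p′ r′ (body : Tree → Tree → Tree → Tree → Tree) →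
      (slots S t ≡ nothing → body (mask (done S)) (N (base S)) (N (machine S)) (N (offset S)) ≡ liveT (mask (done S)) b′ p′ r′) →
      caseTree (simulated t S) nil (λ tag rest → caseTree tag (nil ∙ rest) (λ _ _ →
        caseTree rest nil (λ d x → caseTree x nil (λ b y → caseTree y nil (λ p r → body d b p r))))) ≡
      simulated t (state b′ p′ r′ (slots S))
    whenLive≡ t S b′ p′ r′ body eq with slots S t
    ... | just x  = refl
    ... | nothing = eq refl

    advance≡ : ∀ t D S → ⟦ advanceC ⟧ (N D ∷ simulated t S ∷ constants ∷ []) ≡ simulated t (advance D S)
    advance≡ t D S@(state b p r σ) = trans (whenLive≡ t S (base A) (machine A) (offset A) _ (λ _ → live)) (same (D ≤ᵇ r) (m ≤ᵇ suc p))
      where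
      A = advance D S
      live = trans (if≡ (D ≤ᵇ r) (le≡ refl refl) (if≡ (m ≤ᵇ suc p) (le≡ refl (suc≡ refl)) row next) refl) (shape (D ≤ᵇ r) (m ≤ᵇ suc p))
        where
        row : (nil ∙ nil) ∙ (mask (done S) ∙ (⟦ addC ⟧ (N D ∷ ⟦ addC ⟧ (N D ∷ N b ∷ []) ∷ []) ∙ (nil ∙ nil))) ≡ liveT (mask (done S)) (b + (D + D)) 0 0
        row = cong₂ (λ b z → (nil ∙ nil) ∙ (mask (done S) ∙ (b ∙ (z ∙ z))))
          (trans (add≡ refl (add≡ refl refl)) (cong N (trans (sym (+-assoc D D b)) (+-comm (D + D) b)))) (sym N-zero)
        next : (nil ∙ nil) ∙ (mask (done S) ∙ (N b ∙ (⟦ sucC ⟧ (N p ∷ []) ∙ nil))) ≡ liveT (mask (done S)) b (suc p) 0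
        next = cong₂ (λ p z → (nil ∙ nil) ∙ (mask (done S) ∙ (N b ∙ (p ∙ z)))) (suc≡ refl) (sym N-zero)
        shape : ∀ x y → (if x then (if y then liveT (mask (done S)) (b + (D + D)) 0 0 else liveT (mask (done S)) b (suc p) 0) else liveT (mask (done S)) b p r) ≡
                (let A = if x then (if y then state (b + (D + D)) 0 0 σ else state b (suc p) 0 σ) else S in liveT (mask (done S)) (base A) (machine A) (offset A))
        shape true  true  = refl
        shape true  false = refl
        shape false y     = refl
      same : ∀ x y → (let A = if x then (if y then state (b + (D + D)) 0 0 σ else state b (suc p) 0 σ) else S in
             simulated t (state (base A) (machine A) (offset A) σ) ≡ simulated t A)
      same true  true  = refl
      same true  false = refl
      same false y     = refl

    newRow≡ : ∀ t D S → ⟦ newRowC ⟧ (N D ∷ simulated t S ∷ []) ≡ simulated t (newRow D S)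
    newRow≡ t D S@(state b p r σ) = trans (whenLive≡ t S (base A) (machine A) (offset A) _ (λ _ → live)) (same ((p ≤ᵇ 0) ∧ (r ≤ᵇ 0)))
      where
      A = newRow D S
      live = trans (if≡ ((p ≤ᵇ 0) ∧ (r ≤ᵇ 0)) (and≡ (positive≡ refl) (positive≡ refl)) refl row) (shape ((p ≤ᵇ 0) ∧ (r ≤ᵇ 0)))
        where
        row : (nil ∙ nil) ∙ (mask (done S) ∙ (⟦ addC ⟧ (N D ∷ ⟦ addC ⟧ (N D ∷ N b ∷ []) ∷ []) ∙ (nil ∙ nil))) ≡ liveT (mask (done S)) (b + (D + D)) 0 0
        row = cong₂ (λ b z → (nil ∙ nil) ∙ (mask (done S) ∙ (b ∙ (z ∙ z))))
          (trans (add≡ refl (add≡ refl refl)) (cong N (trans (sym (+-assoc D D b)) (+-comm (D + D) b)))) (sym N-zero)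
        shape : ∀ x → (if x then liveT (mask (done S)) b p r else liveT (mask (done S)) (b + (D + D)) 0 0) ≡
                (let A = if x then S else state (b + (D + D)) 0 0 σ in liveT (mask (done S)) (base A) (machine A) (offset A))
        shape true  = refl
        shape false = refl
      same : ∀ x → (let A = if x then S else state (b + (D + D)) 0 0 σ in simulated t (state (base A) (machine A) (offset A) σ) ≡ simulated t A)
      same true  = refl
      same false = refl

    chunk≡ : ∀ t C D s S h → ⟦ chunkC ⟧ (hot h ∷ simulated t S ∷ hot t ∷ mask C ∷ N D ∷ N (suc s) ∷ constants ∷ []) ≡ simulated t (chunk C D s S h)
    chunk≡ t C D s S h = trans
      (if≡ (stg h ≡ᵇ s) (eq≡ (pick≡ (λ v → N (suc (stg v))) {h} refl refl) refl)
        (trans (cong (loop (var 0F) visitStep (var 0F) ρ orderT) (advance≡ t D S))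
          (foldl-loop visitStep ρ hot (simulated t) (visit C s h) (λ v b S → visit≡ t C s h S v) order (advance D S)))
        refl)
      (push (stg h ≡ᵇ s))
      where
      ρ = nil ∷ nil ∷ hot h ∷ simulated t S ∷ hot t ∷ mask C ∷ N D ∷ N (suc s) ∷ constants ∷ []
      push : ∀ b → (if b then simulated t (foldl (visit C s h) (advance D S) order) else simulated t S) ≡
             simulated t (if b then foldl (visit C s h) (advance D S) order else S)
      push true  = refl
      push false = refl

    stage≡ : ∀ t C D s S → ⟦ stageC ⟧ (N (suc s) ∷ simulated t S ∷ hot t ∷ mask C ∷ N D ∷ constants ∷ []) ≡ simulated t (stage C D S s)
    stage≡ t C D s S = trans
      (cong (λ x → ⟦ newRowC ⟧ (N D ∷ x ∷ [])) (foldl-loop chunkStep (N (suc s) ∷ simulated t S ∷ hot t ∷ mask C ∷ N D ∷ constants ∷ []) hot (simulated t) (chunk C D s) (λ h b S → chunk≡ t C D s S h) order S))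
      (newRow≡ t D (foldl (chunk C D s) S order))

    phase≡ : ∀ t C D S → ⟦ phaseC ⟧ ((N D ∙ mask C) ∷ simulated t S ∷ hot t ∷ constants ∷ []) ≡ simulated t (phase C D S)
    phase≡ t C D S = trans
      (iterate-loop stageStep ((N D ∙ mask C) ∷ simulated t S ∷ hot t ∷ constants ∷ []) (λ i → N (suc i)) (simulated t) (λ s S → stage C D S s) (λ s b S → stage≡ t C D s S) 0 k S)
      (cong (simulated t) (same 0 k S))
      where
      same : ∀ s n S → iterate (λ s S → stage C D S s) s n S ≡ stages C D s n S
      same s zero    S = refl
      same s (suc n) S = same (suc s) n (stage C D S s)

    simulate≡ : ∀ t J (C : ℕ → Mask k) (D : ℕ → ℕ) (S : ℕ → State k) → S 0 ≡ state 0 0 0 (λ _ → nothing) →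
                (∀ j → S (suc j) ≡ phase (C j) (D j) (S j)) →
                ⟦ simulateC ⟧ (hot t ∷ encodeFamily {J} (λ j → N (D (toℕ j)) ∙ mask (C (toℕ j))) ∷ constants ∷ []) ≡ simulated t (S J)
    simulate≡ t J C D S S₀ step = trans
      (cong (loop (var 0F) phaseStep (var 0F) ρ (encodeFamily {J} (λ j → N (D (toℕ j)) ∙ mask (C (toℕ j))))) initial)
      (trans (iterate-loop phaseStep ρ (λ j → N (D j) ∙ mask (C j)) (simulated t) (λ j → phase (C j) (D j)) (λ j b S → phase≡ t (C j) (D j) S) 0 J (S 0))
        (cong (simulated t) (trans (same 0 J) (cong S (+-identityʳ J)))))
      where
      ρ = hot t ∷ encodeFamily {J} (λ j → N (D (toℕ j)) ∙ mask (C (toℕ j))) ∷ constants ∷ []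
      initial : (nil ∙ nil) ∙ (mask {k} (λ _ → false) ∙ (nil ∙ (nil ∙ nil))) ≡ simulated t (S 0)
      initial = trans (cong (λ z → (nil ∙ nil) ∙ (mask {k} (λ _ → false) ∙ (z ∙ (z ∙ z)))) (sym N-zero)) (cong (simulated t) (sym S₀))
      same : ∀ c n → iterate (λ j → phase (C j) (D j)) c n (S c) ≡ S (n + c)
      same c zero    = refl
      same c (suc n) = trans (cong (iterate (λ j → phase (C j) (D j)) (suc c) n) (sym (step c))) (trans (same (suc c) n) (cong S (+-suc n c)))

module PlanningPrograms where

  open Language
  open Arithmetic
  open Families
  open Masks hiding (_∩_)
  open Digraphs
  open ForestPlanning
  open UnitPlanning
  open SchedulingPrograms
  open import Data.Bool using (Bool; true; false; not; if_then_else_)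
  open import Data.Fin using (Fin; zero; suc)
  open import Data.List using (List; []; _∷_; foldl; allFin)
  import Data.List as List
  open import Data.Nat using (ℕ; zero; suc; _*_; _⊔_; _≤ᵇ_)
  open import Data.Nat.Properties hiding (_≟_)
  open import Data.Nat.Tactic.RingSolver using (solve-∀)
  open import Data.Vec using ([]; _∷_)
  open import Function using (_∘_; id)
  open import Relation.Binary.Construct.Closure.Transitive using (TransClosure)
  open import Relation.Binary.PropositionalEquality using (_≡_; refl; trans; cong; cong₂)
  open import Relation.Nullary using (¬_)

  -- constants: zeros over the sets, zeros over the elements, incidence matrix,
  -- weights, costs, identity matrix, edges, and three more that depend on the kind of
  -- instance

  -- arguments: family, constants
  coverC : Code 2
  coverC = app unionC (item 0 (var 1F) ∷ item 1 (var 1F) ∷ var 0F ∷ item 2 (var 1F) ∷ [])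

  valueC : Code 2
  valueC = app sumC (item 3 (var 1F) ∷ app coverC (var 0F ∷ var 1F ∷ []) ∷ [])

  costC : Code 2
  costC = app sumC (item 4 (var 1F) ∷ var 0F ∷ [])

  complementC : Code 1
  complementC = mapC (app notC (var 1F ∷ [])) (var 0F)

  remainingC : Code 2
  remainingC = app (case (app positiveC (var 0F ∷ [])) (app sucC (nil ∷ [])) (var 2F))
    (app sumC (item 3 (var 1F) ∷ app complementC (app coverC (var 0F ∷ var 1F ∷ []) ∷ []) ∷ []) ∷ [])

  eightC : Code 1
  eightC = app doubleC (app doubleC (app doubleC (var 0F ∷ []) ∷ []) ∷ [])

  complement≡ : ∀ {k x} {f : Fin k → Bool} → x ≡ mask f → ⟦ complementC ⟧ (x ∷ []) ≡ mask (λ i → not (f i))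
  complement≡ {f = f} refl = map-loop (app notC (var 1F ∷ [])) (mask f ∷ []) (λ i → encodeBool (f i)) (λ i → encodeBool (not (f i)))
    (λ i _ _ _ → notC-correct (f i))

  eight≡ : ∀ {x a} → x ≡ N a → ⟦ eightC ⟧ (x ∷ []) ≡ N (8 * a)
  eight≡ {a = a} refl = trans (cong (λ t → ⟦ doubleC ⟧ (⟦ doubleC ⟧ (t ∷ []) ∷ [])) (doubleC-correct a))
    (trans (cong (λ t → ⟦ doubleC ⟧ (t ∷ [])) (doubleC-correct (2 * a))) (trans (doubleC-correct (2 * (2 * a))) (cong N (sh a))))
    where
    sh : ∀ a → 2 * (2 * (2 * a)) ≡ 8 * a
    sh = solve-∀

  module Measures {k n} (S : Fin k → Fin n → Bool) (w : Fin n → ℕ) (cost : Fin k → ℕ) (edge : Fin k → Fin k → Bool) (rest : Tree) where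

    open Coverage S w

    constants : Tree
    constants = mask {k} (λ _ → false) ∙ (mask {n} (λ _ → false) ∙ (matrix S ∙ (nums w ∙ (nums cost ∙ (encodeFamily (hot {k}) ∙ (matrix edge ∙ rest))))))

    cover≡ : ∀ C → ⟦ coverC ⟧ (mask C ∷ constants ∷ []) ≡ mask (cov C)
    cover≡ C = unionC-correct (λ (_ : Fin k) → nil) (λ (_ : Fin n) → nil) C S

    value≡ : ∀ {x} C → x ≡ mask C → ⟦ valueC ⟧ (x ∷ constants ∷ []) ≡ N (value C)
    value≡ C refl = trans (cong (λ t → ⟦ sumC ⟧ (nums w ∷ t ∷ [])) (cover≡ C)) (sumC-correct w (cov C))

    cost≡ : ∀ C → ⟦ costC ⟧ (mask C ∷ constants ∷ []) ≡ N (weigh cost C)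
    cost≡ C = sumC-correct cost C

    remaining≡ : ∀ C → ⟦ remainingC ⟧ (mask C ∷ constants ∷ []) ≡ N (1 ⊔ weigh w (not ∘ cov C))
    remaining≡ C = trans (cong (λ t → ⟦ case (app positiveC (var 0F ∷ [])) (app sucC (nil ∷ [])) (var 2F) ⟧ (t ∷ []))
        (trans (cong (λ t → ⟦ sumC ⟧ (nums w ∷ t ∷ [])) (complement≡ {f = cov C} (cover≡ C))) (sumC-correct w (not ∘ cov C))))
      (trans (if≡ (1 ≤ᵇ u) (le≡ N-one refl) refl N-one) (top u))
      where
      u = weigh w (not ∘ cov C)
      top : ∀ u → (if 1 ≤ᵇ u then N u else N 1) ≡ N (1 ⊔ u)
      top zero    = refl
      top (suc u) = refl

  -- Unit costs.  The three last constants are the depths, the ranks and the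
  -- matrix of predecessor closures.

  -- arguments: set, family, time, scale, slack, budget, constants
  worthC : Code 7
  worthC = app andC (app leC (app pickC (item 7 (var 6F) ∷ var 0F ∷ []) ∷ var 2F ∷ []) ∷
    app andC (app leC (app pickC (item 8 (var 6F) ∷ var 0F ∷ []) ∷ var 5F ∷ []) ∷
    app notC (app leC
      (app mulC (var 3F ∷ app valueC (app disjC (item 0 (var 6F) ∷ var 1F ∷ app pickC (item 9 (var 6F) ∷ var 0F ∷ []) ∷ []) ∷ var 6F ∷ []) ∷ []) ∷
       app addC (app mulC (var 3F ∷ app valueC (var 1F ∷ var 6F ∷ []) ∷ []) ∷ var 4F ∷ []) ∷ []) ∷ []) ∷ []) ∷ [])

  -- arguments: family, time, scale, slack, budget, constants
  addStep : Code 9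
  addStep = case (app worthC (var 0F ∷ var 2F ∷ var 4F ∷ var 5F ∷ var 6F ∷ var 7F ∷ var 8F ∷ []))
    (var 2F)
    (app disjC (item 0 (var 10F) ∷ var 4F ∷ app pickC (item 9 (var 10F) ∷ var 2F ∷ []) ∷ []))

  selectC : Code 6
  selectC = loopC addStep (item 5 (var 5F)) (var 0F)

  unitArgs : Codes 4 6
  unitArgs = var 1F ∷ var 0F ∷ app eightC (app mulC (var 2F ∷ var 0F ∷ []) ∷ []) ∷ app remainingC (var 1F ∷ var 3F ∷ []) ∷
    app mulC (var 2F ∷ var 0F ∷ []) ∷ var 3F ∷ []

  -- arguments: time, family, number of machines, constants
  unitPlanC : Code 4
  unitPlanC = app selectC unitArgs

  module UnitCorrectness {k n} (edge : Fin k → Fin k → Bool) (S : Fin k → Fin n → Bool) (w : Fin n → ℕ) (cost : Fin k → ℕ)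
    (acyclic : ∀ i → ¬ TransClosure (Graph.Edge edge) i i) (m : ℕ) where

    open Graph edge
    open Acyclic acyclic
    open Coverage S w
    open Measures S w cost edge (nums depth ∙ (nums rank ∙ (matrix (λ v x → desc x v) ∙ nil)))

    module Plan (t : ℕ) (a F B : ℕ) = UnitPlan edge S w acyclic a F t B

    up≡ : ∀ v → ⟦ pickC ⟧ (matrix (λ v x → desc x v) ∷ hot v ∷ []) ≡ mask (λ x → desc x v)
    up≡ v = pick≡ (λ v → mask (λ x → desc x v)) {v} refl refl

    larger≡ : ∀ C v → ⟦ disjC ⟧ (mask {k} (λ _ → false) ∷ mask C ∷ ⟦ pickC ⟧ (matrix (λ v x → desc x v) ∷ hot v ∷ []) ∷ []) ≡
              mask (C ∪ (λ x → desc x v))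
    larger≡ C v = disj≡ (λ _ → nil) {C} {λ x → desc x v} refl refl (up≡ v)

    worth≡ : ∀ t a F B v C → ⟦ worthC ⟧ (hot v ∷ mask C ∷ N t ∷ N a ∷ N F ∷ N B ∷ constants ∷ []) ≡ encodeBool (Plan.worth t a F B v C)
    worth≡ t a F B v C = and≡ (le≡ (pick≡ (λ v → N (depth v)) {v} refl refl) refl)
      (and≡ (le≡ (pick≡ (λ v → N (rank v)) {v} refl refl) refl)
        (not≡ (le≡ (mul≡ refl (value≡ (C ∪ (λ x → desc x v)) (larger≡ C v))) (add≡ (mul≡ refl (value≡ C refl)) refl))))

    select≡ : ∀ t a F B C → ⟦ selectC ⟧ (mask C ∷ N t ∷ N a ∷ N F ∷ N B ∷ constants ∷ []) ≡ mask (Plan.select t a F B (allFin k) C)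
    select≡ t a F B C = trans
      (cong (λ x → loop (var 0F) addStep (var 0F) ρ x (mask C)) (family-map {k = k} hot id))
      (trans (foldl-loop addStep ρ hot mask (Plan.add t a F B) step (allFin k) C) (cong mask (same (allFin k) C)))
      where
      ρ = mask C ∷ N t ∷ N a ∷ N F ∷ N B ∷ constants ∷ []
      push : ∀ b C v → (if b then mask (C ∪ (λ x → desc x v)) else mask C) ≡ mask (if b then C ∪ (λ x → desc x v) else C)
      push true  C v = refl
      push false C v = refl
      step : ∀ v b C → ⟦ addStep ⟧ (hot v ∷ b ∷ mask C ∷ ρ) ≡ mask (Plan.add t a F B C v)
      step v b C = trans (if≡ (Plan.worth t a F B v C) (worth≡ t a F B v C) (larger≡ C v) refl) (push (Plan.worth t a F B v C) C v)
      same : ∀ vs C → foldl (Plan.add t a F B) C vs ≡ Plan.select t a F B vs C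
      same []       C = refl
      same (v ∷ vs) C = same vs (Plan.add t a F B C v)

    unitPlan≡ : ∀ t C → Computes unitPlanC (N t ∷ mask C ∷ N m ∷ constants ∷ [])
                (mask (Plan.select t (8 * (m * t)) (1 ⊔ weigh w (not ∘ cov C)) (m * t) (allFin k) C))
    unitPlan≡ t C = app≡ selectC unitArgs (N t ∷ mask C ∷ N m ∷ constants ∷ []) (args t C)
      (computes (select≡ t (8 * (m * t)) (1 ⊔ weigh w (not ∘ cov C)) (m * t) C))
      where
      args : ∀ t C → ⟦ unitArgs ⟧* (N t ∷ mask C ∷ N m ∷ constants ∷ []) ≡
             mask C ∷ N t ∷ N (8 * (m * t)) ∷ N (1 ⊔ weigh w (not ∘ cov C)) ∷ N (m * t) ∷ constants ∷ []
      args t C = cong₂ (λ a v → mask C ∷ N t ∷ a ∷ v) (eight≡ (mul≡ refl refl))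
        (cong₂ (λ F B → F ∷ B ∷ constants ∷ []) (remaining≡ C) (mul≡ refl refl))

module ForestPrograms where

  open Language
  open Arithmetic
  open Families
  open Masks hiding (_∩_)
  open Digraphs
  open ForestPlanning
  open SchedulingPrograms
  open PlanningPrograms
  open import Data.Bool using (Bool; true; false; T; _∧_; not; if_then_else_)
  open import Data.Fin using (Fin; zero; suc)
  open import Data.List using (List; []; _∷_; foldl; foldr; tabulate; allFin)
  import Data.List as List
  open import Data.List.Properties using (map-tabulate)
  open import Data.Nat using (ℕ; zero; suc; _+_; _*_; _∸_; _⊔_; _≤_; _≡ᵇ_; z≤n; s≤s; s≤s⁻¹)
  open import Data.Nat.ListAction using (sum)
  open import Data.Nat.Properties hiding (_≟_)
  open import Data.Nat.Tactic.RingSolver using (solve-∀)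
  open import Data.Product using (_×_; _,_; ∃-syntax)
  open import Data.Vec using (Vec; []; _∷_)
  open import Function using (_∘_; id)
  open import Relation.Binary.Construct.Closure.Transitive using (TransClosure)
  open import Relation.Binary.PropositionalEquality using (_≡_; refl; sym; trans; cong; cong₂; subst)
  open import Relation.Nullary using (¬_)
  -- Out-forests.  The three last constants are the classes, the costs of the
  -- predecessor closures and the roots.  The recursion of the planner is run on
  -- a list of tasks, which enter and leave nodes, and a stack of families.

  -- arguments: heavy or light, set, constants
  childC : Code 7
  childC = app andC (app meetsC (var 1F ∷ app pickC (item 6 (var 6F) ∷ var 5F ∷ []) ∷ []) ∷
    case (var 4F) (app notC (same ∷ [])) (app eqC (app pickC (item 7 (var 8F) ∷ var 3F ∷ []) ∷ app pickC (item 7 (var 8F) ∷ var 7F ∷ []) ∷ [])) ∷ [])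
    where
    same : Code 7
    same = app eqC (app pickC (item 7 (var 6F) ∷ var 1F ∷ []) ∷ app pickC (item 7 (var 6F) ∷ var 5F ∷ []) ∷ [])

  childrenC : Code 3
  childrenC = mapC childC (item 5 (var 2F))

  enterH : Code 7
  enterH = case (app meetsC (var 1F ∷ var 4F ∷ [])) (var 0F) (cons (cons trueC (var 3F)) (var 2F))

  -- arguments: nodes to enter, tasks, constants
  enterC : Code 3
  enterC = rec (var 0F) (var 2F) enterH (item 5 (var 2F)) (var 1F)

  -- arguments: set, family to be covered, family to be paid, scale, slack, constants
  balanceC : Code 6
  balanceC = app addC
    (app mulC (app pickC (item 7 (var 5F) ∷ var 0F ∷ []) ∷ app mulC (var 3F ∷ app valueC (var 1F ∷ var 5F ∷ []) ∷ []) ∷ []) ∷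
     app mulC (var 4F ∷ app costC (var 2F ∷ var 5F ∷ []) ∷ []) ∷ [])

  -- arguments: set, old family, new family, time, scale, slack, constants
  acceptC : Code 7
  acceptC = app andC (app leC (app pickC (item 8 (var 6F) ∷ var 0F ∷ []) ∷ var 3F ∷ []) ∷
    app notC (app leC (app balanceC (var 0F ∷ var 2F ∷ var 1F ∷ var 4F ∷ var 5F ∷ var 6F ∷ []) ∷
                       app balanceC (var 0F ∷ var 1F ∷ var 2F ∷ var 4F ∷ var 5F ∷ var 6F ∷ []) ∷ []) ∷ []) ∷ [])

  -- arguments: tasks and stack, time, scale, slack, constants
  stepC : Code 5
  stepC = case (var 0F) nil (case (var 0F) (cons nil (var 1F)) (case (var 0F) nil (case (var 5F) (cons nil nil)
    (case (var 2F)
      (case (var 1F) (cons nil nil)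
        (cons (var 7F) (cons (case (app acceptC (var 5F ∷ var 0F ∷ var 2F ∷ var 11F ∷ var 12F ∷ var 13F ∷ var 14F ∷ [])) (var 0F) (var 4F)) (var 1F))))
      (cons (app enterC (app childrenC (falseC ∷ var 5F ∷ var 14F ∷ []) ∷
               app enterC (app childrenC (trueC ∷ var 5F ∷ var 14F ∷ []) ∷ cons (cons falseC (var 5F)) (var 7F) ∷ var 14F ∷ []) ∷ var 14F ∷ []))
        (cons (app disjC (item 0 (var 14F) ∷ var 2F ∷ var 5F ∷ [])) (cons (var 2F) (var 3F))))))))

  machineStep : Code 8
  machineStep = app stepC (var 2F ∷ var 4F ∷ var 5F ∷ var 6F ∷ var 7F ∷ [])

  -- arguments: tasks and stack, time, scale, slack, constants
  runC : Code 5
  runC = loopC machineStep (item 5 (var 4F)) (var 0F)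

  -- arguments: family, time, scale, slack, constants
  startC passesC : Code 5
  startC = cons (app enterC (item 9 (var 4F) ∷ nil ∷ var 4F ∷ [])) (cons (var 0F) nil)

  startArgs middleArgs : Codes 5 5
  startArgs = startC ∷ var 1F ∷ var 2F ∷ var 3F ∷ var 4F ∷ []
  middleArgs = app runC startArgs ∷ var 1F ∷ var 2F ∷ var 3F ∷ var 4F ∷ []

  finishedC passC : Code 5
  finishedC = app runC middleArgs
  passC = head (tail finishedC)

  passStep : Code 8
  passStep = app passC (var 2F ∷ var 4F ∷ var 5F ∷ var 6F ∷ var 7F ∷ [])

  passesC = loopC passStep (item 5 (var 4F)) (var 0F)

  forestArgs : Codes 4 5
  forestArgs = var 1F ∷ var 0F ∷ app eightC (app mulC (var 2F ∷ var 0F ∷ []) ∷ []) ∷ app remainingC (var 1F ∷ var 3F ∷ []) ∷ var 3F ∷ []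

  -- arguments: time, family, number of machines, constants
  forestPlanC : Code 4
  forestPlanC = app passesC forestArgs

  module ForestCorrectness {k n} (edge : Fin k → Fin k → Bool) (S : Fin k → Fin n → Bool) (w : Fin n → ℕ) (cost : Fin k → ℕ)
    (acyclic : ∀ i → ¬ TransClosure (Graph.Edge edge) i i)
    (out : ∀ {i i′ j} → Graph.Edge edge i j → Graph.Edge edge i′ j → i ≡ i′) (m : ℕ) where

    open Graph edge
    open Acyclic acyclic
    open Forest out
    open Coverage S w
    open Measures S w cost edge (nums class ∙ (nums (λ v → weigh cost (λ x → desc x v)) ∙ (mask root ∙ nil)))

    module Plan (t a F : ℕ) = ForestPlan edge S w cost acyclic out a F t

    child : Bool → Fin k → Mask k
    child b v c = edge v c ∧ (if b then class c ≡ᵇ class v else not (class c ≡ᵇ class v))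

    Task : Set
    Task = Bool × Fin k

    Machine : Set
    Machine = List Task × List (Mask k)

    enter : Mask k → List (Fin k) → List Task → List Task
    enter t cs ts = foldr (λ c r → if t c then (true , c) ∷ r else r) ts cs

    module Simulation (t a F : ℕ) where
      open Plan t a F

      move : Machine → Machine
      move ([] , st)                       = [] , st
      move (_ ∷ ts , [])                   = [] , []
      move ((true , v) ∷ ts , C ∷ st)      =
        enter (child false v) (allFin k) (enter (child true v) (allFin k) ((false , v) ∷ ts)) , (C ∪ point v) ∷ C ∷ st
      move ((false , v) ∷ ts , D ∷ [])     = [] , []
      move ((false , v) ∷ ts , D ∷ C ∷ st) = ts , settle v C D ∷ st

      moves : ℕ → Machine → Machine
      moves zero    M = M
      moves (suc l) M = moves l (move M)

      moves-+ : ∀ l l′ M → moves (l + l′) M ≡ moves l′ (moves l M)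
      moves-+ zero    l′ M = refl
      moves-+ (suc l) l′ M = moves-+ l l′ (move M)

      idle : ∀ l st → moves l ([] , st) ≡ ([] , st)
      idle zero    st = refl
      idle (suc l) st = idle l st

      weights : (Fin k → Bool) → List (Fin k) → ℕ
      weights t cs = sum (List.map (λ c → when (t c) (width c)) cs)

      weights-∑ : ∀ t → weights t (allFin k) ≡ ∑ (λ c → when (t c) (width c))
      weights-∑ t = cong sum (map-tabulate id (λ c → when (t c) (width c)))

      walk-moves : ∀ m v C ts st → width v ≤ m →
                   ∃[ l ] l ≤ 2 * width v × moves l ((true , v) ∷ ts , C ∷ st) ≡ (ts , walk m v C ∷ st)
      sweep-moves : ∀ m t cs C ts st → (∀ c → T (t c) → width c ≤ m) →
                    ∃[ l ] l ≤ 2 * weights t cs × moves l (enter t cs ts , C ∷ st) ≡ (ts , sweep m t cs C ∷ st)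
      sweep-moves m t []       C ts st le = 0 , z≤n , refl
      sweep-moves m t (c ∷ cs) C ts st le with t c in eq
      ... | false = sweep-moves m t cs C ts st le
      ... | true =
        let l , l≤ , run = walk-moves m c C (enter t cs ts) st (le c (subst T (sym eq) _))
            l′ , l′≤ , run′ = sweep-moves m t cs (walk m c C) ts st le
        in l + l′ , ≤-trans (+-mono-≤ l≤ l′≤) (≤-reflexive (sym (*-distribˡ-+ 2 (width c) (weights t cs)))) ,
           trans (moves-+ l l′ _) (trans (cong (moves l′) run) run′)
      walk-moves zero    v C ts st le with () ← ≤-trans (width-≥1 v) le
      walk-moves (suc m) v C ts st le =
        let l , l≤ , run = sweep-moves m (light v) (allFin k) (C ∪ point v)
                             (enter (heavy v) (allFin k) ((false , v) ∷ ts)) (C ∷ st) (λ c t → smaller c (∧ˡ t))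
            l′ , l′≤ , run′ = sweep-moves m (heavy v) (allFin k) _ ((false , v) ∷ ts) (C ∷ st) (λ c t → smaller c (∧ˡ t))
        in suc (l + (l′ + 1)) , count≤ l l′ l≤ l′≤ ,
           trans (moves-+ l (l′ + 1) _) (trans (cong (moves (l′ + 1)) run)
             (trans (moves-+ l′ 1 _) (cong (moves 1) run′)))
        where
        smaller : ∀ c → T (edge v c) → width c ≤ m
        smaller c e = s≤s⁻¹ (≤-trans (width-edge e) le)
        count≤ : ∀ l l′ → l ≤ 2 * weights (light v) (allFin k) → l′ ≤ 2 * weights (heavy v) (allFin k) → suc (l + (l′ + 1)) ≤ 2 * width v
        count≤ l l′ l≤ l′≤ = ≤-trans (s≤s (+-mono-≤ l≤ (+-monoˡ-≤ 1 l′≤))) (≤-trans (≤-reflexive (sh (weights (light v) (allFin k)) (weights (heavy v) (allFin k))))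
          (*-monoʳ-≤ 2 (≤-trans (+-monoʳ-≤ 1 (≤-reflexive (trans (cong₂ _+_ (weights-∑ (light v)) (weights-∑ (heavy v)))
            (trans (sym (∑-+ (λ c → when (light v c) (width c)) (λ c → when (heavy v c) (width c)))) (∑-cong split))))) (widths v))))
          where
          sh : ∀ x y → suc (2 * x + (2 * y + 1)) ≡ 2 * (1 + (x + y))
          sh = solve-∀
          either : ∀ e b x → when (e ∧ not b) x + when (e ∧ b) x ≡ when e x
          either false b     x = refl
          either true  true  x = refl
          either true  false x = +-identityʳ x
          split : ∀ c → when (light v c) (width c) + when (heavy v c) (width c) ≡ when (edge v c) (width c)
          split c = either (edge v c) (class c ≡ᵇ class v) (width c)

      pass-moves : ∀ C → moves (k + k) (enter root (allFin k) [] , C ∷ []) ≡ ([] , pass C ∷ [])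
      pass-moves C =
        let l , l≤ , run = sweep-moves k root (allFin k) C [] [] (λ c _ → width-≤ c)
            l≤2k = ≤-trans l≤ (≤-trans (*-monoʳ-≤ 2 (≤-trans (≤-reflexive (weights-∑ root))
                     (≤-trans (roots-disjoint-weigh (λ _ → 1) (λ _ → true)) (count-≤ {k} (λ _ → true)))))
                     (≤-reflexive (cong (k +_) (+-identityʳ k))))
        in trans (cong (λ l → moves l M) (sym (m+[n∸m]≡n l≤2k)))
             (trans (moves-+ l (k + k ∸ l) M) (trans (cong (moves (k + k ∸ l)) run) (idle (k + k ∸ l) (pass C ∷ []))))
        where
        M : Machine
        M = enter root (allFin k) [] , C ∷ []

      taskT : Task → Tree
      taskT (b , v) = encodeBool b ∙ hot v

      tasksT : List Task → Tree
      tasksT ts = encodeList (List.map taskT ts)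

      machineT : Machine → Tree
      machineT (ts , st) = tasksT ts ∙ encodeList (List.map mask st)

      child≡ : ∀ r c b p f v → ⟦ childC ⟧ (r ∷ hot c ∷ b ∷ p ∷ encodeBool f ∷ hot v ∷ constants ∷ []) ≡ encodeBool (child f v c)
      child≡ r c b p f v = trans (and≡ (member≡ {i = c} {edge v} refl (pick≡ (λ v → mask (edge v)) {v} refl refl)) (pick-flag f))
                           (cong (λ x → encodeBool (edge v c ∧ x)) refl)
        where
        same : ⟦ eqC ⟧ (⟦ pickC ⟧ (nums class ∷ hot c ∷ []) ∷ ⟦ pickC ⟧ (nums class ∷ hot v ∷ []) ∷ []) ≡ encodeBool (class c ≡ᵇ class v)
        same = eq≡ (pick≡ (λ v → N (class v)) {c} refl refl) (pick≡ (λ v → N (class v)) {v} refl refl)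
        pick-flag : ∀ f → caseTree (encodeBool f)
          (⟦ notC ⟧ (⟦ eqC ⟧ (⟦ pickC ⟧ (nums class ∷ hot c ∷ []) ∷ ⟦ pickC ⟧ (nums class ∷ hot v ∷ []) ∷ []) ∷ []))
          (λ _ _ → ⟦ eqC ⟧ (⟦ pickC ⟧ (nums class ∷ hot c ∷ []) ∷ ⟦ pickC ⟧ (nums class ∷ hot v ∷ []) ∷ []))
          ≡ encodeBool (if f then class c ≡ᵇ class v else not (class c ≡ᵇ class v))
        pick-flag true  = same
        pick-flag false = not≡ same

      children≡ : ∀ f v → ⟦ childrenC ⟧ (encodeBool f ∷ hot v ∷ constants ∷ []) ≡ mask (child f v)
      children≡ f v = map-loop childC (encodeBool f ∷ hot v ∷ constants ∷ []) hot (λ c → encodeBool (child f v c))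
        (λ c r b p → child≡ r c b p f v)

      enter≡ : ∀ {x y} t ts → x ≡ mask t → y ≡ tasksT ts → ⟦ enterC ⟧ (x ∷ y ∷ constants ∷ []) ≡ tasksT (enter t (allFin k) ts)
      enter≡ t ts refl refl = trans (cong (λ x → loop (var 0F) (var 2F) enterH ρ x (tasksT ts)) (family-map {k = k} hot id)) (go (allFin k))
        where
        ρ = mask t ∷ tasksT ts ∷ constants ∷ []
        go : ∀ cs → loop (var 0F) (var 2F) enterH ρ (encodeList (List.map hot cs)) (tasksT ts) ≡ tasksT (enter t cs ts)
        go [] = refl
        go (c ∷ cs) = trans
          (if≡ (t c) (member≡ {i = c} {t} refl refl) (cong (taskT (true , c) ∙_) (go cs)) (go cs)) (push (t c))
          where
          push : ∀ b → (if b then taskT (true , c) ∙ tasksT (enter t cs ts) else tasksT (enter t cs ts)) ≡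
                 tasksT (if b then (true , c) ∷ enter t cs ts else enter t cs ts)
          push true  = refl
          push false = refl

      balance≡ : ∀ v C D → Computes balanceC (hot v ∷ mask C ∷ mask D ∷ N a ∷ N F ∷ constants ∷ []) (N (class v * g C + h D))
      balance≡ v C D = computes (add≡ (mul≡ (pick≡ (λ v → N (class v)) {v} refl refl) (mul≡ refl (value≡ C refl))) (mul≡ refl (cost≡ D)))

      accept≡ : ∀ v C D → Computes acceptC (hot v ∷ mask C ∷ mask D ∷ N t ∷ N a ∷ N F ∷ constants ∷ []) (encodeBool (accept v C D))
      accept≡ v C D = and-computes (le-computes (computes (pick≡ (λ v → N (weigh cost (λ x → desc x v))) {v} refl refl)) (computes refl))
        (not-computes (le-computes (app≡ balanceC _ _ refl (balance≡ v D C)) (app≡ balanceC _ _ refl (balance≡ v C D))))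

      ρ : Vec Tree 4
      ρ = N t ∷ N a ∷ N F ∷ constants ∷ []

      move≡ : ∀ M → ⟦ stepC ⟧ (machineT M ∷ ρ) ≡ machineT (move M)
      move≡ ([] , st)     = refl
      move≡ (_ ∷ ts , []) = refl
      move≡ ((true , v) ∷ ts , C ∷ st) = cong₂ (λ ts D → ts ∙ (D ∙ (mask C ∙ encodeList (List.map mask st))))
        (enter≡ (child false v) (enter (child true v) (allFin k) ((false , v) ∷ ts)) (children≡ false v)
          (enter≡ (child true v) ((false , v) ∷ ts) (children≡ true v) refl))
        (disj≡ (λ _ → nil) {C} {point v} refl refl refl)
      move≡ ((false , v) ∷ ts , D ∷ [])     = refl
      move≡ ((false , v) ∷ ts , D ∷ C ∷ st) = cong (λ E → tasksT ts ∙ (E ∙ encodeList (List.map mask st)))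
        (trans (if≡ (accept v C D) (computed (accept≡ v C D)) refl refl) (push (accept v C D)))
        where
        push : ∀ b → (if b then mask D else mask C) ≡ mask (if b then D else C)
        push true  = refl
        push false = refl

      run≡ : ∀ M → Computes runC (machineT M ∷ ρ) (machineT (moves k M))
      run≡ M = computes (trans (cong (λ x → loop (var 0F) machineStep (var 0F) (machineT M ∷ ρ) x (machineT M)) (family-map {k = k} hot id))
        (trans (foldl-loop machineStep (machineT M ∷ ρ) hot machineT (λ M _ → move M) (λ _ _ M → move≡ M) (allFin k) M)
          (cong machineT (same id M))))
        where
        same : ∀ {l} (f : Fin l → Fin k) M → foldl (λ M _ → move M) M (tabulate f) ≡ moves l M
        same {zero}  f M = refl
        same {suc l} f M = same (f ∘ suc) (move M)

      pass≡ : ∀ C → ⟦ passC ⟧ (mask C ∷ ρ) ≡ mask (pass C)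
      pass≡ C = cong (λ M → caseTree (caseTree M nil (λ _ y → y)) nil (λ x _ → x)) (trans (computed finished) (cong machineT end))
        where
        M₀ : Machine
        M₀ = enter root (allFin k) [] , C ∷ []
        start : ⟦ startArgs ⟧* (mask C ∷ ρ) ≡ machineT M₀ ∷ ρ
        start = cong (λ ts → (ts ∙ (mask C ∙ nil)) ∷ ρ) (enter≡ root [] refl refl)
        finished : Computes finishedC (mask C ∷ ρ) (machineT (moves k (moves k M₀)))
        finished = app≡ runC middleArgs (mask C ∷ ρ)
          (cong (_∷ ρ) (computed (app≡ runC startArgs (mask C ∷ ρ) start (run≡ M₀)))) (run≡ (moves k M₀))
        end : moves k (moves k M₀) ≡ ([] , pass C ∷ [])
        end = trans (sym (moves-+ k k M₀)) (pass-moves C)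

      passes≡ : ∀ C → Computes passesC (mask C ∷ ρ) (mask (passes k C))
      passes≡ C = computes (trans (cong (λ x → loop (var 0F) passStep (var 0F) (mask C ∷ ρ) x (mask C)) (family-map {k = k} hot id))
        (trans (foldl-loop passStep (mask C ∷ ρ) hot mask (λ C _ → pass C) (λ _ _ C → pass≡ C) (allFin k) C) (cong mask (same id C))))
        where
        same : ∀ {l} (f : Fin l → Fin k) C → foldl (λ C _ → pass C) C (tabulate f) ≡ passes l C
        same {zero}  f C = refl
        same {suc l} f C = same (f ∘ suc) (pass C)

    forestPlan≡ : ∀ t C → Computes forestPlanC (N t ∷ mask C ∷ N m ∷ constants ∷ [])
                  (mask (Plan.passes t (8 * (m * t)) (1 ⊔ weigh w (not ∘ cov C)) k C))
    forestPlan≡ t C = app≡ passesC forestArgs (N t ∷ mask C ∷ N m ∷ constants ∷ []) (args t C)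
      (Simulation.passes≡ t (8 * (m * t)) (1 ⊔ weigh w (not ∘ cov C)) C)
      where
      args : ∀ t C → ⟦ forestArgs ⟧* (N t ∷ mask C ∷ N m ∷ constants ∷ []) ≡
             mask C ∷ N t ∷ N (8 * (m * t)) ∷ N (1 ⊔ weigh w (not ∘ cov C)) ∷ constants ∷ []
      args t C = cong₂ (λ a F → mask C ∷ N t ∷ a ∷ F ∷ constants ∷ []) (eight≡ (mul≡ refl refl)) (remaining≡ C)

module DerivedData where

  open Language
  open Arithmetic
  open Families
  open Masks hiding (_∩_)
  open Digraphs
  open Scheduling
  open SchedulingPrograms
  open PlanningPrograms
  open import Data.Bool using (Bool; true; false; _∧_; not; if_then_else_)
  open import Data.Fin using (Fin; zero; suc; toℕ)
  open import Data.List using (List; []; _∷_; allFin; filterᵇ; length; _++_)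
  import Data.List as List
  open import Data.List.Properties using (length-++)
  open import Data.Nat using (ℕ; zero; suc; _+_; _^_; _∸_; _≤_; _≤ᵇ_; _<ᵇ_; _≡ᵇ_)
  open import Data.Nat.Binary using (ℕᵇ; zero; 2[1+_]; 1+[2_]; fromℕ) renaming (size to lengthᵇ)
  open import Data.Nat.Properties hiding (_≟_)
  open import Data.Vec using (Vec; []; _∷_)
  open import Function using (id)
  open import Relation.Binary.Construct.Closure.Transitive using (TransClosure)
  open import Relation.Binary.PropositionalEquality using (_≡_; refl; sym; trans; cong; cong₂)
  open import Relation.Nullary using (¬_)

  readH writeH : Code 5
  readH  = cons (case (var 1F) two one) (var 0F)
  writeH = cons (case (var 1F) nil (case (var 0F) falseC trueC)) (var 0F)

  readC writeC : Code 1
  readC  = rec nil nil readH (var 0F) nil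
  writeC = rec nil nil writeH (var 0F) nil

  read≡ : ∀ a → ⟦ readC ⟧ (encodeℕ a ∷ []) ≡ N a
  read≡ a = trans (go (encodeℕ a ∷ []) (fromℕ a)) (sym (N-num a))
    where
    go : ∀ (ρ : Vec Tree 1) b → loop nil nil readH ρ (encodeℕᵇ b) nil ≡ num b
    go ρ zero     = refl
    go ρ 2[1+ b ] = cong (_ ∙_) (go ρ b)
    go ρ 1+[2 b ] = cong (_ ∙_) (go ρ b)

  write≡ : ∀ {x} a → x ≡ N a → ⟦ writeC ⟧ (x ∷ []) ≡ encodeℕ a
  write≡ a refl = trans (cong (λ x → ⟦ writeC ⟧ (x ∷ [])) (N-num a)) (go (num (fromℕ a) ∷ []) (fromℕ a))
    where
    go : ∀ (ρ : Vec Tree 1) b → loop nil nil writeH ρ (num b) nil ≡ encodeℕᵇ b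
    go ρ zero     = refl
    go ρ 2[1+ b ] = cong (_ ∙_) (go ρ b)
    go ρ 1+[2 b ] = cong (_ ∙_) (go ρ b)

  readsC : Code 1
  readsC = mapC (app readC (var 1F ∷ [])) (var 0F)

  reads≡ : ∀ {k} (f : Fin k → ℕ) → ⟦ readsC ⟧ (encodeFamily (λ i → encodeℕ (f i)) ∷ []) ≡ nums f
  reads≡ f = map-loop (app readC (var 1F ∷ [])) (encodeFamily (λ i → encodeℕ (f i)) ∷ []) (λ i → encodeℕ (f i)) (λ i → N (f i)) (λ i _ _ _ → read≡ (f i))

  digits : ℕᵇ → List Tree
  digits zero     = []
  digits 2[1+ b ] = (nil ∙ (nil ∙ nil)) ∷ digits b
  digits 1+[2 b ] = ((nil ∙ nil) ∙ nil) ∷ digits b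

  N-digits : ∀ a → N a ≡ encodeList (digits (fromℕ a))
  N-digits a = trans (N-num a) (go (fromℕ a))
    where
    go : ∀ b → num b ≡ encodeList (digits b)
    go zero     = refl
    go 2[1+ b ] = cong (_ ∙_) (go b)
    go 1+[2 b ] = cong (_ ∙_) (go b)

  length-digits : ∀ a → length (digits (fromℕ a)) ≡ bits a
  length-digits a = go (fromℕ a)
    where
    go : ∀ b → length (digits b) ≡ lengthᵇ b
    go zero     = refl
    go 2[1+ b ] = cong suc (go b)
    go 1+[2 b ] = cong suc (go b)


  bits≡ : ∀ {x a} → x ≡ N a → ⟦ lengthC ⟧ (x ∷ []) ≡ N (bits a)
  bits≡ {a = a} refl = trans (cong (λ x → ⟦ lengthC ⟧ (x ∷ [])) (N-digits a))
    (trans (lengthC-correct (digits (fromℕ a))) (cong N (length-digits a)))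

  -- The argument of the following programs is the list of the constants common to
  -- both planners.

  reachH : Code 8
  reachH = app disjC (item 0 (var 7F) ∷ var 1F ∷
    app unionC (item 0 (var 7F) ∷ item 0 (var 7F) ∷ app pickC (item 6 (var 7F) ∷ var 1F ∷ []) ∷ var 6F ∷ []) ∷ [])

  reachStep : Code 4
  reachStep = mapC reachH (item 5 (var 3F))

  descC : Code 1
  descC = loopC reachStep (item 0 (var 0F)) (item 5 (var 0F))

  -- arguments: list of the same length, matrix
  columnH : Code 10
  columnH = app meetsC (var 5F ∷ app pickC (var 9F ∷ var 1F ∷ []) ∷ [])

  columnsH : Code 6
  columnsH = mapC columnH (var 4F)

  columnsC : Code 2
  columnsC = mapC columnsH (var 0F)

  closuresC ranksC classesC ellsC rootsC layersC depthsC orderC : Code 1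
  closuresC = app columnsC (item 5 (var 0F) ∷ descC ∷ [])
  ranksC    = mapC (app countC (var 1F ∷ [])) closuresC
  classesC  = mapC (app lengthC (app countC (var 1F ∷ []) ∷ [])) descC
  ellsC     = mapC (app sumC (item 4 (var 4F) ∷ var 1F ∷ [])) closuresC
  rootsC    = mapC (app leC (var 1F ∷ app sucC (nil ∷ []) ∷ [])) ranksC

  nextLayerH : Code 8
  nextLayerH = app notC (app meetsC (var 1F ∷ app complementC (var 6F ∷ []) ∷ []) ∷ [])

  nextLayer : Code 4
  nextLayer = mapC nextLayerH (app columnsC (item 5 (var 3F) ∷ item 6 (var 3F) ∷ []))

  layersC = rec nil nextLayer (cons (var 3F) (var 0F)) (item 0 (var 0F)) (item 0 (var 0F))

  depthH : Code 9
  depthH = app notC (app meetsC (var 5F ∷ var 1F ∷ []) ∷ [])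

  depthsH : Code 5
  depthsH = app countC (mapC depthH (app layersC (var 4F ∷ [])) ∷ [])

  depthsC = mapC depthsH (item 5 (var 0F))

  levelH : Code 11
  levelH = case (app eqC (app pickC (var 8F ∷ var 1F ∷ []) ∷ var 5F ∷ [])) (var 0F) (cons (var 3F) (var 2F))

  levelsH : Code 7
  levelsH = rec (var 0F) (var 2F) levelH (var 6F) (var 0F)

  -- arguments: ranks, range, sets
  levelsC : Code 3
  levelsC = rec nil nil levelsH (var 1F) nil

  orderArgs : Codes 1 3
  orderArgs = ranksC ∷ app fromOne (item 0 (var 0F) ∷ []) ∷ item 5 (var 0F) ∷ []

  orderC = app levelsC orderArgs

  heightH : Code 9
  heightH = app leC (var 5F ∷ var 1F ∷ [])

  heightsH : Code 5
  heightsH = app countC (mapC heightH (app fromOne (item 0 (var 4F) ∷ [])) ∷ [])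

  -- the reversed classes, as keys of the scheduler
  heightsC : Code 1
  heightsC = mapC heightsH classesC

  appendC : Code 2
  appendC = rec (var 0F) (var 2F) (cons (var 1F) (var 0F)) (var 0F) (var 1F)


  timesC : Code 1
  timesC = app powers (cons nil (cons nil (app appendC
    (app sumC (item 3 (var 0F) ∷ app complementC (item 1 (var 0F) ∷ []) ∷ []) ∷
     app sumC (item 4 (var 0F) ∷ app complementC (item 0 (var 0F) ∷ []) ∷ []) ∷ []))) ∷ [])

  map≡ : ∀ {v k} {h : Code (4 + v)} {x : Tree} (ρ : Vec Tree v) (e e′ : Fin k → Tree) → x ≡ encodeFamily e →
         (∀ i r b p → ⟦ h ⟧ (r ∷ e i ∷ b ∷ p ∷ ρ) ≡ e′ i) → loop nil nil (cons h (var 0F)) ρ x nil ≡ encodeFamily e′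
  map≡ {h = h} ρ e e′ refl eq = map-loop h ρ e e′ eq

  columns≡ : ∀ {k x} (R : Fin k → Fin k → Bool) → x ≡ matrix R →
             ⟦ columnsC ⟧ (encodeFamily (hot {k}) ∷ x ∷ []) ≡ matrix (λ v u → R u v)
  columns≡ {k} R refl = map-loop columnsH (ids ∷ matrix R ∷ []) hot (λ v → mask (λ u → R u v))
    (λ v r b p → map-loop columnH (r ∷ hot v ∷ b ∷ p ∷ ids ∷ matrix R ∷ []) hot (λ u → encodeBool (R u v))
      (λ u _ _ _ → member≡ {i = v} {R u} refl (pick≡ (λ u → mask (R u)) {u} refl refl)))
    where
    ids = encodeFamily (hot {k})

  filterᵇ-∷ : ∀ {A : Set} (p : A → Bool) x xs → filterᵇ p (x ∷ xs) ≡ (if p x then x ∷ filterᵇ p xs else filterᵇ p xs)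
  filterᵇ-∷ p x xs with p x
  ... | true  = refl
  ... | false = refl

  levels≡ : ∀ {k} (rank : Fin k → ℕ) rank≥1 rank≤ →
            Computes levelsC (nums rank ∷ nums {k} (λ i → suc (toℕ i)) ∷ encodeFamily (hot {k}) ∷ [])
              (encodeList (List.map hot (Order.order rank rank≥1 rank≤)))
  levels≡ {k} rank rank≥1 rank≤ = computes (outer k 1)
    where
    open Order rank rank≥1 rank≤
    rest : List (Fin k) → Tree
    rest cs = encodeList (List.map hot cs)
    ρ : Vec Tree 3
    ρ = nums rank ∷ nums {k} (λ i → suc (toℕ i)) ∷ encodeFamily (hot {k}) ∷ []
    inner : ∀ c b p vs base → loop (var 0F) (var 2F) levelH (rest base ∷ N c ∷ b ∷ p ∷ ρ) (rest vs) (rest base) ≡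
            rest (filterᵇ (λ v → rank v ≡ᵇ c) vs ++ base)
    inner c b p []       base = refl
    inner c b p (v ∷ vs) base = trans
      (if≡ (rank v ≡ᵇ c) (eq≡ (pick≡ (λ v → N (rank v)) {v} refl refl) refl) (cong (hot v ∙_) (inner c b p vs base)) (inner c b p vs base))
      (trans (push (rank v ≡ᵇ c)) (cong (λ l → rest (l ++ base)) (sym (filterᵇ-∷ (λ v → rank v ≡ᵇ c) v vs))))
      where
      selected : List (Fin k)
      selected = filterᵇ (λ v → rank v ≡ᵇ c) vs
      push : ∀ t → (if t then hot v ∙ rest (selected ++ base) else rest (selected ++ base)) ≡ rest ((if t then v ∷ selected else selected) ++ base)
      push true  = refl
      push false = refl
    one-level : ∀ {r x} b p c base → r ≡ rest base → x ≡ N c → ⟦ levelsH ⟧ (r ∷ x ∷ b ∷ p ∷ ρ) ≡ rest (level c ++ base)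
    one-level b p c base refl refl = trans
      (cong (λ x → loop (var 0F) (var 2F) levelH (rest base ∷ N c ∷ b ∷ p ∷ ρ) x (rest base)) (family-map {k = k} hot id))
      (inner c b p (allFin k) base)
    outer : ∀ n c → loop nil nil levelsH ρ (nums {n} (λ i → c + toℕ i)) nil ≡ rest (levels c n)
    outer zero    c = refl
    outer (suc n) c = one-level (nums {n} (λ i → c + suc (toℕ i))) nil c (levels (suc c) n)
      (trans (cong (λ x → loop nil nil levelsH ρ x nil) (family-cong {n} λ i → cong N (+-suc c (toℕ i)))) (outer n (suc c)))
      (cong N (+-identityʳ c))

  module Derived {k n} (edge : Fin k → Fin k → Bool) (S : Fin k → Fin n → Bool) (w : Fin n → ℕ) (cost : Fin k → ℕ)
    (acyclic : ∀ i → ¬ TransClosure (Graph.Edge edge) i i) where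

    open Graph edge
    open Acyclic acyclic
    open Order rank rank-≥1 rank-≤
    open Measures S w cost edge nil renaming (constants to basis)

    zeros ids : Tree
    zeros = mask {k} (λ _ → false)
    ids = encodeFamily (hot {k})

    desc≡ : ⟦ descC ⟧ (basis ∷ []) ≡ matrix desc
    desc≡ = trans (iterate-loop reachStep (basis ∷ []) (λ _ → nil) (λ t → matrix (reach t)) (λ _ → suc) step 0 k 0)
                  (cong (λ t → matrix (reach t)) (trans (same 0 k 0) (+-identityʳ k)))
      where
      step : ∀ (i : ℕ) b t → ⟦ reachStep ⟧ (nil ∷ b ∷ matrix (reach t) ∷ basis ∷ []) ≡ matrix (reach (suc t))
      step i b t = map-loop reachH (nil ∷ b ∷ matrix (reach t) ∷ basis ∷ []) hot (λ u → mask (reach (suc t) u))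
        λ u _ _ _ → disj≡ (λ _ → nil) {point u} {λ v → anyF (λ x → edge u x ∧ reach t x v)} refl refl
          (trans (cong (λ e → ⟦ unionC ⟧ (zeros ∷ zeros ∷ e ∷ matrix (reach t) ∷ [])) (pick≡ (λ u → mask (edge u)) {u} refl refl))
            (unionC-correct (λ (_ : Fin k) → nil) (λ (_ : Fin k) → nil) (edge u) (reach t)))
      same : ∀ c n t → iterate (λ _ → suc) c n t ≡ n + t
      same c zero    t = refl
      same c (suc n) t = trans (same (suc c) n (suc t)) (+-suc n t)

    closures≡ : ⟦ closuresC ⟧ (basis ∷ []) ≡ matrix (λ v x → desc x v)
    closures≡ = columns≡ desc desc≡

    ranks≡ : ⟦ ranksC ⟧ (basis ∷ []) ≡ nums rank
    ranks≡ = map≡ {h = app countC (var 1F ∷ [])} (basis ∷ []) (λ v → mask (λ x → desc x v)) (λ v → N (rank v)) closures≡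
      (λ v _ _ _ → countC-correct (λ x → desc x v))

    classes≡ : ⟦ classesC ⟧ (basis ∷ []) ≡ nums (λ v → bits (width v))
    classes≡ = map≡ {h = app lengthC (app countC (var 1F ∷ []) ∷ [])} (basis ∷ []) (λ v → mask (desc v)) (λ v → N (bits (width v))) desc≡
      (λ v _ _ _ → bits≡ (countC-correct (desc v)))

    ells≡ : ⟦ ellsC ⟧ (basis ∷ []) ≡ nums (λ v → weigh cost (λ x → desc x v))
    ells≡ = map≡ {h = app sumC (item 4 (var 4F) ∷ var 1F ∷ [])} (basis ∷ []) (λ v → mask (λ x → desc x v))
      (λ v → N (weigh cost (λ x → desc x v))) closures≡ (λ v _ _ _ → sumC-correct cost (λ x → desc x v))

    roots≡ : ⟦ rootsC ⟧ (basis ∷ []) ≡ mask (λ v → rank v ≤ᵇ 1)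
    roots≡ = map≡ {h = app leC (var 1F ∷ app sucC (nil ∷ []) ∷ [])} (basis ∷ []) (λ v → N (rank v)) (λ v → encodeBool (rank v ≤ᵇ 1)) ranks≡
      (λ v _ _ _ → le≡ refl N-one)

    layers≡ : ⟦ layersC ⟧ (basis ∷ []) ≡ encodeFamily {k} (λ t → mask (layer (toℕ t)))
    layers≡ = go k 0
      where
      next : ∀ b t → ⟦ nextLayer ⟧ (nil ∷ b ∷ mask (layer t) ∷ basis ∷ []) ≡ mask (layer (suc t))
      next b t = map≡ {h = nextLayerH} (nil ∷ b ∷ mask (layer t) ∷ basis ∷ []) (λ v → mask (λ u → edge u v)) (λ v → encodeBool (layer (suc t) v))
        (columns≡ edge refl) λ v _ _ _ → not≡ (meets≡ {f = λ u → edge u v} {g = λ u → not (layer t u)} refl (complement≡ {k} {f = layer t} refl))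
      go : ∀ n c → loop nil nextLayer (cons (var 3F) (var 0F)) (basis ∷ []) (mask {n} (λ _ → false)) (mask (layer c)) ≡
           encodeFamily {n} (λ t → mask (layer (c + toℕ t)))
      go zero    c = refl
      go (suc n) c = cong₂ _∙_ (cong (λ t → mask (layer t)) (sym (+-identityʳ c)))
        (trans (cong (loop nil nextLayer (cons (var 3F) (var 0F)) (basis ∷ []) (mask {n} (λ _ → false))) (next (mask {n} (λ _ → false)) c))
          (trans (go n (suc c)) (family-cong {n} λ t → cong (λ t → mask (layer t)) (sym (+-suc c (toℕ t))))))

    depths≡ : ⟦ depthsC ⟧ (basis ∷ []) ≡ nums depth
    depths≡ = map-loop depthsH (basis ∷ []) hot (λ v → N (depth v)) λ v r b p →
      trans (cong (λ x → ⟦ countC ⟧ (x ∷ []))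
        (map≡ {k = k} {h = depthH} (r ∷ hot v ∷ b ∷ p ∷ basis ∷ []) (λ t → mask (layer (toℕ t))) (λ t → encodeBool (not (layer (toℕ t) v))) layers≡
          λ t _ _ _ → not≡ (member≡ {i = v} {layer (toℕ t)} refl refl)))
        (countC-correct {k} (λ t → not (layer (toℕ t) v)))

    range≡ : ⟦ fromOne ⟧ (zeros ∷ []) ≡ nums {k} (λ i → suc (toℕ i))
    range≡ = fromOne-correct {k} (λ _ → nil)

    orderArgs≡ : ⟦ orderArgs ⟧* (basis ∷ []) ≡ nums rank ∷ nums {k} (λ i → suc (toℕ i)) ∷ ids ∷ []
    orderArgs≡ = cong₂ (λ r i → r ∷ i ∷ ids ∷ []) ranks≡ range≡

    order≡ : Computes orderC (basis ∷ []) (encodeList (List.map hot order))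
    order≡ = app≡ levelsC orderArgs (basis ∷ []) orderArgs≡ (levels≡ rank rank-≥1 rank-≤)

    heights≡ : (∀ v → bits (width v) ≤ k) → ⟦ heightsC ⟧ (basis ∷ []) ≡ nums (λ v → suc (k ∸ bits (width v)))
    heights≡ le = map≡ {h = heightsH} (basis ∷ []) (λ v → N (bits (width v))) (λ v → N (suc (k ∸ bits (width v)))) classes≡ λ v r b p →
      trans (cong (λ x → ⟦ countC ⟧ (x ∷ []))
        (map≡ {k = k} {h = heightH} (r ∷ N (bits (width v)) ∷ b ∷ p ∷ basis ∷ []) (λ i → N (suc (toℕ i))) (λ i → encodeBool (bits (width v) ≤ᵇ suc (toℕ i))) range≡
          λ i _ _ _ → le≡ refl refl))
        (trans (countC-correct {k} (λ i → bits (width v) ≤ᵇ suc (toℕ i))) (cong N (count-from (bits (width v)) (bits-≥1 (width-≥1 v)) (le v))))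
      where
      above : ∀ n c → ∑ {n} (λ i → when (c <ᵇ suc (toℕ i)) 1) ≡ n ∸ c
      above zero    c       = sym (0∸n≡0 c)
      above (suc n) zero    = cong suc (above n zero)
      above (suc n) (suc c) = above n c
      count-from : ∀ c → 1 ≤ c → c ≤ k → ∑ {k} (λ i → when (c ≤ᵇ suc (toℕ i)) 1) ≡ suc (k ∸ c)
      count-from (suc c) _ lt = trans (above k c) (+-∸-assoc 1 lt)

    append≡ : ∀ xs ys → ⟦ appendC ⟧ (encodeList xs ∷ encodeList ys ∷ []) ≡ encodeList (xs ++ ys)
    append≡ xs ys = go xs
      where
      go : ∀ xs′ → loop (var 0F) (var 2F) (cons (var 1F) (var 0F)) (encodeList xs ∷ encodeList ys ∷ []) (encodeList xs′) (encodeList ys) ≡ encodeList (xs′ ++ ys)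
      go []        = refl
      go (x ∷ xs′) = cong (x ∙_) (go xs′)

    phases : ℕ
    phases = suc (bits (∑ w)) + suc (bits (∑ cost))

    times≡ : ⟦ timesC ⟧ (basis ∷ []) ≡ nums {phases} (λ j → 2 ^ toℕ j)
    times≡ = trans (cong (λ x → ⟦ powers ⟧ ((nil ∙ (nil ∙ x)) ∷ []))
        (trans (cong₂ (λ x y → ⟦ appendC ⟧ (x ∷ y ∷ []))
            (trans (cong (λ x → ⟦ sumC ⟧ (nums w ∷ x ∷ [])) (complement≡ {n} {f = λ _ → false} refl)) (trans (sumC-correct {n} w (λ _ → true)) (N-digits (∑ w))))
            (trans (cong (λ x → ⟦ sumC ⟧ (nums cost ∷ x ∷ [])) (complement≡ {k} {f = λ _ → false} refl)) (trans (sumC-correct {k} cost (λ _ → true)) (N-digits (∑ cost)))))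
          (append≡ dw dc)))
      (trans (powers-correct (nil ∷ nil ∷ dw ++ dc)) (cong (λ l → nums {l} (λ j → 2 ^ toℕ j)) len))
      where
      dw dc : List Tree
      dw = digits (fromℕ (∑ w))
      dc = digits (fromℕ (∑ cost))
      len : 2 + length (dw ++ dc) ≡ phases
      len = trans (cong (2 +_) (trans (length-++ dw) (cong₂ _+_ (length-digits (∑ w)) (length-digits (∑ cost)))))
                  (cong suc (sym (+-suc (bits (∑ w)) (bits (∑ cost)))))

module MainPrograms where

  open Language
  open Arithmetic
  open Families
  open Masks hiding (_∩_)
  open Digraphs
  open Scheduling
  open LowerBounds
  open Phases
  open Guarantees
  open SchedulingPrograms
  open PlanningPrograms
  open ForestPrograms
  open DerivedData
  open import Data.Bool using (false; T)
  open import Data.Fin using (Fin; zero; suc; toℕ)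
  open import Data.Maybe using (just; nothing; _>>=_)
  open import Data.Nat using (ℕ; zero; suc; _+_; _^_)
  open import Data.Nat.Properties hiding (_≟_)
  open import Data.Product using (_,_)
  open import Data.Vec using ([]; _∷_; lookup)
  open import Function using (_∘_)
  open import Relation.Binary.PropositionalEquality using (_≡_; refl; sym; trans; cong; cong₂)

  basisC : Code 1
  basisC = cons zerosK (cons (app zerosC (item 2 (var 0F) ∷ [])) (cons (item 3 (var 0F))
    (cons (app readsC (item 2 (var 0F) ∷ [])) (cons (app readsC (item 1 (var 0F) ∷ []))
    (cons (app identityC (zerosK ∷ [])) (cons (tail (tail (tail (tail (var 0F))))) nil))))))
    where
    zerosK : Code 1
    zerosK = app zerosC (item 1 (var 0F) ∷ [])

  nextC : Code 4 → Code 6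
  nextC planC = app planC (var 0F ∷ var 2F ∷ var 3F ∷ var 4F ∷ [])

  emitC : Code 4 → Code 1 → Code 7
  emitC planC heightC = cons (cons (app heightC (var 1F ∷ [])) (app planC (var 1F ∷ var 3F ∷ var 4F ∷ var 5F ∷ []))) (var 0F)

  entryC : Code 1
  entryC = case (var 0F) nil (case (var 0F)
    (case (var 1F) nil (cons (app writeC (var 0F ∷ [])) (case (var 1F) nil (app writeC (app addC (var 0F ∷ var 1F ∷ []) ∷ [])))))
    nil)

  entryH : Code 7
  entryH = app entryC (app simulateC (var 1F ∷ var 5F ∷ var 6F ∷ []) ∷ [])

  -- arguments: sets, phases, constants of the scheduler
  entriesC : Code 3
  entriesC = mapC entryH (var 0F)

  inputArgs : Codes 1 2
  inputArgs = app readC (item 0 (var 0F) ∷ []) ∷ app basisC (var 0F ∷ []) ∷ []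

  module Entries (I : Instance) (stg : Fin (Instance.k I) → ℕ) (plan : ℕ → Mask (Instance.k I) → Mask (Instance.k I)) (D : ℕ → ℕ)
    (G : Algorithm.Guarantee I stg plan D) where

    open Instance I
    open Algorithm I stg plan D
    open Analysis G using (module After; after)
    open Scheduler edge acyclic cost m stg using (module Valid)
    open SchedulingCorrectness edge acyclic cost m stg

    phasesT : ℕ → Tree
    phasesT J = encodeFamily {J} (λ j → N (D (2 ^ toℕ j)) ∙ mask (family (suc (toℕ j))))

    entry≡ : ∀ J v → ⟦ entryC ⟧ (simulated v (at J) ∷ []) ≡ encodeEntry (schedule J v)
    entry≡ J v = go (slots (at J) v) refl
      where
      go : ∀ x → slots (at J) v ≡ x → ⟦ entryC ⟧ (simulated v (at J) ∷ []) ≡ encodeEntry {m} (x >>= onMachine)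
      go nothing eq = cong (λ x → ⟦ entryC ⟧ (x ∷ [])) (simulated-live v (at J) eq)
      go (just x@(q , b , r)) eq =
        let p , on , p≡ = onMachine⁺ x (Valid.slot< (After.valid (after J) 0) eq)
        in trans (cong (λ x → ⟦ entryC ⟧ (x ∷ [])) (simulated-frozen v (at J) eq))
             (trans (cong₂ _∙_ (write≡ (toℕ p) (cong N (sym p≡))) (write≡ (b + r) (add≡ refl refl))) (cong encodeEntry (sym on)))

    entries≡ : ∀ J → Computes entriesC (encodeFamily (hot {k}) ∷ phasesT J ∷ constants ∷ []) (encodeSchedule I (schedule J))
    entries≡ J = computes (map-loop entryH (encodeFamily (hot {k}) ∷ phasesT J ∷ constants ∷ []) hot (λ v → encodeEntry (schedule J v)) λ v _ _ _ →
      trans (cong (λ x → ⟦ entryC ⟧ (x ∷ [])) (simulate≡ v J (family ∘ suc) (λ j → D (2 ^ j)) at refl (λ _ → refl))) (entry≡ J v))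

  module Main (planC : Code 4) (heightC keysC restC : Code 1)
    (ok₁ : T (linear? (lookup (growth (nextC planC)) 2F))) (ok₂ : T (linear? (lookup (growth (emitC planC heightC)) 0F))) where

    -- arguments: number of machines, constants of the planner, basis
    phasesC : Code 3
    phasesC = rec nil (nextC planC) (emitC planC heightC) {ok₁} {ok₂} (app timesC (var 2F ∷ [])) (item 0 (var 2F))

    -- arguments: number of machines, basis
    plannerC schedulerC finalC : Code 2
    plannerC = cons (item 0 (var 1F)) (cons (item 1 (var 1F)) (cons (item 2 (var 1F)) (cons (item 3 (var 1F)) (cons (item 4 (var 1F))
      (cons (item 5 (var 1F)) (cons (item 6 (var 1F)) (app restC (var 1F ∷ []))))))))
    schedulerC = cons (app keysC (var 1F ∷ [])) (cons (app descC (var 1F ∷ [])) (cons (item 4 (var 1F)) (cons (item 0 (var 1F))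
      (cons (var 0F) (cons (app orderC (var 1F ∷ [])) (cons (app fromOne (item 0 (var 1F) ∷ [])) nil))))))

    finalArgs : Codes 2 3
    finalArgs = item 5 (var 1F) ∷ app phasesC (var 0F ∷ plannerC ∷ var 1F ∷ []) ∷ schedulerC ∷ []

    finalC = app entriesC finalArgs

    mainC : Code 1
    mainC = app finalC inputArgs

    module MainCorrectness (I : Instance) (stg : Fin (Instance.k I) → ℕ) (plan : ℕ → Mask (Instance.k I) → Mask (Instance.k I)) (D : ℕ → ℕ)
      (G : Algorithm.Guarantee I stg plan D) (rest : Tree) where

      open Instance I
      open Algorithm I stg plan D using (family; schedule)
      open Entries I stg plan D G
      open Derived edge (incidence I) weight cost acyclic
      open Measures (incidence I) weight cost edge nil using () renaming (constants to basis)
      open Measures (incidence I) weight cost edge rest using () renaming (constants to plannerT)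
      open SchedulingCorrectness edge acyclic cost m stg using () renaming (constants to schedulerT)

      module _ (plan≡ : ∀ t C → Computes planC (N t ∷ mask C ∷ N m ∷ plannerT ∷ []) (mask (plan t C)))
        (height≡ : ∀ t → ⟦ heightC ⟧ (N t ∷ []) ≡ N (D t))
        (keys≡ : ⟦ keysC ⟧ (basis ∷ []) ≡ nums (λ v → suc (stg v))) (rest≡ : ⟦ restC ⟧ (basis ∷ []) ≡ rest) where

        phases≡ : ⟦ phasesC ⟧ (N m ∷ plannerT ∷ basis ∷ []) ≡ phasesT phases
        phases≡ = trans (cong (λ x → loop nil (nextC planC) (emitC planC heightC) ρ x (mask (family 0))) times≡) (go phases 0)
          where
          ρ = N m ∷ plannerT ∷ basis ∷ []
          go : ∀ n c → loop nil (nextC planC) (emitC planC heightC) ρ (nums {n} (λ j → 2 ^ (c + toℕ j))) (mask (family c)) ≡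
               encodeFamily {n} (λ j → N (D (2 ^ (c + toℕ j))) ∙ mask (family (suc (c + toℕ j))))
          go zero    c = refl
          go (suc n) c = cong₂ _∙_
            (cong₂ _∙_ (height≡ (2 ^ (c + 0)))
              (trans (computed (plan≡ (2 ^ (c + 0)) (family c))) (cong (λ c′ → mask (plan (2 ^ (c + 0)) (family c′))) (sym (+-identityʳ c)))))
            (trans (cong₂ (loop nil (nextC planC) (emitC planC heightC) ρ)
                (family-cong {n} λ j → cong (λ c′ → N (2 ^ c′)) (+-suc c (toℕ j)))
                (trans (computed (plan≡ (2 ^ (c + 0)) (family c))) (cong (λ c′ → mask (plan (2 ^ c′) (family c))) (+-identityʳ c))))
              (trans (go n (suc c)) (family-cong {n} λ j → cong (λ c′ → N (D (2 ^ c′)) ∙ mask (family (suc c′))) (sym (+-suc c (toℕ j))))))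

        planner≡ : ⟦ plannerC ⟧ (N m ∷ basis ∷ []) ≡ plannerT
        planner≡ = cong (λ r → zeros ∙ (mask {n} (λ _ → false) ∙ (matrix (incidence I) ∙ (nums weight ∙ (nums cost ∙ (ids ∙ (matrix edge ∙ r))))))) rest≡

        scheduler≡ : ⟦ schedulerC ⟧ (N m ∷ basis ∷ []) ≡ schedulerT
        scheduler≡ = cong₂ _∙_ keys≡ (cong₂ _∙_ desc≡ (cong (λ r → nums cost ∙ (zeros ∙ (N m ∙ r))) (cong₂ _∙_ (computed order≡) (cong (_∙ nil) range≡))))

        finalArgs≡ : ⟦ finalArgs ⟧* (N m ∷ basis ∷ []) ≡ encodeFamily (hot {k}) ∷ phasesT phases ∷ schedulerT ∷ []
        finalArgs≡ = cong₂ (λ p s → encodeFamily (hot {k}) ∷ p ∷ s ∷ []) (trans (cong (λ K → ⟦ phasesC ⟧ (N m ∷ K ∷ basis ∷ [])) planner≡) phases≡) scheduler≡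

        final≡ : Computes finalC (N m ∷ basis ∷ []) (encodeSchedule I (schedule phases))
        final≡ = app≡ entriesC finalArgs (N m ∷ basis ∷ []) finalArgs≡ (entries≡ phases)

        basis≡ : ⟦ basisC ⟧ (encodeInstance I ∷ []) ≡ basis
        basis≡ = cong₂ _∙_ zeroK (cong₂ _∙_ (zerosC-correct (λ u → encodeℕ (weight u))) (cong (matrix (incidence I) ∙_)
          (cong₂ _∙_ (reads≡ weight) (cong₂ _∙_ (reads≡ cost)
            (cong (_∙ (matrix edge ∙ nil)) (trans (cong (λ x → ⟦ identityC ⟧ (x ∷ [])) zeroK) (identityC-correct {k} (λ _ → nil))))))))
          where
          zeroK = zerosC-correct (λ i → encodeℕ (cost i))

        inputArgs≡ : ⟦ inputArgs ⟧* (encodeInstance I ∷ []) ≡ N m ∷ basis ∷ []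
        inputArgs≡ = cong₂ (λ m b → m ∷ b ∷ []) (read≡ m) basis≡

        main≡ : Computes mainC (encodeInstance I ∷ []) (encodeSchedule I (schedule phases))
        main≡ = app≡ finalC inputArgs (encodeInstance I ∷ []) inputArgs≡ final≡

  module Unit = Main unitPlanC (app sucC (nil ∷ [])) depthsC (cons depthsC (cons ranksC (cons closuresC nil))) _ _

  module OutTrees = Main forestPlanC (var 0F) heightsC (cons classesC (cons ellsC (cons rootsC nil))) _ _

module Approximations where

  open Language
  open Compilation using (program; polyTime)
  open Arithmetic
  open Families
  open Masks using (weigh)
  open Digraphs
  open LowerBounds
  open Phases
  open Guarantees using (module ForestCase; module UnitCase)
  open SchedulingPrograms using (Computes; computed)
  open PlanningPrograms
  open ForestPrograms
  open DerivedData
  open MainPrograms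
  open import Data.Nat using (suc; _^_; _≤_)
  open import Data.Nat.Properties
  open import Data.Product using (_×_; _,_; ∃-syntax)
  open import Data.Vec using ([]; _∷_)
  open import Relation.Binary.PropositionalEquality using (_≡_; refl; sym; trans; cong; subst)

  approximation : ∀ {Class Ratio} (c : Code 1) →
    (∀ I → 2 ≤ Instance.k I → Class I → ∃[ σ ] Computes c (encodeInstance I ∷ []) (encodeSchedule I σ) × IsApproximationFor Ratio I σ) →
    PolyTimeApproximation Class Ratio
  approximation c correct =
    let a , d , runs = polyTime c
    in program c , a , d , λ I k≥2 class →
      let σ , eq , good = correct I k≥2 class
          t , run , t≤ = runs (encodeInstance I)
      in σ , t , subst (λ y → Runs (program c) (encodeInstance I) y t) (computed eq) run , t≤ , good

  triple≡ : ∀ {x x′ y y′ z z′ : Tree} → x ≡ x′ → y ≡ y′ → z ≡ z′ → x ∙ (y ∙ (z ∙ nil)) ≡ x′ ∙ (y′ ∙ (z′ ∙ nil))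
  triple≡ refl refl refl = refl

  below-power : ∀ a → suc a ≤ 2 ^ suc (bits a)
  below-power a = ≤-trans (n≤1+n (suc a)) (bits-upper a)

  unit-approximation : PolyTimeApproximation UnitCost (Within-k^⅔ 192)
  unit-approximation = approximation {UnitCost} {Within-k^⅔ 192} Unit.mainC correct
    where
    correct : ∀ I → 2 ≤ Instance.k I → UnitCost I → ∃[ σ ] Computes Unit.mainC (encodeInstance I ∷ []) (encodeSchedule I σ) ×
              IsApproximationFor (Within-k^⅔ 192) I σ
    correct I k≥2 unit = schedule phases , main≡ unitPlan≡ (λ _ → N-one) keys≡ rest≡ , feasible , λ τ feas → ratio (approximate τ feas)
      where
      open Instance I
      open Graph edge using (rank; desc)
      open Graph.Acyclic edge acyclic using (depth)
      open UnitCase I unit k≥2 using (guarantee; plan; stg; suc-stg; ratio)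
      open Algorithm I stg plan (λ _ → 1) using (schedule)
      open Algorithm.Analysis I stg plan (λ _ → 1) guarantee using (module Result)
      open Derived edge (incidence I) weight cost acyclic
      open Result (suc (bits (∑ cost))) (suc (bits (∑ weight))) (<⇒≤ (below-power (∑ cost))) (below-power (∑ weight)) using (feasible; approximate)
      open UnitCorrectness edge (incidence I) weight cost acyclic m using (unitPlan≡)
      open Measures (incidence I) weight cost edge nil using () renaming (constants to basis)
      open Unit.MainCorrectness I stg plan (λ _ → 1) guarantee (nums depth ∙ (nums rank ∙ (matrix (λ v x → desc x v) ∙ nil))) using (main≡)
      keys≡ : ⟦ depthsC ⟧ (basis ∷ []) ≡ nums (λ v → suc (stg v))
      keys≡ = trans depths≡ (family-cong λ v → cong N (sym (suc-stg v)))
      rest≡ : ⟦ cons depthsC (cons ranksC (cons closuresC nil)) ⟧ (basis ∷ []) ≡ nums depth ∙ (nums rank ∙ (matrix (λ v x → desc x v) ∙ nil))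
      rest≡ = triple≡ depths≡ ranks≡ closures≡

  forest-approximation : PolyTimeApproximation OutForest (Within-log 288)
  forest-approximation = approximation {OutForest} {Within-log 288} OutTrees.mainC correct
    where
    correct : ∀ I → 2 ≤ Instance.k I → OutForest I → ∃[ σ ] Computes OutTrees.mainC (encodeInstance I ∷ []) (encodeSchedule I σ) ×
              IsApproximationFor (Within-log 288) I σ
    correct I k≥2 out = schedule phases , main≡ forestPlan≡ (λ _ → refl) (heights≡ class≤k) rest≡ , feasible , λ τ feas → ratio k≥2 (approximate τ feas)
      where
      open Instance I
      open Graph edge using (desc)
      open Graph.Acyclic.Forest edge acyclic out using (class; root; class-≤)
      open ForestCase I out using (guarantee; plan; stg; ratio; L≤k)
      open Algorithm I stg plan (λ t → t) using (schedule)
      open Algorithm.Analysis I stg plan (λ t → t) guarantee using (module Result)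
      open Derived edge (incidence I) weight cost acyclic
      open Result (suc (bits (∑ cost))) (suc (bits (∑ weight))) (<⇒≤ (below-power (∑ cost))) (below-power (∑ weight)) using (feasible; approximate)
      open ForestCorrectness edge (incidence I) weight cost acyclic out m using (forestPlan≡)
      open Measures (incidence I) weight cost edge nil using () renaming (constants to basis)
      rest : Tree
      rest = nums class ∙ (nums (λ v → weigh cost (λ x → desc x v)) ∙ (mask root ∙ nil))
      open OutTrees.MainCorrectness I stg plan (λ t → t) guarantee rest using (main≡)
      class≤k : ∀ v → class v ≤ k
      class≤k v = ≤-trans (class-≤ v) L≤k
      rest≡ : ⟦ cons classesC (cons ellsC (cons rootsC nil)) ⟧ (basis ∷ []) ≡ rest
      rest≡ = triple≡ classes≡ ells≡ roots≡

open Approximations using (unit-approximation; forest-approximation)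

corollary5p3 :
    (∃[ C ] PolyTimeApproximation UnitCost (Within-k^⅔ C)) ×
    (∃[ C ] PolyTimeApproximation OutForest (Within-log C))
corollary5p3 = (192 , unit-approximation) , (288 , forest-approximation)
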